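{- For every even integer $k\ge 6$ and every integer $d$ with $k/2\le d\le k-1$, there exist $\epsilon>0$ and $n_2\in \mathbb N$ such that for every $k$-graph $\mathcal{H}$ on $n\ge n_2$ vertices with $n\in \frac k2\mathbb N$ the following holds. If $\delta_d(\mathcal{H})>\overline\delta(n,k,d)$ and $\mathcal{H}$ is $\epsilon$-close to a $\mathcal{B}_{n,k}$ or a $\overline \mathcal{B}_{n,k}$, then $\mathcal{H}$ contains a Hamilton $(k/2)$-cycle.
   Context: A $k$-graph has vertex set $V$ and edge set $E\subseteq\binom{V}{k}$; $\delta_d$ is the minimum number of edges containing a $d$-set, over all $d$-sets. A Hamilton $\ell$-cycle is a spanning subhypergraph whose vertices can be ordered cyclically so that each edge consists of $k$ consecutive vertices and consecutive edges share exactly $\ell$ vertices. Given an $n$-element vertex set $V$ with partition $V=A\,\dot\cup\,B$, a set $S$ is odd (resp. even) if $|S\cap A|$ is odd (resp. even); $\mathcal{B}_{n,k}(A,B)$ has as edges all odd $k$-sets and $\overline{\mathcal{B}}_{n,k}(A,B)$ all even $k$-sets; $\mathcal{B}'_{n,k}(A,B)$ is $\mathcal{B}_{n,k}(A,B)$ plus all $k$-subsets of $A$ containing a fixed vertex of $A$. We write $\mathcal{B}_{n,k}$, $\overline{\mathcal{B}}_{n,k}$ for these hypergraphs with respect to some partition with $|A|,|B|$ differing by at most one (equal sizes). $\mathcal{H}$ is $\epsilon$-close to $\mathcal{H}'$ (both on $n$ vertices) if $\mathcal{H}$ can be made a copy of $\mathcal{H}'$ by adding and deleting at most $\epsilon n^k$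 edges. The family $\mathcal{H}_{\mathrm{ext}}(n,k)$ (over all partitions $A\cup B$) is: if $n\in k\mathbb{N}$, all $\mathcal{B}_{n,k}(A,B)$ with $n/k-|A|$ odd and all $\overline{\mathcal{B}}_{n,k}(A,B)$ with $|A|$ odd; if $n\in\frac k2\mathbb{N}\setminus k\mathbb{N}$, all $\mathcal{B}_{n,k}(A,B)$, together with all $\mathcal{B}'_{n,k}(A,B)$ with $\lfloor n/k\rfloor-|A|$ odd when $k\in 4\mathbb{N}$, and all $\mathcal{B}'_{n,k}(A,B)$ with $\lfloor n/k\rfloor-|A|$ even when $k\in 2\mathbb{N}\setminus 4\mathbb{N}$. $\overline\delta(n,k,d)$ is the maximum of $\delta_d(\mathcal{F})$ over $\mathcal{F}\in\mathcal{H}_{\mathrm{ext}}(n,k)$. -}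

module Defs where

open import Data.Bool using (Bool; true; false; _∧_; _∨_; not; _xor_; if_then_else_)
open import Data.Nat using (ℕ; zero; suc; _+_; _*_; _∸_; _^_; _≤_; _<_; _≡ᵇ_; _⊔_; _⊓_)
open import Data.Nat.DivMod using (_mod_; _/_; _%_)
open import Data.Nat.Divisibility using (_∣_; _∣?_)
open import Data.Fin using (Fin)
open import Data.Fin.Subset using (Subset; ⊥; ⁅_⁆; _∪_; _∩_; ∣_∣)
open import Data.Fin.Permutation using (Permutation′; _⟨$⟩ʳ_)
open import Data.Vec using (Vec; []; _∷_; tabulate; lookup)
open import Data.List using (List; []; _∷_; map; _++_; foldr; filter; concatMap; upTo)
open import Data.Product using (Σ; _×_; _,_)
open import Data.Integer using (+_)
open import Data.Rational using (ℚ) renaming (_/_ to _/ℚ_; _*_ to _*ℚ_; _≤_ to _≤ℚ_)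
open import Relation.Nullary.Decidable using (does)
open import Relation.Binary.PropositionalEquality using (_≡_)
open import Data.Empty renaming (⊥ to Empty)

allSubsets : (n : ℕ) → List (Subset n)
allSubsets zero    = [] ∷ []
allSubsets (suc n) = map (true ∷_) (allSubsets n) ++ map (false ∷_) (allSubsets n)

count : {A : Set} → (A → Bool) → List A → ℕ
count p []       = 0
count p (x ∷ xs) = if p x then suc (count p xs) else count p xs

_⊆ᵇ_ : {n : ℕ} → Subset n → Subset n → Bool
[]      ⊆ᵇ []      = true
(s ∷ S) ⊆ᵇ (t ∷ T) = (not s ∨ t) ∧ (S ⊆ᵇ T)

oddᵇ : ℕ → Bool
oddᵇ zero    = false
oddᵇ (suc m) = not (oddᵇ m)

-- minimum / maximum of a list of naturals (empty list ↦ 0; never used for empty lists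
-- in the relevant range of n)
minList : List ℕ → ℕ
minList []           = 0
minList (x ∷ [])     = x
minList (x ∷ y ∷ ys) = x ⊓ minList (y ∷ ys)

maxList : List ℕ → ℕ
maxList []       = 0
maxList (x ∷ xs) = x ⊔ maxList xs

KGraph : ℕ → Set
KGraph n = Subset n → Bool

Uniform : {n : ℕ} → ℕ → KGraph n → Set
Uniform k H = ∀ S → H S ≡ true → ∣ S ∣ ≡ k

deg : {n : ℕ} → KGraph n → Subset n → ℕ
deg {n} H S = count (λ T → H T ∧ (S ⊆ᵇ T)) (allSubsets n)

δ : {n : ℕ} → ℕ → KGraph n → ℕ
δ {n} d H = minList (map (deg H) (filter (λ S → ∣ S ∣ Data.Nat.≟ d) (allSubsets n)))

-- The extremal constructions, for the partition A ∪ (Fin n ∖ A)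

isOdd : {n : ℕ} → Subset n → Subset n → Bool
isOdd A S = oddᵇ ∣ S ∩ A ∣

𝓑 : {n : ℕ} → ℕ → Subset n → KGraph n
𝓑 k A S = (∣ S ∣ ≡ᵇ k) ∧ isOdd A S

𝓑̄ : {n : ℕ} → ℕ → Subset n → KGraph n
𝓑̄ k A S = (∣ S ∣ ≡ᵇ k) ∧ not (isOdd A S)

𝓑′ : {n : ℕ} → ℕ → Subset n → Fin n → KGraph n
𝓑′ k A a S = 𝓑 k A S ∨ ((∣ S ∣ ≡ᵇ k) ∧ (S ⊆ᵇ A) ∧ lookup S a)

-- the family H_ext(n,k) as a list (over all partitions; B' over all choices a ∈ A)
-- Parities of ⌊n/k⌋ - |A| are computed as parities of ⌊n/k⌋ + |A| (same parity in ℤ).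
ext : (n k : ℕ) → List (KGraph n)
ext n zero = []
ext n (suc k′) = if does (suc k′ ∣? n) then divCase else halfCase
  where
  k = suc k′
  q = n / k
  divCase : List (KGraph n)
  divCase = concatMap
    (λ A → (if oddᵇ (q + ∣ A ∣) then 𝓑 k A ∷ [] else [])
        ++ (if oddᵇ ∣ A ∣ then 𝓑̄ k A ∷ [] else []))
    (allSubsets n)
  primeCond : Subset n → Bool
  primeCond A = if (k % 4 ≡ᵇ 0) then oddᵇ (q + ∣ A ∣)
                else (if (k % 2 ≡ᵇ 0) then not (oddᵇ (q + ∣ A ∣)) else false)
  halfCase : List (KGraph n)
  halfCase = concatMap
    (λ A → 𝓑 k A ∷
       (if primeCond A
        then map (𝓑′ k A) (filter (λ a → Data.Bool._≟_ (lookup A a) true) (Data.List.allFin n))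
        else []))
    (allSubsets n)

δ̄ : ℕ → ℕ → ℕ → ℕ
δ̄ n k d = maxList (map (δ d) (ext n k))

copy : {n : ℕ} → Permutation′ n → KGraph n → KGraph n
copy π H′ S = H′ (tabulate (λ i → lookup S (π ⟨$⟩ʳ i)))

diff : {n : ℕ} → KGraph n → KGraph n → ℕ
diff {n} H H′ = count (λ S → H S xor H′ S) (allSubsets n)

ℕtoℚ : ℕ → ℚ
ℕtoℚ m = (+ m) /ℚ 1

Close : {n : ℕ} → ℚ → ℕ → KGraph n → KGraph n → Set
Close {n} ε k H H′ = Σ (Permutation′ n) λ π → ℕtoℚ (diff H (copy π H′)) ≤ℚ (ε *ℚ ℕtoℚ (n ^ k))

Balanced : {n : ℕ} → Subset n → Set
Balanced {n} A = (∣ A ∣ ≤ suc (n ∸ ∣ A ∣)) × (n ∸ ∣ A ∣ ≤ suc ∣ A ∣)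

CloseToB : {n : ℕ} → ℚ → ℕ → KGraph n → Set
CloseToB {n} ε k H = Σ (Subset n) λ A → Balanced A × Close ε k H (𝓑 k A)

CloseToB̄ : {n : ℕ} → ℚ → ℕ → KGraph n → Set
CloseToB̄ {n} ε k H = Σ (Subset n) λ A → Balanced A × Close ε k H (𝓑̄ k A)

segment : {n : ℕ} → Permutation′ (suc n) → ℕ → ℕ → Subset (suc n)
segment {n} π s k = foldr (λ j acc → ⁅ π ⟨$⟩ʳ ((s + j) mod (suc n)) ⁆ ∪ acc) ⊥ (upTo k)

-- H contains a Hamilton ℓ-cycle: a cyclic ordering π(0),...,π(n-1) of all vertices such
-- that, with (k-ℓ) ∣ n, every segment of k consecutive vertices starting at a multiple of
-- k-ℓ is an edge of H (consecutive such edges share exactly ℓ vertices).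
HamCycle : {n : ℕ} → ℕ → ℕ → KGraph n → Set
HamCycle {zero}  k ℓ H = Empty
HamCycle {suc m} k ℓ H =
  ((k ∸ ℓ) ∣ suc m) ×
  Σ (Permutation′ (suc m)) λ π →
    ∀ i → i * (k ∸ ℓ) < suc m → H (segment π (i * (k ∸ ℓ)) k) ≡ true

module Submission where

-- The vertices are cut into blocks of size h = k / 2, and a Hamilton h-cycle is a cyclic sequence of blocks in which consecutive
-- unions are edges. After moving a few vertices between the classes, every vertex lies in many right edges, those of the parity
-- τ prescribed by the nearby extremal graph, and most sets of that parity are edges. A walk through right edges can then be
-- extended greedily; atypical vertices are absorbed at the start, and a matching into prepared slots uses up the rest. Along right
-- edges the parities of the blocks follow a fixed pattern, so only the total parity can obstruct closing the cycle. In
-- the obstructed cases H has to beat a member of the extremal family, which yields wrong edges; a short gadget through one, two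
-- or three of them corrects the parity.

open import Defs
open import Data.Bool using (Bool; true; false; _∧_; _∨_; not; _xor_; if_then_else_) renaming (T to IsTrue)
open import Data.Bool.Properties using (∧-zeroʳ; ∧-identityʳ; xor-assoc; xor-comm; xor-identityʳ; not-involutive) renaming (xor-same to xor-self; T? to IsTrue?)
open import Data.Empty using () renaming (⊥ to Void)
open import Data.Fin using (Fin; zero; suc; toℕ; fromℕ<)
open import Data.List using (List; []; _∷_; _++_; map; length; concat; [_]; replicate; tabulate; allFin; cartesianProduct; take; drop; foldr; upTo; applyUpTo; _ʳ++_; concatMap)
open import Data.Nat.ListAction using (sum)
open import Data.List.Properties using (concat-++; ∷-injectiveˡ; ∷-injectiveʳ; length-++; map-++; ++-assoc; ++-identityʳ; length-map; length-replicate; tabulate-cong; map-tabulate; map-upTo; length-zipWith; ≡-dec)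
open import Data.Nat using (ℕ; zero; suc; _+_; _*_; _∸_; _^_; _≤_; _<_; _/_; z≤n; s≤s; NonZero; >-nonZero; _≤ᵇ_; _≤?_; _<?_)
open import Data.Nat.Divisibility using (_∣_; _∣?_; divides)
open import Data.Nat.Properties
open import Data.Nat.Tactic.RingSolver using (solve-∀)
open import Data.Product using (Σ; _×_; _,_; ∃; proj₁; proj₂)
open import Data.Rational using (ℚ; 0ℚ) renaming (_<_ to _<ℚ_)
open import Data.Sum using (_⊎_; inj₁; inj₂)
open import Function using (_∘_; case_of_)
open import Relation.Binary.PropositionalEquality hiding (J; [_])
open import Relation.Nullary using (Dec; yes; no; ¬_; does; contradiction)
open import Data.List.Membership.Propositional using (_∈_; _∉_)
open import Data.List.Relation.Binary.Permutation.Propositional using (_↭_; module PermutationReasoning; ↭-refl; ↭-sym; ↭-trans; ↭-reflexive; ↭⇒↭ₛ)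
open import Data.List.Relation.Binary.Permutation.Propositional.Properties using (shift; ++⁺; ++⁺ˡ; ++⁺ʳ; ++-comm; shifts; ↭-length; map⁺; ∈-resp-↭; ↭-map-inv; ++↭ʳ++)
import Data.List.Relation.Binary.Permutation.Setoid.Properties as PermSetoid
open import Data.List.Relation.Unary.All as All using (All; []; _∷_)
open import Data.List.Relation.Unary.AllPairs using ([]; _∷_)
open import Data.List.Relation.Unary.Any using (here; there)
open import Data.List.Relation.Unary.Unique.Propositional using (Unique)
open import Data.Fin.Properties using (any?; toℕ-fromℕ<; toℕ<n; toℕ-injective) renaming (_≟_ to _≟F_)
open import Data.Nat.DivMod using (m/n*n≤m; m/n*n≡m; /-monoʳ-≤; _mod_; _%_; m<n⇒m%n≡m; [m+n]%n≡m%n; m%n<n; +-distrib-/-∣ʳ; m<n⇒m/n≡0; m*n/n≡m; [m+kn]%n≡m%n; m*n%n≡0)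
open import Data.Nat.Base using (_!)
open import Data.List.Relation.Binary.Sublist.Propositional using (_⊆_; []; _∷_; _∷ʳ_; ⊆-trans; ⊆-refl)
open import Data.Unit using (⊤; tt)
open import Data.List.Membership.Propositional.Properties using (∈-++⁺ˡ; ∈-++⁺ʳ; ∈-++⁻; ∈-map⁺; ∈-allFin; ∈-cartesianProduct⁺; ∈-filter⁺; ∈-filter⁻; ∈-tabulate⁻; ∈-concat⁺′; ∈-tabulate⁺)
open import Data.List.Relation.Binary.Sublist.Propositional.Properties using (All-resp-⊆; Any-resp-⊆) renaming (map⁺ to ⊆-map)
import Data.List.Relation.Unary.Unique.Propositional.Properties as Uniq
import Data.Vec as Vec
import Data.Vec.Properties as VecP
open import Data.Fin.Subset using (Subset; ⁅_⁆; _∪_; ∣_∣; _∩_) renaming (⊥ to ∅)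
open import Data.Fin.Permutation using (permutation; Permutation′; _⟨$⟩ʳ_)
open import Data.Fin.Subset.Properties using (∪-assoc; ∪-comm)
import Data.Nat
open import Data.Integer using (+<+) renaming (+_ to int)
import Data.Integer.Properties as ℤP
import Data.Rational as ℚ
import Data.Rational.Properties as ℚP
import Data.Rational.Unnormalised as ℚᵘ
import Data.Rational.Unnormalised.Properties as ℚᵘP
open import Relation.Nullary.Decidable using (dec-true; dec-false; _×-dec_)
open import Data.List.Relation.Unary.All.Properties using (++⁻ˡ)

-- Counting tuples of vertices

bit : Bool → ℕ
bit b = if b then 1 else 0

+-swap-middle : ∀ a b c d → (a + b) + (c + d) ≡ (a + c) + (b + d)
+-swap-middle = solve-∀

twice-twice : ∀ a → 2 * (2 * a) ≡ 4 * a
twice-twice = solve-∀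

*-swap : ∀ a b c → a * (b * c) ≡ b * (a * c)
*-swap = solve-∀

≡-≤ : ∀ {a b c} → a ≡ b → b ≤ c → a ≤ c
≡-≤ refl le = le

≤-≡ : ∀ {a b c} → a ≤ b → b ≡ c → a ≤ c
≤-≡ le refl = le

++-length : ∀ {A : Set} (xs : List A) {ys a b} → length xs ≡ a → length ys ≡ b → length (xs ++ ys) ≡ a + b
++-length xs p q = trans (length-++ xs) (cong₂ _+_ p q)

opaque
 ∑ : ∀ {n} → (Fin n → ℕ) → ℕ
 ∑ {zero} f = 0
 ∑ {suc n} f = f zero + ∑ (λ i → f (suc i))

 Sum : ∀ {n} → ℕ → (List (Fin n) → ℕ) → ℕ
 Sum zero f = f []
 Sum (suc t) f = ∑ (λ v → Sum t (λ xs → f (v ∷ xs)))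

 # : ∀ {n} → ℕ → (List (Fin n) → Bool) → ℕ
 # t P = Sum t (λ xs → bit (P xs))

 ∑-mono : ∀ {n} {f g : Fin n → ℕ} → (∀ v → f v ≤ g v) → ∑ f ≤ ∑ g
 ∑-mono {zero} le = z≤n
 ∑-mono {suc n} le = +-mono-≤ (le zero) (∑-mono (λ v → le (suc v)))

 ∑-cong : ∀ {n} {f g : Fin n → ℕ} → (∀ v → f v ≡ g v) → ∑ f ≡ ∑ g
 ∑-cong {zero} eq = refl
 ∑-cong {suc n} eq = cong₂ _+_ (eq zero) (∑-cong (λ v → eq (suc v)))

 ∑-+ : ∀ {n} (f g : Fin n → ℕ) → ∑ (λ v → f v + g v) ≡ ∑ f + ∑ g
 ∑-+ {zero} f g = refl
 ∑-+ {suc n} f g = trans (cong (f zero + g zero +_) (∑-+ (λ v → f (suc v)) (λ v → g (suc v))))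
  (+-swap-middle (f zero) (g zero) _ _)

 ∑-* : ∀ {n} c (f : Fin n → ℕ) → ∑ (λ v → c * f v) ≡ c * ∑ f
 ∑-* {zero} c f = sym (*-zeroʳ c)
 ∑-* {suc n} c f = trans (cong (c * f zero +_) (∑-* c (λ v → f (suc v)))) (sym (*-distribˡ-+ c (f zero) _))

 ∑-const : ∀ n c → ∑ {n} (λ _ → c) ≡ n * c
 ∑-const zero c = refl
 ∑-const (suc n) c = cong (c +_) (∑-const n c)

 ∑-comm : ∀ {n m} (f : Fin n → Fin m → ℕ) → ∑ (λ v → ∑ (f v)) ≡ ∑ (λ w → ∑ (λ v → f v w))
 ∑-comm {zero} {m} f = sym (trans (∑-const m 0) (*-zeroʳ m))
 ∑-comm {suc n} f = trans (cong (∑ (f zero) +_) (∑-comm (λ v → f (suc v))))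
  (sym (∑-+ (f zero) (λ w → ∑ (λ v → f (suc v) w))))

 S-mono : ∀ {n} t {f g : List (Fin n) → ℕ} →
  (∀ xs → length xs ≡ t → f xs ≤ g xs) → Sum t f ≤ Sum t g
 S-mono zero le = le [] refl
 S-mono (suc t) le = ∑-mono (λ v → S-mono t (λ xs e → le (v ∷ xs) (cong suc e)))

 S-cong : ∀ {n} t {f g : List (Fin n) → ℕ} →
  (∀ xs → length xs ≡ t → f xs ≡ g xs) → Sum t f ≡ Sum t g
 S-cong zero eq = eq [] refl
 S-cong (suc t) eq = ∑-cong (λ v → S-cong t (λ xs e → eq (v ∷ xs) (cong suc e)))

 S-++ : ∀ {n} a b (f : List (Fin n) → ℕ) → Sum (a + b) f ≡ Sum a (λ xs → Sum b (λ ys → f (xs ++ ys)))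
 S-++ zero b f = refl
 S-++ (suc a) b f = ∑-cong (λ v → S-++ a b (λ xs → f (v ∷ xs)))

 S-+ : ∀ {n} t (f g : List (Fin n) → ℕ) → Sum t (λ xs → f xs + g xs) ≡ Sum t f + Sum t g
 S-+ zero f g = refl
 S-+ (suc t) f g = trans (∑-cong (λ v → S-+ t (λ xs → f (v ∷ xs)) (λ xs → g (v ∷ xs)))) (∑-+ (λ v → Sum t (λ xs → f (v ∷ xs))) (λ v → Sum t (λ xs → g (v ∷ xs))))

 S-* : ∀ {n} t c (f : List (Fin n) → ℕ) → Sum t (λ xs → c * f xs) ≡ c * Sum t f
 S-* zero c f = refl
 S-* (suc t) c f = trans (∑-cong (λ v → S-* t c (λ xs → f (v ∷ xs)))) (∑-* c (λ v → Sum t (λ xs → f (v ∷ xs))))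

 S-const : ∀ {n} t c → Sum {n} t (λ _ → c) ≡ n ^ t * c
 S-const zero c = sym (*-identityˡ c)
 S-const {n} (suc t) c = trans (∑-cong {n} {λ _ → Sum {n} t (λ _ → c)} {λ _ → n ^ t * c} (λ v → S-const {n} t c))
  (trans (∑-const n (n ^ t * c)) (sym (*-assoc n (n ^ t) c)))

 S-∑ : ∀ {n m} t (f : Fin m → List (Fin n) → ℕ) →
  Sum t (λ xs → ∑ (λ v → f v xs)) ≡ ∑ (λ v → Sum t (f v))
 S-∑ zero f = refl
 S-∑ (suc t) f = trans (∑-cong (λ w → S-∑ t (λ v xs → f v (w ∷ xs)))) (∑-comm (λ w v → Sum t (λ xs → f v (w ∷ xs))))

 #≡S : ∀ {n} t (P : List (Fin n) → Bool) → # t P ≡ Sum t (λ xs → bit (P xs))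
 #≡S t P = refl

 #-suc : ∀ {n} t (P : List (Fin n) → Bool) → # (suc t) P ≡ ∑ (λ v → # t (λ xs → P (v ∷ xs)))
 #-suc t P = refl

 #-zero : ∀ {n} (P : List (Fin n) → Bool) → # 0 P ≡ bit (P [])
 #-zero P = refl

 ∑-suc : ∀ {n} (f : Fin (suc n) → ℕ) → ∑ f ≡ f zero + ∑ (λ i → f (suc i))
 ∑-suc f = refl

 #-++ : ∀ {n} a b (P : List (Fin n) → Bool) → # (a + b) P ≡ Sum a (λ xs → # b (λ ys → P (xs ++ ys)))
 #-++ a b P = S-++ a b (λ xs → bit (P xs))

 term-≤-∑ : ∀ {n} (f : Fin n → ℕ) v → f v ≤ ∑ f
 term-≤-∑ f zero = m≤m+n (f zero) (∑ (λ v → f (suc v)))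
 term-≤-∑ f (suc v) = ≤-trans (term-≤-∑ (λ v → f (suc v)) v) (m≤n+m _ (f zero))

 ∑-find : ∀ {n} (f : Fin n → ℕ) → 0 < ∑ f → ∃ λ v → 0 < f v
 ∑-find {suc n} f lt with 0 <? f zero
 ... | yes p = zero , p
 ... | no ¬p with ∑-find (λ v → f (suc v)) (subst (λ z → 0 < z + ∑ (λ v → f (suc v))) (n≤0⇒n≡0 (≮⇒≥ ¬p)) lt)
 ... | v , p = suc v , p

 #-cong : ∀ {n} t {P R : List (Fin n) → Bool} → (∀ xs → length xs ≡ t → P xs ≡ R xs) → # t P ≡ # t R
 #-cong t e = S-cong t (λ xs l → cong bit (e xs l))

 #-split : ∀ {n} t {P R T : List (Fin n) → Bool} → (∀ xs → length xs ≡ t → bit (P xs) ≡ bit (R xs) + bit (T xs)) → # t P ≡ # t R + # t T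
 #-split t e = trans (S-cong t e) (S-+ t _ _)

 #-none : ∀ {n} t → # {n} t (λ _ → false) ≡ 0
 #-none {n} t = trans (S-const {n} t 0) (*-zeroʳ (n ^ t))

 #-find : ∀ {n} t {P : List (Fin n) → Bool} → 0 < # t P → ∃ λ xs → length xs ≡ t × P xs ≡ true
 #-find zero {P} lt with P [] in e
 ... | true = [] , refl , e
 #-find (suc t) {P} lt with ∑-find (λ v → # t (λ xs → P (v ∷ xs))) lt
 ... | v , lt′ with #-find t lt′
 ... | xs , e , p = v ∷ xs , cong suc e , p

 size : ∀ {n} → (Fin n → Bool) → ℕ
 size P = ∑ (λ v → bit (P v))

 size≡ : ∀ {n} (P : Fin n → Bool) → size P ≡ ∑ (λ v → bit (P v))
 size≡ P = refl

bit-mono : ∀ {a b} → (a ≡ true → b ≡ true) → bit a ≤ bit b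
bit-mono {false} i = z≤n
bit-mono {true} i = ≤-reflexive (cong bit (sym (i refl)))

bit-∨ : ∀ a b → bit (a ∨ b) ≤ bit a + bit b
bit-∨ false b = ≤-refl
bit-∨ true b = s≤s z≤n

bit≤1 : ∀ a → bit a ≤ 1
bit≤1 false = z≤n
bit≤1 true = ≤-refl

bit-not : ∀ a → bit a + bit (not a) ≡ 1
bit-not false = refl
bit-not true = refl

∧-true : ∀ {a b} → a ∧ b ≡ true → a ≡ true × b ≡ true
∧-true {true} {true} e = refl , refl

∧-intro : ∀ {a b} → a ≡ true → b ≡ true → a ∧ b ≡ true
∧-intro refl refl = refl

∨-true : ∀ {a b} → a ∨ b ≡ true → a ≡ true ⊎ b ≡ true
∨-true {true} e = inj₁ refl
∨-true {false} e = inj₂ e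

∨-false : ∀ {a b} → a ∨ b ≡ false → a ≡ false × b ≡ false
∨-false {false} {false} e = refl , refl

∧-left : ∀ {a b} → a ∧ b ≡ true → a ≡ true
∧-left {a} e = proj₁ (∧-true {a} e)

∧-right : ∀ {a b} → a ∧ b ≡ true → b ≡ true
∧-right {a} e = proj₂ (∧-true {a} e)

∨-left : ∀ {a b} → a ∨ b ≡ false → a ≡ false
∨-left {a} e = proj₁ (∨-false {a} e)

∨-right : ∀ {a b} → a ∨ b ≡ false → b ≡ false
∨-right {a} e = proj₂ (∨-false {a} e)

∨-introˡ : ∀ {a b} → a ≡ true → a ∨ b ≡ true
∨-introˡ refl = refl

∨-introʳ : ∀ {a b} → b ≡ true → a ∨ b ≡ true
∨-introʳ {true} e = refl
∨-introʳ {false} e = e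

not-true : ∀ {a} → not a ≡ true → a ≡ false
not-true {false} e = refl

not-false : ∀ {a} → not a ≡ false → a ≡ true
not-false {true} e = refl

¬true : ∀ {a} → ¬ (a ≡ true) → a ≡ false
¬true {false} _ = refl
¬true {true} f = contradiction refl f

decide : ∀ b → b ≡ true ⊎ b ≡ false
decide true = inj₁ refl
decide false = inj₂ refl

≤ᵇ-true : ∀ {a b} → (a ≤ᵇ b) ≡ true → a ≤ b
≤ᵇ-true {a} {b} e = ≤ᵇ⇒≤ a b (subst IsTrue (sym e) _)

≤ᵇ-false : ∀ {a b} → (a ≤ᵇ b) ≡ false → b < a
≤ᵇ-false {a} {b} e = ≰⇒> λ le → subst IsTrue e (≤⇒≤ᵇ le)

≤⇒≤ᵇ-true : ∀ {a b} → a ≤ b → (a ≤ᵇ b) ≡ true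
≤⇒≤ᵇ-true {a} {b} le with a ≤ᵇ b in e
... | true = refl
... | false = contradiction le (<⇒≱ (≤ᵇ-false e))

opaque
 unfolding #

 #-mono : ∀ {n} t {P R : List (Fin n) → Bool} →
  (∀ xs → length xs ≡ t → P xs ≡ true → R xs ≡ true) → # t P ≤ # t R
 #-mono t i = S-mono t (λ xs e → bit-mono (i xs e))

 #-∨ : ∀ {n} t (P R : List (Fin n) → Bool) → # t (λ xs → P xs ∨ R xs) ≤ # t P + # t R
 #-∨ t P R = ≤-≡ (S-mono t (λ xs _ → bit-∨ (P xs) (R xs))) (S-+ t (λ xs → bit (P xs)) (λ xs → bit (R xs)))

 #-≤ : ∀ {n} t (P : List (Fin n) → Bool) → # t P ≤ n ^ t
 #-≤ {n} t P = ≤-≡ (S-mono t (λ xs _ → bit≤1 (P xs))) (trans (S-const {n} t 1) (*-identityʳ (n ^ t)))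

 #-not : ∀ {n} t (P : List (Fin n) → Bool) → # t P + # t (λ xs → not (P xs)) ≡ n ^ t
 #-not {n} t P = trans (sym (S-+ t (λ xs → bit (P xs)) (λ xs → bit (not (P xs))))) (trans (S-cong t (λ xs _ → bit-not (P xs)))
  (trans (S-const {n} t 1) (*-identityʳ (n ^ t))))

 S-bit : ∀ {n} t c (P : List (Fin n) → Bool) → Sum t (λ xs → c * bit (P xs)) ≡ c * # t P
 S-bit t c P = S-* t c (λ xs → bit (P xs))

record Rare {n} (q t : ℕ) (P : List (Fin n) → Bool) : Set where
 constructor mkRare
 field rare-≤ : q * # t P ≤ n ^ t
open Rare public

record Dense {n} (q t : ℕ) (P : List (Fin n) → Bool) : Set where
 constructor mkDense
 field dense-≤ : n ^ t ≤ q * # t P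
open Dense public

rare-weaken : ∀ {n q q′ t} {P : List (Fin n) → Bool} → q′ ≤ q → Rare q t P → Rare q′ t P
rare-weaken {t = t} {P} le (mkRare r) = mkRare (≤-trans (*-monoˡ-≤ (# t P) le) r)

rare-mono : ∀ {n q t} {P R : List (Fin n) → Bool} →
 (∀ xs → length xs ≡ t → P xs ≡ true → R xs ≡ true) → Rare q t R → Rare q t P
rare-mono {q = q} {t} i (mkRare r) = mkRare (≤-trans (*-monoʳ-≤ q (#-mono t i)) r)

dense-weaken : ∀ {n q q′ t} {P : List (Fin n) → Bool} → q ≤ q′ → Dense q t P → Dense q′ t P
dense-weaken {t = t} {P} le (mkDense r) = mkDense (≤-trans r (*-monoˡ-≤ (# t P) le))

dense-mono : ∀ {n q t} {P R : List (Fin n) → Bool} →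
 (∀ xs → length xs ≡ t → P xs ≡ true → R xs ≡ true) → Dense q t P → Dense q t R
dense-mono {q = q} {t} i (mkDense r) = mkDense (≤-trans r (*-monoʳ-≤ q (#-mono t i)))

rare-∨ : ∀ {n q t} {P R : List (Fin n) → Bool} →
 Rare (2 * q) t P → Rare (2 * q) t R → Rare q t (λ xs → P xs ∨ R xs)
rare-∨ {n} {q} {t} {P} {R} (mkRare p) (mkRare r) = mkRare (*-cancelˡ-≤ 2 (begin
 2 * (q * # t (λ xs → P xs ∨ R xs)) ≤⟨ *-monoʳ-≤ 2 (*-monoʳ-≤ q (#-∨ t P R)) ⟩
 2 * (q * (# t P + # t R)) ≡⟨ regroup q (# t P) (# t R) ⟩
 2 * q * # t P + 2 * q * # t R ≤⟨ +-mono-≤ p r ⟩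
 n ^ t + n ^ t ≡⟨ cong (n ^ t +_) (sym (+-identityʳ _)) ⟩
 2 * n ^ t ∎))
 where
 open ≤-Reasoning
 regroup : ∀ q a b → 2 * (q * (a + b)) ≡ 2 * q * a + 2 * q * b
 regroup = solve-∀

dense-minus : ∀ {n q t} {P R : List (Fin n) → Bool} →
 Dense q t P → Rare (2 * q) t R → Dense (2 * q) t (λ xs → P xs ∧ not (R xs))
dense-minus {n} {q} {t} {P} {R} (mkDense p) (mkRare r) = mkDense (+-cancelʳ-≤ (n ^ t) _ _ (begin
 n ^ t + n ^ t ≡⟨ cong (n ^ t +_) (sym (+-identityʳ _)) ⟩
 2 * n ^ t ≤⟨ *-monoʳ-≤ 2 p ⟩
 2 * (q * # t P) ≡⟨ sym (*-assoc 2 q _) ⟩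
 2 * q * # t P ≤⟨ *-monoʳ-≤ (2 * q) (≤-trans (#-mono t split) (#-∨ t _ R)) ⟩
 2 * q * (# t PR + # t R) ≡⟨ *-distribˡ-+ (2 * q) (# t PR) (# t R) ⟩
 2 * q * # t PR + 2 * q * # t R ≤⟨ +-monoʳ-≤ _ r ⟩
 2 * q * # t PR + n ^ t ∎))
 where
 open ≤-Reasoning
 PR : List (Fin n) → Bool
 PR xs = P xs ∧ not (R xs)
 split : ∀ xs → length xs ≡ t → P xs ≡ true → (PR xs ∨ R xs) ≡ true
 split xs _ e with R xs
 ... | true = ∨-introʳ refl
 ... | false = cong (λ z → (z ∧ true) ∨ false) e

dense-find : ∀ {n q t} .{{_ : NonZero n}} {P : List (Fin n) → Bool} →
 Dense q t P → ∃ λ xs → length xs ≡ t × P xs ≡ true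
dense-find {n} {q} {t} {P} (mkDense p) with # t P in e
... | suc c = #-find t (subst (0 <_) (sym e) (s≤s z≤n))
... | zero = contradiction (≤-trans (m^n>0 n t) (≤-≡ p (*-zeroʳ q))) λ ()

light : ∀ {n} → ℕ → ℕ → (List (Fin n) → Bool) → List (Fin n) → Bool
light {n} q b P xs = q * # b (λ ys → P (xs ++ ys)) ≤ᵇ n ^ b

heavy : ∀ {n} → ℕ → ℕ → (List (Fin n) → Bool) → List (Fin n) → Bool
heavy {n} q b P xs = n ^ b ≤ᵇ q * # b (λ ys → P (xs ++ ys))

light-rare : ∀ {n q b} {P : List (Fin n) → Bool} xs → light q b P xs ≡ true → Rare q b (λ ys → P (xs ++ ys))
light-rare xs e = mkRare (≤ᵇ-true e)

heavy-dense : ∀ {n q b} {P : List (Fin n) → Bool} xs → heavy q b P xs ≡ true → Dense q b (λ ys → P (xs ++ ys))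
heavy-dense xs e = mkDense (≤ᵇ-true e)

markov : ∀ {n} .{{_ : NonZero n}} Q q {a b} {P : List (Fin n) → Bool} →
 Rare (Q * q) (a + b) P → Rare Q a (λ xs → not (light q b P xs))
markov {n} Q q {a} {b} {P} (mkRare r) = mkRare (*-cancelˡ-≤ (n ^ b) {{m^n≢0 n b}} (begin
 n ^ b * (Q * # a notlight) ≡⟨ *-swap (n ^ b) Q (# a notlight) ⟩
 Q * (n ^ b * # a notlight) ≡⟨ cong (Q *_) (sym (S-bit a (n ^ b) notlight)) ⟩
 Q * Sum a (λ xs → n ^ b * bit (notlight xs)) ≤⟨ *-monoʳ-≤ Q (S-mono a (λ xs _ → step xs)) ⟩
 Q * Sum a (λ xs → q * # b (λ ys → P (xs ++ ys))) ≡⟨ cong (Q *_) (S-* a q _) ⟩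
 Q * (q * Sum a (λ xs → # b (λ ys → P (xs ++ ys)))) ≡⟨ cong (λ z → Q * (q * z)) (sym (#-++ a b P)) ⟩
 Q * (q * # (a + b) P) ≡⟨ sym (*-assoc Q q _) ⟩
 Q * q * # (a + b) P ≤⟨ r ⟩
 n ^ (a + b) ≡⟨ trans (^-distribˡ-+-* n a b) (*-comm (n ^ a) _) ⟩
 n ^ b * n ^ a ∎))
 where
 open ≤-Reasoning
 notlight : List (Fin n) → Bool
 notlight xs = not (light q b P xs)
 step : ∀ xs → n ^ b * bit (notlight xs) ≤ q * # b (λ ys → P (xs ++ ys))
 step xs with light q b P xs in e
 ... | true = ≡-≤ (*-zeroʳ (n ^ b)) z≤n
 ... | false = ≡-≤ (*-identityʳ (n ^ b)) (<⇒≤ (≤ᵇ-false e))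

dense-heavy : ∀ {n} .{{_ : NonZero n}} q {a b} {P : List (Fin n) → Bool} →
 Dense q (a + b) P → Dense (2 * q) a (heavy (2 * q) b P)
dense-heavy {n} q {a} {b} {P} (mkDense p) = mkDense (*-cancelˡ-≤ (n ^ b) {{m^n≢0 n b}} (+-cancelʳ-≤ (n ^ a * n ^ b) _ _ (begin
 n ^ b * n ^ a + n ^ a * n ^ b ≡⟨ twice (n ^ a) (n ^ b) ⟩
 2 * (n ^ a * n ^ b) ≡⟨ cong (2 *_) (sym (^-distribˡ-+-* n a b)) ⟩
 2 * n ^ (a + b) ≤⟨ *-monoʳ-≤ 2 p ⟩
 2 * (q * # (a + b) P) ≡⟨ sym (*-assoc 2 q _) ⟩
 2 * q * # (a + b) P ≡⟨ cong (2 * q *_) (#-++ a b P) ⟩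
 2 * q * Sum a (λ xs → # b (λ ys → P (xs ++ ys))) ≡⟨ sym (S-* a (2 * q) _) ⟩
 Sum a (λ xs → 2 * q * # b (λ ys → P (xs ++ ys))) ≤⟨ S-mono a (λ xs _ → step xs) ⟩
 Sum a (λ xs → n ^ b * (2 * q) * bit (hv xs) + n ^ b) ≡⟨ trans (S-+ a _ _) (cong₂ _+_ (S-bit a (n ^ b * (2 * q)) hv) (S-const {n} a (n ^ b))) ⟩
 n ^ b * (2 * q) * # a hv + n ^ a * n ^ b ≡⟨ cong (_+ n ^ a * n ^ b) (*-assoc (n ^ b) (2 * q) _) ⟩
 n ^ b * (2 * q * # a hv) + n ^ a * n ^ b ∎)))
 where
 open ≤-Reasoning
 hv : List (Fin n) → Bool
 hv = heavy (2 * q) b P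
 twice : ∀ x y → y * x + x * y ≡ 2 * (x * y)
 twice = solve-∀
 step : ∀ xs → 2 * q * # b (λ ys → P (xs ++ ys)) ≤ n ^ b * (2 * q) * bit (hv xs) + n ^ b
 step xs with heavy (2 * q) b P xs in e
 ... | true = ≤-trans (*-monoʳ-≤ (2 * q) (#-≤ b _)) (≡-≤ (trans (*-comm (2 * q) (n ^ b)) (sym (*-identityʳ _))) (m≤m+n _ _))
 ... | false = ≤-trans (<⇒≤ (≤ᵇ-false {n ^ b} e)) (m≤n+m (n ^ b) _)

none-rare : ∀ {n} q t → Rare {n} q t (λ _ → false)
none-rare {n} q t = mkRare (≡-≤ (trans (cong (q *_) (#-none t)) (*-zeroʳ q)) z≤n)

Unique-↭ : ∀ {A : Set} {xs ys : List A} → xs ↭ ys → Unique xs → Unique ys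
Unique-↭ {A} p = PermSetoid.Unique-resp-↭ (setoid A) (↭⇒↭ₛ p)

infix 4 _≐_
_≐_ : Bool → Bool → Bool
a ≐ b = not (a xor b)

≐-refl : ∀ a → (a ≐ a) ≡ true
≐-refl true = refl
≐-refl false = refl

≐-true : ∀ {a b} → (a ≐ b) ≡ true → a ≡ b
≐-true {true} {true} e = refl
≐-true {false} {false} e = refl

≐-intro : ∀ {a b} → a ≡ b → (a ≐ b) ≡ true
≐-intro {a} refl = ≐-refl a

≐-false : ∀ {a b} → (a ≐ b) ≡ false → a ≡ not b
≐-false {true} {false} e = refl
≐-false {false} {true} e = refl

mem : ∀ {n} → Fin n → List (Fin n) → Bool
mem v [] = false
mem v (u ∷ U) = does (v ≟F u) ∨ mem v U

fresh : ∀ {n} → List (Fin n) → List (Fin n) → Bool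
fresh U [] = true
fresh U (x ∷ xs) = not (mem x U) ∧ fresh (x ∷ U) xs

mem-∈ : ∀ {n} {v : Fin n} U → mem v U ≡ true → v ∈ U
mem-∈ {v = v} (u ∷ U) e with v ≟F u
... | yes p = here p
... | no _ = there (mem-∈ U e)

∈-mem : ∀ {n} {v : Fin n} {U} → v ∈ U → mem v U ≡ true
∈-mem {v = v} {u ∷ U} (here p) with v ≟F u
... | yes _ = refl
... | no ¬p = contradiction p ¬p
∈-mem {v = v} {u ∷ U} (there m) = ∨-introʳ {does (v ≟F u)} (∈-mem m)

mem-∉ : ∀ {n} {v : Fin n} U → mem v U ≡ false → v ∉ U
mem-∉ U e m = contradiction (trans (sym (∈-mem m)) e) λ ()

∉-mem : ∀ {n} {v : Fin n} U → v ∉ U → mem v U ≡ false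
∉-mem U ∉ = ¬true λ e → ∉ (mem-∈ U e)

∉-All : ∀ {A : Set} {v : A} {U} → v ∉ U → All (v ≢_) U
∉-All {U = []} ∉ = []
∉-All {U = u ∷ U} ∉ = (λ e → ∉ (here e)) ∷ ∉-All (λ m → ∉ (there m))

All-∉ : ∀ {A : Set} {v : A} {U} → All (v ≢_) U → v ∉ U
All-∉ (p ∷ ps) (here e) = p e
All-∉ (p ∷ ps) (there m) = All-∉ ps m

fresh-unique : ∀ {n} {U : List (Fin n)} xs → Unique U → fresh U xs ≡ true → Unique (xs ++ U)
fresh-unique [] u e = u
fresh-unique {U = U} (x ∷ xs) u e with ∧-true {not (mem x U)} e
... | e₁ , e₂ = Unique-↭ (shift x xs U)
 (fresh-unique xs (∉-All (mem-∉ U (not-true e₁)) ∷ u) e₂)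

unique-fresh : ∀ {n} {U : List (Fin n)} xs → Unique (xs ++ U) → fresh U xs ≡ true
unique-fresh [] u = refl
unique-fresh {U = U} (x ∷ xs) u with Unique-↭ (↭-sym (shift x xs U)) u
... | u′ = ∧-intro (cong not (∉-mem U (∉U xs u′))) (unique-fresh xs u′)
 where
 ∉U : ∀ ys → Unique (ys ++ x ∷ U) → x ∉ U
 ∉U [] (p ∷ _) = All-∉ p
 ∉U (y ∷ ys) (_ ∷ q) = ∉U ys q

∑-indicator : ∀ {n} (v : Fin n) b → ∑ (λ w → bit (does (w ≟F v) ∧ b)) ≡ bit b
∑-indicator {suc n} zero b = trans (∑-suc {n} _)
 (trans (cong (bit b +_) (trans (∑-const n 0) (*-zeroʳ n))) (+-identityʳ (bit b)))
∑-indicator {suc n} (suc v) b = trans (∑-suc {n} _) (trans (∑-cong step) (∑-indicator v b))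
 where
 step : ∀ w → bit (does (suc w ≟F suc v) ∧ b) ≡ bit (does (w ≟F v) ∧ b)
 step w with w ≟F v
 ... | yes _ = refl
 ... | no _ = refl

cnt : ∀ {n} → (Fin n → Bool) → Bool → List (Fin n) → ℕ
cnt χ c [] = 0
cnt χ c (x ∷ xs) = bit (χ x ≐ c) + cnt χ c xs

avail : ∀ {n} → (Fin n → Bool) → Bool → List (Fin n) → ℕ
avail χ c U = size (λ v → (χ v ≐ c) ∧ not (mem v U))

avail-∷ : ∀ {n} (χ : Fin n → Bool) c v U →
 avail χ c U ≡ avail χ c (v ∷ U) + bit (not (mem v U) ∧ (χ v ≐ c))
avail-∷ {n} χ c v U = trans (size≡ P) (trans (∑-cong pointwise)
 (trans (∑-+ (λ w → bit (P′ w)) (λ w → bit (does (w ≟F v) ∧ b)))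
  (cong₂ _+_ (sym (size≡ P′)) (∑-indicator v b))))
 where
 b : Bool
 b = not (mem v U) ∧ (χ v ≐ c)
 P P′ : Fin n → Bool
 P w = (χ w ≐ c) ∧ not (mem w U)
 P′ w = (χ w ≐ c) ∧ not (mem w (v ∷ U))
 pointwise : ∀ w → bit (P w) ≡ bit (P′ w) + bit (does (w ≟F v) ∧ b)
 pointwise w with w ≟F v
 ... | no _ = sym (+-identityʳ _)
 ... | yes refl with χ v ≐ c | mem v U
 ... | true | true = refl
 ... | true | false = refl
 ... | false | true = refl
 ... | false | false = refl

avail-≤ : ∀ {n} (χ : Fin n → Bool) c v U → avail χ c U ≤ suc (avail χ c (v ∷ U))
avail-≤ χ c v U = ≡-≤ (avail-∷ χ c v U)
 (≤-≡ (+-monoʳ-≤ (avail χ c (v ∷ U)) (bit≤1 (not (mem v U) ∧ (χ v ≐ c)))) (+-comm _ 1))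

avail-cnt : ∀ {n} (χ : Fin n → Bool) c {U} → Unique U → avail χ c U + cnt χ c U ≡ avail χ c []
avail-cnt χ c {[]} [] = +-identityʳ _
avail-cnt χ c {v ∷ U} (p ∷ u) = begin
 avail χ c (v ∷ U) + (bit (χ v ≐ c) + cnt χ c U)
  ≡⟨ sym (+-assoc (avail χ c (v ∷ U)) _ _) ⟩
 avail χ c (v ∷ U) + bit (χ v ≐ c) + cnt χ c U
  ≡⟨ cong (λ b → avail χ c (v ∷ U) + bit (not b ∧ (χ v ≐ c)) + cnt χ c U) (sym (∉-mem U (All-∉ p))) ⟩
 avail χ c (v ∷ U) + bit (not (mem v U) ∧ (χ v ≐ c)) + cnt χ c U
  ≡⟨ cong (_+ cnt χ c U) (sym (avail-∷ χ c v U)) ⟩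
 avail χ c U + cnt χ c U
  ≡⟨ avail-cnt χ c u ⟩
 avail χ c [] ∎
 where open ≡-Reasoning

avail-total : ∀ {n} (χ : Fin n → Bool) → avail χ true [] + avail χ false [] ≡ n
avail-total {n} χ = trans (cong₂ _+_ (size≡ _) (size≡ _)) (trans (sym (∑-+ {n} _ _))
 (trans (∑-cong pointwise) (trans (∑-const n 1) (*-identityʳ n))))
 where
 pointwise : ∀ v → bit ((χ v ≐ true) ∧ true) + bit ((χ v ≐ false) ∧ true) ≡ 1
 pointwise v with χ v
 ... | true = refl
 ... | false = refl

cnt-total : ∀ {n} (χ : Fin n → Bool) xs → cnt χ true xs + cnt χ false xs ≡ length xs
cnt-total χ [] = refl
cnt-total χ (x ∷ xs) = trans (+-swap-middle (bit (χ x ≐ true)) _ _ _) (cong₂ _+_ one (cnt-total χ xs))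
 where
 one : bit (χ x ≐ true) + bit (χ x ≐ false) ≡ 1
 one with χ x
 ... | true = refl
 ... | false = refl

cnt-++ : ∀ {n} (χ : Fin n → Bool) c xs ys → cnt χ c (xs ++ ys) ≡ cnt χ c xs + cnt χ c ys
cnt-++ χ c [] ys = refl
cnt-++ χ c (x ∷ xs) ys = trans (cong (bit (χ x ≐ c) +_) (cnt-++ χ c xs ys)) (sym (+-assoc (bit (χ x ≐ c)) _ _))

opaque
 unfolding ∑ size
 small-or-large : ∀ {n} (P : Fin n → Bool) (f : Fin n → ℕ) q →
  (∃ λ v → P v ≡ true × f v < q) ⊎ (size P * q ≤ ∑ f)
 small-or-large {zero} P f q = inj₂ z≤n
 small-or-large {suc n} P f q with small-or-large (λ i → P (suc i)) (λ i → f (suc i)) q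
 ... | inj₁ (v , Pv , fv) = inj₁ (suc v , Pv , fv)
 ... | inj₂ le with P zero in eq
 ... | false = inj₂ (≤-trans le (m≤n+m _ (f zero)))
 ... | true with f zero <? q
 ... | yes fz = inj₁ (zero , eq , fz)
 ... | no ¬fz = inj₂ (+-mono-≤ (≮⇒≥ ¬fz) le)

-- The classes are consumed one vertex at a time, so that only the number of unused vertices
-- of each class matters, not the number of all vertices.
choose : ∀ {n} (χ : Fin n → Bool) cs U p (P : List (Fin n) → Bool) →
 (∀ c → p + length cs ≤ avail χ c U) → # (length cs) P < p ^ length cs →
 ∃ λ xs → map χ xs ≡ cs × fresh U xs ≡ true × P xs ≡ false
choose χ [] U p P big few with P [] in e
... | false = [] , refl , refl , e
... | true = contradiction (subst (_< 1) (trans (#-zero P) (cong bit e)) few) (<-irrefl refl)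
choose χ (c ∷ cs) U p P big few
 with small-or-large (λ v → (χ v ≐ c) ∧ not (mem v U)) (λ v → # (length cs) (λ xs → P (v ∷ xs))) (p ^ length cs)
... | inj₂ le = contradiction (≤-trans (*-monoˡ-≤ (p ^ length cs) (≤-trans (m≤m+n p _) (big c))) le)
 (<⇒≱ (subst (_< p * p ^ length cs) (#-suc (length cs) P) few))
... | inj₁ (v , ok , few′) with ∧-true {χ v ≐ c} ok
... | ok₁ , ok₂ with choose χ cs (v ∷ U) p (λ xs → P (v ∷ xs))
     (λ c′ → ≤-pred (≡-≤ (sym (+-suc p (length cs))) (≤-trans (big c′) (avail-≤ χ c′ v U)))) few′
... | xs , e , f , ok′ = v ∷ xs , cong₂ _∷_ (≐-true ok₁) e , ∧-intro ok₂ f , ok′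

clash-bound : ∀ {n} t (U : List (Fin n)) →
 n * # t (λ xs → not (fresh U xs)) ≤ t * (length U + t) * n ^ t
clash-bound {n} zero U = ≡-≤ (trans (cong (n *_) (#-zero {n} (λ xs → not (fresh U xs)))) (*-zeroʳ n)) z≤n
clash-bound {n} (suc t) U = begin
 n * # (suc t) clash
  ≡⟨ cong (n *_) (#-suc t clash) ⟩
 n * ∑ (λ v → # t (λ xs → clash (v ∷ xs)))
  ≤⟨ *-monoʳ-≤ n (∑-mono split) ⟩
 n * ∑ (λ v → n ^ t * bit (mem v U) + # t (λ xs → not (fresh (v ∷ U) xs)))
  ≡⟨ cong (n *_) (trans (∑-+ _ _) (cong (_+ ∑ rest) (∑-* (n ^ t) (λ v → bit (mem v U))))) ⟩
 n * (n ^ t * ∑ (λ v → bit (mem v U)) + ∑ rest)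
  ≤⟨ *-monoʳ-≤ n (+-monoˡ-≤ (∑ rest) (*-monoʳ-≤ (n ^ t) (mem-size U))) ⟩
 n * (n ^ t * length U + ∑ rest)
  ≡⟨ *-distribˡ-+ n _ _ ⟩
 n * (n ^ t * length U) + n * ∑ rest
  ≡⟨ cong (n * (n ^ t * length U) +_) (sym (∑-* n rest)) ⟩
 n * (n ^ t * length U) + ∑ (λ v → n * rest v)
  ≤⟨ +-monoʳ-≤ _ (∑-mono (λ v → clash-bound t (v ∷ U))) ⟩
 n * (n ^ t * length U) + ∑ {n} (λ v → t * (suc (length U) + t) * n ^ t)
  ≡⟨ cong (n * (n ^ t * length U) +_) (∑-const n _) ⟩
 n * (n ^ t * length U) + n * (t * (suc (length U) + t) * n ^ t)
  ≡⟨ regroup n (n ^ t) (length U) t ⟩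
 (length U + t * (suc (length U) + t)) * (n * n ^ t)
  ≤⟨ *-monoˡ-≤ (n * n ^ t) (+-mono-≤ (m≤m+n (length U) (suc t)) (≤-reflexive (cong (t *_) (sym (+-suc (length U) t))))) ⟩
 (length U + suc t + t * (length U + suc t)) * (n * n ^ t) ∎
 where
 open ≤-Reasoning
 clash : List (Fin n) → Bool
 clash xs = not (fresh U xs)
 rest : Fin n → ℕ
 rest v = # t (λ xs → not (fresh (v ∷ U) xs))
 regroup : ∀ n x u t → n * (x * u) + n * (t * (suc u + t) * x) ≡ (u + t * (suc u + t)) * (n * x)
 regroup = solve-∀
 mem-size : ∀ U → ∑ (λ v → bit (mem v U)) ≤ length U
 mem-size [] = ≤-reflexive (trans (∑-const n 0) (*-zeroʳ n))
 mem-size (u ∷ U) = ≤-trans (∑-mono (λ v → bit-∨ (does (v ≟F u)) (mem v U)))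
  (≡-≤ (∑-+ _ _) (+-mono-≤ (≤-reflexive (trans
   (∑-cong (λ v → cong bit (sym (∧-comm′ (does (v ≟F u)))))) (∑-indicator u true))) (mem-size U)))
  where
  ∧-comm′ : ∀ b → b ∧ true ≡ b
  ∧-comm′ true = refl
  ∧-comm′ false = refl
 split : ∀ v → # t (λ xs → clash (v ∷ xs)) ≤ n ^ t * bit (mem v U) + rest v
 split v with mem v U
 ... | true = ≤-trans (#-≤ t _) (≡-≤ (sym (*-identityʳ (n ^ t))) (m≤m+n _ _))
 ... | false = m≤n+m _ _

clash-rare : ∀ {n} .{{_ : NonZero n}} q t (U : List (Fin n)) → q * (t * (length U + t)) ≤ n →
 Rare q t (λ xs → not (fresh U xs))
clash-rare {n} q t U le = mkRare (*-cancelˡ-≤ n (begin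
 n * (q * # t clash) ≡⟨ *-swap n q (# t clash) ⟩
 q * (n * # t clash) ≤⟨ *-monoʳ-≤ q (clash-bound t U) ⟩
 q * (t * (length U + t) * n ^ t) ≡⟨ sym (*-assoc q _ (n ^ t)) ⟩
 q * (t * (length U + t)) * n ^ t ≤⟨ *-monoˡ-≤ (n ^ t) le ⟩
 n * n ^ t ∎))
 where
 open ≤-Reasoning
 clash : List (Fin n) → Bool
 clash xs = not (fresh U xs)

fresh-list-unique : ∀ {n} (xs : List (Fin n)) → fresh [] xs ≡ true → Unique xs
fresh-list-unique xs e = subst Unique (++-identityʳ xs) (fresh-unique xs [] e)

unique-fresh-[] : ∀ {n} (xs : List (Fin n)) → Unique xs → fresh [] xs ≡ true
unique-fresh-[] xs u = unique-fresh xs (subst Unique (sym (++-identityʳ xs)) u)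

-- Traces of set systems

opaque
 allᵇ : ∀ {h} → (Fin h → Bool) → Bool
 allᵇ {zero} P = true
 allᵇ {suc h} P = P zero ∧ allᵇ (λ x → P (suc x))

 allᵇ-elim : ∀ {h} {P : Fin h → Bool} → allᵇ P ≡ true → ∀ x → P x ≡ true
 allᵇ-elim {P = P} e zero = ∧-left {P zero} e
 allᵇ-elim {P = P} e (suc x) = allᵇ-elim (∧-right {P zero} e) x

 allᵇ-intro : ∀ {h} {P : Fin h → Bool} → (∀ x → P x ≡ true) → allᵇ P ≡ true
 allᵇ-intro {zero} p = refl
 allᵇ-intro {suc h} p = ∧-intro (p zero) (allᵇ-intro (λ x → p (suc x)))

 allᵇ-false : ∀ {h} {P : Fin h → Bool} → allᵇ P ≡ false → ∃ λ x → P x ≡ false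
 allᵇ-false {suc h} {P} e with P zero in e₀
 ... | false = zero , e₀
 ... | true with allᵇ-false {h} e
 ... | x , ex = suc x , ex

bool-≡ : ∀ {a b} → (a ≡ true → b ≡ true) → (b ≡ true → a ≡ true) → a ≡ b
bool-≡ {true} {b} f g = sym (f refl)
bool-≡ {false} {b} f g = sym (¬true λ e → contradiction (g e) λ ())

size-cong : ∀ {n} {P R : Fin n → Bool} → (∀ v → P v ≡ R v) → size P ≡ size R
size-cong {P = P} {R} eq = trans (size≡ P) (trans (∑-cong (λ v → cong bit (eq v))) (sym (size≡ R)))

size-split : ∀ {n} (P R R′ : Fin n → Bool) → (∀ v → bit (P v) ≡ bit (R v) + bit (R′ v)) →
 size P ≡ size R + size R′
size-split P R R′ eq = trans (size≡ P) (trans (∑-cong eq) (trans (∑-+ _ _)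
 (sym (cong₂ _+_ (size≡ R) (size≡ R′)))))

size-false : ∀ {n} {P : Fin n → Bool} → (∀ v → P v ≡ false) → size P ≡ 0
size-false {n} {P} e = trans (size≡ P) (trans (∑-cong (λ v → cong bit (e v))) (trans (∑-const n 0) (*-zeroʳ n)))

size-find : ∀ {n} {P : Fin n → Bool} → 0 < size P → ∃ λ v → P v ≡ true
size-find {P = P} lt with ∑-find (λ v → bit (P v)) (subst (0 <_) (size≡ P) lt)
... | v , p = v , bit-true p
 where
 bit-true : ∀ {b} → 0 < bit b → b ≡ true
 bit-true {true} _ = refl

size-pos : ∀ {n} {P : Fin n → Bool} v → P v ≡ true → 0 < size P
size-pos {n} {P} v e = ≡-≤ (sym (∑-indicator v true))
 (≤-≡ (∑-mono le) (sym (size≡ P)))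
 where
 le : ∀ w → bit (does (w ≟F v) ∧ true) ≤ bit (P w)
 le w with w ≟F v
 ... | yes refl = ≤-reflexive (cong bit (sym e))
 ... | no _ = z≤n

size-indicator : ∀ {n} (v : Fin n) b → size (λ w → does (w ≟F v) ∧ b) ≡ bit b
size-indicator v b = trans (size≡ _) (∑-indicator v b)

∑-select : ∀ {n} c (P : Fin n → Bool) → ∑ (λ v → c * bit (P v)) ≡ c * size P
∑-select c P = trans (∑-* c _) (cong (c *_) (sym (size≡ P)))

weight : ℕ → ℕ → ℕ
weight W zero = 0
weight W (suc b) = W / suc b

weight-≤ : ∀ W b → weight W b * b ≤ W
weight-≤ W zero = z≤n
weight-≤ W (suc b) = m/n*n≤m W (suc b)

weight-! : ∀ h b → 0 < b → b ≤ h → weight (h !) b * b ≡ h !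
weight-! h (suc b) _ le = m/n*n≡m (∣-trans (m∣m*n (b !)) (m≤n⇒m!∣n! le))
 where open import Data.Nat.Divisibility using (∣-trans; m∣m*n; m≤n⇒m!∣n!)

weight-antitone : ∀ W {a b} → 0 < a → a ≤ b → weight W b ≤ weight W a
weight-antitone W {suc a} {suc b} _ le = /-monoʳ-≤ W le

-- Row q of M, restricted to the columns alive in X, is a set; Y tells which rows are alive.
module Traces {r h : ℕ} (M : Fin r → Fin h → Bool) where

 opaque
  sub : (Fin h → Bool) → Fin r → (Fin h → Bool) → Bool
  sub X q I = allᵇ (λ x → not (X x ∧ M q x) ∨ I x)

  sub-elim : ∀ {X q I} → sub X q I ≡ true → ∀ x → X x ≡ true → M q x ≡ true → I x ≡ true
  sub-elim {X} {q} {I} e x Xx Mx with allᵇ-elim e x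
  ... | e′ rewrite Xx | Mx = e′

  sub-intro : ∀ {X q I} → (∀ x → X x ≡ true → M q x ≡ true → I x ≡ true) → sub X q I ≡ true
  sub-intro {X} {q} {I} f = allᵇ-intro step
   where
   step : ∀ x → (not (X x ∧ M q x) ∨ I x) ≡ true
   step x with X x in e₁ | M q x in e₂
   ... | false | _ = refl
   ... | true | false = refl
   ... | true | true = f x e₁ e₂

  sub-false : ∀ {X q I} → sub X q I ≡ false → ∃ λ x → X x ≡ true × M q x ≡ true × I x ≡ false
  sub-false {X} {q} {I} e with allᵇ-false e
  ... | x , e′ with X x in e₁ | M q x in e₂
  ... | true | true = x , e₁ , e₂ , e′
  ... | true | false = contradiction e′ λ ()
  ... | false | _ = contradiction e′ λ ()

 Goal : (Fin h → Bool) → (Fin r → Bool) → ℕ → Set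
 Goal X Y t = ∃ λ I → (∀ x → I x ≡ true → X x ≡ true) × size I + size (λ q → Y q ∧ sub X q I) ≡ t

 Nonempty : (Fin h → Bool) → (Fin r → Bool) → Set
 Nonempty X Y = ∀ q → Y q ≡ true → ∃ λ x → X x ≡ true × M q x ≡ true

 missed : (Fin r → Bool) → Fin h → ℕ
 missed Y x = size (λ q → Y q ∧ not (M q x))

 outside : (Fin h → Bool) → Fin r → ℕ
 outside X q = size (λ x → X x ∧ not (M q x))

 -- Double counting of the non-incident pairs, where the pair (x, q) has weight 1 / missed x.
 light-pair : ∀ X Y → size Y < size X → (∀ x → X x ≡ true → ∃ λ q → Y q ≡ true × M q x ≡ false) →
  ∃ λ x → ∃ λ q → X x ≡ true × Y q ≡ true × M q x ≡ false × missed Y x < outside X q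
 light-pair X Y lt miss with any? (λ x → any? (λ q → Data.Bool._≟_
   (X x ∧ (Y q ∧ (not (M q x) ∧ (suc (missed Y x) ≤ᵇ outside X q)))) true))
 ... | yes (x , q , e) with ∧-true {X x} e
 ... | e₁ , e′ with ∧-true {Y q} e′
 ... | e₂ , e″ with ∧-true {not (M q x)} e″
 ... | e₃ , e₄ = x , q , e₁ , e₂ , not-true e₃ , ≤ᵇ-true e₄
 light-pair X Y lt miss | no none = contradiction lt (≤⇒≯ (*-cancelʳ-≤ (size X) (size Y) W {{W≢0}} (begin
  size X * W ≡⟨ trans (*-comm (size X) W) (sym (∑-select W X)) ⟩
  ∑ (λ x → W * bit (X x)) ≤⟨ ∑-mono row ⟩
  ∑ (λ x → ∑ (λ q → weight W (missed Y x) * bit (pair x q))) ≤⟨ ∑-mono (λ x → ∑-mono (λ q → compare x q)) ⟩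
  ∑ (λ x → ∑ (λ q → weight W (outside X q) * bit (pair x q))) ≡⟨ ∑-comm _ ⟩
  ∑ (λ q → ∑ (λ x → weight W (outside X q) * bit (pair x q))) ≤⟨ ∑-mono column ⟩
  ∑ (λ q → W * bit (Y q)) ≡⟨ trans (∑-select W Y) (*-comm W (size Y)) ⟩
  size Y * W ∎)))
  where
  open ≤-Reasoning
  W : ℕ
  W = r !
  W≢0 : NonZero W
  W≢0 = r !≢0
  pair : Fin h → Fin r → Bool
  pair x q = X x ∧ (Y q ∧ not (M q x))
  row : ∀ x → W * bit (X x) ≤ ∑ (λ q → weight W (missed Y x) * bit (pair x q))
  row x with X x in e
  ... | false = ≡-≤ (*-zeroʳ W) z≤n
  ... | true with miss x e
  ... | q , Yq , Mq = ≤-reflexive (trans (*-identityʳ W) (trans (sym (weight-! r (missed Y x)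
      (size-pos q (∧-intro Yq (cong not Mq))) missed≤)) (sym (∑-select (weight W (missed Y x)) (λ q → Y q ∧ not (M q x))))))
   where
   missed≤ : missed Y x ≤ r
   missed≤ = ≡-≤ (size≡ _) (≤-≡ (∑-mono (λ q → bit≤1 (Y q ∧ not (M q x))))
    (trans (∑-const r 1) (*-identityʳ r)))
  column : ∀ q → ∑ (λ x → weight W (outside X q) * bit (pair x q)) ≤ W * bit (Y q)
  column q with Y q
  ... | false = ≤-reflexive (trans (∑-cong (λ x → cong (λ b → weight W (outside X q) * bit b) (∧-false (X x))))
     (trans (∑-const h _) (trans (cong (h *_) (*-zeroʳ (weight W (outside X q)))) (trans (*-zeroʳ h) (sym (*-zeroʳ W))))))
   where
   ∧-false : ∀ b → b ∧ false ≡ false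
   ∧-false true = refl
   ∧-false false = refl
  ... | true = ≡-≤ (∑-select (weight W (outside X q)) (λ x → X x ∧ not (M q x)))
     (≤-≡ (weight-≤ W (outside X q)) (sym (*-identityʳ W)))
  compare : ∀ x q → weight W (missed Y x) * bit (pair x q) ≤ weight W (outside X q) * bit (pair x q)
  compare x q with X x in e₁ | Y q in e₂ | M q x in e₃
  ... | false | _ | _ = ≤-reflexive (trans (*-zeroʳ (weight W (missed Y x))) (sym (*-zeroʳ (weight W (outside X q)))))
  ... | true | false | _ = ≤-reflexive (trans (*-zeroʳ (weight W (missed Y x))) (sym (*-zeroʳ (weight W (outside X q)))))
  ... | true | true | true = ≤-reflexive (trans (*-zeroʳ (weight W (missed Y x))) (sym (*-zeroʳ (weight W (outside X q)))))
  ... | true | true | false = *-monoˡ-≤ 1 (weight-antitone W (size-pos x (∧-intro e₁ (cong not e₃)))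
     (≮⇒≥ λ lt′ → none (x , q , ∧-intro e₁ (∧-intro e₂ (∧-intro (cong not e₃) (≤⇒≤ᵇ-true lt′))))))
  open import Data.Nat.Properties using (_!≢0)

 without : Fin h → (Fin h → Bool) → Fin h → Bool
 without u X x = X x ∧ not (does (x ≟F u))

 without-self : ∀ u X → without u X u ≡ false
 without-self u X with u ≟F u
 ... | yes _ = ∧-zeroʳ (X u)
 ... | no ¬p = contradiction refl ¬p

 without-other : ∀ u X {x} → x ≢ u → X x ≡ true → without u X x ≡ true
 without-other u X {x} ne e with x ≟F u
 ... | yes p = contradiction p ne
 ... | no _ = ∧-intro e refl

 size-without : ∀ u X → X u ≡ true → size X ≡ suc (size (without u X))
 size-without u X e = trans (size-split X (λ x → does (x ≟F u) ∧ true) (without u X) pointwise)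
  (cong (_+ size (without u X)) (size-indicator u true))
  where
  pointwise : ∀ x → bit (X x) ≡ bit (does (x ≟F u) ∧ true) + bit (without u X x)
  pointwise x with x ≟F u
  ... | yes refl rewrite e = refl
  ... | no _ with X x
  ... | true = refl
  ... | false = refl

 -- Either a vertex can be discarded, or some set J is forced into I and a vertex u outside J,
 -- which lies in at least as many sets as J has elements, is forced out of I.
 traces : ∀ fuel X Y t → size X ≤ fuel → Nonempty X Y → size Y ≤ t → t < size X → Goal X Y t
 traces zero X Y t fuel ne rt tX = contradiction (≤-trans tX fuel) λ ()
 traces (suc fuel) X Y t fuel≥ ne rt tX with suc t <? size X
 ... | yes tX′ = discard (size-find {P = X} (≤-trans (s≤s z≤n) tX))
  where
  discard : (∃ λ u → X u ≡ true) → Goal X Y t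
  discard (u , Xu) = done (traces fuel (without u X) Y′ t
    (≤-pred (subst (_≤ suc fuel) (size-without u X Xu) fuel≥)) ne′
    (≤-trans (≡-≤ (size≡ Y′) (≤-≡ (∑-mono (λ q → bit-mono (λ e → ∧-left e))) (sym (size≡ Y)))) rt)
    (≤-pred (subst (suc t <_) (size-without u X Xu) tX′)))
   where
   Y′ : Fin r → Bool
   Y′ q = Y q ∧ not (M q u)
   ne′ : Nonempty (without u X) Y′
   ne′ q e with ∧-true {Y q} e
   ... | Yq , Mq with ne q Yq
   ... | x , Xx , Mx = x , without-other u X (λ { refl → contradiction (trans (sym Mx) (not-true Mq)) λ () }) Xx , Mx
   done : Goal (without u X) Y′ t → Goal X Y t
   done (I , IX , eq) = I , (λ x e → ∧-left {X x} (IX x e)) ,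
    trans (cong (size I +_) (size-cong λ q → bool-≡ (to q) (from q))) eq
    where
    Iu : I u ≡ false
    Iu = ¬true λ e → contradiction (trans (sym (IX u e)) (without-self u X)) λ ()
    to : ∀ q → Y q ∧ sub X q I ≡ true → Y′ q ∧ sub (without u X) q I ≡ true
    to q e with ∧-true {Y q} e
    ... | Yq , s = ∧-intro (∧-intro Yq (cong not (¬true λ Mu → contradiction (trans (sym (sub-elim s u Xu Mu)) Iu) λ ())))
     (sub-intro λ x Xx Mx → sub-elim s x (∧-left {X x} Xx) Mx)
    from : ∀ q → Y′ q ∧ sub (without u X) q I ≡ true → Y q ∧ sub X q I ≡ true
    from q e with ∧-true {Y′ q} e
    ... | Yq′ , s with ∧-true {Y q} Yq′
    ... | Yq , Mu = ∧-intro Yq (sub-intro λ x Xx Mx → sub-elim s x (without-other u X (λ { refl →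
        contradiction (trans (sym Mx) (not-true Mu)) λ () }) Xx) Mx)
 ... | no tX′ with any? (λ u → Data.Bool._≟_ (X u ∧ allᵇ (λ q → not (Y q) ∨ M q u)) true)
 ... | yes (u , e) = common (∧-true e)
  where
  common : X u ≡ true × allᵇ (λ q → not (Y q) ∨ M q u) ≡ true → Goal X Y t
  common (Xu , all) = without u X , (λ x e → ∧-left {X x} e) ,
   trans (cong (size (without u X) +_) (size-false none)) (trans (+-identityʳ _)
    (suc-injective (trans (sym (size-without u X Xu)) (≤-antisym (≮⇒≥ tX′) tX))))
   where
   none : ∀ q → Y q ∧ sub X q (without u X) ≡ false
   none q = ¬true contra
    where
    contra : ¬ (Y q ∧ sub X q (without u X) ≡ true)
    contra e with ∧-true {Y q} e | allᵇ-elim all q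
    ... | Yq , s | e′ rewrite Yq = contradiction (trans (sym (sub-elim s u Xu e′)) (without-self u X)) λ ()
 ... | no none = force (light-pair X Y (≤-<-trans rt tX) miss)
  where
  sX : size X ≡ suc t
  sX = ≤-antisym (≮⇒≥ tX′) tX
  miss : ∀ x → X x ≡ true → ∃ λ q → Y q ≡ true × M q x ≡ false
  miss x Xx with allᵇ-false (¬true λ e → none (x , ∧-intro Xx e))
  ... | q , e with ∨-false {not (Y q)} e
  ... | e₁ , e₂ = q , not-false e₁ , e₂
  force : (∃ λ u → ∃ λ p → X u ≡ true × Y p ≡ true × M p u ≡ false × missed Y u < outside X p) → Goal X Y t
  force (u , p , Xu , Yp , Mpu , light) = done (traces fuel X′ Y′ (size Y′ + (outside X p ∸ suc (missed Y u)))
    (≤-trans (m≤n+m (size X′) (size J)) (≤-pred (≡-≤ (sym sizeX) fuel≥)))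
    ne′ (m≤m+n _ _) target<)
   where
   J X′ : Fin h → Bool
   J x = X x ∧ M p x
   X′ x = without u X x ∧ not (M p x)
   Y′ inJ : Fin r → Bool
   Y′ q = (Y q ∧ not (M q u)) ∧ not (sub X q J)
   inJ q = Y q ∧ sub X q J
   slack : ℕ
   slack = outside X p ∸ suc (missed Y u)
   outside≡ : outside X p ≡ suc (missed Y u + slack)
   outside≡ = sym (m+[n∸m]≡n light)
   outside-X′ : outside X p ≡ suc (size X′)
   outside-X′ = trans (size-split _ (λ x → does (x ≟F u) ∧ true) X′ pointwise) (cong (_+ size X′) (size-indicator u true))
    where
    pointwise : ∀ x → bit (X x ∧ not (M p x)) ≡ bit (does (x ≟F u) ∧ true) + bit (X′ x)
    pointwise x with x ≟F u
    ... | yes refl rewrite Xu | Mpu = refl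
    ... | no _ with X x
    ... | true = refl
    ... | false = refl
   sizeX : size X ≡ suc (size J + size X′)
   sizeX = trans (size-split X J (λ x → X x ∧ not (M p x)) pointwise)
    (trans (cong (size J +_) outside-X′) (+-suc (size J) (size X′)))
    where
    pointwise : ∀ x → bit (X x) ≡ bit (J x) + bit (X x ∧ not (M p x))
    pointwise x with X x | M p x
    ... | true | true = refl
    ... | true | false = refl
    ... | false | true = refl
    ... | false | false = refl
   inJ-avoids : ∀ q → inJ q ≡ true → M q u ≡ false
   inJ-avoids q e with ∧-true {Y q} e
   ... | Yq , s = ¬true λ Mu → contradiction (trans (sym (sub-elim s u Xu Mu))
      (trans (cong (_∧ M p u) Xu) Mpu)) λ ()
   missed≡ : missed Y u ≡ size inJ + size Y′
   missed≡ = size-split _ inJ Y′ pointwise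
    where
    pointwise : ∀ q → bit (Y q ∧ not (M q u)) ≡ bit (inJ q) + bit (Y′ q)
    pointwise q with sub X q J in s | Y q in y | M q u in m
    ... | true | true | true = contradiction (trans (sym m) (inJ-avoids q (∧-intro y s))) λ ()
    ... | true | true | false = refl
    ... | true | false | _ = refl
    ... | false | true | true = refl
    ... | false | true | false = refl
    ... | false | false | _ = refl
   inJ>0 : 0 < size inJ
   inJ>0 = size-pos p (∧-intro Yp (sub-intro λ x Xx Mx → ∧-intro Xx Mx))
   target< : size Y′ + slack < size X′
   target< = ≤-≡ (+-monoˡ-≤ (size Y′ + slack) inJ>0) (trans (sym (+-assoc (size inJ) _ slack))
    (trans (cong (_+ slack) (sym missed≡)) (suc-injective (trans (sym outside≡) outside-X′))))
   ne′ : Nonempty X′ Y′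
   ne′ q e with ∧-true {Y q ∧ not (M q u)} e
   ... | e₁ , e₂ with ∧-true {Y q} e₁ | sub-false (not-true e₂)
   ... | Yq , Mqu | x , Xx , Mx , Jx = x , ∧-intro (without-other u X (λ { refl → contradiction (trans (sym Mx) (not-true Mqu)) λ () }) Xx)
        (cong not (trans (cong (_∧ M p x) (sym Xx)) Jx)) , Mx
   done : Goal X′ Y′ (size Y′ + slack) → Goal X Y t
   done (I , IX , eq) = I∪J , IX′ , (begin
    size I∪J + size (λ q → Y q ∧ sub X q I∪J)
     ≡⟨ cong₂ _+_ (size-split I∪J I J union) (size-split _ inJ (λ q → Y′ q ∧ sub X′ q I) rows) ⟩
    (size I + size J) + (size inJ + size (λ q → Y′ q ∧ sub X′ q I))
     ≡⟨ shuffle (size I) (size J) (size inJ) _ ⟩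
    size J + (size inJ + (size I + size (λ q → Y′ q ∧ sub X′ q I)))
     ≡⟨ cong (λ z → size J + (size inJ + z)) eq ⟩
    size J + (size inJ + (size Y′ + slack))
     ≡⟨ cong (size J +_) (trans (sym (+-assoc (size inJ) _ slack)) (cong (_+ slack) (sym missed≡))) ⟩
    size J + (missed Y u + slack)
     ≡⟨ cong (size J +_) (suc-injective (trans (sym outside≡) outside-X′)) ⟩
    size J + size X′
     ≡⟨ suc-injective (trans (sym sizeX) sX) ⟩
    t ∎)
    where
    open ≡-Reasoning
    shuffle : ∀ a b c d → (a + b) + (c + d) ≡ b + (c + (a + d))
    shuffle = solve-∀
    I∪J : Fin h → Bool
    I∪J x = I x ∨ J x
    I-X′ : ∀ x → I x ≡ true → X x ≡ true × x ≢ u × M p x ≡ false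
    I-X′ x e with ∧-true {without u X x} (IX x e)
    ... | e₁ , e₂ = ∧-left {X x} e₁ , (λ { refl → contradiction (trans (sym e₁) (without-self u X)) λ () }) , not-true e₂
    IX′ : ∀ x → I∪J x ≡ true → X x ≡ true
    IX′ x e with ∨-true {I x} e
    ... | inj₁ i = proj₁ (I-X′ x i)
    ... | inj₂ j = ∧-left {X x} j
    union : ∀ x → bit (I∪J x) ≡ bit (I x) + bit (J x)
    union x with I x in e
    ... | false = refl
    ... | true rewrite proj₂ (proj₂ (I-X′ x e)) | proj₁ (I-X′ x e) = refl
    I∪J-u : I∪J u ≡ false
    I∪J-u = ¬true λ e → case ∨-true {I u} e of λ
     { (inj₁ i) → proj₁ (proj₂ (I-X′ u i)) refl
     ; (inj₂ j) → contradiction (trans (sym (∧-right {X u} j)) Mpu) λ () }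
    rows : ∀ q → bit (Y q ∧ sub X q I∪J) ≡ bit (inJ q) + bit (Y′ q ∧ sub X′ q I)
    rows q with Y q
    ... | false = refl
    ... | true with sub X q J in s
    ... | true = trans (cong bit (sub-intro {I = I∪J} λ x Xx Mx → ∨-introʳ {I x} (sub-elim s x Xx Mx)))
        (cong (λ b → suc (bit (b ∧ sub X′ q I))) (sym (∧-false (not (M q u)))))
     where
     ∧-false : ∀ b → b ∧ false ≡ false
     ∧-false true = refl
     ∧-false false = refl
    ... | false with M q u in m
    ... | true = cong bit (¬true λ s′ → contradiction (trans (sym (sub-elim {I = I∪J} s′ u Xu m)) I∪J-u) λ ())
    ... | false = cong bit (bool-≡ {sub X q I∪J} {sub X′ q I}
         (λ s′ → sub-intro λ x Xx Mx → inI x (∧-true {without u X x} Xx) (sub-elim {I = I∪J} s′ x (∧-left {X x} (∧-left {without u X x} Xx)) Mx))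
         (λ s′ → sub-intro λ x Xx Mx → back x Xx Mx s′))
     where
     inI : ∀ x → without u X x ≡ true × not (M p x) ≡ true → I∪J x ≡ true → I x ≡ true
     inI x (_ , nM) e with ∨-true {I x} e
     ... | inj₁ i = i
     ... | inj₂ j = contradiction (trans (sym (∧-right {X x} j)) (not-true nM)) λ ()
     back : ∀ x → X x ≡ true → M q x ≡ true → sub X′ q I ≡ true → I∪J x ≡ true
     back x Xx Mx s′ with M p x in mp
     ... | true = ∨-introʳ {I x} (∧-intro Xx refl)
     ... | false = ∨-introˡ {I x} (sub-elim s′ x (∧-intro (without-other u X (λ { refl →
         contradiction (trans (sym Mx) m) λ () }) Xx) (cong not mp)) Mx)

-- Ramsey theory for pairs of edges

Homogeneous : {A : Set} → ℕ → (List A → Bool) → List A → Bool → Set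
Homogeneous k f ys b = ∀ zs → zs ⊆ ys → length zs ≡ k → f zs ≡ b

EndHomogeneous : {A : Set} → ℕ → (List A → Bool) → List (A × Bool) → Set
EndHomogeneous k f [] = ⊤
EndHomogeneous k f ((x , b) ∷ ps) =
 (∀ zs → zs ⊆ map proj₁ ps → length zs ≡ k → f (x ∷ zs) ≡ b) × EndHomogeneous k f ps

select : {A : Set} → Bool → List (A × Bool) → List A
select c [] = []
select c ((x , b) ∷ ps) = if b ≐ c then x ∷ select c ps else select c ps

select-⊆ : {A : Set} (c : Bool) (ps : List (A × Bool)) → select c ps ⊆ map proj₁ ps
select-⊆ c [] = []
select-⊆ c ((x , b) ∷ ps) with b ≐ c
... | true = refl ∷ select-⊆ c ps
... | false = x ∷ʳ select-⊆ c ps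

select-homogeneous : {A : Set} (k : ℕ) (f : List A → Bool) (c : Bool) (ps : List (A × Bool)) →
 EndHomogeneous k f ps → Homogeneous (suc k) f (select c ps) c
select-homogeneous k f c [] _ .[] [] ()
select-homogeneous k f c ((x , b) ∷ ps) (hx , hs) zs sub len with b ≐ c in e
select-homogeneous k f c ((x , b) ∷ ps) (hx , hs) zs sub len | false = select-homogeneous k f c ps hs zs sub len
select-homogeneous k f c ((x , b) ∷ ps) (hx , hs) zs (.x ∷ʳ sub) len | true = select-homogeneous k f c ps hs zs sub len
select-homogeneous k f c ((x , b) ∷ ps) (hx , hs) (.x ∷ zs) (refl ∷ sub) len | true =
 trans (hx zs (⊆-trans sub (select-⊆ c ps)) (suc-injective len)) (≐-true e)

select-length : {A : Set} (ps : List (A × Bool)) → length (select true ps) + length (select false ps) ≡ length ps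
select-length [] = refl
select-length ((x , true) ∷ ps) = cong suc (select-length ps)
select-length ((x , false) ∷ ps) = trans (+-suc _ _) (cong suc (select-length ps))

Ramsey : ℕ → ℕ → ℕ → Set₁
Ramsey k M N = ∀ {A : Set} (f : List A → Bool) xs → N ≤ length xs →
 ∃ λ ys → ys ⊆ xs × M ≤ length ys × ∃ λ b → Homogeneous k f ys b

ramsey : (k M : ℕ) → ∃ (Ramsey k M)
ramsey zero M = M , λ f xs le → xs , ⊆-refl , le , f [] , λ { [] _ _ → refl }
ramsey (suc k) M with end-homogeneous (M + M)
 where
 end-homogeneous : ∀ L → ∃ λ N → ∀ {A : Set} (f : List A → Bool) xs → N ≤ length xs →
  ∃ λ ps → map proj₁ ps ⊆ xs × length ps ≡ L × EndHomogeneous k f ps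
 end-homogeneous zero = 0 , λ f xs _ → [] , minimum xs , refl , tt
  where
  minimum : ∀ {A : Set} (xs : List A) → [] ⊆ xs
  minimum [] = []
  minimum (x ∷ xs) = x ∷ʳ minimum xs
 end-homogeneous (suc L) with end-homogeneous L
 ... | N₁ , r₁ with ramsey k N₁
 ... | N₂ , r₂ = suc N₂ , λ { f (x ∷ xs) (s≤s le) → extend f x xs (r₂ (λ zs → f (x ∷ zs)) xs le) }
  where
  extend : ∀ {A : Set} f (x : A) xs → (∃ λ ys → ys ⊆ xs × N₁ ≤ length ys × ∃ λ b → Homogeneous k (λ zs → f (x ∷ zs)) ys b) →
   ∃ λ ps → map proj₁ ps ⊆ x ∷ xs × length ps ≡ suc L × EndHomogeneous k f ps
  extend f x xs (ys , sub , le , b , hom) with r₁ f ys le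
  ... | ps , sub′ , len , end = (x , b) ∷ ps , refl ∷ ⊆-trans sub′ sub , cong suc len ,
     (λ zs s → hom zs (⊆-trans s sub′)) , end
... | N , r = N , λ f xs le → finish f xs (r f xs le)
 where
 finish : ∀ {A : Set} f (xs : List A) → (∃ λ ps → map proj₁ ps ⊆ xs × length ps ≡ M + M × EndHomogeneous k f ps) →
  ∃ λ ys → ys ⊆ xs × M ≤ length ys × ∃ λ b → Homogeneous (suc k) f ys b
 finish f xs (ps , sub , len , end) with M ≤? length (select true ps)
 ... | yes le = select true ps , ⊆-trans (select-⊆ true ps) sub , le , true , select-homogeneous k f true ps end
 ... | no ¬le = select false ps , ⊆-trans (select-⊆ false ps) sub ,
    +-cancelˡ-≤ M M _ (≡-≤ (sym (trans (select-length ps) len)) (+-monoˡ-≤ _ (<⇒≤ (≰⇒> ¬le)))) ,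
    false , select-homogeneous k f false ps end

ramseyAll : {ι : Set} (is : List ι) (k M : ℕ) → ∃ λ N → ∀ {A : Set} (f : ι → List A → Bool) xs → N ≤ length xs →
 ∃ λ ys → ys ⊆ xs × M ≤ length ys × All (λ i → ∃ (Homogeneous k (f i) ys)) is
ramseyAll [] k M = M , λ f xs le → xs , ⊆-refl , le , []
ramseyAll {ι} (i ∷ is) k M with ramsey k M
... | N₁ , r₁ with ramseyAll is k N₁
... | N₂ , r₂ = N₂ , λ f xs le → step f xs (r₂ f xs le)
 where
 step : ∀ {A : Set} (f : ι → List A → Bool) xs →
  (∃ λ ys → ys ⊆ xs × N₁ ≤ length ys × All (λ i → ∃ (Homogeneous k (f i) ys)) is) →
  ∃ λ ys → ys ⊆ xs × M ≤ length ys × All (λ i → ∃ (Homogeneous k (f i) ys)) (i ∷ is)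
 step f xs (ys , sub , le , homs) with r₁ (f i) ys le
 ... | ys′ , sub′ , le′ , b , hom = ys′ , ⊆-trans sub′ sub , le′ ,
    (b , hom) ∷ All.map (λ { (b′ , h) → b′ , λ zs s → h zs (⊆-trans s sub′) }) homs

∈-allSubsets : ∀ {n} (X : Subset n) → X ∈ allSubsets n
∈-allSubsets Vec.[] = here refl
∈-allSubsets (true Vec.∷ X) = ∈-++⁺ˡ (∈-map⁺ (true Vec.∷_) (∈-allSubsets X))
∈-allSubsets {suc n} (false Vec.∷ X) = ∈-++⁺ʳ (map (true Vec.∷_) (allSubsets n)) (∈-map⁺ (false Vec.∷_) (∈-allSubsets X))

unique-++ : {A : Set} {xs ys : List A} → Unique xs → Unique ys → (∀ {x} → x ∈ xs → x ∉ ys) → Unique (xs ++ ys)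
unique-++ u v d = Uniq.++⁺ u v λ { (p , q) → d p q }

unique-++ˡ : {A : Set} (xs : List A) {ys : List A} → Unique (xs ++ ys) → Unique xs
unique-++ˡ [] u = []
unique-++ˡ (x ∷ xs) (p ∷ u) = ++⁻ˡ xs p ∷ unique-++ˡ xs u

unique-++ʳ : {A : Set} (xs : List A) {ys : List A} → Unique (xs ++ ys) → Unique ys
unique-++ʳ [] u = u
unique-++ʳ (x ∷ xs) (p ∷ u) = unique-++ʳ xs u

unique-⊆ : {A : Set} {xs ys : List A} → xs ⊆ ys → Unique ys → Unique xs
unique-⊆ [] u = u
unique-⊆ (y ∷ʳ s) (_ ∷ u) = unique-⊆ s u
unique-⊆ (refl ∷ s) (p ∷ u) = All-resp-⊆ s p ∷ unique-⊆ s u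

unique-disjoint : {A : Set} (xs : List A) {ys : List A} → Unique (xs ++ ys) → ∀ {x} → x ∈ xs → x ∉ ys
unique-disjoint (x ∷ xs) (p ∷ u) (here refl) m = All-∉ p (∈-++⁺ʳ xs m)
unique-disjoint (x ∷ xs) (p ∷ u) (there q) m = unique-disjoint xs u q m

unique-tabulate : {A : Set} {h : ℕ} {f : Fin h → A} → (∀ i j → f i ≡ f j → i ≡ j) → Unique (tabulate f)
unique-tabulate inj = Uniq.tabulate⁺ (λ {i} {j} → inj i j)

tabulate-injective : {A : Set} {h : ℕ} {f : Fin h → A} → Unique (tabulate f) → ∀ i j → f i ≡ f j → i ≡ j
tabulate-injective u zero zero e = refl
tabulate-injective {f = f} (p ∷ u) zero (suc j) e = contradiction (subst (_∈ tabulate (λ i → f (suc i))) (sym e) (∈-tabulate⁺ j)) (All-∉ p)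
tabulate-injective {f = f} (p ∷ u) (suc i) zero e = contradiction (subst (_∈ tabulate (λ i → f (suc i))) e (∈-tabulate⁺ i)) (All-∉ p)
tabulate-injective (p ∷ u) (suc i) (suc j) e = cong suc (tabulate-injective u i j e)

common onlyˡ onlyʳ : ∀ {n h} → (Fin h → Fin n) → (Fin h → Fin n) → List (Fin n)
common {h = zero} f g = []
common {h = suc h} f g = (if does (f zero ≟F g zero) then [ f zero ] else []) ++ common (λ j → f (suc j)) (λ j → g (suc j))
onlyˡ {h = zero} f g = []
onlyˡ {h = suc h} f g = (if does (f zero ≟F g zero) then [] else [ f zero ]) ++ onlyˡ (λ j → f (suc j)) (λ j → g (suc j))
onlyʳ {h = zero} f g = []
onlyʳ {h = suc h} f g = (if does (f zero ≟F g zero) then [] else [ g zero ]) ++ onlyʳ (λ j → f (suc j)) (λ j → g (suc j))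

common-onlyˡ : ∀ {n} h (f g : Fin h → Fin n) → tabulate f ↭ common f g ++ onlyˡ f g
common-onlyˡ zero f g = ↭-refl
common-onlyˡ (suc h) f g with f zero ≟F g zero | common-onlyˡ h (λ j → f (suc j)) (λ j → g (suc j))
... | yes _ | p = ++⁺ˡ [ f zero ] p
... | no _ | p = ↭-trans (++⁺ˡ [ f zero ] p) (↭-sym (shift (f zero) (common (λ j → f (suc j)) (λ j → g (suc j))) _))

common-onlyʳ : ∀ {n} h (f g : Fin h → Fin n) → tabulate g ↭ common f g ++ onlyʳ f g
common-onlyʳ zero f g = ↭-refl
common-onlyʳ (suc h) f g with f zero ≟F g zero | common-onlyʳ h (λ j → f (suc j)) (λ j → g (suc j))
... | yes e | p = ↭-trans (↭-reflexive (cong (_∷ tabulate (λ j → g (suc j))) (sym e))) (++⁺ˡ [ f zero ] p)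
... | no _ | p = ↭-trans (++⁺ˡ [ g zero ] p) (↭-sym (shift (g zero) (common (λ j → f (suc j)) (λ j → g (suc j))) _))

common-length : ∀ {n} h (f g : Fin h → Fin n) → length (common f g) ≡ size (λ j → does (f j ≟F g j))
common-length zero f g = sym (size-false {0} λ ())
common-length (suc h) f g with does (f zero ≟F g zero) in e | common-length h (λ j → f (suc j)) (λ j → g (suc j))
... | true | p = trans (cong suc p) (sym (trans (size≡ _) (trans (∑-suc (λ j → bit (does (f j ≟F g j))))
   (cong₂ _+_ (cong bit e) (sym (size≡ _))))))
... | false | p = trans p (sym (trans (size≡ _) (trans (∑-suc (λ j → bit (does (f j ≟F g j))))
   (cong₂ _+_ (cong bit e) (sym (size≡ _))))))

∈-onlyʳ : ∀ {n} h (f g : Fin h → Fin n) {x} → x ∈ onlyʳ f g → ∃ λ j → x ≡ g j × f j ≢ g j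
∈-onlyʳ (suc h) f g m with f zero ≟F g zero
∈-onlyʳ (suc h) f g m | yes _ with ∈-onlyʳ h (λ j → f (suc j)) (λ j → g (suc j)) m
... | j , e , ne = suc j , e , ne
∈-onlyʳ (suc h) f g (here e) | no ne = zero , e , ne
∈-onlyʳ (suc h) f g (there m) | no ne with ∈-onlyʳ h (λ j → f (suc j)) (λ j → g (suc j)) m
... | j , e , ne′ = suc j , e , ne′

data Level : Set where
 lo mid hi : Level

data Kind : Set where
 lo-mid lo-hi mid-hi : Kind

low high : Kind → Level
low lo-mid = lo
low lo-hi = lo
low mid-hi = mid
high lo-mid = mid
high lo-hi = hi
high mid-hi = hi

mixed : ∀ {h} → (Fin h → Bool) → (Fin h → Kind) → Fin h → Level
mixed C s j = if C j then high (s j) else low (s j)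

flat : ∀ {A : Set} {h} → (Fin h → Level → A) → (Fin h → Kind) → List A
flat {h = zero} B s = []
flat {h = suc h} B s = B zero (low (s zero)) ∷ B zero (high (s zero)) ∷ flat (λ j → B (suc j)) (λ j → s (suc j))

flat-length : ∀ {A : Set} {h} (B : Fin h → Level → A) s → length (flat B s) ≡ h + h
flat-length {h = zero} B s = refl
flat-length {h = suc h} B s = cong suc (trans (cong suc (flat-length (λ j → B (suc j)) (λ j → s (suc j)))) (sym (+-suc h h)))

Blocks : {A : Set} (h : ℕ) → List A → (Fin h → Level → A) → Set₁
Blocks {A} h ys B = (∀ s → flat B s ⊆ ys) × (∀ j l → B j l ∈ ys) ×
 (∀ {V : Set} (f : A → V) → Unique (map f ys) → ∀ i j l l′ → f (B i l) ≡ f (B j l′) → i ≡ j × l ≡ l′)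

cut : {A : Set} (h : ℕ) (ys : List A) → 3 * h ≤ length ys → ∃ (Blocks h ys)
cut zero ys le = (λ ()) , (λ _ → minimum ys) , (λ ()) , λ _ _ ()
 where
 minimum : ∀ {A : Set} (xs : List A) → [] ⊆ xs
 minimum [] = []
 minimum (x ∷ xs) = x ∷ʳ minimum xs
cut {A} (suc h) ys le with ys | ≡-≤ (sym (*-suc 3 h)) le
... | x ∷ y ∷ z ∷ zs | s≤s (s≤s (s≤s le′)) with cut h zs le′
... | B , subs , ins , inj = B′ , subs′ , ins′ , inj′
 where
 B′ : Fin (suc h) → Level → A
 B′ zero lo = x
 B′ zero mid = y
 B′ zero hi = z
 B′ (suc j) l = B j l
 subs′ : ∀ s → flat B′ s ⊆ x ∷ y ∷ z ∷ zs
 subs′ s with s zero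
 ... | lo-mid = refl ∷ refl ∷ (z ∷ʳ subs (λ j → s (suc j)))
 ... | lo-hi = refl ∷ (y ∷ʳ (refl ∷ subs (λ j → s (suc j))))
 ... | mid-hi = x ∷ʳ (refl ∷ refl ∷ subs (λ j → s (suc j)))
 ins′ : ∀ j l → B′ j l ∈ x ∷ y ∷ z ∷ zs
 ins′ zero lo = here refl
 ins′ zero mid = there (here refl)
 ins′ zero hi = there (there (here refl))
 ins′ (suc j) l = there (there (there (ins j l)))
 inj′ : ∀ {V : Set} (f : A → V) → Unique (map f (x ∷ y ∷ z ∷ zs)) → ∀ i j l l′ → f (B′ i l) ≡ f (B′ j l′) → i ≡ j × l ≡ l′
 inj′ f (px ∷ py ∷ pz ∷ u) = go
  where
  inzs : ∀ j l → f (B j l) ∈ map f zs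
  inzs j l = ∈-map⁺ f (ins j l)
  new : ∀ l j l′ → f (B′ zero l) ≢ f (B j l′)
  new lo j l′ e = All-∉ px (there (there (subst (_∈ map f zs) (sym e) (inzs j l′))))
  new mid j l′ e = All-∉ py (there (subst (_∈ map f zs) (sym e) (inzs j l′)))
  new hi j l′ e = All-∉ pz (subst (_∈ map f zs) (sym e) (inzs j l′))
  go : ∀ i j l l′ → f (B′ i l) ≡ f (B′ j l′) → i ≡ j × l ≡ l′
  go zero zero lo lo e = refl , refl
  go zero zero mid mid e = refl , refl
  go zero zero hi hi e = refl , refl
  go zero zero lo mid e = contradiction (here e) (All-∉ px)
  go zero zero lo hi e = contradiction (there (here e)) (All-∉ px)
  go zero zero mid hi e = contradiction (here e) (All-∉ py)
  go zero zero mid lo e = contradiction (here (sym e)) (All-∉ px)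
  go zero zero hi lo e = contradiction (there (here (sym e))) (All-∉ px)
  go zero zero hi mid e = contradiction (here (sym e)) (All-∉ py)
  go zero (suc j) l l′ e = contradiction e (new l j l′)
  go (suc i) zero l l′ e = contradiction (sym e) (new l′ i l)
  go (suc i) (suc j) l l′ e with inj f u i j l l′ e
  ... | refl , eq = refl , eq

rep : {V : Set} → Bool → V × V → V
rep true = proj₁
rep false = proj₂

mixList : ∀ {V : Set} {h} → (Fin h → Bool) → (Fin h → Bool) → List (V × V) → List V
mixList {h = suc h} C cs (x ∷ y ∷ ts) = rep (cs zero) (if C zero then y else x) ∷ mixList (λ j → C (suc j)) (λ j → cs (suc j)) ts
mixList C cs ts = []

mixList-flat : ∀ {V : Set} {h} (C cs : Fin h → Bool) (B : Fin h → Level → V × V) s →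
 mixList C cs (flat B s) ≡ tabulate (λ j → rep (cs j) (B j (mixed C s j)))
mixList-flat {h = zero} C cs B s = refl
mixList-flat {h = suc h} C cs B s with C zero
... | true = cong (_ ∷_) (mixList-flat (λ j → C (suc j)) (λ j → cs (suc j)) (λ j → B (suc j)) (λ j → s (suc j)))
... | false = cong (_ ∷_) (mixList-flat (λ j → C (suc j)) (λ j → cs (suc j)) (λ j → B (suc j)) (λ j → s (suc j)))

nth : ∀ {V : Set} {h} → V → List V → Fin h → V
nth v₀ (x ∷ xs) zero = x
nth v₀ (x ∷ xs) (suc j) = nth v₀ xs j
nth v₀ [] j = v₀

nth-tabulate : ∀ {V : Set} {h} (v₀ : V) (f : Fin h → V) j → nth v₀ (tabulate f) j ≡ f j
nth-tabulate v₀ f zero = refl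
nth-tabulate v₀ f (suc j) = nth-tabulate v₀ (λ i → f (suc i)) j

positions : ∀ h → List (Fin h ⊎ Fin h)
positions h = map inj₁ (allFin h) ++ map inj₂ (allFin h)

∈-positions : ∀ {h} (q : Fin h ⊎ Fin h) → q ∈ positions h
∈-positions (inj₁ j) = ∈-++⁺ˡ (∈-map⁺ inj₁ (∈-allFin j))
∈-positions {h} (inj₂ j) = ∈-++⁺ʳ (map inj₁ (allFin h)) (∈-map⁺ inj₂ (∈-allFin j))

does-≟ : ∀ {n} {a b c d : Fin n} → does (a ≟F b) ≡ does (c ≟F d) → a ≡ b → c ≡ d
does-≟ {a = a} {b} {c} {d} e p with a ≟F b | c ≟F d
... | yes _ | yes q = q
... | no ¬p | _ = contradiction p ¬p
... | yes _ | no _ = contradiction e λ ()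

does-true : ∀ {n} {a b : Fin n} → does (a ≟F b) ≡ true → a ≡ b
does-true {a = a} {b} e with a ≟F b
... | yes p = p

true-does : ∀ {n} {a b : Fin n} → a ≡ b → does (a ≟F b) ≡ true
true-does {a = a} {b} e with a ≟F b
... | yes p = refl
... | no ¬p = contradiction e ¬p

Index : ℕ → Set
Index h = Subset h × (Fin h ⊎ Fin h) × (Fin h ⊎ Fin h)

indices : ∀ h → List (Index h)
indices h = cartesianProduct (allSubsets h) (cartesianProduct (positions h) (positions h))

interchange : {A : Set} (a b c d : List A) → (a ++ b) ++ (c ++ d) ↭ (a ++ c) ++ (b ++ d)
interchange a b c d = ↭-trans (↭-reflexive (++-assoc a b (c ++ d)))
 (↭-trans (++⁺ˡ a (shifts b c)) (↭-reflexive (sym (++-assoc a c (b ++ d)))))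

-- Frankl–Füredi: on a homogeneous sequence of times, whether the q-th vertex of the edge of D
-- changes when the coordinates in C are moved to later times only depends on C and q.
module Canonical {n h : ℕ} (cs : Fin h → Bool) (v₀ : Fin n) (Y : List (Fin n) → Fin h → Fin n) where

 vertex : List (Fin n) → Fin h ⊎ Fin h → Fin n
 vertex D (inj₁ j) = nth v₀ D j
 vertex D (inj₂ q) = Y D q

 test : Index h → List (Fin n × Fin n) → Bool
 test (C , q , q′) ts = does (vertex (mixList (λ _ → false) cs ts) q ≟F vertex (mixList (Vec.lookup C) cs ts) q′)

 module _ (B : Fin h → Level → Fin n × Fin n) (ys : List (Fin n × Fin n))
  (flat⊆ : ∀ s → flat B s ⊆ ys)
  (hom : All (λ i → ∃ (Homogeneous (h + h) (test i) ys)) (indices h))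
  (apart : ∀ c j l l′ → rep c (B j l) ≡ rep c (B j l′) → l ≡ l′) where

  D : (Fin h → Level) → List (Fin n)
  D σ = tabulate (λ j → rep (cs j) (B j (σ j)))

  z : (Fin h → Level) → Fin h ⊎ Fin h → Fin n
  z σ = vertex (D σ)

  D-cong : ∀ {σ σ′} → (∀ j → σ j ≡ σ′ j) → D σ ≡ D σ′
  D-cong e = tabulate-cong (λ j → cong (λ l → rep (cs j) (B j l)) (e j))

  z-cong : ∀ {σ σ′} q → (∀ j → σ j ≡ σ′ j) → z σ q ≡ z σ′ q
  z-cong q e = cong (λ D → vertex D q) (D-cong e)

  test-flat : ∀ C q q′ s → test (Vec.tabulate C , q , q′) (flat B s) ≡
   does (z (λ j → low (s j)) q ≟F z (mixed C s) q′)
  test-flat C q q′ s = cong₂ (λ D D′ → does (vertex D q ≟F vertex D′ q′))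
   (mixList-flat (λ _ → false) cs B s)
   (trans (mixList-flat (Vec.lookup (Vec.tabulate C)) cs B s)
    (tabulate-cong (λ j → cong (λ c → rep (cs j) (B j (if c then high (s j) else low (s j)))) (VecP.lookup∘tabulate C j))))

  transfer : ∀ C q q′ s s′ → z (λ j → low (s j)) q ≡ z (mixed C s) q′ →
   z (λ j → low (s′ j)) q ≡ z (mixed C s′) q′
  transfer C q q′ s s′ = does-≟ (trans (sym (test-flat C q q′ s)) (trans (same s s′) (test-flat C q q′ s′)))
   where
   same : ∀ s s′ → test (Vec.tabulate C , q , q′) (flat B s) ≡ test (Vec.tabulate C , q , q′) (flat B s′)
   same s s′ with All.lookup hom (∈-cartesianProduct⁺ (∈-allSubsets (Vec.tabulate C))
     (∈-cartesianProduct⁺ (∈-positions q) (∈-positions q′)))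
   ... | b , eq = trans (eq _ (flat⊆ s) (flat-length B s)) (sym (eq _ (flat⊆ s′) (flat-length B s′)))

  on : (Fin h → Bool) → Level → Fin h → Level
  on C l j = if C j then l else lo

  -- Moving C from lo to mid, from lo to hi and from mid to hi are the same test.
  compare : ∀ C q q′ → z (λ _ → lo) q ≡ z (on C mid) q′ →
   z (λ _ → lo) q ≡ z (on C hi) q′ × z (on C mid) q ≡ z (on C hi) q′
  compare C q q′ e = trans (z-cong q λ j → sym (low₁ j)) (trans (transfer C q q′ s₀ s₁ e₀) (z-cong q′ eq₁)) ,
   trans (z-cong q λ j → sym (eq₂ j)) (trans (transfer C q q′ s₀ s₂ e₀) (z-cong q′ eq₃))
   where
   s₀ s₁ s₂ : Fin h → Kind
   s₀ _ = lo-mid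
   s₁ j = if C j then lo-hi else lo-mid
   s₂ j = if C j then mid-hi else lo-mid
   e₀ : z (λ j → low (s₀ j)) q ≡ z (mixed C s₀) q′
   e₀ = e
   low₁ : ∀ j → low (s₁ j) ≡ lo
   low₁ j with C j
   ... | true = refl
   ... | false = refl
   eq₁ : ∀ j → mixed C s₁ j ≡ on C hi j
   eq₁ j with C j
   ... | true = refl
   ... | false = refl
   eq₂ : ∀ j → low (s₂ j) ≡ on C mid j
   eq₂ j with C j
   ... | true = refl
   ... | false = refl
   eq₃ : ∀ j → mixed C s₂ j ≡ on C hi j
   eq₃ j with C j
   ... | true = refl
   ... | false = refl

  single : Fin h → Fin h → Bool
  single i j = does (j ≟F i)

  depends : Fin h ⊎ Fin h → Fin h → Bool
  depends q i = not (does (z (λ _ → lo) q ≟F z (on (single i) mid) q))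

  agree⇒independent : ∀ C q → z (λ _ → lo) q ≡ z (on C mid) q → ∀ i → C i ≡ true → depends q i ≡ false
  agree⇒independent C q e i Ci = cong not (true-does (transfer (single i) q q s₂ (λ _ → lo-mid) (begin
   z (λ j → low (s₂ j)) q ≡⟨ z-cong q eq₂ ⟩
   z (on C mid) q ≡⟨ sym e ⟩
   z (λ _ → lo) q ≡⟨ z-cong q (λ j → sym (eq₀ j)) ⟩
   z (λ j → low (s₁ j)) q ≡⟨ transfer C q q (λ _ → lo-mid) s₁ e ⟩
   z (mixed C s₁) q ≡⟨ z-cong q eq₁ ⟩
   z (mixed (single i) s₂) q ∎)))
   where
   open ≡-Reasoning
   s₁ s₂ : Fin h → Kind
   s₁ j = if single i j then lo-hi else lo-mid
   s₂ j = if C j then mid-hi else lo-mid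
   eq₀ : ∀ j → low (s₁ j) ≡ lo
   eq₀ j with single i j
   ... | true = refl
   ... | false = refl
   eq₁ : ∀ j → mixed C s₁ j ≡ mixed (single i) s₂ j
   eq₁ j with j ≟F i
   ... | yes refl rewrite Ci = refl
   ... | no _ with C j
   ... | true = refl
   ... | false = refl
   eq₂ : ∀ j → low (s₂ j) ≡ on C mid j
   eq₂ j with C j
   ... | true = refl
   ... | false = refl

  independent⇒agree : ∀ C q → (∀ i → C i ≡ true → depends q i ≡ false) → z (λ _ → lo) q ≡ z (on C mid) q
  independent⇒agree C q ind = trans (go (allFin h)) (z-cong q λ j → cong (λ b → if b then mid else lo)
    (trans (cong (C j ∧_) (∈-mem (∈-allFin j))) (∧-identityʳ (C j))))
   where
   part : List (Fin h) → Fin h → Bool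
   part L j = C j ∧ mem j L
   go : ∀ L → z (λ _ → lo) q ≡ z (on (part L) mid) q
   go [] = z-cong q λ j → cong (λ b → if b then mid else lo) (sym (∧-zeroʳ (C j)))
   go (i ∷ L) with C i in Ci | mem i L in m
   ... | false | _ = trans (go L) (z-cong q λ j → cong (λ b → if b then mid else lo) (same j))
    where
    same : ∀ j → part L j ≡ part (i ∷ L) j
    same j with j ≟F i
    ... | yes refl rewrite Ci = refl
    ... | no _ = refl
   ... | true | true = trans (go L) (z-cong q λ j → cong (λ b → if b then mid else lo) (same j))
    where
    same : ∀ j → part L j ≡ part (i ∷ L) j
    same j with j ≟F i
    ... | yes refl rewrite m = refl
    ... | no _ = refl
   ... | true | false = trans (go L) (trans (z-cong q (λ j → sym (eq₁ j)))
      (trans (transfer (single i) q q (λ _ → lo-mid) s (does-true (not-false (ind i Ci)))) (z-cong q eq₂)))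
    where
    s : Fin h → Kind
    s j = if part L j then mid-hi else lo-mid
    eq₁ : ∀ j → low (s j) ≡ on (part L) mid j
    eq₁ j with part L j
    ... | true = refl
    ... | false = refl
    eq₂ : ∀ j → mixed (single i) s j ≡ on (part (i ∷ L)) mid j
    eq₂ j with j ≟F i
    ... | yes refl rewrite Ci | m = refl
    ... | no _ with C j | mem j L
    ... | true | true = refl
    ... | true | false = refl
    ... | false | _ = refl

  module _ (uniq : ∀ σ → Unique (D σ ++ tabulate (Y (D σ)))) where

   z-injective : ∀ σ q q′ → z σ q ≡ z σ q′ → q ≡ q′
   z-injective σ (inj₁ i) (inj₁ j) e = cong inj₁ (tabulate-injective (unique-++ˡ (D σ) (uniq σ)) i j
    (trans (sym (nth-tabulate v₀ _ i)) (trans e (nth-tabulate v₀ _ j))))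
   z-injective σ (inj₁ i) (inj₂ j) e = contradiction
    (subst (_∈ tabulate (Y (D σ))) (trans (sym e) (nth-tabulate v₀ _ i)) (∈-tabulate⁺ {f = Y (D σ)} j))
    (unique-disjoint (D σ) (uniq σ) (∈-tabulate⁺ i))
   z-injective σ (inj₂ i) (inj₁ j) e = contradiction
    (subst (_∈ tabulate (Y (D σ))) (trans e (nth-tabulate v₀ _ j)) (∈-tabulate⁺ {f = Y (D σ)} i))
    (unique-disjoint (D σ) (uniq σ) (∈-tabulate⁺ j))
   z-injective σ (inj₂ i) (inj₂ j) e = cong inj₂ (tabulate-injective (unique-++ʳ (D σ) (uniq σ)) i j e)

   aligned : ∀ C q q′ → z (λ _ → lo) q ≡ z (on C mid) q′ → q ≡ q′
   aligned C q q′ e with compare C q q′ e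
   ... | e₁ , e₂ = z-injective (on C mid) q q′ (trans e₂ (trans (sym e₁) e))

   alive : Fin h → Bool
   alive q = not (allᵇ (λ i → not (depends (inj₂ q) i)))

   open Traces {h} {h} (λ q i → depends (inj₂ q) i)

   dead-sub : ∀ q I → alive q ≡ false → sub (λ _ → true) q I ≡ true
   dead-sub q I e = sub-intro λ i _ d → contradiction (trans (sym (cong not d)) (allᵇ-elim (not-false e) i)) λ ()

   size-all : size {h} (λ _ → true) ≡ h
   size-all = trans (size≡ _) (trans (∑-const h 1) (*-identityʳ h))

   agreement : ∀ I → ℕ
   agreement I = size I + size (λ q → sub (λ _ → true) q I)

   alive+dead : size alive + size (λ q → not (alive q)) ≡ h
   alive+dead = trans (sym (size-split (λ _ → true) alive (λ q → not (alive q)) (λ q → sym (bit-not (alive q))))) size-all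

   rows : ∀ I → size (λ q → sub (λ _ → true) q I) ≡ size (λ q → alive q ∧ sub (λ _ → true) q I) + size (λ q → not (alive q))
   rows I = size-split _ _ _ pointwise
    where
    pointwise : ∀ q → bit (sub (λ _ → true) q I) ≡ bit (alive q ∧ sub (λ _ → true) q I) + bit (not (alive q))
    pointwise q with alive q in e
    ... | true = sym (+-identityʳ _)
    ... | false = cong bit (dead-sub q I e)

   select-coordinates : ∃ λ I → agreement I ≡ 0 ⊎ agreement I ≡ h
   select-coordinates with size alive <? h
   ... | no all = (λ _ → false) , inj₁ (cong₂ _+_ (size-false (λ _ → refl)) (trans (rows (λ _ → false))
       (cong₂ _+_ (size-false none) dead0)))
    where
    dead0 : size (λ q → not (alive q)) ≡ 0
    dead0 = n≤0⇒n≡0 (+-cancelˡ-≤ (size alive) _ 0 (≡-≤ alive+dead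
     (≤-≡ (≮⇒≥ all) (sym (+-identityʳ _)))))
    none : ∀ q → alive q ∧ sub (λ _ → true) q (λ _ → false) ≡ false
    none q = ¬true λ e → contr (∧-true {alive q} e)
     where
     contr : ¬ (alive q ≡ true × sub (λ _ → true) q (λ _ → false) ≡ true)
     contr (a , s) with allᵇ-false (not-true a)
     ... | i , d = contradiction (sub-elim s i refl (not-false d)) λ ()
   ... | yes lt with traces (size {h} (λ _ → true)) (λ _ → true) alive (size alive) ≤-refl nonempty ≤-refl (subst (size alive <_) (sym size-all) lt)
    where
    nonempty : Nonempty (λ _ → true) alive
    nonempty q a with allᵇ-false (not-true a)
    ... | i , d = i , refl , not-false d
   ... | I , _ , eq = I , inj₂ (trans (cong (size I +_) (rows I)) (trans (sym (+-assoc (size I) _ _))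
       (trans (cong (_+ size (λ q → not (alive q))) eq) alive+dead)))

   Result : Set
   Result = ∃ λ σ → ∃ λ σ′ → ∃ λ S → ∃ λ T₁ → ∃ λ T₂ →
    (D σ ++ tabulate (Y (D σ)) ↭ S ++ T₁) × (D σ′ ++ tabulate (Y (D σ′)) ↭ S ++ T₂) ×
    Unique ((S ++ T₁) ++ T₂) × (length S ≡ 0 ⊎ length S ≡ h)

   result : Result
   result with select-coordinates
   ... | I , sizes = (λ _ → lo) , on C mid , common f₁ g₁ ++ common f₂ g₂ , onlyˡ f₁ g₁ ++ onlyˡ f₂ g₂ , onlyʳ f₁ g₁ ++ onlyʳ f₂ g₂ ,
      perm₁ , perm₂ , unique-++ (Unique-↭ perm₁ (uniq _)) (unique-++ʳ (common f₁ g₁ ++ common f₂ g₂) (Unique-↭ perm₂ (uniq _))) disj ,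
      size-case sizes
    where
    C : Fin h → Bool
    C i = not (I i)
    f₁ f₂ g₁ g₂ : Fin h → Fin n
    f₁ j = rep (cs j) (B j lo)
    f₂ = Y (D (λ _ → lo))
    g₁ j = rep (cs j) (B j (on C mid j))
    g₂ = Y (D (on C mid))
    perm₁ : D (λ _ → lo) ++ tabulate f₂ ↭ (common f₁ g₁ ++ common f₂ g₂) ++ (onlyˡ f₁ g₁ ++ onlyˡ f₂ g₂)
    perm₁ = ↭-trans (++⁺ (common-onlyˡ h f₁ g₁) (common-onlyˡ h f₂ g₂)) (interchange (common f₁ g₁) _ (common f₂ g₂) _)
    perm₂ : D (on C mid) ++ tabulate g₂ ↭ (common f₁ g₁ ++ common f₂ g₂) ++ (onlyʳ f₁ g₁ ++ onlyʳ f₂ g₂)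
    perm₂ = ↭-trans (++⁺ (common-onlyʳ h f₁ g₁) (common-onlyʳ h f₂ g₂)) (interchange (common f₁ g₁) _ (common f₂ g₂) _)
    in-edge : ∀ σ {x} → x ∈ D σ ++ tabulate (Y (D σ)) → ∃ λ q → x ≡ z σ q
    in-edge σ m with ∈-++⁻ (D σ) m
    ... | inj₁ d with ∈-tabulate⁻ d
    ... | j , e = inj₁ j , trans e (sym (nth-tabulate v₀ _ j))
    in-edge σ m | inj₂ y with ∈-tabulate⁻ y
    ... | j , e = inj₂ j , e
    moved : ∀ {x} → x ∈ onlyʳ f₁ g₁ ++ onlyʳ f₂ g₂ → ∃ λ q → x ≡ z (on C mid) q × z (λ _ → lo) q ≢ x
    moved m with ∈-++⁻ (onlyʳ f₁ g₁) m
    ... | inj₁ d with ∈-onlyʳ h f₁ g₁ d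
    ... | j , e , ne = inj₁ j , trans e (sym (nth-tabulate v₀ _ j)) , λ e′ → ne (trans (sym (nth-tabulate v₀ _ j)) (trans e′ e))
    moved m | inj₂ y with ∈-onlyʳ h f₂ g₂ y
    ... | j , e , ne = inj₂ j , e , λ e′ → ne (trans e′ e)
    disj : ∀ {x} → x ∈ (common f₁ g₁ ++ common f₂ g₂) ++ (onlyˡ f₁ g₁ ++ onlyˡ f₂ g₂) → x ∉ onlyʳ f₁ g₁ ++ onlyʳ f₂ g₂
    disj m m′ with in-edge (λ _ → lo) (∈-resp-↭ (↭-sym perm₁) m) | moved m′
    ... | q , e | q′ , e′ , ne with aligned C q q′ (trans (sym e) e′)
    ... | refl = ne (sym e)
    length-S : length (common f₁ g₁ ++ common f₂ g₂) ≡ agreement I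
    length-S = trans (length-++ (common f₁ g₁)) (cong₂ _+_
     (trans (common-length h f₁ g₁) (size-cong (λ j → bool-≡ (λ e → toI j (does-true e)) (λ e → true-does (fromI j e)))))
     (trans (common-length h f₂ g₂) (size-cong (λ q → bool-≡
      (λ e → sub-intro λ i _ d → inI q i (does-true e) d)
      (λ s → true-does (independent⇒agree C (inj₂ q) (λ i Ci → ¬true λ d → contradiction (trans (sym Ci) (cong not (sub-elim s i refl d))) λ ())))))))
     where
     toI : ∀ j → f₁ j ≡ g₁ j → I j ≡ true
     toI j e with I j
     ... | true = refl
     ... | false = contradiction (apart (cs j) j lo mid e) λ ()
     fromI : ∀ j → I j ≡ true → f₁ j ≡ g₁ j
     fromI j e rewrite e = refl
     inI : ∀ q i → f₂ q ≡ g₂ q → depends (inj₂ q) i ≡ true → I i ≡ true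
     inI q i e d with I i in Ii
     ... | true = refl
     ... | false = contradiction (trans (sym d) (agree⇒independent C (inj₂ q) e i (cong not Ii))) λ ()
    size-case : agreement I ≡ 0 ⊎ agreement I ≡ h →
     length (common f₁ g₁ ++ common f₂ g₂) ≡ 0 ⊎ length (common f₁ g₁ ++ common f₂ g₂) ≡ h
    size-case (inj₁ e) = inj₁ (trans length-S e)
    size-case (inj₂ e) = inj₂ (trans length-S e)

CoverPair : ℕ → ℕ → Set
CoverPair h N = ∀ {n} (χ : Fin n → Bool) (cs : Fin h → Bool) (v₀ : Fin n) (Y : List (Fin n) → Fin h → Fin n)
 (xs : List (Fin n × Fin n)) → N ≤ length xs →
 (∀ {p} → p ∈ xs → ∀ c → χ (rep c p) ≡ c) → (∀ c → Unique (map (rep c) xs)) →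
 (∀ D → map χ D ≡ tabulate cs → Unique D → Unique (D ++ tabulate (Y D))) →
 ∃ λ D → ∃ λ D′ → ∃ λ S → ∃ λ T₁ → ∃ λ T₂ →
 (map χ D ≡ tabulate cs × Unique D) × (map χ D′ ≡ tabulate cs × Unique D′) ×
 (D ++ tabulate (Y D) ↭ S ++ T₁) × (D′ ++ tabulate (Y D′) ↭ S ++ T₂) ×
 Unique ((S ++ T₁) ++ T₂) × (length S ≡ 0 ⊎ length S ≡ h)

cover-pair : ∀ h → ∃ (CoverPair h)
cover-pair h with ramseyAll (indices h) (h + h) (3 * h)
... | N , r = N , main
 where
 main : CoverPair h N
 main χ cs v₀ Y xs le col uniq valid with r (Canonical.test cs v₀ Y) xs le
 ... | ys , sub , le′ , hom with cut h ys le′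
 ... | B , subs , ins , inj = build (C.result B ys subs hom apart λ σ → valid _ (colours σ) (unique-D σ))
  where
  module C = Canonical cs v₀ Y
  unique-ys : ∀ c → Unique (map (rep c) ys)
  unique-ys c = unique-⊆ (⊆-map (rep c) sub) (uniq c)
  in-xs : ∀ j l → B j l ∈ xs
  in-xs j l = Any-resp-⊆ sub (ins j l)
  apart : ∀ c j l l′ → rep c (B j l) ≡ rep c (B j l′) → l ≡ l′
  apart c j l l′ e = proj₂ (inj (rep c) (unique-ys c) j j l l′ e)
  colours : ∀ σ → map χ (tabulate (λ j → rep (cs j) (B j (σ j)))) ≡ tabulate cs
  colours σ = trans (map-tabulate _ χ) (tabulate-cong (λ j → col (in-xs j (σ j)) (cs j)))
  unique-D : ∀ σ → Unique (tabulate (λ j → rep (cs j) (B j (σ j))))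
  unique-D σ = unique-tabulate λ i j e → same i j e (trans (sym (col (in-xs i (σ i)) (cs i)))
    (trans (cong χ e) (col (in-xs j (σ j)) (cs j))))
   where
   same : ∀ i j → rep (cs i) (B i (σ i)) ≡ rep (cs j) (B j (σ j)) → cs i ≡ cs j → i ≡ j
   same i j e c rewrite c = proj₁ (inj (rep (cs j)) (unique-ys (cs j)) i j (σ i) (σ j) e)
  build : C.Result B ys subs hom apart (λ σ → valid _ (colours σ) (unique-D σ)) → _
  build (σ , σ′ , S , T₁ , T₂ , p₁ , p₂ , u , l) =
   _ , _ , S , T₁ , T₂ , (colours σ , unique-D σ) , (colours σ′ , unique-D σ′) , p₁ , p₂ , u , l

-- Matchings and parities

count-cong : {A : Set} {p q : A → Bool} (xs : List A) → (∀ x → p x ≡ q x) → count p xs ≡ count q xs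
count-cong [] e = refl
count-cong {p = p} {q} (x ∷ xs) e rewrite e x | count-cong {p = p} {q} xs e = refl

count-∷ : {A : Set} (p : A → Bool) (x : A) (xs : List A) → count p (x ∷ xs) ≡ bit (p x) + count p xs
count-∷ p x xs with p x
... | true = refl
... | false = refl

count-++ : {A : Set} (p : A → Bool) (xs ys : List A) → count p (xs ++ ys) ≡ count p xs + count p ys
count-++ p [] ys = refl
count-++ p (x ∷ xs) ys with p x
... | true = cong suc (count-++ p xs ys)
... | false = count-++ p xs ys

count-map : {A B : Set} (p : B → Bool) (f : A → B) (xs : List A) → count p (map f xs) ≡ count (λ x → p (f x)) xs
count-map p f [] = refl
count-map p f (x ∷ xs) with p (f x)
... | true = cong suc (count-map p f xs)
... | false = count-map p f xs

count-↭ : {A : Set} (p : A → Bool) {xs ys : List A} → xs ↭ ys → count p xs ≡ count p ys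
count-↭ p _↭_.refl = refl
count-↭ p (_↭_.prep x e) with p x
... | true = cong suc (count-↭ p e)
... | false = count-↭ p e
count-↭ p (_↭_.swap x y e) with p x | p y
... | true | true = cong (λ c → suc (suc c)) (count-↭ p e)
... | true | false = cong suc (count-↭ p e)
... | false | true = cong suc (count-↭ p e)
... | false | false = count-↭ p e
count-↭ p (_↭_.trans e e′) = trans (count-↭ p e) (count-↭ p e′)

count-∑ : {A : Set} {n : ℕ} (p : Fin n → A → Bool) (xs : List A) →
 ∑ (λ v → count (p v) xs) ≡ sum (map (λ x → size (λ v → p v x)) xs)
count-∑ {n = n} p [] = trans (∑-const n 0) (*-zeroʳ n)
count-∑ {n = n} p (x ∷ xs) = trans (∑-cong (λ v → count-∷ (p v) x xs))
 (trans (∑-+ (λ v → bit (p v x)) (λ v → count (p v) xs)) (cong₂ _+_ (sym (size≡ (λ v → p v x))) (count-∑ p xs)))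

size-mono : ∀ {n} {P R : Fin n → Bool} → (∀ v → P v ≡ true → R v ≡ true) → size P ≤ size R
size-mono {P = P} {R} i = ≡-≤ (size≡ P) (≤-≡ (∑-mono (λ v → bit-mono (i v))) (sym (size≡ R)))

count-unique : ∀ {n} (p : Fin n → Bool) {xs} → Unique xs → count p xs ≤ size p
count-unique p {xs} u = ≤-trans (go xs u) (size-mono (λ v e → ∧-left e))
 where
 go : ∀ xs → Unique xs → count p xs ≤ size (λ v → p v ∧ mem v xs)
 go [] u = z≤n
 go (x ∷ xs) (ux ∷ u) = ≡-≤ (count-∷ p x xs) (≤-≡ (+-monoʳ-≤ (bit (p x)) (go xs u))
  (sym (trans (size-split _ (λ v → does (v ≟F x) ∧ p x) (λ v → p v ∧ mem v xs) pointwise)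
   (cong (_+ size (λ v → p v ∧ mem v xs)) (size-indicator x (p x))))))
  where
  pointwise : ∀ v → bit (p v ∧ mem v (x ∷ xs)) ≡ bit (does (v ≟F x) ∧ p x) + bit (p v ∧ mem v xs)
  pointwise v with v ≟F x
  ... | no _ = refl
  ... | yes refl rewrite ∉-mem xs (All-∉ ux) with p v
  ... | true = refl
  ... | false = refl

count-find : {A : Set} (p : A → Bool) (xs : List A) → count p xs < length xs →
 ∃ λ as → ∃ λ x → ∃ λ bs → xs ≡ as ++ x ∷ bs × p x ≡ false
count-find p (x ∷ xs) lt with p x in e
... | false = [] , x , xs , refl , e
... | true with count-find p xs (≤-pred lt)
... | as , y , bs , refl , ey = x ∷ as , y , bs , refl , ey

count-∨ : {A : Set} (p q : A → Bool) (xs : List A) → count (λ x → p x ∨ q x) xs ≤ count p xs + count q xs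
count-∨ p q [] = z≤n
count-∨ p q (x ∷ xs) with p x | q x
... | true | true = s≤s (≤-trans (count-∨ p q xs) (+-monoʳ-≤ (count p xs) (n≤1+n _)))
... | true | false = s≤s (count-∨ p q xs)
... | false | true = ≤-≡ (s≤s (count-∨ p q xs)) (sym (+-suc _ _))
... | false | false = count-∨ p q xs

module Arrange {A B : Set} (ok : A → B → Bool) where

 Ok : A × B → Set
 Ok (a , b) = ok a b ≡ true

 Sparse : List (A × B) → Set
 Sparse ps = ∀ a b → (a ∈ map proj₁ ps) → (b ∈ map proj₂ ps) →
  count (λ b′ → not (ok a b′)) (map proj₂ ps) + count (λ a′ → not (ok a′ b)) (map proj₁ ps) < length ps

 Swapped : List (A × B) → Set
 Swapped ps = ∃ λ qs → (map proj₁ qs ↭ map proj₁ ps) × (map proj₂ qs ↭ map proj₂ ps) × All Ok qs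

 sparse-↭ : ∀ {ps qs} → map proj₁ qs ↭ map proj₁ ps → map proj₂ qs ↭ map proj₂ ps → Sparse ps → Sparse qs
 sparse-↭ {ps} {qs} e₁ e₂ sp a b ma mb = subst₂ _<_
  (sym (cong₂ _+_ (count-↭ (λ b′ → not (ok a b′)) e₂) (count-↭ (λ a′ → not (ok a′ b)) e₁)))
  (trans (sym (length-map proj₁ ps)) (trans (sym (↭-length e₁)) (length-map proj₁ qs)))
  (sp a b (∈-resp-↭ e₁ ma) (∈-resp-↭ e₂ mb))

 -- A misfit (a , b) exchanges partners with some pair (a′ , b′) such that both new pairs fit.
 arrange : ∀ fuel (ps qs : List (A × B)) → length qs ≤ fuel → All Ok ps → Sparse (qs ++ ps) → Swapped (qs ++ ps)
 arrange fuel ps [] le oks sp = ps , ↭-refl , ↭-refl , oks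
 arrange (suc fuel) ps ((a , b) ∷ qs) (s≤s le) oks sp with ok a b in e
 ... | true = done (arrange fuel ((a , b) ∷ ps) qs le (e ∷ oks) (sparse-↭ (map⁺ proj₁ (shift (a , b) qs ps)) (map⁺ proj₂ (shift (a , b) qs ps)) sp))
  where
  done : Swapped (qs ++ (a , b) ∷ ps) → Swapped ((a , b) ∷ qs ++ ps)
  done (rs , e₁ , e₂ , o) = rs , ↭-trans e₁ (map⁺ proj₁ (shift (a , b) qs ps)) , ↭-trans e₂ (map⁺ proj₂ (shift (a , b) qs ps)) , o
 ... | false with count-find (λ r → not (ok a (proj₂ r)) ∨ not (ok (proj₁ r) b)) ((a , b) ∷ qs ++ ps)
    (≤-<-trans (≤-≡ (count-∨ (λ r → not (ok a (proj₂ r))) (λ r → not (ok (proj₁ r) b)) ((a , b) ∷ qs ++ ps))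
     (sym (cong₂ _+_ (count-map (λ b′ → not (ok a b′)) proj₂ ((a , b) ∷ qs ++ ps)) (count-map (λ a′ → not (ok a′ b)) proj₁ ((a , b) ∷ qs ++ ps)))))
     (sp a b (here refl) (here refl)))
 ... | [] , r , bs , eq , mis = contradiction (trans (sym (cong not (trans (cong (λ r → ok a (proj₂ r)) (sym (∷-injectiveˡ eq))) e)))
     (∨-left mis)) λ ()
 ... | r₀ ∷ as , (a′ , b′) , bs , eq , mis = locate
  where
  eq′ : qs ++ ps ≡ as ++ (a′ , b′) ∷ bs
  eq′ = ∷-injectiveʳ eq
  okab′ : ok a b′ ≡ true
  okab′ = not-false (∨-left mis)
  oka′b : ok a′ b ≡ true
  oka′b = not-false (∨-right {not (ok a b′)} mis)
  finish : ∀ qs′ ps′ → length qs′ ≤ fuel → All Ok ps′ → (qs ++ ps ↭ (a′ , b′) ∷ qs′ ++ ps′) → Swapped ((a , b) ∷ qs ++ ps)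
  finish qs′ ps′ le′ oks′ perm = result (arrange fuel ((a , b′) ∷ (a′ , b) ∷ ps′) qs′ le′ (okab′ ∷ oka′b ∷ oks′) (sparse-↭ to₁ to₂ sp))
   where
   move : ∀ {C : Set} (f : A × B → C) (x y : A × B) → map f (qs′ ++ x ∷ y ∷ ps′) ↭ f x ∷ f y ∷ map f (qs′ ++ ps′)
   move f x y = map⁺ f (↭-trans (shift x qs′ (y ∷ ps′)) (_↭_.prep x (shift y qs′ ps′)))
   to₁ : map proj₁ (qs′ ++ (a , b′) ∷ (a′ , b) ∷ ps′) ↭ map proj₁ ((a , b) ∷ qs ++ ps)
   to₁ = ↭-trans (move proj₁ (a , b′) (a′ , b)) (_↭_.prep a (↭-sym (map⁺ proj₁ perm)))
   to₂ : map proj₂ (qs′ ++ (a , b′) ∷ (a′ , b) ∷ ps′) ↭ map proj₂ ((a , b) ∷ qs ++ ps)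
   to₂ = ↭-trans (move proj₂ (a , b′) (a′ , b)) (↭-trans (_↭_.swap b′ b ↭-refl) (_↭_.prep b (↭-sym (map⁺ proj₂ perm))))
   result : Swapped (qs′ ++ (a , b′) ∷ (a′ , b) ∷ ps′) → Swapped ((a , b) ∷ qs ++ ps)
   result (rs , e₁ , e₂ , o) = rs , ↭-trans e₁ to₁ , ↭-trans e₂ to₂ , o
  locate : Swapped ((a , b) ∷ qs ++ ps)
  locate with split qs as eq′
   where
   split : ∀ {C : Set} (qs as : List C) {ps x bs} → qs ++ ps ≡ as ++ x ∷ bs →
    (∃ λ cs → qs ≡ as ++ x ∷ cs × bs ≡ cs ++ ps) ⊎ (∃ λ cs → as ≡ qs ++ cs × ps ≡ cs ++ x ∷ bs)
   split [] as e = inj₂ (as , refl , e)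
   split (q ∷ qs) [] refl = inj₁ (qs , refl , refl)
   split (q ∷ qs) (a ∷ as) e with ∷-injectiveˡ e | split qs as (∷-injectiveʳ e)
   ... | refl | inj₁ (cs , refl , e₂) = inj₁ (cs , refl , e₂)
   ... | refl | inj₂ (cs , refl , e₂) = inj₂ (cs , refl , e₂)
  ... | inj₁ (cs , refl , refl) = finish (as ++ cs) ps
     (≤-trans (n≤1+n _) (≡-≤ (trans (cong suc (length-++ as)) (trans (sym (+-suc (length as) (length cs))) (sym (length-++ as)))) le)) oks
     (↭-trans (↭-reflexive (++-assoc as _ ps)) (↭-trans (shift (a′ , b′) as (cs ++ ps)) (↭-reflexive (cong ((a′ , b′) ∷_) (sym (++-assoc as cs ps))))))
  ... | inj₂ (cs , refl , refl) = finish qs (cs ++ bs) le (drop-middle cs oks)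
     (↭-trans (↭-reflexive (sym (++-assoc qs cs _))) (↭-trans (shift (a′ , b′) (qs ++ cs) bs) (↭-reflexive (cong ((a′ , b′) ∷_) (++-assoc qs cs bs)))))
   where
   drop-middle : ∀ cs {x bs} → All Ok (cs ++ x ∷ bs) → All Ok (cs ++ bs)
   drop-middle [] (_ ∷ o) = o
   drop-middle (c ∷ cs) (p ∷ o) = p ∷ drop-middle cs o

 Fits : List A → List B → Set
 Fits [] [] = ⊤
 Fits (a ∷ as) (b ∷ bs) = ok a b ≡ true × Fits as bs
 Fits _ _ = Void

 arranged : ∀ as bs → length as ≡ length bs →
  (∀ {a b} → a ∈ as → b ∈ bs → count (λ b′ → not (ok a b′)) bs + count (λ a′ → not (ok a′ b)) as < length bs) →
  ∃ λ as′ → as′ ↭ as × Fits as′ bs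
 arranged as bs len sp = realign (arrange (length ps) [] ps ≤-refl [] (subst Sparse (sym (++-identityʳ ps)) sparse))
  where
  ps : List (A × B)
  ps = Data.List.zip as bs
  zip₁ : ∀ (as : List A) (bs : List B) → length as ≡ length bs → map proj₁ (Data.List.zip as bs) ≡ as
  zip₁ [] [] e = refl
  zip₁ (a ∷ as) (b ∷ bs) e = cong (a ∷_) (zip₁ as bs (suc-injective e))
  zip₂ : ∀ (as : List A) (bs : List B) → length as ≡ length bs → map proj₂ (Data.List.zip as bs) ≡ bs
  zip₂ [] [] e = refl
  zip₂ (a ∷ as) (b ∷ bs) e = cong (b ∷_) (zip₂ as bs (suc-injective e))
  sparse : Sparse ps
  sparse a b ma mb = subst₂ _<_
   (cong₂ _+_ (cong (count (λ b′ → not (ok a b′))) (sym (zip₂ as bs len))) (cong (count (λ a′ → not (ok a′ b))) (sym (zip₁ as bs len))))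
   (trans (cong length (sym (zip₂ as bs len))) (length-map proj₂ ps))
   (sp (subst (a ∈_) (zip₁ as bs len) ma) (subst (b ∈_) (zip₂ as bs len) mb))
  fits : ∀ qs → All Ok qs → Fits (map proj₁ qs) (map proj₂ qs)
  fits [] [] = tt
  fits (q ∷ qs) (o ∷ os) = o , fits qs os
  All-↭ : ∀ {xs ys : List (A × B)} → xs ↭ ys → All Ok xs → All Ok ys
  All-↭ e os = All.tabulate (λ m → All.lookup os (∈-resp-↭ (↭-sym e) m))
  realign : Swapped (ps ++ []) → ∃ λ as′ → as′ ↭ as × Fits as′ bs
  realign (qs , e₁ , e₂ , o) with ↭-map-inv proj₂ (↭-trans e₂ (↭-reflexive (trans (cong (map proj₂) (++-identityʳ ps)) (zip₂ as bs len))))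
  ... | rs , eq , perm = map proj₁ rs ,
     ↭-trans (map⁺ proj₁ (↭-sym perm)) (↭-trans e₁ (↭-reflexive (trans (cong (map proj₁) (++-identityʳ ps)) (zip₁ as bs len)))) ,
     subst (Fits (map proj₁ rs)) (sym eq) (fits rs (All-↭ perm o))

xors : List Bool → Bool
xors [] = false
xors (b ∷ bs) = b xor xors bs

xor-cancel : ∀ a b → a xor (a xor b) ≡ b
xor-cancel true true = refl
xor-cancel true false = refl
xor-cancel false b = refl

xors-++ : ∀ as bs → xors (as ++ bs) ≡ xors as xor xors bs
xors-++ [] bs = refl
xors-++ (a ∷ as) bs = trans (cong (a xor_) (xors-++ as bs)) (sym (xor-assoc a _ _))

xors-↭ : ∀ {as bs} → as ↭ bs → xors as ≡ xors bs
xors-↭ _↭_.refl = refl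
xors-↭ (_↭_.prep x e) = cong (x xor_) (xors-↭ e)
xors-↭ (_↭_.swap x y e) = trans (cong (λ z → x xor (y xor z)) (xors-↭ e))
 (trans (sym (xor-assoc x y _)) (trans (cong (_xor _) (xor-comm x y)) (xor-assoc y x _)))
xors-↭ (_↭_.trans e e′) = trans (xors-↭ e) (xors-↭ e′)

pattern-of-parity : ℕ → Bool → List Bool
pattern-of-parity zero b = []
pattern-of-parity (suc t) b = b ∷ replicate t false

xors-replicate-false : ∀ t → xors (replicate t false) ≡ false
xors-replicate-false zero = refl
xors-replicate-false (suc t) = xors-replicate-false t

pattern-parity : ∀ t b → xors (pattern-of-parity (suc t) b) ≡ b
pattern-parity t b = trans (cong (b xor_) (xors-replicate-false t)) (xor-identityʳ b)

pattern-length : ∀ t b → length (pattern-of-parity t b) ≡ t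
pattern-length zero b = refl
pattern-length (suc t) b = cong suc (length-replicate t)

colours : ℕ → ℕ → List Bool
colours a b = replicate a true ++ replicate b false

colours-parity : ∀ a b → xors (colours a b) ≡ oddᵇ a
colours-parity zero b = xors-replicate-false b
colours-parity (suc a) b = trans (cong not (colours-parity a b)) refl

colours-length : ∀ a b → length (colours a b) ≡ a + b
colours-length a b = ++-length (replicate a true) (length-replicate a) (length-replicate b)

odd-+ : ∀ a b → oddᵇ (a + b) ≡ oddᵇ a xor oddᵇ b
odd-+ zero b = refl
odd-+ (suc a) b = trans (cong not (odd-+ a b)) (sym (xor-assoc true (oddᵇ a) (oddᵇ b)))

-- Extending walks of blocks

BoolFun : ℕ → Set
BoolFun zero = Bool
BoolFun (suc n) = Bool → BoolFun n

Agree : ∀ n → BoolFun n → BoolFun n → Set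
Agree zero f g = f ≡ g
Agree (suc n) f g = ∀ x → Agree n (f x) (g x)

check : ∀ n → BoolFun n → BoolFun n → Bool
check zero f g = f ≐ g
check (suc n) f g = check n (f true) (g true) ∧ check n (f false) (g false)

truth-table : ∀ n f g → check n f g ≡ true → Agree n f g
truth-table zero f g e = ≐-true e
truth-table (suc n) f g e true = truth-table n (f true) (g true) (∧-left e)
truth-table (suc n) f g e false = truth-table n (f false) (g false) (∧-right {check n (f true) (g true)} e)

endPar : Bool → ℕ → Bool → Bool
endPar τ zero b = b
endPar τ (suc u) b = endPar τ u (b xor τ)

-- The parity of the union of u further blocks, when the last block has parity b and all further edges are right.
sumRest : Bool → ℕ → Bool → Bool
sumRest τ zero b = false
sumRest τ (suc u) b = (b xor τ) xor sumRest τ u (b xor τ)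

record Base : Set where
 field
  n : ℕ
  pos : NonZero n
  χ : Fin n → Bool
  τ : Bool
  E : List (Fin n) → Bool
  E-↭ : ∀ {xs ys} → xs ↭ ys → E xs ≡ E ys
  g′ : ℕ

module Blocks (B : Base) where

 open Base B public

 instance
  n≢0 : NonZero n
  n≢0 = pos

 V : Set
 V = Fin n

 g h : ℕ
 g = suc g′
 h = suc g

 par : List V → Bool
 par xs = xors (map χ xs)

 bad linked : List V → Bool
 bad xs = (par xs ≐ τ) ∧ not (E xs)
 linked xs = E xs ∧ (par xs ≐ τ)

 rich : ℕ → List V → Bool
 rich q X = heavy q h linked X

 par-++ : ∀ xs ys → par (xs ++ ys) ≡ par xs xor par ys
 par-++ xs ys = trans (cong xors (map-++ χ xs ys)) (xors-++ (map χ xs) (map χ ys))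

 par-↭ : ∀ {xs ys} → xs ↭ ys → par xs ≡ par ys
 par-↭ e = xors-↭ (map⁺ χ e)

 bad-↭ : ∀ {xs ys} → xs ↭ ys → bad xs ≡ bad ys
 bad-↭ e = cong₂ (λ p x → (p ≐ τ) ∧ not x) (par-↭ e) (E-↭ e)

 right-edge : ∀ {xs} → par xs ≡ τ → bad xs ≡ false → E xs ≡ true
 right-edge {xs} p b with E xs
 ... | true = refl
 ... | false = contradiction (trans (sym b) (trans (cong (λ z → (z ≐ τ) ∧ true) p) (∧-intro (≐-refl τ) refl))) λ ()

 next-edge : ∀ X Y → par Y ≡ par X xor τ → bad (X ++ Y) ≡ false → E (X ++ Y) ≡ true
 next-edge X Y p b = right-edge (trans (par-++ X Y) (trans (cong (par X xor_) p) (xor-cancel (par X) τ))) b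

 data Walk : List V → List (List V) → List V → Set where
  stop : ∀ {X} → Walk X [] X
  step : ∀ {X Z Y Bs} → E (X ++ Z) ≡ true → length Z ≡ h → Walk Z Bs Y → Walk X (Z ∷ Bs) Y

 walk-++ : ∀ {X Y Z Bs Cs} → Walk X Bs Y → Walk Y Cs Z → Walk X (Bs ++ Cs) Z
 walk-++ stop w = w
 walk-++ (step e l v) w = step e l (walk-++ v w)

 total-parity : Bool
 total-parity = oddᵇ (avail χ true [])

 Slot : Set
 Slot = List V × List V × List V

 fits : V → Slot → Bool
 fits v (F , C , F′) = not (bad (F ++ v ∷ C)) ∧ not (bad ((v ∷ C) ++ F′))

record Params (B : Base) : Set where
 open Blocks B
 field
  K q ρ c p N : ℕ
  q>0 : 0 < q
  n≤cp : n ≤ c * p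
  K-big : c ^ h < K
  ρ≤K : 4 * ρ ≤ K
  room : 4 * ρ * (h * (N + h)) ≤ n
  bad-rare : Rare (4 * K * (4 * K * q)) (h + h) bad
  splits : ∀ w b → Dense ρ g (λ f → (par (w ∷ f) ≐ b) ∧ rich ρ (w ∷ f))

module Steps {B : Base} (Q : Params B) where

 open Blocks B public
 open Params Q public

 2≤4 : 2 ≤ 4
 2≤4 = s≤s (s≤s z≤n)

 q₁ : ℕ
 q₁ = 4 * K * q

 4K≤q₁ : 4 * K ≤ q₁
 4K≤q₁ = ≡-≤ (sym (*-identityʳ (4 * K))) (*-monoʳ-≤ (4 * K) q>0)

 opaque
  good : List V → Bool
  good X = light q₁ h bad X

  good-rare : ∀ X → good X ≡ true → Rare q₁ h (λ Y → bad (X ++ Y))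
  good-rare X e = light-rare {P = bad} X e

  not-good : Rare (4 * K) h (λ X → not (good X))
  not-good = markov (4 * K) q₁ bad-rare

  centred : List V → Bool
  centred C = light q₁ (suc h) bad C

  centred-rare : ∀ C → centred C ≡ true → Rare q₁ (suc h) (λ Y → bad (C ++ Y))
  centred-rare C e = light-rare {P = bad} C e

  not-centred : Rare (4 * K) g (λ C → not (centred C))
  not-centred = markov (4 * K) q₁ (subst (λ t → Rare (4 * K * q₁) t bad) (sym (+-suc g h)) bad-rare)

 c≢0 : NonZero c
 c≢0 with c in e
 ... | suc _ = _
 ... | zero = contradiction (subst (λ c → n ≤ c * p) e n≤cp) (<⇒≱ (n>0 n))
  where
  n>0 : ∀ n .{{_ : NonZero n}} → 0 < n
  n>0 (suc n) = s≤s z≤n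

 p>0 : 0 < p
 p>0 with p in e
 ... | suc _ = s≤s z≤n
 ... | zero = contradiction (≤-≡ n≤cp (trans (cong (c *_) e) (*-zeroʳ c))) (<⇒≱ (n>0 n))
  where
  n>0 : ∀ n .{{_ : NonZero n}} → 0 < n
  n>0 (suc n) = s≤s z≤n

 few : ∀ t {P : List V → Bool} → t ≤ h → Rare K t P → # t P < p ^ t
 few t {P} t≤h (mkRare r) = ≰⇒> λ ge → <⇒≱ (^-pos t) (0≥ ge)
  where
  open ≤-Reasoning
  ^-pos : ∀ t → 0 < p ^ t
  ^-pos t = m^n>0 p {{>-nonZero p>0}} t
  0≥ : p ^ t ≤ # t P → p ^ t ≤ 0
  0≥ ge = +-cancelʳ-≤ (c ^ t * p ^ t) (p ^ t) 0 (begin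
   p ^ t + c ^ t * p ^ t ≤⟨ *-monoˡ-≤ (p ^ t) (≤-trans (s≤s (^-monoʳ-≤ c {{c≢0}} t≤h)) K-big) ⟩
   K * p ^ t ≤⟨ *-monoʳ-≤ K ge ⟩
   K * # t P ≤⟨ r ⟩
   n ^ t ≤⟨ ^-monoˡ-≤ t n≤cp ⟩
   (c * p) ^ t ≡⟨ ^-distribʳ-* t c p ⟩
   c ^ t * p ^ t ∎)
   where
   ^-distribʳ-* : ∀ t a b → (a * b) ^ t ≡ a ^ t * b ^ t
   ^-distribʳ-* zero a b = refl
   ^-distribʳ-* (suc t) a b = trans (cong (a * b *_) (^-distribʳ-* t a b)) ([m*n]*[o*p]≡[m*o]*[n*p] a b _ _)

 Roomy : ℕ → List V → Set
 Roomy j U = ∀ c → j + (p + h) ≤ avail χ c U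

 roomy-++ : ∀ j xs {U} → Roomy (length xs + j) U → Roomy j (xs ++ U)
 roomy-++ j [] r = r
 roomy-++ j (x ∷ xs) {U} r = λ c → ≤-pred (≤-trans ≤-refl (≤-trans (roomy-++ (suc j) xs (λ c′ → ≡-≤ (cong (_+ (p + h)) (+-suc (length xs) j)) (r c′)) c) (avail-≤ χ c x (xs ++ U))))

 pick : ∀ cs U (P : List V → Bool) → length cs ≤ h → Roomy 0 U → Rare K (length cs) P →
  ∃ λ xs → map χ xs ≡ cs × fresh U xs ≡ true × P xs ≡ false
 pick cs U P le roomy r = choose χ cs U p P (λ c → ≤-trans (+-monoʳ-≤ p le) (roomy c)) (few (length cs) le r)

 pick-dense : ∀ t U {P R : List V → Bool} → t ≤ h → length U ≤ N → Dense ρ t P → Rare (4 * ρ) t R →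
  ∃ λ xs → length xs ≡ t × fresh U xs ≡ true × P xs ≡ true × R xs ≡ false
 pick-dense t U {P} {R} t≤h U≤N d r with dense-find {q = 2 * ρ} (dense-minus {q = ρ} d (rare-∨ {q = 2 * ρ}
   (rare-weaken (≤-reflexive (twice-twice ρ)) (clash-rare (4 * ρ) t U (≤-trans (*-monoʳ-≤ (4 * ρ) (*-mono-≤ t≤h (+-mono-≤ U≤N t≤h))) room)))
   (rare-weaken (≤-reflexive (twice-twice ρ)) r)))
 ... | xs , len , e with ∧-true {P xs} e
 ... | Px , e′ with ∨-false {not (fresh U xs)} (not-true e′)
 ... | f , Rx = xs , len , not-false f , Px , Rx

 avoid : List V → List V → List V → Bool
 avoid L F X = bad (L ++ X) ∨ (bad (F ++ X) ∨ not (good X))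

 avoid-rare : ∀ L F → good L ≡ true → good F ≡ true → Rare K h (avoid L F)
 avoid-rare L F gL gF = rare-∨ {q = K}
  (rare-weaken (≤-trans (*-monoˡ-≤ K 2≤4) 4K≤q₁) (good-rare L gL))
  (rare-∨ {q = 2 * K} (rare-weaken (≡-≤ (twice-twice K) 4K≤q₁) (good-rare F gF))
   (rare-weaken (≤-reflexive (twice-twice K)) not-good))

 record State (F₀ : List V) (u k : ℕ) (s : Bool) (L U : List V) : Set where
  field
   len-F₀ : length F₀ ≡ h
   good-F₀ : good F₀ ≡ true
   len-L : length L ≡ h
   good-L : good L ≡ true
   joint : bad (F₀ ++ L) ≡ false
   unique : Unique U
   count-U : length U + k + u * h ≡ n
   closing : endPar τ u (par L) ≡ par F₀ xor τ
   total : sumRest τ u (par L) ≡ total-parity xor (par U xor s)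

 advance : ∀ {F₀ u k s L U} X → State F₀ (suc u) k s L U → length X ≡ h → par X ≡ par L xor τ →
  avoid L F₀ X ≡ false → fresh U X ≡ true → State F₀ u k s X (X ++ U)
 advance {F₀} {u} {k} {s} {L} {U} X st len pX av fr = record
  { len-F₀ = len-F₀; good-F₀ = good-F₀; len-L = len
  ; good-L = not-false ((∨-right {bad (F₀ ++ X)} (∨-right {bad (L ++ X)} av)))
  ; joint = ∨-left {bad (F₀ ++ X)} (∨-right {bad (L ++ X)} av)
  ; unique = fresh-unique X unique fr
  ; count-U = trans (trans (cong (λ l → l + k + u * h) (trans (length-++ X) (cong (_+ length U) len))) (regroup h (length U) k (u * h))) count-U
  ; closing = trans (cong (endPar τ u) pX) closing
  ; total = trans (cong (sumRest τ u) pX) (trans (sym (xor-cancel (par L xor τ) _)) (trans (cong ((par L xor τ) xor_) total)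
    (trans (truth-table 4 (λ x a b c → x xor (a xor (b xor c))) (λ x a b c → a xor ((x xor b) xor c)) refl (par L xor τ) total-parity (par U) s)
     (cong (λ z → total-parity xor (z xor s)) (sym (trans (par-++ X U) (cong (_xor par U) pX)))))))
  }
  where
  open State st
  regroup : ∀ h l k r → h + l + k + r ≡ l + k + (h + r)
  regroup = solve-∀

 advance₃ : ∀ {F₀ u k s L U} L′ U′ k′ s′ → State F₀ (3 + u) k s L U → length L′ ≡ h → good L′ ≡ true →
  bad (F₀ ++ L′) ≡ false → Unique U′ → length U′ + k′ ≡ length U + k + 3 * h →
  par L′ ≡ ((par L xor τ) xor τ) xor τ →
  par U′ xor s′ ≡ (par L xor τ) xor (((par L xor τ) xor τ) xor ((((par L xor τ) xor τ) xor τ) xor (par U xor s))) →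
  State F₀ u k′ s′ L′ U′
 advance₃ {F₀} {u} {k} {s} {L} {U} L′ U′ k′ s′ st len gL jo un counted pL pU = record
  { len-F₀ = len-F₀; good-F₀ = good-F₀; len-L = len; good-L = gL; joint = jo; unique = un
  ; count-U = trans (cong (_+ u * h) counted) (trans (regroup (length U + k) h (u * h)) count-U)
  ; closing = trans (cong (endPar τ u) pL) closing
  ; total = trans (cong (sumRest τ u) pL) (trans (solve-for b₁ b₂ b₃ _ _ total) (trans
    (truth-table 5 (λ x y z a w → x xor (y xor (z xor (a xor w)))) (λ x y z a w → a xor (x xor (y xor (z xor w)))) refl b₁ b₂ b₃ total-parity (par U xor s))
    (cong (total-parity xor_) (sym pU))))
  }
  where
  open State st
  b₁ b₂ b₃ : Bool
  b₁ = par L xor τ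
  b₂ = b₁ xor τ
  b₃ = b₂ xor τ
  regroup : ∀ l h r → l + 3 * h + r ≡ l + (h + (h + (h + r)))
  regroup = solve-∀
  solve-for : ∀ x y z R t → x xor (y xor (z xor R)) ≡ t → R ≡ x xor (y xor (z xor t))
  solve-for x y z R .(x xor (y xor (z xor R))) refl =
   truth-table 4 (λ x y z R → R) (λ x y z R → x xor (y xor (z xor (x xor (y xor (z xor R)))))) refl x y z R

 length-colours : ∀ {cs} (X : List V) → map χ X ≡ cs → length X ≡ length cs
 length-colours X e = trans (sym (length-map χ X)) (cong length e)

 extend : ∀ {F₀ u k s L U} cs → State F₀ (suc u) k s L U → length cs ≡ h → xors cs ≡ par L xor τ → Roomy 0 U →
  ∃ λ X → map χ X ≡ cs × E (L ++ X) ≡ true × State F₀ u k s X (X ++ U)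
 extend {F₀} {u} {k} {s} {L} {U} cs st len pcs roomy
  with pick cs U (avoid L F₀) (≤-reflexive len) roomy
   (subst (λ t → Rare K t (avoid L F₀)) (sym len) (avoid-rare L F₀ (State.good-L st) (State.good-F₀ st)))
 ... | X , col , fr , av = X , col , next-edge L X pX (∨-left av) ,
    advance X st (trans (length-colours X col) len) pX av fr
  where
  pX : par X ≡ par L xor τ
  pX = trans (cong xors col) pcs

 one-vertex : ∀ q {P : List V → Bool} → q * # 1 P ≤ n ^ 1 → q * size (λ v → P [ v ]) ≤ n
 one-vertex q {P} le = ≡-≤ (cong (q *_) (sym (trans (#-suc 0 P)
  (trans (∑-cong (λ v → #-zero (λ xs → P (v ∷ xs)))) (sym (size≡ _)))))) (≤-≡ le (*-identityʳ n))

 record SlotStep (F₀ : List V) (u k : ℕ) (s c : Bool) (L U : List V) : Set where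
  field
   F C F′ : List V
   enter : E (L ++ F) ≡ true
   len-F : length F ≡ h
   len-C : length C ≡ g
   len-F′ : length F′ ≡ h
   through : ∀ v → χ v ≡ c → fits v (F , C , F′) ≡ true → E (F ++ v ∷ C) ≡ true × E ((v ∷ C) ++ F′) ≡ true
   misfits : q * size (λ v → not (fits v (F , C , F′))) ≤ 2 * n
   after : State F₀ u (suc k) (s xor c) F′ (F′ ++ (C ++ (F ++ U)))

 slot : ∀ {F₀ u k s L U} c → State F₀ (3 + u) k s L U → Roomy (2 * h) U → SlotStep F₀ u k s c L U
 slot {F₀} {u} {k} {s} {L} {U} c st roomy = start (extend (pattern-of-parity h b₁) st (pattern-length h b₁) (pattern-parity g b₁) (λ d → ≤-trans (m≤n+m (p + h) (2 * h)) (roomy d)))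
  where
  open State st
  b₁ b₂ b₃ : Bool
  b₁ = par L xor τ
  b₂ = b₁ xor τ
  b₃ = b₂ xor τ
  start : (∃ λ F → map χ F ≡ pattern-of-parity h b₁ × E (L ++ F) ≡ true × State F₀ (2 + u) k s F (F ++ U)) →
   SlotStep F₀ u k s c L U
  start (F , colF , eF , stF) = middle (pick (pattern-of-parity g (b₂ xor c)) (F ++ U) R₂
    (≡-≤ lenC (n≤1+n g)) (λ d → ≤-trans (m≤n+m (p + h) (1 * h)) (roomy-++ (1 * h) F {U} (λ d → ≡-≤ (cong (λ l → l + 1 * h + (p + h)) lenF) (roomy d)) d))
    (subst (λ t → Rare K t R₂) (sym lenC) (rare-∨ {q = K}
     (rare-weaken (*-monoˡ-≤ K 2≤4) (markov (4 * K) q (subst (λ t → Rare q₁ t (λ Y → bad (F ++ Y))) (+-comm 1 g) (good-rare F (State.good-L stF)))))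
     (rare-weaken (*-monoˡ-≤ K 2≤4) not-centred))))
   where
   lenF : length F ≡ h
   lenF = State.len-L stF
   lenC : length (pattern-of-parity g (b₂ xor c)) ≡ g
   lenC = pattern-length g (b₂ xor c)
   R₂ : List V → Bool
   R₂ C = not (light q 1 (λ Y → bad (F ++ Y)) C) ∨ not (centred C)
   middle : (∃ λ C → map χ C ≡ pattern-of-parity g (b₂ xor c) × fresh (F ++ U) C ≡ true × R₂ C ≡ false) → SlotStep F₀ u k s c L U
   middle (C , colC , frC , avC) = end (pick (pattern-of-parity h b₃) (C ++ (F ++ U)) R₃ (≤-reflexive (pattern-length h b₃)) roomyC
     (subst (λ t → Rare K t R₃) (sym (pattern-length h b₃)) (rare-∨ {q = K}
      (rare-weaken (*-monoˡ-≤ K 2≤4) (markov (4 * K) q (subst (λ t → Rare q₁ t (λ Y → bad (C ++ Y))) (+-comm 1 h) (centred-rare C centredC))))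
      (rare-∨ {q = 2 * K} (rare-weaken (≡-≤ (twice-twice K) 4K≤q₁) (good-rare F₀ good-F₀))
       (rare-weaken (≤-reflexive (twice-twice K)) not-good)))))
    where
    length-C : length C ≡ g
    length-C = trans (length-colours C colC) lenC
    roomyC : Roomy 0 (C ++ (F ++ U))
    roomyC = roomy-++ 0 C (roomy-++ (length C + 0) F (λ d → ≤-trans (+-monoˡ-≤ (p + h)
     (≡-≤ (cong₂ _+_ lenF (cong (_+ 0) length-C)) (+-monoʳ-≤ h (+-monoˡ-≤ 0 (n≤1+n g))))) (roomy d)))
    lightC : light q 1 (λ Y → bad (F ++ Y)) C ≡ true
    lightC = not-false (∨-left avC)
    centredC : centred C ≡ true
    centredC = not-false (∨-right {not (light q 1 (λ Y → bad (F ++ Y)) C)} avC)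
    R₃ : List V → Bool
    R₃ X = not (light q 1 (λ Y → bad (C ++ Y)) X) ∨ (bad (F₀ ++ X) ∨ not (good X))
    end : (∃ λ F′ → map χ F′ ≡ pattern-of-parity h b₃ × fresh (C ++ (F ++ U)) F′ ≡ true × R₃ F′ ≡ false) → SlotStep F₀ u k s c L U
    end (F′ , colF′ , frF′ , avF′) = record
     { F = F; C = C; F′ = F′; enter = eF; len-F = lenF; len-C = length-C; len-F′ = lenF′
     ; through = λ v cv fv → next-edge F (v ∷ C) (parvC v cv) (not-true (∧-left fv)) ,
       next-edge (v ∷ C) F′ (trans pF′ (cong (_xor τ) (sym (trans (parvC v cv) (cong (_xor τ) pF))))) (not-true (∧-right {not (bad (F ++ v ∷ C))} fv))
     ; misfits = misfits≤
     ; after = advance₃ F′ (F′ ++ (C ++ (F ++ U))) (suc k) (s xor c) st lenF′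
       (not-false (∨-right {bad (F₀ ++ F′)} rest)) (∨-left rest)
       (fresh-unique F′ (fresh-unique C (State.unique stF) frC) frF′) counted pF′ parU
     }
     where
     rest : bad (F₀ ++ F′) ∨ not (good F′) ≡ false
     rest = ∨-right {not (light q 1 (λ Y → bad (C ++ Y)) F′)} avF′
     lenF′ : length F′ ≡ h
     lenF′ = trans (length-colours F′ colF′) (pattern-length h b₃)
     pF : par F ≡ b₁
     pF = trans (cong xors colF) (pattern-parity g b₁)
     pC : par C ≡ b₂ xor c
     pC = trans (cong xors colC) (pattern-parity g′ (b₂ xor c))
     pF′ : par F′ ≡ b₃
     pF′ = trans (cong xors colF′) (pattern-parity g b₃)
     parvC : ∀ v → χ v ≡ c → par (v ∷ C) ≡ par F xor τ
     parvC v cv = trans (cong₂ _xor_ cv pC) (trans (truth-table 2 (λ b c → c xor (b xor c)) (λ b c → b) refl b₂ c) (cong (_xor τ) (sym pF)))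
     parU : par (F′ ++ (C ++ (F ++ U))) xor (s xor c) ≡ b₁ xor (b₂ xor (b₃ xor (par U xor s)))
     parU = trans (cong (_xor (s xor c)) (trans (par-++ F′ _) (cong₂ _xor_ pF′ (trans (par-++ C _) (cong₂ _xor_ pC (trans (par-++ F U) (cong (_xor par U) pF)))))))
      (truth-table 6 (λ x y z c P s → (z xor ((y xor c) xor (x xor P))) xor (s xor c)) (λ x y z c P s → x xor (y xor (z xor (P xor s)))) refl b₁ b₂ b₃ c (par U) s)
     counted : length (F′ ++ (C ++ (F ++ U))) + suc k ≡ length U + k + 3 * h
     counted = trans (cong (_+ suc k) (++-length F′ lenF′ (++-length C length-C (trans (length-++ F) (cong (_+ length U) lenF)))))
      (arith g (length U) k)
      where
      arith : ∀ g l k → suc g + (g + (suc g + l)) + suc k ≡ l + k + 3 * suc g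
      arith = solve-∀
     misfits≤ : q * size (λ v → not (fits v (F , C , F′))) ≤ 2 * n
     misfits≤ = begin
      q * size (λ v → not (fits v (F , C , F′))) ≤⟨ *-monoʳ-≤ q split ⟩
      q * (size bad₁ + size bad₂) ≡⟨ *-distribˡ-+ q (size bad₁) (size bad₂) ⟩
      q * size bad₁ + q * size bad₂ ≤⟨ +-mono-≤ (one-vertex q {λ Y → bad (F ++ (C ++ Y))} (≤ᵇ-true lightC))
                                  (one-vertex q {λ Y → bad (C ++ (F′ ++ Y))} (≤ᵇ-true (not-false (∨-left avF′)))) ⟩
      n + n ≡⟨ cong (n +_) (sym (+-identityʳ n)) ⟩
      2 * n ∎
      where
      open ≤-Reasoning
      bad₁ bad₂ : V → Bool
      bad₁ v = bad (F ++ (C ++ [ v ]))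
      bad₂ v = bad (C ++ (F′ ++ [ v ]))
      eq₁ : ∀ v → bad (F ++ v ∷ C) ≡ bad₁ v
      eq₁ v = bad-↭ (++⁺ˡ F (++-comm [ v ] C))
      eq₂ : ∀ v → bad ((v ∷ C) ++ F′) ≡ bad₂ v
      eq₂ v = bad-↭ (↭-trans (++-comm [ v ] (C ++ F′)) (↭-reflexive (++-assoc C F′ [ v ])))
      de-morgan : ∀ a b → bit (not (not a ∧ not b)) ≤ bit a + bit b
      de-morgan true true = s≤s z≤n
      de-morgan true false = s≤s z≤n
      de-morgan false true = s≤s z≤n
      de-morgan false false = z≤n
      split : size (λ v → not (fits v (F , C , F′))) ≤ size bad₁ + size bad₂
      split = ≡-≤ (size≡ _) (≤-≡ (∑-mono λ v → ≤-≡ (de-morgan (bad (F ++ v ∷ C)) (bad ((v ∷ C) ++ F′)))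
       (cong₂ (λ a b → bit a + bit b) (eq₁ v) (eq₂ v))) (trans (∑-+ _ _) (sym (cong₂ _+_ (size≡ bad₁) (size≡ bad₂)))))

 record CoverStep (F₀ : List V) (u k : ℕ) (s : Bool) (w : V) (L U : List V) : Set where
  field
   Z X Z′ : List V
   walk : Walk L (Z ∷ X ∷ Z′ ∷ []) Z′
   w∈X : w ∈ X
   after : State F₀ u k s Z′ (Z′ ++ (Z ++ (X ++ U)))

 linked-parity : ∀ X Z → linked (X ++ Z) ≡ true → E (X ++ Z) ≡ true × par Z ≡ par X xor τ
 linked-parity X Z e with ∧-true {E (X ++ Z)} e
 ... | e₁ , e₂ = e₁ , trans (sym (xor-cancel (par X) (par Z))) (cong (par X xor_) (trans (sym (par-++ X Z)) (≐-true e₂)))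

 cover : ∀ {F₀ u k s L U} w → State F₀ (3 + u) k s L U → mem w U ≡ false → length U + (h + h) ≤ N → CoverStep F₀ u k s w L U
 cover {F₀} {u} {k} {s} {L} {U} w st w∉U U≤ = start (pick-dense g (w ∷ U) {R = λ _ → false} (n≤1+n g)
   (≤-trans (≤-≡ (s≤s (m≤m+n _ (g + h))) (sym (+-suc (length U) (g + h)))) U≤) (splits w (par L)) (none-rare (4 * ρ) g))
  where
  open State st
  start : (∃ λ f → length f ≡ g × fresh (w ∷ U) f ≡ true × (par (w ∷ f) ≐ par L) ∧ rich ρ (w ∷ f) ≡ true × false ≡ false) → CoverStep F₀ u k s w L U
  start (f , len , fr , e , _) = second (pick-dense h (X ++ U) ≤-refl XU≤ dense (rare-weaken ρ≤K (avoid-rare L F₀ good-L good-F₀)))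
   where
   X : List V
   X = w ∷ f
   pX : par X ≡ par L
   pX = ≐-true (∧-left {par X ≐ par L} e)
   dense : Dense ρ h (λ Z → linked (X ++ Z))
   dense = heavy-dense {P = linked} X (∧-right {par X ≐ par L} e)
   lenX : length X ≡ h
   lenX = cong suc len
   XU≤ : length (X ++ U) ≤ N
   XU≤ = ≡-≤ (trans (length-++ X) (trans (cong (_+ length U) lenX) (+-comm h (length U)))) (≤-trans (+-monoʳ-≤ (length U) (m≤m+n h h)) U≤)
   uX : Unique (X ++ U)
   uX = Unique-↭ (shift w f U) (fresh-unique f (∉-All (mem-∉ U w∉U) ∷ unique) fr)
   second : (∃ λ Z → length Z ≡ h × fresh (X ++ U) Z ≡ true × linked (X ++ Z) ≡ true × avoid L F₀ Z ≡ false) → CoverStep F₀ u k s w L U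
   second (Z , lenZ , frZ , lkZ , avZ) = third (pick-dense h (Z ++ (X ++ U)) ≤-refl
     (≡-≤ (trans (length-++ Z) (trans (cong₂ _+_ lenZ (trans (length-++ X) (cong (_+ length U) lenX))) (arith h (length U)))) U≤)
     dense (rare-weaken ρ≤K (avoid-rare F₀ F₀ good-F₀ good-F₀)))
    where
    arith : ∀ h l → h + (h + l) ≡ l + (h + h)
    arith = solve-∀
    lpZ : E (X ++ Z) ≡ true × par Z ≡ par X xor τ
    lpZ = linked-parity X Z lkZ
    third : (∃ λ Z′ → length Z′ ≡ h × fresh (Z ++ (X ++ U)) Z′ ≡ true × linked (X ++ Z′) ≡ true × avoid F₀ F₀ Z′ ≡ false) → CoverStep F₀ u k s w L U
    third (Z′ , lenZ′ , frZ′ , lkZ′ , avZ′) = record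
     { Z = Z; X = X; Z′ = Z′
     ; walk = step (next-edge L Z pZ (∨-left avZ)) lenZ
       (step (trans (E-↭ (++-comm Z X)) (proj₁ lpZ)) lenX (step (proj₁ lpZ′) lenZ′ stop))
     ; w∈X = here refl
     ; after = advance₃ Z′ (Z′ ++ (Z ++ (X ++ U))) k s st lenZ′ (not-false (∨-right {bad (F₀ ++ Z′)} (∨-right {bad (F₀ ++ Z′)} avZ′)))
       (∨-left avZ′) (fresh-unique Z′ (fresh-unique Z uX frZ) frZ′) counted
       (trans (proj₂ lpZ′) (cong (_xor τ) (trans pX (sym (xor-xor (par L) τ)))))
       parU
     }
     where
     lpZ′ : E (X ++ Z′) ≡ true × par Z′ ≡ par X xor τ
     lpZ′ = linked-parity X Z′ lkZ′
     pZ : par Z ≡ par L xor τ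
     pZ = trans (proj₂ lpZ) (cong (_xor τ) pX)
     xor-xor : ∀ a b → (a xor b) xor b ≡ a
     xor-xor = truth-table 2 (λ a b → (a xor b) xor b) (λ a b → a) refl
     counted : length (Z′ ++ (Z ++ (X ++ U))) + k ≡ length U + k + 3 * h
     counted = trans (cong (_+ k) (++-length Z′ lenZ′ (++-length Z lenZ (trans (length-++ X) (cong (_+ length U) lenX)))))
      (arith′ h (length U) k)
      where
      arith′ : ∀ h l k → h + (h + (h + l)) + k ≡ l + k + 3 * h
      arith′ = solve-∀
     parU : par (Z′ ++ (Z ++ (X ++ U))) xor s ≡ (par L xor τ) xor (((par L xor τ) xor τ) xor ((((par L xor τ) xor τ) xor τ) xor (par U xor s)))
     parU = trans (cong (_xor s) (trans (par-++ Z′ _) (cong₂ _xor_ (trans (proj₂ lpZ′) (cong (_xor τ) pX)) (trans (par-++ Z _) (cong₂ _xor_ pZ (trans (par-++ X U) (cong (_xor par U) pX)))))))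
      (truth-table 4 (λ b t P s → ((b xor t) xor ((b xor t) xor (b xor P))) xor s)
       (λ b t P s → (b xor t) xor (((b xor t) xor t) xor ((((b xor t) xor t) xor t) xor (P xor s)))) refl (par L) τ (par U) s)

record HamBlocks (B : Base) : Set where
 open Blocks B
 field
  F₀ L : List V
  Bs : List (List V)
  len-F₀ : length F₀ ≡ h
  walk : Walk F₀ Bs L
  close : E (L ++ F₀) ≡ true
  unique : Unique (F₀ ++ concat Bs)
  full : length (F₀ ++ concat Bs) ≡ n

block-colours : ∀ u a g b → 2 ≤ g → 2 + u ≤ a → a ≤ (2 + u) * g →
 ∃ λ a₁ → ∃ λ a′ → a₁ ≤ suc g × oddᵇ a₁ ≡ b × a ≡ a₁ + a′ × suc u ≤ a′ × a′ ≤ (suc u) * g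
block-colours u a g b g≥2 lo≤ ≤hi with suc u * g ≤? a
... | no ¬p = small a b lo≤ (≰⇒> ¬p)
 where
 small : ∀ a b → 2 + u ≤ a → a < suc u * g →
  ∃ λ a₁ → ∃ λ a′ → a₁ ≤ suc g × oddᵇ a₁ ≡ b × a ≡ a₁ + a′ × suc u ≤ a′ × a′ ≤ (suc u) * g
 small a false le lt = 0 , a , z≤n , refl , refl , ≤-trans (n≤1+n _) le , <⇒≤ lt
 small (suc a′) true (s≤s le) lt = 1 , a′ , s≤s z≤n , refl , refl , le , ≤-trans (n≤1+n a′) (<⇒≤ lt)
... | yes p with m≤n⇒∃[o]m+o≡n p
... | r , refl with Data.Bool._≟_ (oddᵇ r) b
... | yes e = r , suc u * g , ≤-trans r≤g (n≤1+n g) , e , +-comm (suc u * g) r ,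
     ≡-≤ (sym (*-identityʳ (suc u))) (*-monoʳ-≤ (suc u) (≤-trans (s≤s z≤n) g≥2)) , ≤-refl
 where
 r≤g : r ≤ g
 r≤g = +-cancelˡ-≤ (suc u * g) r g (≤-≡ ≤hi (+-comm g (suc u * g)))
... | no ¬e = suc r , u * g + (g ∸ 1) , s≤s r≤g , flip (oddᵇ r) b ¬e , shift-one g g≥2 , lower g g≥2 ,
     ≡-≤ (+-comm (u * g) (g ∸ 1)) (+-monoˡ-≤ (u * g) (m∸n≤m g 1))
 where
 r≤g : r ≤ g
 r≤g = +-cancelˡ-≤ (suc u * g) r g (≤-≡ ≤hi (+-comm g (suc u * g)))
 flip : ∀ x b → x ≢ b → not x ≡ b
 flip true false _ = refl
 flip false true _ = refl
 flip true true n = contradiction refl n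
 flip false false n = contradiction refl n
 shift-one : ∀ g → 2 ≤ g → suc u * g + r ≡ suc r + (u * g + (g ∸ 1))
 shift-one (suc g) _ = arith (u * suc g) g r
  where
  arith : ∀ x g r → suc g + x + r ≡ suc r + (x + g)
  arith = solve-∀
 lower : ∀ g → 2 ≤ g → suc u ≤ u * g + (g ∸ 1)
 lower (suc zero) (s≤s ())
 lower (suc (suc g)) _ = ≡-≤ (+-comm 1 u) (+-mono-≤ (≡-≤ (sym (*-identityʳ u)) (*-monoʳ-≤ u (s≤s (z≤n {suc g})))) (s≤s z≤n))

odd-cnt : ∀ {n} (χ : Fin n → Bool) xs → oddᵇ (cnt χ true xs) ≡ xors (map χ xs)
odd-cnt χ [] = refl
odd-cnt χ (x ∷ xs) with χ x
... | true = cong not (odd-cnt χ xs)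
... | false = odd-cnt χ xs

cnt-colours : ∀ {n} (χ : Fin n → Bool) xs a b → map χ xs ≡ colours a b → cnt χ true xs ≡ a
cnt-colours χ [] zero zero e = refl
cnt-colours χ (x ∷ xs) (suc a) b e rewrite ∷-injectiveˡ e = cong suc (cnt-colours χ xs a b (∷-injectiveʳ e))
cnt-colours χ (x ∷ xs) zero (suc b) e rewrite ∷-injectiveˡ e = cnt-colours χ xs zero b (∷-injectiveʳ e)

members : ∀ {n} → (Fin n → Bool) → List (Fin n)
members {n} P = Data.List.filterᵇ P (allFin n)

members-length : ∀ {n} (P : Fin n → Bool) → length (members P) ≡ size P
members-length {n} P = trans (len-filter (allFin n)) (go n P)
 where
 len-filter : ∀ xs → length (Data.List.filterᵇ P xs) ≡ count P xs
 len-filter [] = refl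
 len-filter (x ∷ xs) with P x
 ... | true = cong suc (len-filter xs)
 ... | false = len-filter xs
 go : ∀ n (P : Fin n → Bool) → count P (allFin n) ≡ size P
 go zero P = sym (size-false λ ())
 go (suc n) P = trans (count-∷ P zero (tabulate suc)) (trans (cong (bit (P zero) +_)
  (trans (cong (count P) (sym (map-tabulate (λ i → i) suc))) (trans (count-map P suc (allFin n)) (go n (λ i → P (suc i))))))
  (sym (trans (size≡ P) (trans (∑-suc _) (cong (bit (P zero) +_) (sym (size≡ _)))))))

∈-members : ∀ {n} (P : Fin n → Bool) {v} → P v ≡ true → v ∈ members P
∈-members P {v} e = ∈-filter⁺ (IsTrue? ∘ P) (∈-allFin v) (subst IsTrue (sym e) tt)

members-elim : ∀ {n} (P : Fin n → Bool) {v} → v ∈ members P → P v ≡ true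
members-elim {n} P m = truth (proj₂ (∈-filter⁻ (IsTrue? ∘ P) {xs = allFin n} m))
 where
 truth : ∀ {b} → IsTrue b → b ≡ true
 truth {true} _ = refl

members-unique : ∀ {n} (P : Fin n → Bool) → Unique (members P)
members-unique {n} P = Uniq.filter⁺ (IsTrue? ∘ P) (Uniq.allFin⁺ n)

slotParity : ℕ → Bool → Bool → Bool
slotParity zero c s = s
slotParity (suc t) c s = slotParity t c (s xor c)

slotParity-true : ∀ t s → slotParity t true s ≡ s xor oddᵇ t
slotParity-true zero s = sym (xor-identityʳ s)
slotParity-true (suc t) s = trans (slotParity-true t (s xor true)) (xor-assoc s true (oddᵇ t))

slotParity-false : ∀ t s → slotParity t false s ≡ s
slotParity-false zero s = refl
slotParity-false (suc t) s = trans (slotParity-false t (s xor false)) (xor-identityʳ s)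

module Phases {B : Base} (Q : Params B) where

 open Steps Q public

 open module Arr = Arrange fits using (Fits) public

 fill : List V → List Slot → List (List V)
 fill (v ∷ vs) ((F , C , F′) ∷ us) = F ∷ (v ∷ C) ∷ F′ ∷ fill vs us
 fill _ _ = []

 Few : Slot → Set
 Few u = q * size (λ v → not (fits v u)) ≤ 2 * n

 record Slots (t : ℕ) (F₀ : List V) (u k : ℕ) (s c : Bool) (L U : List V) : Set where
  field
   us : List Slot
   L′ U′ : List V
   len : length us ≡ t
   walk : ∀ vs → (∀ {v} → v ∈ vs → χ v ≡ c) → Fits vs us → Walk L (fill vs us) L′
   perm : ∀ vs → length vs ≡ t → concat (fill vs us) ++ U ↭ vs ++ U′
   few-misfits : All Few us
   after : State F₀ u (t + k) (slotParity t c s) L′ U′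

 slots : ∀ t {F₀ u k s L U} c → State F₀ (t * 3 + u) k s L U → Roomy (t * (3 * h)) U → Slots t F₀ u k s c L U
 slots zero c st r = record
  { us = []; L′ = _; U′ = _; len = refl; walk = λ { [] _ _ → stop }; perm = λ { [] _ → ↭-refl }; few-misfits = []; after = st }
 slots (suc t) {F₀} {u} {k} {s} {L} {U} c st r = next (slot c st λ d → ≤-trans (+-monoˡ-≤ (p + h) (≤-trans (*-monoˡ-≤ h 2≤3) (m≤m+n (3 * h) (t * (3 * h))))) (r d))
  where
  2≤3 : 2 ≤ 3
  2≤3 = s≤s (s≤s z≤n)
  next : SlotStep F₀ (t * 3 + u) k s c L U → Slots (suc t) F₀ u k s c L U
  next S₁ = more (slots t c after (roomy-++ (t * (3 * h)) F′ (roomy-++ (length F′ + t * (3 * h)) C (roomy-++ (length C + (length F′ + t * (3 * h))) F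
    (λ d → ≤-trans (+-monoˡ-≤ (p + h) (≡-≤ (cong₂ _+_ len-F (cong₂ _+_ len-C (cong (_+ t * (3 * h)) len-F′))) (fit g (t * (3 * h))))) (r d))))))
   where
   open SlotStep S₁
   fit : ∀ g x → suc g + (g + (suc g + x)) ≤ 3 * suc g + x
   fit g x = ≤-≡ (n≤1+n _) (arith g x)
    where
    arith : ∀ g x → suc (suc g + (g + (suc g + x))) ≡ 3 * suc g + x
    arith = solve-∀
   more : Slots t F₀ u (suc k) (s xor c) c F′ (F′ ++ (C ++ (F ++ U))) → Slots (suc t) F₀ u k s c L U
   more S₂ = record
    { us = (F , C , F′) ∷ S₂.us; L′ = S₂.L′; U′ = S₂.U′; len = cong suc S₂.len
    ; walk = λ { (v ∷ vs) col (f , fs) → step enter len-F (step (proj₁ (through v (col (here refl)) f)) (cong suc len-C)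
      (step (proj₂ (through v (col (here refl)) f)) len-F′ (S₂.walk vs (λ m → col (there m)) fs))) }
    ; perm = λ { (v ∷ vs) e → perm′ v vs (suc-injective e) }
    ; few-misfits = misfits ∷ S₂.few-misfits
    ; after = subst (λ k → State F₀ u k (slotParity t c (s xor c)) S₂.L′ S₂.U′) (+-suc t k) S₂.after }
    where
    module S₂ = Slots S₂
    open PermutationReasoning
    perm′ : ∀ v vs → length vs ≡ t → concat (fill (v ∷ vs) ((F , C , F′) ∷ S₂.us)) ++ U ↭ v ∷ vs ++ S₂.U′
    perm′ v vs e = begin
     (F ++ (v ∷ C ++ (F′ ++ X))) ++ U ≡⟨ ++-assoc F _ U ⟩
     F ++ (v ∷ (C ++ (F′ ++ X)) ++ U) ↭⟨ shift v F _ ⟩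
     v ∷ F ++ ((C ++ (F′ ++ X)) ++ U) ↭⟨ _↭_.prep v (rearrange F C F′ X U) ⟩
     v ∷ X ++ (F′ ++ (C ++ (F ++ U))) ↭⟨ _↭_.prep v (S₂.perm vs e) ⟩
     v ∷ vs ++ S₂.U′ ∎
     where
     X : List V
     X = concat (fill vs S₂.us)
     rearrange : ∀ F C F′ X U → F ++ ((C ++ (F′ ++ X)) ++ U) ↭ X ++ (F′ ++ (C ++ (F ++ U)))
     rearrange F C F′ X U = begin
      F ++ ((C ++ (F′ ++ X)) ++ U) ≡⟨ cong (F ++_) (trans (++-assoc C _ U) (cong (C ++_) (++-assoc F′ X U))) ⟩
      F ++ (C ++ (F′ ++ (X ++ U))) ↭⟨ ++⁺ˡ F (++⁺ˡ C (shifts F′ X)) ⟩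
      F ++ (C ++ (X ++ (F′ ++ U))) ↭⟨ ++⁺ˡ F (shifts C X) ⟩
      F ++ (X ++ (C ++ (F′ ++ U))) ↭⟨ shifts F X ⟩
      X ++ (F ++ (C ++ (F′ ++ U))) ↭⟨ ++⁺ˡ X (shifts F C) ⟩
      X ++ (C ++ (F ++ (F′ ++ U))) ↭⟨ ++⁺ˡ X (++⁺ˡ C (shifts F F′)) ⟩
      X ++ (C ++ (F′ ++ (F ++ U))) ↭⟨ ++⁺ˡ X (shifts C F′) ⟩
      X ++ (F′ ++ (C ++ (F ++ U))) ∎

 record Covered (ws : List V) (F₀ : List V) (u v k : ℕ) (s : Bool) (L U : List V) : Set where
  field
   u′ : ℕ
   Bs : List (List V)
   L′ U′ : List V
   u≤u′ : u ≤ u′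
   u′≤v : u′ ≤ v
   walk : Walk L Bs L′
   perm : concat Bs ++ U ↭ U′
   covers : ∀ {w} → w ∈ ws → w ∈ U′
   after : State F₀ u′ k s L′ U′

 coverAll : ∀ ws {F₀ u v k s L U} → length ws * 3 + u ≤ v → n + (h + h) ≤ N + u * h →
  State F₀ v k s L U → Covered ws F₀ u v k s L U
 coverAll [] {v = v} le room′ st = record
  { u′ = v; Bs = []; L′ = _; U′ = _; u≤u′ = le; u′≤v = ≤-refl; walk = stop; perm = ↭-refl; covers = λ (); after = st }
 coverAll (w ∷ ws) {F₀} {u} {v} {k} {s} {L} {U} le room′ st with mem w U in e
 ... | true = skip (coverAll ws (≤-trans (m≤n+m _ 3) le) room′ st)
  where
  skip : Covered ws F₀ u v k s L U → Covered (w ∷ ws) F₀ u v k s L U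
  skip C = record
   { u′ = u′; Bs = Bs; L′ = L′; U′ = U′; u≤u′ = u≤u′; u′≤v = u′≤v; walk = walk; perm = perm
   ; covers = λ { (here refl) → ∈-resp-↭ perm (∈-++⁺ʳ (concat Bs) (mem-∈ U e)) ; (there m) → covers m }; after = after }
   where open Covered C
 ... | false with m≤n⇒∃[o]m+o≡n {3} {v} (≤-trans (m≤m+n 3 _) le)
 ... | v′ , refl = next (cover w st e U≤N)
  where
  u≤v′ : u ≤ v′
  u≤v′ = ≤-trans (m≤n+m u (length ws * 3)) (≤-pred (≤-pred (≤-pred le)))
  U≤N : length U + (h + h) ≤ N
  U≤N = +-cancelʳ-≤ (u * h) _ N (≤-trans (≡-≤ (arith (length U) (h + h) (u * h)) (+-monoˡ-≤ (h + h)
   (≤-≡ (+-mono-≤ (m≤m+n (length U) k) (*-monoˡ-≤ h (≤-trans u≤v′ (m≤n+m v′ 3)))) (State.count-U st)))) room′)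
   where
   arith : ∀ a b c → a + b + c ≡ a + c + b
   arith = solve-∀
  next : CoverStep F₀ v′ k s w L U → Covered (w ∷ ws) F₀ u (3 + v′) k s L U
  next S₁ = more (coverAll ws (≤-pred (≤-pred (≤-pred le))) room′ S₁.after)
   where
   module S₁ = CoverStep S₁
   more : Covered ws F₀ u v′ k s S₁.Z′ (S₁.Z′ ++ (S₁.Z ++ (S₁.X ++ U))) → Covered (w ∷ ws) F₀ u (3 + v′) k s L U
   more C = record
    { u′ = u′; Bs = S₁.Z ∷ S₁.X ∷ S₁.Z′ ∷ Bs; L′ = L′; U′ = U′; u≤u′ = u≤u′; u′≤v = ≤-trans u′≤v (m≤n+m v′ 3); walk = walk-++ S₁.walk walk
    ; perm = perm′
    ; covers = λ { (here refl) → ∈-resp-↭ perm (∈-++⁺ʳ (concat Bs) (∈-++⁺ʳ S₁.Z′ (∈-++⁺ʳ S₁.Z (∈-++⁺ˡ S₁.w∈X)))) ; (there m) → covers m }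
    ; after = after }
    where
    open Covered C
    open PermutationReasoning
    Y : List V
    Y = concat Bs
    perm′ : (S₁.Z ++ (S₁.X ++ (S₁.Z′ ++ Y))) ++ U ↭ U′
    perm′ = begin
     (S₁.Z ++ (S₁.X ++ (S₁.Z′ ++ Y))) ++ U ≡⟨ trans (++-assoc S₁.Z _ U) (cong (S₁.Z ++_) (trans (++-assoc S₁.X _ U) (cong (S₁.X ++_) (++-assoc S₁.Z′ Y U)))) ⟩
     S₁.Z ++ (S₁.X ++ (S₁.Z′ ++ (Y ++ U))) ↭⟨ ++⁺ˡ S₁.Z (++⁺ˡ S₁.X (shifts S₁.Z′ Y)) ⟩
     S₁.Z ++ (S₁.X ++ (Y ++ (S₁.Z′ ++ U))) ↭⟨ ++⁺ˡ S₁.Z (shifts S₁.X Y) ⟩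
     S₁.Z ++ (Y ++ (S₁.X ++ (S₁.Z′ ++ U))) ↭⟨ shifts S₁.Z Y ⟩
     Y ++ (S₁.Z ++ (S₁.X ++ (S₁.Z′ ++ U))) ↭⟨ ++⁺ˡ Y (++⁺ˡ S₁.Z (shifts S₁.X S₁.Z′)) ⟩
     Y ++ (S₁.Z ++ (S₁.Z′ ++ (S₁.X ++ U))) ↭⟨ ++⁺ˡ Y (shifts S₁.Z S₁.Z′) ⟩
     Y ++ (S₁.Z′ ++ (S₁.Z ++ (S₁.X ++ U))) ↭⟨ perm ⟩
     U′ ∎

 record Padded (F₀ : List V) (t : ℕ) (k : ℕ) (s : Bool) (L U : List V) : Set where
  field
   Bs : List (List V)
   L′ U′ : List V
   walk : Walk L Bs L′
   perm : concat Bs ++ U ↭ U′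
   left : avail χ true U′ ≡ t
   after : State F₀ 0 k s L′ U′

 parity-left : ∀ {F₀ u k s L U} a t → State F₀ u k s L U → s ≡ oddᵇ t → avail χ true U ≡ a + t →
  sumRest τ u (par L) ≡ oddᵇ a
 parity-left {U = U} a t st refl e = trans (State.total st) (trans (cong (_xor (par U xor oddᵇ t))
   (trans (cong oddᵇ (trans (sym (avail-cnt χ true (State.unique st))) (cong (_+ cnt χ true U) e)))
    (trans (odd-+ (a + t) _) (cong₂ _xor_ (odd-+ a t) (odd-cnt χ U)))))
   (truth-table 3 (λ a t U → ((a xor t) xor U) xor (U xor t)) (λ a t U → a) refl (oddᵇ a) (oddᵇ t) (par U)))

 both : ∀ t {F₀ u s L U} → State F₀ u (t + t) s L U → u * h + t + t ≡ avail χ true U + avail χ false U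
 both t {u = u} {U = U} st = +-cancelʳ-≡ (length U) _ _ (begin
  u * h + t + t + length U ≡⟨ arith (u * h) t (length U) ⟩
  length U + (t + t) + u * h ≡⟨ State.count-U st ⟩
  n ≡⟨ sym (avail-total χ) ⟩
  avail χ true [] + avail χ false [] ≡⟨ sym (cong₂ _+_ (avail-cnt χ true (State.unique st)) (avail-cnt χ false (State.unique st))) ⟩
  (avail χ true U + cnt χ true U) + (avail χ false U + cnt χ false U) ≡⟨ +-swap-middle (avail χ true U) _ _ _ ⟩
  avail χ true U + avail χ false U + (cnt χ true U + cnt χ false U) ≡⟨ cong (avail χ true U + avail χ false U +_) (cnt-total χ U) ⟩
  avail χ true U + avail χ false U + length U ∎)
  where
  open ≡-Reasoning
  arith : ∀ x t l → x + t + t + l ≡ l + (t + t) + x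
  arith = solve-∀

 pad : ∀ u a t {F₀ s L U} → 2 ≤ g → p + h ≤ t → s ≡ oddᵇ t → State F₀ u (t + t) s L U →
  avail χ true U ≡ a + t → u ≤ a → a ≤ u * g → Padded F₀ t (t + t) s L U
 pad zero a t g≥2 pt se st av lo≤ ≤hi = record
  { Bs = []; L′ = _; U′ = _; walk = stop; perm = ↭-refl; left = trans av (cong (_+ t) (n≤0⇒n≡0 ≤hi)); after = st }
 pad (suc u) a t {F₀} {s} {L} {U} g≥2 pt se st av lo≤ ≤hi = next (plan u refl)
  where
  open State st
  Plan : ℕ → Set
  Plan u = ∃ λ a₁ → ∃ λ a′ → a₁ ≤ suc g × oddᵇ a₁ ≡ par L xor τ × a ≡ a₁ + a′ × u ≤ a′ × a′ ≤ u * g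
  plan : ∀ v → v ≡ u → Plan v
  plan zero refl = a , 0 , ≤-trans ≤hi (≡-≤ (+-identityʳ g) (n≤1+n g)) ,
   trans (sym (parity-left a t st se av)) (xor-identityʳ _) , sym (+-identityʳ a) , z≤n , z≤n
  plan (suc v) refl = block-colours v a g (par L xor τ) g≥2 lo≤ ≤hi
  roomy : Roomy 0 U
  roomy true = ≤-trans pt (≤-≡ (m≤n+m t a) (sym av))
  roomy false = ≤-trans pt (+-cancelˡ-≤ (a + t) t _ (≤-≡ (≤-≡ (+-monoˡ-≤ t (+-monoˡ-≤ t (≤-trans ≤hi (*-monoʳ-≤ (suc u) (n≤1+n g)))))
    (both t st)) (cong (_+ avail χ false U) av)))
  next : Plan u → Padded F₀ t (t + t) s L U
  next (a₁ , a′ , a₁≤h , odd , eq , lo′ , hi′) = more (extend (colours a₁ (h ∸ a₁)) st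
    (trans (colours-length a₁ (h ∸ a₁)) (m+[n∸m]≡n a₁≤h)) (trans (colours-parity a₁ (h ∸ a₁)) odd) roomy)
   where
   more : (∃ λ X → map χ X ≡ colours a₁ (h ∸ a₁) × E (L ++ X) ≡ true × State F₀ u (t + t) s X (X ++ U)) → Padded F₀ t (t + t) s L U
   more (X , col , e , stX) = end (pad u a′ t g≥2 pt se stX av′ lo′ hi′)
    where
    av′ : avail χ true (X ++ U) ≡ a′ + t
    av′ = +-cancelʳ-≡ (cnt χ true (X ++ U)) _ _ (begin
     avail χ true (X ++ U) + cnt χ true (X ++ U) ≡⟨ avail-cnt χ true (State.unique stX) ⟩
     avail χ true [] ≡⟨ sym (avail-cnt χ true unique) ⟩
     avail χ true U + cnt χ true U ≡⟨ cong (_+ cnt χ true U) (trans av (cong (_+ t) eq)) ⟩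
     a₁ + a′ + t + cnt χ true U ≡⟨ arith a₁ a′ t _ ⟩
     a′ + t + (a₁ + cnt χ true U) ≡⟨ cong (λ z → a′ + t + (z + cnt χ true U)) (sym (cnt-colours χ X a₁ _ col)) ⟩
     a′ + t + (cnt χ true X + cnt χ true U) ≡⟨ cong (a′ + t +_) (sym (cnt-++ χ true X U)) ⟩
     a′ + t + cnt χ true (X ++ U) ∎)
     where
     open ≡-Reasoning
     arith : ∀ a b t c → a + b + t + c ≡ b + t + (a + c)
     arith = solve-∀
    end : Padded F₀ t (t + t) s X (X ++ U) → Padded F₀ t (t + t) s L U
    end P = record
     { Bs = X ∷ P.Bs; L′ = P.L′; U′ = P.U′; walk = step e (State.len-L stX) P.walk
     ; perm = ↭-trans (↭-trans (↭-reflexive (++-assoc X (concat P.Bs) U)) (shifts X (concat P.Bs))) P.perm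
     ; left = P.left; after = P.after }
     where module P = Padded P

module Assembly {B : Base} (Q : Params B) where

 open Phases Q public

 record Gadget (u : ℕ) : Set where
  field
   F₀ L : List V
   Bs : List (List V)
   walk : Walk F₀ Bs L
   state : State F₀ u 0 false L (F₀ ++ concat Bs)
   short : length (F₀ ++ concat Bs) ≤ 21 * h

 record Plan (ℓ u₀ : ℕ) : Set where
  field
   t w u : ℕ
   blocks : u₀ ≡ t * 3 + (t * 3 + (w * 3 + u))
   early : ℓ + (t * 3 + (t * 3 + w * 3)) * h + (h + h) ≤ N
   classes : ∀ c → t + u₀ + (ℓ + (t * 3 + (t * 3 + w * 3)) * h) ≤ avail χ c []
   pools : p + h ≤ t
   matching : 4 * n ≤ q * t
   covering : 8 * n ≤ q * w
   2≤g : 2 ≤ g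

 avail-++ : ∀ c U → avail χ c [] ≤ avail χ c U + length U
 avail-++ c [] = ≤-reflexive (sym (+-identityʳ _))
 avail-++ c (x ∷ U) = ≤-trans (avail-++ c U) (≤-≡ (+-monoˡ-≤ (length U) (avail-≤ χ c x U)) (sym (+-suc _ (length U))))

 module Start {u₀ : ℕ} (G : Gadget u₀) (P : Plan (length (Gadget.F₀ G ++ concat (Gadget.Bs G))) u₀) where

  open Gadget G public
  open Plan P public

  U₀ : List V
  U₀ = F₀ ++ concat Bs

  u₁ u₂ D : ℕ
  u₁ = t * 3 + (w * 3 + u)
  u₂ = w * 3 + u
  D = length U₀ + (t * 3 + (t * 3 + w * 3)) * h

  start : State F₀ (t * 3 + u₁) 0 false L U₀
  start = subst (λ u → State F₀ u 0 false L U₀) blocks state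

  roomy₀ : Roomy (t * (3 * h) + t * (3 * h)) U₀
  roomy₀ c = +-cancelʳ-≤ (length U₀) _ _ (≤-trans (≤-trans (+-monoˡ-≤ (length U₀) (+-monoʳ-≤ (t * (3 * h) + t * (3 * h)) pools))
   (≤-≡ (m≤m+n _ (w * 3 * h + u₀)) (arith t (length U₀) w h u₀))) (≤-trans (classes c) (avail-++ c U₀)))
   where
   arith : ∀ t l w h u → t * (3 * h) + t * (3 * h) + t + l + (w * 3 * h + u) ≡ t + u + (l + (t * 3 + (t * 3 + w * 3)) * h)
   arith = solve-∀

  first : Slots t F₀ u₁ 0 false true L U₀
  first = slots t true start (λ c → ≤-trans (+-monoˡ-≤ (p + h) (m≤m+n (t * (3 * h)) (t * (3 * h)))) (roomy₀ c))

 module Second {u₀ : ℕ} (G : Gadget u₀) (P : Plan (length (Gadget.F₀ G ++ concat (Gadget.Bs G))) u₀)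
  (S₁ : Slots (Plan.t P) (Gadget.F₀ G) (Start.u₁ G P) 0 false true (Gadget.L G) (Start.U₀ G P)) where

  open Start G P public
  module S₁ = Slots S₁

  after₁ : State F₀ u₁ (t + 0) (slotParity t true false) S₁.L′ S₁.U′
  after₁ = S₁.after

  length-U₁ : length S₁.U′ ≤ length U₀ + t * (3 * h)
  length-U₁ = shorter (State.count-U start) (State.count-U after₁)
   where
   shorter : length U₀ + 0 + (t * 3 + u₁) * h ≡ n → length S₁.U′ + (t + 0) + u₁ * h ≡ n → length S₁.U′ ≤ length U₀ + t * (3 * h)
   shorter e₁ e₂ = +-cancelʳ-≤ (t + 0 + u₁ * h) _ _ (≡-≤ (trans (sym (+-assoc (length S₁.U′) (t + 0) (u₁ * h)))
    (trans e₂ (sym e₁))) (≤-≡ (m≤m+n _ t) (arith (length U₀) t u₁ h)))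
    where
    arith : ∀ l t v h → l + 0 + (t * 3 + v) * h + t ≡ l + t * (3 * h) + (t + 0 + v * h)
    arith = solve-∀

  roomy₁ : Roomy (t * (3 * h)) S₁.U′
  roomy₁ c = +-cancelʳ-≤ (length U₀ + t * (3 * h)) _ _ (≤-trans (≡-≤ (arith (t * (3 * h)) (p + h) (length U₀))
   (≤-trans (+-monoˡ-≤ (length U₀) (+-monoʳ-≤ (t * (3 * h) + t * (3 * h)) pools)) (≤-≡ (m≤m+n _ (w * 3 * h + u₀)) (arith′ t (length U₀) w h u₀))))
   (≤-trans (classes c) (≤-trans (avail-++ c S₁.U′) (+-monoʳ-≤ _ length-U₁))))
   where
   arith : ∀ x y l → x + y + (l + x) ≡ x + x + y + l
   arith = solve-∀
   arith′ : ∀ t l w h u → t * (3 * h) + t * (3 * h) + t + l + (w * 3 * h + u) ≡ t + u + (l + (t * 3 + (t * 3 + w * 3)) * h)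
   arith′ = solve-∀

  second : Slots t F₀ u₂ (t + 0) (slotParity t true false) false S₁.L′ S₁.U′
  second = slots t false after₁ roomy₁

 module Third {u₀ : ℕ} (G : Gadget u₀) (P : Plan (length (Gadget.F₀ G ++ concat (Gadget.Bs G))) u₀)
  (S₁ : Slots (Plan.t P) (Gadget.F₀ G) (Start.u₁ G P) 0 false true (Gadget.L G) (Start.U₀ G P))
  (S₂ : Slots (Plan.t P) (Gadget.F₀ G) (Start.u₂ G P) (Plan.t P + 0) (slotParity (Plan.t P) true false) false (Slots.L′ S₁) (Slots.U′ S₁)) where

  open Second G P S₁ public
  module S₂ = Slots S₂

  s₂ : Bool
  s₂ = slotParity t false (slotParity t true false)

  s₂≡ : s₂ ≡ oddᵇ t
  s₂≡ = trans (slotParity-false t _) (slotParity-true t false)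

  after₂ : State F₀ u₂ (t + t) s₂ S₂.L′ S₂.U′
  after₂ = subst (λ k → State F₀ u₂ k s₂ S₂.L′ S₂.U′) (cong (t +_) (+-identityʳ t)) S₂.after

  heavyMisfit : List Slot → V → Bool
  heavyMisfit us v = t ≤ᵇ 2 * count (λ sl → not (fits v sl)) us

  misfit-total : ∀ us → All Few us → q * ∑ (λ v → count (λ sl → not (fits v sl)) us) ≤ length us * (2 * n)
  misfit-total us few-us = ≡-≤ (cong (q *_) (count-∑ (λ v sl → not (fits v sl)) us)) (go us few-us)
   where
   go : ∀ us → All Few us → q * sum (map (λ sl → size (λ v → not (fits v sl))) us) ≤ length us * (2 * n)
   go [] [] = ≤-reflexive (*-zeroʳ q)
   go (sl ∷ us) (f ∷ fs) = ≡-≤ (*-distribˡ-+ q (size (λ v → not (fits v sl))) _) (+-mono-≤ f (go us fs))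

  t>0 : 0 < t
  t>0 = ≤-trans p>0 (≤-trans (m≤m+n p h) pools)

  heavy-few : ∀ us → length us ≡ t → All Few us → q * size (heavyMisfit us) ≤ 4 * n
  heavy-few us len fs = *-cancelˡ-≤ t {{>-nonZero t>0}} (begin
   t * (q * size hm) ≡⟨ *-swap t q (size hm) ⟩
   q * (t * size hm) ≡⟨ cong (q *_) (sym (∑-select t hm)) ⟩
   q * ∑ (λ v → t * bit (hm v)) ≤⟨ *-monoʳ-≤ q (∑-mono pointwise) ⟩
   q * ∑ (λ v → 2 * mis v) ≡⟨ cong (q *_) (∑-* 2 mis) ⟩
   q * (2 * ∑ mis) ≡⟨ *-swap q 2 (∑ mis) ⟩
   2 * (q * ∑ mis) ≤⟨ *-monoʳ-≤ 2 (≤-≡ (misfit-total us fs) (cong (_* (2 * n)) len)) ⟩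
   2 * (t * (2 * n)) ≡⟨ arith t n ⟩
   t * (4 * n) ∎)
   where
   open ≤-Reasoning
   hm : V → Bool
   hm = heavyMisfit us
   mis : V → ℕ
   mis v = count (λ sl → not (fits v sl)) us
   arith : ∀ t n → 2 * (t * (2 * n)) ≡ t * (4 * n)
   arith = solve-∀
   pointwise : ∀ v → t * bit (hm v) ≤ 2 * mis v
   pointwise v with hm v in e
   ... | true = ≡-≤ (*-identityʳ t) (≤ᵇ-true e)
   ... | false = ≡-≤ (*-zeroʳ t) z≤n

  ws : List V
  ws = members (heavyMisfit S₁.us) ++ members (heavyMisfit S₂.us)

  ws-length : length ws ≤ w
  ws-length = *-cancelˡ-≤ q {{>-nonZero q>0}} (≡-≤ (trans (cong (q *_) (++-length (members (heavyMisfit S₁.us))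
   (members-length _) (members-length _))) (*-distribˡ-+ q _ _)) (≤-trans (+-mono-≤ (heavy-few S₁.us S₁.len S₁.few-misfits) (heavy-few S₂.us S₂.len S₂.few-misfits))
    (≡-≤ (arith n) covering)))
   where
   arith : ∀ n → 4 * n + 4 * n ≡ 8 * n
   arith = solve-∀

  D+uh : D + u * h ≡ n
  D+uh = trans (arith (length U₀) t w u h) (State.count-U start)
   where
   arith : ∀ l t w u h → l + (t * 3 + (t * 3 + w * 3)) * h + u * h ≡ l + 0 + (t * 3 + (t * 3 + (w * 3 + u))) * h
   arith = solve-∀

  covered : Covered ws F₀ u u₂ (t + t) s₂ S₂.L′ S₂.U′
  covered = coverAll ws (+-monoˡ-≤ u (*-monoˡ-≤ 3 ws-length)) (≡-≤ (trans (cong (_+ (h + h)) (sym D+uh)) (arith D (u * h) (h + h))) (+-monoˡ-≤ (u * h) early)) after₂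
   where
   arith : ∀ a b c → a + b + c ≡ a + c + b
   arith = solve-∀

  module Fourth (C : Covered ws F₀ u u₂ (t + t) s₂ S₂.L′ S₂.U′) where

   module C = Covered C

   u′≤u₀ : C.u′ ≤ u₀
   u′≤u₀ = ≤-trans C.u′≤v (≤-≡ (≤-trans (m≤n+m u₂ (t * 3)) (m≤n+m (t * 3 + u₂) (t * 3))) (sym blocks))

   length-U₃ : length C.U′ ≤ D
   length-U₃ = +-cancelʳ-≤ (u * h) _ D (≤-≡ (+-mono-≤ (m≤m+n (length C.U′) (t + t)) (*-monoˡ-≤ h C.u≤u′))
    (trans (State.count-U C.after) (sym D+uh)))

   enough : ∀ c → t + C.u′ ≤ avail χ c C.U′
   enough c = +-cancelʳ-≤ D _ _ (≤-trans (≤-trans (+-monoˡ-≤ D (+-monoʳ-≤ t u′≤u₀)) (classes c))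
    (≤-trans (avail-++ c C.U′) (+-monoʳ-≤ _ length-U₃)))

   padded : Padded F₀ t (t + t) s₂ C.L′ C.U′
   padded = from (m≤n⇒∃[o]m+o≡n (enough true))
    where
    arith : ∀ t u o → t + u + o ≡ u + o + t
    arith = solve-∀
    arith′ : ∀ t u o → u + o + (t + (t + u)) ≡ t + u + o + (t + u)
    arith′ = solve-∀
    arith″ : ∀ u g t → u * suc g + t + t ≡ u * g + (t + (t + u))
    arith″ = solve-∀
    from : (∃ λ o → t + C.u′ + o ≡ avail χ true C.U′) → Padded F₀ t (t + t) s₂ C.L′ C.U′
    from (o , eq) = pad C.u′ (C.u′ + o) t 2≤g pools s₂≡ C.after (trans (sym eq) (arith t C.u′ o)) (m≤m+n C.u′ o)
     (+-cancelʳ-≤ (t + (t + C.u′)) (C.u′ + o) (C.u′ * g) upper)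
     where
     open ≤-Reasoning
     upper : C.u′ + o + (t + (t + C.u′)) ≤ C.u′ * g + (t + (t + C.u′))
     upper = begin
      C.u′ + o + (t + (t + C.u′)) ≡⟨ arith′ t C.u′ o ⟩
      t + C.u′ + o + (t + C.u′) ≤⟨ +-mono-≤ (≤-reflexive eq) (enough false) ⟩
      avail χ true C.U′ + avail χ false C.U′ ≡⟨ sym (both t C.after) ⟩
      C.u′ * h + t + t ≡⟨ arith″ C.u′ g t ⟩
      C.u′ * g + (t + (t + C.u′)) ∎

   module Fifth (P : Padded F₀ t (t + t) s₂ C.L′ C.U′) where

    module P = Padded P

    vacant : Bool → V → Bool
    vacant c v = (χ v ≐ c) ∧ not (mem v P.U′)

    vs : Bool → List V
    vs c = members (vacant c)

    vs-length : ∀ c → length (vs c) ≡ t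
    vs-length true = trans (members-length (vacant true)) P.left
    vs-length false = trans (members-length (vacant false)) (sym (+-cancelˡ-≡ t t _ (trans (both t P.after) (cong (_+ avail χ false P.U′) P.left))))

    vs-colour : ∀ c {v} → v ∈ vs c → χ v ≡ c
    vs-colour c {v} m = ≐-true (∧-left {χ v ≐ c} (members-elim (vacant c) m))

    vs-vacant : ∀ c {v} → v ∈ vs c → v ∉ P.U′
    vs-vacant c {v} m = mem-∉ P.U′ (not-true (∧-right {χ v ≐ c} (members-elim (vacant c) m)))

    vs-light : ∀ c {v} → v ∈ vs c → v ∉ ws
    vs-light c m m′ = vs-vacant c m (∈-resp-↭ P.perm (∈-++⁺ʳ (concat P.Bs) (C.covers m′)))

    matched : ∀ c us → length us ≡ t → All Few us → (∀ {v} → v ∈ vs c → heavyMisfit us v ≡ false) →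
     ∃ λ vs′ → vs′ ↭ vs c × Fits vs′ us
    matched c us len fs lightly = Arr.arranged (vs c) us (trans (vs-length c) (sym len)) λ {v} {sl} mv ms →
     *-cancelˡ-< 2 _ _ (≤-trans (s≤s (≡-≤ (*-distribˡ-+ 2 (count (λ b → not (fits v b)) us) _) (+-monoʳ-≤ _ (column sl (All.lookup fs ms)))))
      (≤-≡ (+-monoˡ-≤ t (≤ᵇ-false (lightly mv))) (trans (cong (t +_) (sym (+-identityʳ t))) (cong (2 *_) (sym len)))))
     where
     column : ∀ sl → Few sl → 2 * count (λ v → not (fits v sl)) (vs c) ≤ t
     column sl f = *-cancelˡ-≤ q {{>-nonZero q>0}} (≤-trans (≤-trans (*-monoʳ-≤ q (*-monoʳ-≤ 2 (count-unique (λ v → not (fits v sl)) (members-unique (vacant c)))))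
      (≡-≤ (*-swap q 2 _) (≤-≡ (*-monoʳ-≤ 2 f) (sym (*-assoc 2 2 n))))) matching)

    matched₁ : ∃ λ vs′ → vs′ ↭ vs true × Fits vs′ S₁.us
    matched₁ = matched true S₁.us S₁.len S₁.few-misfits λ {v} m → ¬true λ e →
     vs-light true m (∈-++⁺ˡ (∈-members (heavyMisfit S₁.us) e))

    matched₂ : ∃ λ vs′ → vs′ ↭ vs false × Fits vs′ S₂.us
    matched₂ = matched false S₂.us S₂.len S₂.few-misfits λ {v} m → ¬true λ e →
     vs-light false m (∈-++⁺ʳ (members (heavyMisfit S₁.us)) (∈-members (heavyMisfit S₂.us) e))

    hamBlocks : HamBlocks B
    hamBlocks = build matched₁ matched₂
     where
     build : (∃ λ vs′ → vs′ ↭ vs true × Fits vs′ S₁.us) → (∃ λ vs′ → vs′ ↭ vs false × Fits vs′ S₂.us) → HamBlocks B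
     build (v₁ , p₁ , f₁) (v₂ , p₂ , f₂) = record
      { F₀ = F₀; L = P.L′; Bs = Bs ++ (X₁ ++ (X₂ ++ (C.Bs ++ P.Bs)))
      ; len-F₀ = State.len-F₀ state
      ; walk = walk-++ walk (walk-++ (S₁.walk v₁ (λ m → vs-colour true (∈-resp-↭ p₁ m)) f₁)
        (walk-++ (S₂.walk v₂ (λ m → vs-colour false (∈-resp-↭ p₂ m)) f₂) (walk-++ C.walk P.walk)))
      ; close = trans (E-↭ (++-comm P.L′ F₀)) (right-edge (trans (par-++ F₀ P.L′)
        (trans (cong (par F₀ xor_) (State.closing P.after)) (xor-cancel (par F₀) τ))) (State.joint P.after))
      ; unique = Unique-↭ (↭-sym all-perm) all-unique
      ; full = trans (↭-length all-perm) (trans (length-++ v₁) (trans (cong₂ _+_ (trans (↭-length p₁) (vs-length true))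
        (trans (length-++ v₂) (cong (_+ length P.U′) (trans (↭-length p₂) (vs-length false))))) (trans (arith t (length P.U′)) (State.count-U P.after)))) }
      where
      arith : ∀ t l → t + (t + l) ≡ l + (t + t) + 0
      arith = solve-∀
      X₁ X₂ : List (List V)
      X₁ = fill v₁ S₁.us
      X₂ = fill v₂ S₂.us
      all-unique : Unique (v₁ ++ (v₂ ++ P.U′))
      all-unique = unique-++ (Unique-↭ (↭-sym p₁) (members-unique (vacant true)))
       (unique-++ (Unique-↭ (↭-sym p₂) (members-unique (vacant false))) (State.unique P.after) (λ m → vs-vacant false (∈-resp-↭ p₂ m))) apart
       where
       apart : ∀ {x} → x ∈ v₁ → x ∉ v₂ ++ P.U′
       apart m m′ with ∈-++⁻ v₂ m′
       ... | inj₁ i = contradiction (trans (sym (vs-colour true (∈-resp-↭ p₁ m))) (vs-colour false (∈-resp-↭ p₂ i))) λ ()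
       ... | inj₂ i = vs-vacant true (∈-resp-↭ p₁ m) i
      open PermutationReasoning
      reverse-order : ∀ (U x₁ x₂ y z : List V) → U ++ (x₁ ++ (x₂ ++ (y ++ z))) ↭ z ++ (y ++ (x₂ ++ (x₁ ++ U)))
      reverse-order U x₁ x₂ y z = begin
       U ++ (x₁ ++ (x₂ ++ (y ++ z))) ↭⟨ ++-comm U _ ⟩
       (x₁ ++ (x₂ ++ (y ++ z))) ++ U ≡⟨ ++-assoc x₁ _ U ⟩
       x₁ ++ ((x₂ ++ (y ++ z)) ++ U) ≡⟨ cong (x₁ ++_) (trans (++-assoc x₂ _ U) (cong (x₂ ++_) (++-assoc y z U))) ⟩
       x₁ ++ (x₂ ++ (y ++ (z ++ U))) ↭⟨ ++⁺ˡ x₁ (++⁺ˡ x₂ (shifts y z)) ⟩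
       x₁ ++ (x₂ ++ (z ++ (y ++ U))) ↭⟨ ++⁺ˡ x₁ (shifts x₂ z) ⟩
       x₁ ++ (z ++ (x₂ ++ (y ++ U))) ↭⟨ shifts x₁ z ⟩
       z ++ (x₁ ++ (x₂ ++ (y ++ U))) ↭⟨ ++⁺ˡ z (++⁺ˡ x₁ (shifts x₂ y)) ⟩
       z ++ (x₁ ++ (y ++ (x₂ ++ U))) ↭⟨ ++⁺ˡ z (shifts x₁ y) ⟩
       z ++ (y ++ (x₁ ++ (x₂ ++ U))) ↭⟨ ++⁺ˡ z (++⁺ˡ y (shifts x₁ x₂)) ⟩
       z ++ (y ++ (x₂ ++ (x₁ ++ U))) ∎
      all-perm : F₀ ++ concat (Bs ++ (X₁ ++ (X₂ ++ (C.Bs ++ P.Bs)))) ↭ v₁ ++ (v₂ ++ P.U′)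
      all-perm = begin
       F₀ ++ concat (Bs ++ (X₁ ++ (X₂ ++ (C.Bs ++ P.Bs))))
        ≡⟨ cong (F₀ ++_) (sym (concat-++ Bs _)) ⟩
       F₀ ++ (concat Bs ++ concat (X₁ ++ (X₂ ++ (C.Bs ++ P.Bs))))
        ≡⟨ sym (++-assoc F₀ (concat Bs) _) ⟩
       U₀ ++ concat (X₁ ++ (X₂ ++ (C.Bs ++ P.Bs)))
        ≡⟨ cong (U₀ ++_) (trans (sym (concat-++ X₁ _)) (cong (concat X₁ ++_) (trans (sym (concat-++ X₂ _)) (cong (concat X₂ ++_) (sym (concat-++ C.Bs P.Bs)))))) ⟩
       U₀ ++ (concat X₁ ++ (concat X₂ ++ (concat C.Bs ++ concat P.Bs)))
        ↭⟨ reverse-order U₀ (concat X₁) (concat X₂) (concat C.Bs) (concat P.Bs) ⟩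
       concat P.Bs ++ (concat C.Bs ++ (concat X₂ ++ (concat X₁ ++ U₀)))
        ↭⟨ ++⁺ˡ (concat P.Bs) (++⁺ˡ (concat C.Bs) (++⁺ˡ (concat X₂) (S₁.perm v₁ (trans (↭-length p₁) (vs-length true))))) ⟩
       concat P.Bs ++ (concat C.Bs ++ (concat X₂ ++ (v₁ ++ S₁.U′)))
        ↭⟨ ++⁺ˡ (concat P.Bs) (++⁺ˡ (concat C.Bs) (shifts (concat X₂) v₁)) ⟩
       concat P.Bs ++ (concat C.Bs ++ (v₁ ++ (concat X₂ ++ S₁.U′)))
        ↭⟨ ++⁺ˡ (concat P.Bs) (++⁺ˡ (concat C.Bs) (++⁺ˡ v₁ (S₂.perm v₂ (trans (↭-length p₂) (vs-length false))))) ⟩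
       concat P.Bs ++ (concat C.Bs ++ (v₁ ++ (v₂ ++ S₂.U′)))
        ↭⟨ ++⁺ˡ (concat P.Bs) (shifts (concat C.Bs) v₁) ⟩
       concat P.Bs ++ (v₁ ++ (concat C.Bs ++ (v₂ ++ S₂.U′)))
        ↭⟨ shifts (concat P.Bs) v₁ ⟩
       v₁ ++ (concat P.Bs ++ (concat C.Bs ++ (v₂ ++ S₂.U′)))
        ↭⟨ ++⁺ˡ v₁ (++⁺ˡ (concat P.Bs) (shifts (concat C.Bs) v₂)) ⟩
       v₁ ++ (concat P.Bs ++ (v₂ ++ (concat C.Bs ++ S₂.U′)))
        ↭⟨ ++⁺ˡ v₁ (shifts (concat P.Bs) v₂) ⟩
       v₁ ++ (v₂ ++ (concat P.Bs ++ (concat C.Bs ++ S₂.U′)))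
        ↭⟨ ++⁺ˡ v₁ (++⁺ˡ v₂ (++⁺ˡ (concat P.Bs) C.perm)) ⟩
       v₁ ++ (v₂ ++ (concat P.Bs ++ C.U′))
        ↭⟨ ++⁺ˡ v₁ (++⁺ˡ v₂ P.perm) ⟩
       v₁ ++ (v₂ ++ P.U′) ∎

 assemble : ∀ {u₀} (G : Gadget u₀) → Plan (length (Gadget.F₀ G ++ concat (Gadget.Bs G))) u₀ → HamBlocks B
 assemble G P = third (Start.first G P)
  where
  third : Slots (Plan.t P) (Gadget.F₀ G) (Start.u₁ G P) 0 false true (Gadget.L G) (Start.U₀ G P) → HamBlocks B
  third S₁ = fourth (Second.second G P S₁)
   where
   fourth : Slots (Plan.t P) (Gadget.F₀ G) (Start.u₂ G P) (Plan.t P + 0) (slotParity (Plan.t P) true false) false (Slots.L′ S₁) (Slots.U′ S₁) → HamBlocks B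
   fourth S₂ = Third.Fourth.Fifth.hamBlocks G P S₁ S₂ (Third.covered G P S₁ S₂) (Third.Fourth.padded G P S₁ S₂ (Third.covered G P S₁ S₂))

-- From walks to Hamilton cycles

setOf : ∀ {n} → List (Fin n) → Subset n
setOf = foldr (λ v X → ⁅ v ⁆ ∪ X) ∅

setOf-↭ : ∀ {n} {xs ys : List (Fin n)} → xs ↭ ys → setOf xs ≡ setOf ys
setOf-↭ _↭_.refl = refl
setOf-↭ (_↭_.prep x e) = cong (⁅ x ⁆ ∪_) (setOf-↭ e)
setOf-↭ (_↭_.swap {xs} {ys} x y e) = trans (sym (∪-assoc ⁅ x ⁆ ⁅ y ⁆ (setOf xs)))
 (trans (cong₂ _∪_ (∪-comm ⁅ x ⁆ ⁅ y ⁆) (setOf-↭ e)) (∪-assoc ⁅ y ⁆ ⁅ x ⁆ (setOf ys)))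
setOf-↭ (_↭_.trans e e′) = trans (setOf-↭ e) (setOf-↭ e′)

at : {A : Set} → A → List A → ℕ → A
at d [] j = d
at d (x ∷ xs) zero = x
at d (x ∷ xs) (suc j) = at d xs j

at-drop : {A : Set} (d : A) (xs : List A) (s j : ℕ) → at d (drop s xs) j ≡ at d xs (s + j)
at-drop d xs zero j = refl
at-drop d [] (suc s) j = refl
at-drop d (x ∷ xs) (suc s) j = at-drop d xs s j

at-++ˡ : {A : Set} (d : A) (xs ys : List A) {j : ℕ} → j < length xs → at d (xs ++ ys) j ≡ at d xs j
at-++ˡ d (x ∷ xs) ys {zero} lt = refl
at-++ˡ d (x ∷ xs) ys {suc j} (s≤s lt) = at-++ˡ d xs ys lt

at-++ʳ : {A : Set} (d : A) (xs ys : List A) (j : ℕ) → at d (xs ++ ys) (length xs + j) ≡ at d ys j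
at-++ʳ d [] ys j = refl
at-++ʳ d (x ∷ xs) ys j = at-++ʳ d xs ys j

at-∈ : {A : Set} (d : A) (xs : List A) {j : ℕ} → j < length xs → at d xs j ∈ xs
at-∈ d (x ∷ xs) {zero} lt = here refl
at-∈ d (x ∷ xs) {suc j} (s≤s lt) = there (at-∈ d xs lt)

at-injective : {A : Set} (d : A) {xs : List A} → Unique xs → ∀ {i j} → i < length xs → j < length xs →
 at d xs i ≡ at d xs j → i ≡ j
at-injective d (p ∷ u) {zero} {zero} _ _ e = refl
at-injective d {x ∷ xs} (p ∷ u) {zero} {suc j} _ (s≤s lt) e = contradiction (subst (_∈ xs) (sym e) (at-∈ d xs lt)) (All-∉ p)
at-injective d {x ∷ xs} (p ∷ u) {suc i} {zero} (s≤s lt) _ e = contradiction (subst (_∈ xs) e (at-∈ d xs lt)) (All-∉ p)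
at-injective d (p ∷ u) {suc i} {suc j} (s≤s l) (s≤s l′) e = cong suc (at-injective d u l l′ e)

∈-at : {A : Set} (d : A) {xs : List A} {v : A} → v ∈ xs → ∃ λ j → j < length xs × at d xs j ≡ v
∈-at d (here refl) = 0 , s≤s z≤n , refl
∈-at d (there m) with ∈-at d m
... | j , lt , e = suc j , s≤s lt , e

take-at : {A : Set} (d : A) (xs : List A) (k : ℕ) → k ≤ length xs → applyUpTo (at d xs) k ≡ take k xs
take-at d xs zero le = refl
take-at d (x ∷ xs) (suc k) (s≤s le) = cong (x ∷_) (take-at d xs k le)

applyUpTo-cong : {A : Set} (f g : ℕ → A) (k : ℕ) → (∀ j → j < k → f j ≡ g j) → applyUpTo f k ≡ applyUpTo g k
applyUpTo-cong f g zero e = refl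
applyUpTo-cong f g (suc k) e = cong₂ _∷_ (e 0 (s≤s z≤n)) (applyUpTo-cong (λ j → f (suc j)) (λ j → g (suc j)) k (λ j lt → e (suc j) (s≤s lt)))

drop-length : {A : Set} (s : ℕ) (xs : List A) {k : ℕ} → s + k ≤ length xs → k ≤ length (drop s xs)
drop-length zero xs le = le
drop-length (suc s) (x ∷ xs) (s≤s le) = drop-length s xs le

unique-length : ∀ {n} {xs : List (Fin n)} → Unique xs → length xs ≤ n
unique-length {n} {xs} u = ≡-≤ (sym (cnt-total (λ _ → true) xs))
 (≤-≡ (+-mono-≤ (part true) (part false)) (avail-total {n} (λ _ → true)))
 where
 part : ∀ c → cnt (λ _ → true) c xs ≤ avail (λ _ → true) c []
 part c = ≤-≡ (m≤n+m _ _) (avail-cnt (λ _ → true) c u)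

unique-full : ∀ {n} {xs : List (Fin n)} → Unique xs → length xs ≡ n → ∀ v → v ∈ xs
unique-full {n} {xs} u len v with mem v xs in e
... | true = mem-∈ xs e
... | false = contradiction (unique-length (∉-All (mem-∉ xs e) ∷ u)) (<⇒≱ (s≤s (≤-reflexive (sym len))))

foldr-map : {A B C : Set} (f : B → C → C) (c : C) (g : A → B) (xs : List A) → foldr (λ x → f (g x)) c xs ≡ foldr f c (map g xs)
foldr-map f c g [] = refl
foldr-map f c g (x ∷ xs) = cong (f (g x)) (foldr-map f c g xs)

module _ {m : ℕ} (xs : List (Fin (suc m))) (u : Unique xs) (len : length xs ≡ suc m) where

 ordering : Permutation′ (suc m)
 ordering = permutation π π⁻¹ π-π⁻¹ π⁻¹-π
  where
  π π⁻¹ : Fin (suc m) → Fin (suc m)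
  π i = at zero xs (toℕ i)
  π⁻¹ v = fromℕ< (subst (proj₁ (∈-at zero (unique-full u len v)) <_) len (proj₁ (proj₂ (∈-at zero (unique-full u len v)))))
  π-π⁻¹ : ∀ v → π (π⁻¹ v) ≡ v
  π-π⁻¹ v = trans (cong (at zero xs) (toℕ-fromℕ< _)) (proj₂ (proj₂ (∈-at zero (unique-full u len v))))
  bound : ∀ (i : Fin (suc m)) → toℕ i < length xs
  bound i = subst (toℕ i <_) (sym len) (toℕ<n i)
  π⁻¹-π : ∀ i → π⁻¹ (π i) ≡ i
  π⁻¹-π i = toℕ-injective (at-injective zero u (bound _) (bound i) (π-π⁻¹ (π i)))

 window : ∀ s k → s < suc m → k ≤ suc m → segment ordering s k ≡ setOf (take k (drop s (xs ++ xs)))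
 window s k s< k≤ = trans (foldr-map (λ v X → ⁅ v ⁆ ∪ X) ∅ position (upTo k)) (cong setOf
   (trans (map-upTo position k) (trans (applyUpTo-cong position (at zero (drop s (xs ++ xs))) k same)
    (take-at zero (drop s (xs ++ xs)) k (drop-length s (xs ++ xs) (≤-≡ (+-mono-≤ (<⇒≤ s<) k≤)
     (sym (++-length xs len len))))))))
  where
  position : ℕ → Fin (suc m)
  position j = at zero xs (toℕ ((s + j) mod (suc m)))
  mod-at : ∀ p → p < suc m + suc m → at zero xs (toℕ (p mod (suc m))) ≡ at zero (xs ++ xs) p
  mod-at p lt with p <? suc m
  ... | yes small = trans (cong (at zero xs) (trans (toℕ-fromℕ< (m%n<n p (suc m))) (m<n⇒m%n≡m small)))
     (sym (at-++ˡ zero xs xs (subst (p <_) (sym len) small)))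
  ... | no large with m≤n⇒∃[o]m+o≡n (≮⇒≥ large)
  ... | o , refl = trans (cong (at zero xs) (trans (toℕ-fromℕ< (m%n<n (suc m + o) (suc m))) (trans (cong (_% suc m) (+-comm (suc m) o))
      (trans ([m+n]%n≡m%n o (suc m)) (m<n⇒m%n≡m (+-cancelˡ-< (suc m) o (suc m) lt))))))
      (sym (trans (cong (λ l → at zero (xs ++ xs) (l + o)) (sym len)) (at-++ʳ zero xs xs o)))
  same : ∀ j → j < k → position j ≡ at zero (drop s (xs ++ xs)) j
  same j j<k = trans (mod-at (s + j) (+-mono-< s< (<-≤-trans j<k k≤))) (sym (at-drop zero (xs ++ xs) s j))

 ham-cycle : ∀ (H : KGraph (suc m)) h → h + h ≤ suc m → h ∣ suc m →
  (∀ i → i * h < suc m → H (setOf (take (h + h) (drop (i * h) (xs ++ xs)))) ≡ true) → HamCycle (h + h) h H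
 ham-cycle H h le div edges rewrite m+n∸n≡m h h = div , ordering , λ i lt →
  trans (cong H (window (i * h) (h + h) lt le)) (edges i lt)

module _ (B : Base) where

 open Blocks B

 walk-window : ∀ {X Ds Y} → Walk X Ds Y → length X ≡ h → ∀ i → i < length Ds →
  E (take (h + h) (drop (i * h) (X ++ concat Ds))) ≡ true
 walk-window {X} (step {Z = Z} {Bs = Ds} e lenZ w) lenX zero lt = trans (cong E (trans (cong (take (h + h)) (sym (++-assoc X Z (concat Ds))))
   (take-all {h + h} (X ++ Z) (concat Ds) (++-length X lenX lenZ)))) e
  where
  take-all : ∀ {l} (xs ys : List V) → length xs ≡ l → take l (xs ++ ys) ≡ xs
  take-all {zero} [] ys e = refl
  take-all {suc l} (x ∷ xs) ys e = cong (x ∷_) (take-all {l} xs ys (suc-injective e))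
 walk-window {X} (step {Z = Z} {Bs = Ds} e lenZ w) lenX (suc i) (s≤s lt) =
  trans (cong (λ ys → E (take (h + h) ys)) (drop-block (i * h) X (Z ++ concat Ds) lenX)) (walk-window w lenZ i lt)
  where
  drop-block : ∀ {l} r (xs ys : List V) → length xs ≡ l → drop (l + r) (xs ++ ys) ≡ drop r ys
  drop-block {zero} r [] ys e = refl
  drop-block {suc l} r (x ∷ xs) ys e = drop-block {l} r xs ys (suc-injective e)

 walk-length : ∀ {X Ds Y} → Walk X Ds Y → length (concat Ds) ≡ length Ds * h
 walk-length stop = refl
 walk-length (step {Z = Z} e l w) = ++-length Z l (walk-length w)

 cyclic-windows : (Hm : HamBlocks B) → let xs = HamBlocks.F₀ Hm ++ concat (HamBlocks.Bs Hm) in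
  ∀ i → i * h < n → E (take (h + h) (drop (i * h) (xs ++ xs))) ≡ true
 cyclic-windows Hm i lt = trans (cong (λ ys → E (take (h + h) (drop (i * h) ys))) around)
   (walk-window (walk-++ walk (step close len-F₀ walk)) len-F₀ i (≤-trans i< (≡-≤ (+-comm 1 (length Bs)) (≤-≡ (+-monoʳ-≤ (length Bs) (s≤s z≤n))
    (sym (length-++ Bs))))))
  where
  open HamBlocks Hm
  around : (F₀ ++ concat Bs) ++ (F₀ ++ concat Bs) ≡ F₀ ++ concat (Bs ++ F₀ ∷ Bs)
  around = trans (++-assoc F₀ (concat Bs) _) (cong (F₀ ++_) (concat-++ Bs (F₀ ∷ Bs)))
  i< : i < suc (length Bs)
  i< = *-cancelʳ-< h i (suc (length Bs)) (<-≤-trans lt (≤-reflexive (trans (sym full) (++-length F₀ len-F₀ (walk-length walk)))))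

-- Segments around wrong edges

endPar-+ : ∀ τ a u b → endPar τ (a + u) b ≡ endPar τ u (endPar τ a b)
endPar-+ τ zero u b = refl
endPar-+ τ (suc a) u b = endPar-+ τ a u (b xor τ)

sumRest-+ : ∀ τ a u b → sumRest τ (a + u) b ≡ sumRest τ a b xor sumRest τ u (endPar τ a b)
sumRest-+ τ zero u b = refl
sumRest-+ τ (suc a) u b = trans (cong ((b xor τ) xor_) (sumRest-+ τ a u (b xor τ))) (sym (xor-assoc (b xor τ) _ _))

sumRest-not : ∀ u b → sumRest true u (not b) ≡ sumRest true u b xor oddᵇ u
sumRest-not zero b = refl
sumRest-not (suc u) b = trans (cong (λ z → z xor sumRest true u z) (truth-table 1 (λ b → not b xor true) (λ b → not (b xor true)) refl b))
 (trans (cong (not (b xor true) xor_) (sumRest-not u (b xor true)))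
  (truth-table 3 (λ x r o → not x xor (r xor o)) (λ x r o → (x xor r) xor not o) refl (b xor true) (sumRest true u (b xor true)) (oddᵇ u)))

endPar-parity : ∀ τ u b → endPar τ u b ≡ b xor (oddᵇ u ∧ τ)
endPar-parity τ zero b = sym (xor-identityʳ b)
endPar-parity τ (suc u) b = trans (endPar-parity τ u (b xor τ))
 (truth-table 3 (λ b t o → (b xor t) xor (o ∧ t)) (λ b t o → b xor (not o ∧ t)) refl b τ (oddᵇ u))

sumRest-odd : ∀ τ u b → oddᵇ u ≡ true → sumRest τ u (not b) ≡ not (sumRest τ u b)
sumRest-odd true u b o = trans (sumRest-not u b) (trans (cong (sumRest true u b xor_) o) (xor-comm (sumRest true u b) true))
sumRest-odd false u b o = trans (zero-rest u (not b)) (trans (cong (_∧ not b) o) (cong not (sym (trans (zero-rest u b) (cong (_∧ b) o)))))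
 where
 zero-rest : ∀ u b → sumRest false u b ≡ oddᵇ u ∧ b
 zero-rest zero b = refl
 zero-rest (suc u) b = trans (cong (λ z → z xor sumRest false u z) (xor-identityʳ b)) (trans (cong (b xor_) (zero-rest u b))
  (truth-table 2 (λ b o → b xor (o ∧ b)) (λ b o → not o ∧ b) refl b (oddᵇ u)))

module Segments {B : Base} (Q : Params B) where

 open Assembly Q public

 link : Bool → List V → Bool
 link b xs = E xs ∧ (par xs ≐ b)

 link-parity : ∀ b X Z → link b (X ++ Z) ≡ true → E (X ++ Z) ≡ true × par Z ≡ par X xor b
 link-parity b X Z e with ∧-true {E (X ++ Z)} e
 ... | e₁ , e₂ = e₁ , trans (sym (xor-cancel (par X) (par Z))) (cong (par X xor_) (trans (sym (par-++ X Z)) (≐-true e₂)))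

 Flex : Bool → List V → Set
 Flex b X = Dense ρ h (λ Z → link b (X ++ Z))

 record Seg (W : List V) (j : ℕ) (x y s : Bool) : Set where
  field
   X Y : List V
   Bs : List (List V)
   walk : Walk X Bs Y
   blocks : length (X ∷ Bs) ≡ j
   len-X : length X ≡ h
   len-Y : length Y ≡ h
   good-X : good X ≡ true
   good-Y : good Y ≡ true
   par-X : par X ≡ x
   par-Y : par Y ≡ y
   par-all : par (X ++ concat Bs) ≡ s
   unique : Unique ((X ++ concat Bs) ++ W)

  vertices : List V
  vertices = X ++ concat Bs

 walk-size : ∀ {X Bs Y} → Walk X Bs Y → length X ≡ h → length (X ++ concat Bs) ≡ length (X ∷ Bs) * h
 walk-size {X} w e = ++-length X e (walk-length B w)

 seg-size : ∀ {W j x y s} (S₁ : Seg W j x y s) → length (Seg.vertices S₁) ≡ j * h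
 seg-size S₁ = trans (walk-size walk len-X) (cong (_* h) blocks)
  where open Seg S₁

 attach : ∀ b X U → Flex b X → length U ≤ N → ∃ λ Z → length Z ≡ h × fresh U Z ≡ true ×
  (E (X ++ Z) ≡ true × par Z ≡ par X xor b) × good Z ≡ true
 attach b X U d le = found (pick-dense h U {P = λ Z → link b (X ++ Z)} {R = λ Z → not (good Z)} ≤-refl le d (rare-weaken (≤-trans ρ≤K K≤4K) not-good))
  where
  K≤4K : K ≤ 4 * K
  K≤4K = m≤m+n K (3 * K)
  found : (∃ λ Z → length Z ≡ h × fresh U Z ≡ true × link b (X ++ Z) ≡ true × not (good Z) ≡ false) →
   ∃ λ Z → length Z ≡ h × fresh U Z ≡ true × (E (X ++ Z) ≡ true × par Z ≡ par X xor b) × good Z ≡ true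
  found (Z , len , f , l , g) = Z , len , f , link-parity b X Z l , not-false g

 wrap : ∀ b {A Cs D W} → Walk A Cs D → length A ≡ h → Flex b A → Flex b D →
  Unique ((A ++ concat Cs) ++ W) → length ((A ++ concat Cs) ++ W) + h ≤ N →
  Seg W (3 + length Cs) (par A xor b) (par D xor b) ((par A xor b) xor (par (A ++ concat Cs) xor (par D xor b)))
 wrap b {A} {Cs} {D} {W} w lenA dA dD u le = first (attach b A (M ++ W) dA (≤-trans (m≤m+n _ h) le))
  where
  M : List V
  M = A ++ concat Cs
  Result : Set
  Result = Seg W (3 + length Cs) (par A xor b) (par D xor b) ((par A xor b) xor (par (A ++ concat Cs) xor (par D xor b)))
  first : (∃ λ Z → length Z ≡ h × fresh (M ++ W) Z ≡ true × (E (A ++ Z) ≡ true × par Z ≡ par A xor b) × good Z ≡ true) → Result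
  first (Z , lenZ , fZ , (eZ , pZ) , gZ) = second (attach b D (Z ++ (M ++ W)) dD (≡-≤ (trans (length-++ Z)
    (trans (cong (_+ length (M ++ W)) lenZ) (+-comm h _))) le))
   where
   second : (∃ λ Z′ → length Z′ ≡ h × fresh (Z ++ (M ++ W)) Z′ ≡ true × (E (D ++ Z′) ≡ true × par Z′ ≡ par D xor b) × good Z′ ≡ true) → Result
   second (Z′ , lenZ′ , fZ′ , (eZ′ , pZ′) , gZ′) = record
    { X = Z; Y = Z′; Bs = A ∷ Cs ++ [ Z′ ]
    ; walk = step (trans (E-↭ (++-comm Z A)) eZ) lenA (walk-++ w (step eZ′ lenZ′ stop))
    ; blocks = cong (λ l → suc (suc l)) (trans (length-++ Cs) (+-comm (length Cs) 1))
    ; len-X = lenZ; len-Y = lenZ′; good-X = gZ; good-Y = gZ′; par-X = pZ; par-Y = pZ′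
    ; par-all = trans (par-++ Z _) (cong₂ _xor_ pZ (trans (cong par inner) (trans (par-++ M Z′) (cong (par M xor_) pZ′))))
    ; unique = Unique-↭ perm (fresh-unique Z′ (fresh-unique Z u fZ) fZ′) }
    where
    inner : concat (A ∷ Cs ++ [ Z′ ]) ≡ M ++ Z′
    inner = trans (cong (A ++_) (trans (sym (concat-++ Cs [ Z′ ])) (cong (concat Cs ++_) (++-identityʳ Z′)))) (sym (++-assoc A (concat Cs) Z′))
    perm : Z′ ++ (Z ++ (M ++ W)) ↭ (Z ++ concat (A ∷ Cs ++ [ Z′ ])) ++ W
    perm = ↭-trans (shifts Z′ Z) (↭-trans (++⁺ˡ Z (shifts Z′ M)) (↭-reflexive (trans (cong (Z ++_) (sym (++-assoc M Z′ W)))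
     (trans (sym (++-assoc Z (M ++ Z′) W)) (cong (λ l → (Z ++ l) ++ W) (sym inner))))))

 Wide : Set
 Wide = ∀ c → N + (p + h) ≤ avail χ c []

 wide-roomy : ∀ U → Wide → length U ≤ N → Roomy 0 U
 wide-roomy U wide le c = +-cancelʳ-≤ (length U) (p + h) _ (≤-trans (≡-≤ (+-comm (p + h) (length U)) (+-monoˡ-≤ (p + h) le))
  (≤-trans (wide c) (avail-++ c U)))

 connect : ∀ Y X U → Wide → length U ≤ N → good Y ≡ true → good X ≡ true →
  ∃ λ C → (length C ≡ h × par C ≡ par Y xor τ) × fresh U C ≡ true × avoid Y X C ≡ false
 connect Y X U wide le gY gX = found (pick cs U (avoid Y X) (≤-reflexive len) (wide-roomy U wide le)
   (subst (λ t → Rare K t (avoid Y X)) (sym len) (avoid-rare Y X gY gX)))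
  where
  cs : List Bool
  cs = pattern-of-parity h (par Y xor τ)
  len : length cs ≡ h
  len = pattern-length h (par Y xor τ)
  found : (∃ λ C → map χ C ≡ cs × fresh U C ≡ true × avoid Y X C ≡ false) →
   ∃ λ C → (length C ≡ h × par C ≡ par Y xor τ) × fresh U C ≡ true × avoid Y X C ≡ false
  found (C , col , f , av) = C , (trans (length-colours C col) len , trans (cong xors col) (pattern-parity g (par Y xor τ))) , f , av

 join : ∀ {W W₁ j₁ j₂ x₁ y₁ s₁ y₂ s₂} → Wide → (S₁ : Seg W₁ j₁ x₁ y₁ s₁) (S₂ : Seg (Seg.vertices S₁ ++ W) j₂ y₁ y₂ s₂) →
  length (Seg.vertices S₂ ++ (Seg.vertices S₁ ++ W)) ≤ N →
  Seg W (j₁ + suc j₂) x₁ y₂ (s₁ xor ((y₁ xor τ) xor s₂))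
 join {W} {_} {j₁} {j₂} {x₁} {y₁} {s₁} {y₂} {s₂} wide S₁ S₂ le = build (connect S₁.Y S₂.X (S₂.vertices ++ (S₁.vertices ++ W)) wide le S₁.good-Y S₂.good-X)
  where
  module S₁ = Seg S₁
  module S₂ = Seg S₂
  build : (∃ λ C → (length C ≡ h × par C ≡ par S₁.Y xor τ) × fresh (S₂.vertices ++ (S₁.vertices ++ W)) C ≡ true × avoid S₁.Y S₂.X C ≡ false) →
   Seg W (j₁ + suc j₂) x₁ y₂ (s₁ xor ((y₁ xor τ) xor s₂))
  build (C , (lenC , pC) , f , av) = record
   { X = S₁.X; Y = S₂.Y; Bs = S₁.Bs ++ C ∷ S₂.X ∷ S₂.Bs
   ; walk = walk-++ S₁.walk (step (next-edge S₁.Y C pC (∨-left av)) lenC (step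
     (trans (E-↭ (++-comm C S₂.X)) (next-edge S₂.X C (trans pC (cong (_xor τ) (trans S₁.par-Y (sym S₂.par-X))))
      (∨-left (∨-right {bad (S₁.Y ++ C)} av)))) S₂.len-X S₂.walk))
   ; blocks = trans (cong suc (length-++ S₁.Bs)) (cong₂ _+_ S₁.blocks (cong suc S₂.blocks))
   ; len-X = S₁.len-X; len-Y = S₂.len-Y; good-X = S₁.good-X; good-Y = S₂.good-Y; par-X = S₁.par-X; par-Y = S₂.par-Y
   ; par-all = trans (cong par flat-all) (trans (par-++ S₁.vertices _) (cong₂ _xor_ S₁.par-all (trans (par-++ C _) (cong₂ _xor_ (trans pC (cong (_xor τ) S₁.par-Y)) S₂.par-all))))
   ; unique = Unique-↭ perm (fresh-unique C S₂.unique f) }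
   where
   flat-all : S₁.X ++ concat (S₁.Bs ++ C ∷ S₂.X ∷ S₂.Bs) ≡ S₁.vertices ++ (C ++ S₂.vertices)
   flat-all = trans (cong (S₁.X ++_) (sym (concat-++ S₁.Bs _))) (sym (++-assoc S₁.X (concat S₁.Bs) _))
   perm : C ++ (S₂.vertices ++ (S₁.vertices ++ W)) ↭ (S₁.X ++ concat (S₁.Bs ++ C ∷ S₂.X ∷ S₂.Bs)) ++ W
   perm = ↭-trans (↭-reflexive (sym (++-assoc C S₂.vertices _))) (↭-trans (shifts (C ++ S₂.vertices) S₁.vertices)
    (↭-reflexive (trans (sym (++-assoc S₁.vertices (C ++ S₂.vertices) W)) (cong (_++ W) (sym flat-all)))))

 -- One more right block makes the last block of the segment compatible with the first one.
 cap : ∀ {j x y s} u → Wide → 20 * h ≤ N → j * h ≤ 20 * h → (j + suc u) * h ≡ n → Seg [] j x y s →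
  endPar τ (suc u) y ≡ x xor τ → sumRest τ (suc u) y ≡ total-parity xor s → Gadget u
 cap {j} {x} {y} {s} u wide big le m S₁ closing total = build (connect S₁.Y S₁.X S₁.vertices wide (≡-≤ (seg-size S₁) (≤-trans le big)) S₁.good-Y S₁.good-X)
  where
  module S₁ = Seg S₁
  build : (∃ λ C → (length C ≡ h × par C ≡ par S₁.Y xor τ) × fresh S₁.vertices C ≡ true × avoid S₁.Y S₁.X C ≡ false) → Gadget u
  build (C , (lenC , pC) , f , av) = record
   { F₀ = S₁.X; L = C; Bs = S₁.Bs ++ [ C ]
   ; walk = walk-++ S₁.walk (step (next-edge S₁.Y C pC (∨-left av)) lenC stop)
   ; state = record
    { len-F₀ = S₁.len-X; good-F₀ = S₁.good-X; len-L = lenC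
    ; good-L = not-false (∨-right {bad (S₁.X ++ C)} (∨-right {bad (S₁.Y ++ C)} av))
    ; joint = ∨-left (∨-right {bad (S₁.Y ++ C)} av)
    ; unique = Unique-↭ (↭-trans (++-comm C S₁.vertices) (↭-reflexive (sym flat-all))) (fresh-unique C (Unique-↭ (↭-reflexive (++-identityʳ S₁.vertices)) S₁.unique) f)
    ; count-U = trans (cong (λ l → l + 0 + u * h) (trans (cong length flat-all) (++-length S₁.vertices (seg-size S₁) lenC))) (trans (arith j u h) m)
    ; closing = trans (cong (endPar τ u) pC′) (trans closing′ (cong (_xor τ) (sym S₁.par-X)))
    ; total = trans (cong (sumRest τ u) pC′) (trans (sym (xor-cancel (y xor τ) _)) (trans (cong ((y xor τ) xor_) total′)
      (trans (truth-table 3 (λ c P s → c xor (P xor s)) (λ c P s → P xor ((s xor c) xor false)) refl (y xor τ) total-parity s)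
       (cong (λ z → total-parity xor (z xor false)) (sym (trans (cong par flat-all) (trans (par-++ S₁.vertices C) (cong₂ _xor_ S₁.par-all pC′))))))))
    }
   ; short = ≡-≤ (trans (cong length flat-all) (++-length S₁.vertices (seg-size S₁) lenC)) (≤-≡ (+-monoˡ-≤ h le) (+-comm (20 * h) h)) }
   where
   closing′ : endPar τ u (y xor τ) ≡ x xor τ
   closing′ = closing
   total′ : (y xor τ) xor sumRest τ u (y xor τ) ≡ total-parity xor s
   total′ = total
   pC′ : par C ≡ y xor τ
   pC′ = trans pC (cong (_xor τ) S₁.par-Y)
   flat-all : S₁.X ++ concat (S₁.Bs ++ [ C ]) ≡ S₁.vertices ++ C
   flat-all = trans (cong (S₁.X ++_) (trans (sym (concat-++ S₁.Bs [ C ])) (cong (concat S₁.Bs ++_) (++-identityʳ C)))) (sym (++-assoc S₁.X (concat S₁.Bs) C))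
   arith : ∀ j u h → j * h + h + 0 + u * h ≡ (j + suc u) * h
   arith = solve-∀

module Parities {B : Base} (Q : Params B) where

 open Segments Q public

 cast-seg : ∀ {W j x y s x′ y′ s′} → x ≡ x′ → y ≡ y′ → s ≡ s′ → Seg W j x y s → Seg W j x′ y′ s′
 cast-seg refl refl refl S₁ = S₁

 Big : Set
 Big = 20 * h ≤ N

 k≤20 : ∀ k j → k + j ≡ 20 → Big → k * h ≤ N
 k≤20 k j e big = ≤-trans (*-monoˡ-≤ h (≤-≡ (m≤m+n k j) e)) big

 ≤20 : ∀ k j → k + j ≡ 20 → k * h ≤ 20 * h
 ≤20 k j e = *-monoˡ-≤ h (≤-≡ (m≤m+n k j) e)

 clean : ∀ b u → Wide → Big → (1 + suc u) * h ≡ n → endPar τ (suc u) b ≡ b xor τ →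
  sumRest τ (suc u) b ≡ total-parity xor b → Gadget u
 clean b u wide big m closing total = found (pick cs [] (λ X → not (good X)) (≤-reflexive len) (wide-roomy [] wide z≤n)
   (subst (λ t → Rare K t (λ X → not (good X))) (sym len) (rare-weaken (m≤m+n K (3 * K)) not-good)))
  where
  cs : List Bool
  cs = pattern-of-parity h b
  len : length cs ≡ h
  len = pattern-length h b
  found : (∃ λ X → map χ X ≡ cs × fresh [] X ≡ true × not (good X) ≡ false) → Gadget u
  found (X , col , f , gX) = cap {1} {b} {b} {b} u wide big (≤20 1 19 refl) m seg closing total
   where
   pX : par X ≡ b
   pX = trans (cong xors col) (pattern-parity g b)
   lenX : length X ≡ h
   lenX = trans (length-colours X col) len
   seg : Seg [] 1 b b b
   seg = record
    { X = X; Y = X; Bs = []; walk = stop; blocks = refl; len-X = lenX; len-Y = lenX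
    ; good-X = not-false gX; good-Y = not-false gX; par-X = pX; par-Y = pX
    ; par-all = trans (cong par (++-identityʳ X)) pX
    ; unique = subst (λ l → Unique (l ++ [])) (sym (++-identityʳ X)) (fresh-unique X [] f) }

 even-obstructed : ℕ → Set
 even-obstructed m₁ = ∀ x → sumRest τ m₁ x ≡ not (total-parity xor x)

 even-decide : ∀ u → Wide → Big → (1 + suc u) * h ≡ n → oddᵇ (suc u) ≡ true → Gadget u ⊎ even-obstructed (suc u)
 even-decide u wide big m o = found (decide (sumRest τ (suc u) false ≐ total-parity))
  where
  closing : endPar τ (suc u) false ≡ false xor τ
  closing = trans (endPar-parity τ (suc u) false) (cong (_∧ τ) o)
  found : (sumRest τ (suc u) false ≐ total-parity) ≡ true ⊎ (sumRest τ (suc u) false ≐ total-parity) ≡ false → Gadget u ⊎ even-obstructed (suc u)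
  found (inj₁ e) = inj₁ (clean false u wide big m closing (trans (≐-true e) (sym (xor-identityʳ total-parity))))
  found (inj₂ e) = inj₂ obstructed
   where
   obstructed : even-obstructed (suc u)
   obstructed false = trans (≐-false {sumRest τ (suc u) false} e) (cong not (sym (xor-identityʳ total-parity)))
   obstructed true = trans (sumRest-odd τ (suc u) false o) (cong not (trans (≐-false {sumRest τ (suc u) false} e) (xor-comm true total-parity)))

 -- A segment with two wrong edges ends like a right segment of the same length, but the parity of its union is flipped.
 flipped : ∀ a {x s} u → Wide → Big → suc a * h ≤ 20 * h → (suc a + suc u) * h ≡ n → oddᵇ (a + suc u) ≡ true → even-obstructed (a + suc u) →
  endPar τ a x ≡ x → s ≡ not (x xor sumRest τ a x) → Seg [] (suc a) x x s → Gadget u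
 flipped a {x} {s} u wide big le m o obs e₁ e₂ S₁ = cap u wide big le m S₁
  (trans (cong (endPar τ (suc u)) (sym e₁)) (trans (sym (endPar-+ τ a (suc u) x)) (trans (endPar-parity τ (a + suc u) x) (cong (λ b → x xor (b ∧ τ)) o))))
  (trans (solve-for (sumRest τ a x) (sumRest τ (suc u) x) _ (trans (cong (λ z → sumRest τ a x xor sumRest τ (suc u) z) (sym e₁)) (trans (sym (sumRest-+ τ a (suc u) x)) (obs x))))
   (trans (truth-table 3 (λ r P x → r xor not (P xor x)) (λ r P x → P xor not (x xor r)) refl (sumRest τ a x) total-parity x) (cong (total-parity xor_) (sym e₂))))
  where
  solve-for : ∀ r R t → r xor R ≡ t → R ≡ r xor t
  solve-for r R .(r xor R) refl = sym (xor-cancel r R)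

 par-1 : ∀ X → par (X ++ []) ≡ par X
 par-1 X = cong par (++-identityʳ X)

 par-2 : ∀ X Y → par (X ++ (Y ++ [])) ≡ par X xor par Y
 par-2 X Y = trans (par-++ X _) (cong (par X xor_) (par-1 Y))

 par-3 : ∀ X Y Z → par (X ++ (Y ++ (Z ++ []))) ≡ par X xor (par Y xor par Z)
 par-3 X Y Z = trans (par-++ X _) (cong (par X xor_) (par-2 Y Z))

 even-triple : ∀ S u → Wide → Big → (3 + suc u) * h ≡ n → oddᵇ (2 + suc u) ≡ true → even-obstructed (2 + suc u) →
  length S ≡ h → Unique S → Flex (not τ) S → Gadget u
 even-triple S u wide big m o obs len un fl = flipped 2 {x} {par S} u wide big (≤20 3 17 refl) m o obs
   (truth-table 2 (λ b t → (b xor t) xor t) (λ b t → b) refl x τ)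
   (truth-table 2 (λ s t → s) (λ s t → not ((s xor not t) xor (((s xor not t) xor t) xor ((((s xor not t) xor t) xor t) xor false)))) refl (par S) τ)
   (cast-seg refl refl (trans (cong (λ z → x xor (z xor x)) (par-1 S)) (truth-table 2 (λ x s → x xor (s xor x)) (λ x s → s) refl x (par S)))
    (wrap (not τ) {S} {[]} {S} {[]} stop len fl fl (subst Unique (sym (trans (++-identityʳ (S ++ [])) (++-identityʳ S))) un)
     (≡-≤ (cong (_+ h) (trans (cong length (trans (++-identityʳ (S ++ [])) (++-identityʳ S))) len)) (≡-≤ (cong (h +_) (sym (+-identityʳ h))) (k≤20 2 18 refl big)))))
  where
  x : Bool
  x = par S xor not τ

 piece : ∀ S T W → length S ≡ h → length T ≡ h → E (S ++ T) ≡ true → Flex τ S → Flex τ T → Unique ((S ++ T) ++ W) →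
  length W + 3 * h ≤ N → Seg W 4 (par S xor τ) (par T xor τ) ((par S xor τ) xor ((par S xor par T) xor (par T xor τ)))
 piece S T W lS lT e fS fT u le = cast-seg refl refl (cong (λ z → (par S xor τ) xor (z xor (par T xor τ))) (par-2 S T))
  (wrap τ {S} {T ∷ []} {T} {W} (step e lT stop) lS fS fT (subst (λ l → Unique ((S ++ l) ++ W)) (sym (++-identityʳ T)) u)
   (≡-≤ (trans (cong (_+ h) (trans (length-++ (S ++ (T ++ []))) (cong (_+ length W) (++-length S lS (trans (cong length (++-identityʳ T)) lT))))) (arith h (length W))) le))
  where
  arith : ∀ h w → h + h + w + h ≡ w + 3 * h
  arith = solve-∀

 piece₂ : ∀ T₁ S T₂ W → length T₁ ≡ h → length S ≡ h → length T₂ ≡ h → E (T₁ ++ S) ≡ true → E (S ++ T₂) ≡ true → Flex τ T₁ → Flex τ T₂ →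
  Unique ((T₁ ++ (S ++ T₂)) ++ W) → length W + 4 * h ≤ N →
  Seg W 5 (par T₁ xor τ) (par T₂ xor τ) ((par T₁ xor τ) xor ((par T₁ xor (par S xor par T₂)) xor (par T₂ xor τ)))
 piece₂ T₁ S T₂ W l₁ lS l₂ e₁ e₂ f₁ f₂ u le = cast-seg refl refl (cong (λ z → (par T₁ xor τ) xor (z xor (par T₂ xor τ))) (par-3 T₁ S T₂))
  (wrap τ {T₁} {S ∷ T₂ ∷ []} {T₂} {W} (step e₁ lS (step e₂ l₂ stop)) l₁ f₁ f₂ (subst (λ l → Unique ((T₁ ++ (S ++ l)) ++ W)) (sym (++-identityʳ T₂)) u)
   (≡-≤ (trans (cong (_+ h) (trans (length-++ (T₁ ++ (S ++ (T₂ ++ [])))) (cong (_+ length W) (++-length T₁ l₁ (++-length S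
    lS (trans (cong length (++-identityʳ T₂)) l₂)))))) (arith h (length W))) le))
  where
  arith : ∀ h w → h + (h + h) + w + h ≡ w + 4 * h
  arith = solve-∀

 even-share : ∀ T₁ S T₂ u → Wide → Big → (5 + suc u) * h ≡ n → oddᵇ (4 + suc u) ≡ true → even-obstructed (4 + suc u) →
  length T₁ ≡ h → length S ≡ h → length T₂ ≡ h → E (T₁ ++ S) ≡ true → E (S ++ T₂) ≡ true → Flex τ T₁ → Flex τ T₂ →
  Unique (T₁ ++ (S ++ T₂)) → par T₁ ≡ par S xor not τ → par T₂ ≡ par S xor not τ → Gadget u
 even-share T₁ S T₂ u wide big m o obs l₁ lS l₂ e₁ e₂ f₁ f₂ un p₁ p₂ = flipped 4 {x} u wide big (≤20 5 15 refl) m o obs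
   (truth-table 2 (λ b t → (((b xor t) xor t) xor t) xor t) (λ b t → b) refl x τ)
   (truth-table 2 (λ s t → s)
    (λ s t → not (f s t xor ((f s t xor t) xor (((f s t xor t) xor t) xor ((((f s t xor t) xor t) xor t) xor (((((f s t xor t) xor t) xor t) xor t) xor false)))))) refl (par S) τ)
   (cast-seg (cong (_xor τ) p₁) (cong (_xor τ) p₂) (trans (cong₂ (λ a b → (a xor τ) xor ((a xor (par S xor b)) xor (b xor τ))) p₁ p₂)
     (truth-table 2 (λ s t → ((s xor not t) xor t) xor (((s xor not t) xor (s xor (s xor not t))) xor ((s xor not t) xor t))) (λ s t → s) refl (par S) τ))
    (piece₂ T₁ S T₂ [] l₁ lS l₂ e₁ e₂ f₁ f₂ (subst Unique (sym (++-identityʳ _)) un) (k≤20 4 16 refl big)))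
  where
  f : Bool → Bool → Bool
  f s t = (s xor not t) xor t
  x : Bool
  x = f (par S) τ

 even-two : ∀ S₁ T₁ S₂ T₂ u → Wide → Big → (9 + suc u) * h ≡ n → oddᵇ (8 + suc u) ≡ true → even-obstructed (8 + suc u) →
  length S₁ ≡ h → length T₁ ≡ h → length S₂ ≡ h → length T₂ ≡ h → E (S₁ ++ T₁) ≡ true → E (S₂ ++ T₂) ≡ true →
  Flex τ S₁ → Flex τ T₁ → Flex τ S₂ → Flex τ T₂ → Unique ((S₁ ++ T₁) ++ (S₂ ++ T₂)) →
  par T₂ ≡ par T₁ → par S₁ ≡ par T₁ xor not τ → par S₂ ≡ par T₁ xor not τ → Gadget u
 even-two S₁ T₁ S₂ T₂ u wide big m o obs lS₁ lT₁ lS₂ lT₂ e₁ e₂ fS₁ fT₁ fS₂ fT₂ un pT pS₁ pS₂ =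
  flipped 8 {x} u wide big (≤20 9 11 refl) m o obs
   (truth-table 2 (λ b t → (((((((b xor t) xor t) xor t) xor t) xor t) xor t) xor t) xor t) (λ b t → b) refl x τ)
   (s≡ (par T₁) τ)
   (cast-seg refl refl refl (join wide first second second≤))
  where
  x : Bool
  x = (par T₁ xor not τ) xor τ
  first : Seg (S₂ ++ T₂) 4 x (par T₁ xor τ) (x xor (((par T₁ xor not τ) xor par T₁) xor (par T₁ xor τ)))
  first = cast-seg (cong (_xor τ) pS₁) refl (cong (λ z → (z xor τ) xor ((z xor par T₁) xor (par T₁ xor τ))) pS₁)
   (piece S₁ T₁ (S₂ ++ T₂) lS₁ lT₁ e₁ fS₁ fT₁ un (≡-≤ (trans (cong (_+ 3 * h) (++-length S₂ lS₂ lT₂)) (arith h)) (k≤20 5 15 refl big)))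
   where
   arith : ∀ h → h + h + 3 * h ≡ 5 * h
   arith = solve-∀
  module F = Seg first
  flip-order : Unique ((T₂ ++ S₂) ++ (F.vertices ++ []))
  flip-order = Unique-↭ (↭-trans (++-comm F.vertices (S₂ ++ T₂)) (↭-trans (++⁺ʳ F.vertices (++-comm S₂ T₂)) (↭-reflexive (cong ((T₂ ++ S₂) ++_) (sym (++-identityʳ F.vertices)))))) F.unique
  size-F : length (F.vertices ++ []) ≡ 4 * h
  size-F = trans (cong length (++-identityʳ F.vertices)) (seg-size first)
  second : Seg (F.vertices ++ []) 4 (par T₁ xor τ) x ((par T₁ xor τ) xor ((par T₁ xor (par T₁ xor not τ)) xor x))
  second = cast-seg (cong (_xor τ) pT) (cong (_xor τ) pS₂) (cong₂ (λ a b → (a xor τ) xor ((a xor b) xor (b xor τ))) pT pS₂)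
   (piece T₂ S₂ (F.vertices ++ []) lT₂ lS₂ (trans (E-↭ (++-comm T₂ S₂)) e₂) fT₂ fS₂ flip-order
    (≡-≤ (trans (cong (_+ 3 * h) size-F) (arith h)) (k≤20 7 13 refl big)))
   where
   arith : ∀ h → 4 * h + 3 * h ≡ 7 * h
   arith = solve-∀
  second≤ : length (Seg.vertices second ++ (F.vertices ++ [])) ≤ N
  second≤ = ≡-≤ (trans (length-++ (Seg.vertices second)) (trans (cong₂ _+_ (seg-size second) size-F) (arith h))) (k≤20 8 12 refl big)
   where
   arith : ∀ h → 4 * h + 4 * h ≡ 8 * h
   arith = solve-∀
  s≡ : ∀ q t → let x = (q xor not t) xor t in
   (x xor (((q xor not t) xor q) xor (q xor t))) xor (((q xor t) xor t) xor ((q xor t) xor ((q xor (q xor not t)) xor x))) ≡ not (x xor sumRest t 8 x)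
  s≡ true true = refl
  s≡ true false = refl
  s≡ false true = refl
  s≡ false false = refl

 module Odd (τ≡ : τ ≡ true) (u : ℕ) (m : (14 + suc u) * h ≡ n) (o : oddᵇ (suc u) ≡ true) (wide : Wide) (big : Big) where

  σ : Bool → Bool
  σ b = sumRest τ (suc u) b

  odd-finish : ∀ j r {x s} → j + r ≡ 14 → oddᵇ r ≡ false → j * h ≤ 20 * h → s ≡ false → Seg [] j x x s → sumRest τ (r + suc u) x ≡ total-parity →
   Gadget (r + u)
  odd-finish j r {x} jr or le refl S₁ total = cap (r + u) wide big le (trans (cong (_* h) (trans (cong (j +_) (sym (+-suc r u))) (trans (sym (+-assoc j r (suc u))) (cong (_+ suc u) jr)))) m) S₁
   (trans (endPar-parity τ (suc (r + u)) x) (cong (λ b → x xor (b ∧ τ)) (trans (cong oddᵇ (sym (+-suc r u))) (trans (odd-+ r (suc u)) (cong₂ _xor_ or o)))))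
   (trans (cong (λ v → sumRest τ v x) (sym (+-suc r u))) (trans total (sym (xor-identityʳ total-parity))))

  σ-not : ∀ b → σ (not b) ≡ not (σ b)
  σ-not b = sumRest-odd τ (suc u) b o

  rest-10 : ∀ b → sumRest τ (10 + suc u) b ≡ not (σ b)
  rest-10 b = trans (sumRest-+ τ 10 (suc u) b) (subst (λ τ → sumRest τ 10 b xor sumRest τ (suc u) (endPar τ 10 b) ≡ not (sumRest τ (suc u) b)) (sym τ≡) (concrete b))
   where
   concrete : ∀ b → sumRest true 10 b xor sumRest true (suc u) (endPar true 10 b) ≡ not (sumRest true (suc u) b)
   concrete true = refl
   concrete false = refl

  rest-4 : ∀ b → sumRest τ (4 + suc u) b ≡ σ b
  rest-4 b = trans (sumRest-+ τ 4 (suc u) b) (subst (λ τ → sumRest τ 4 b xor sumRest τ (suc u) (endPar τ 4 b) ≡ sumRest τ (suc u) b) (sym τ≡) (concrete b))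
   where
   concrete : ∀ b → sumRest true 4 b xor sumRest true (suc u) (endPar true 4 b) ≡ sumRest true (suc u) b
   concrete true = refl
   concrete false = refl

  not-τ : ∀ b → b xor τ ≡ not b
  not-τ b = trans (cong (b xor_) τ≡) (xor-comm b true)

  pieceε : ∀ {ε} S T W → length S ≡ h → length T ≡ h → E (S ++ T) ≡ true → Flex τ S → Flex τ T → Unique ((S ++ T) ++ W) →
   length W + 3 * h ≤ N → par S ≡ ε → par T ≡ ε → Seg W 4 (not ε) (not ε) false
  pieceε {ε} S T W lS lT e fS fT u le refl pT = cast-seg (not-τ (par S)) (trans (cong (_xor τ) pT) (not-τ (par S)))
   (trans (cong (λ z → (par S xor τ) xor ((par S xor z) xor (z xor τ))) pT) (truth-table 2 (λ s t → (s xor t) xor ((s xor s) xor (s xor t))) (λ s t → false) refl (par S) τ))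
   (piece S T W lS lT e fS fT u le)

  odd-one : ∀ {ε} S T → σ ε ≡ total-parity → length S ≡ h → length T ≡ h → E (S ++ T) ≡ true → Flex τ S → Flex τ T → Unique (S ++ T) →
   par S ≡ ε → par T ≡ ε → Gadget (10 + u)
  odd-one {ε} S T ok lS lT e fS fT un pS pT = odd-finish 4 10 refl refl (≤20 4 16 refl) refl
   (pieceε S T [] lS lT e fS fT (subst Unique (sym (++-identityʳ _)) un) (k≤20 3 17 refl big) pS pT)
   (trans (rest-10 (not ε)) (trans (cong not (σ-not ε)) (trans (not-involutive (σ ε)) ok)))

  join-false : ∀ {W W₁ j₁ j₂ ε} → (S₁ : Seg W₁ j₁ (not ε) (not ε) false) (S₂ : Seg (Seg.vertices S₁ ++ W) j₂ (not ε) (not ε) ε) →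
   length (Seg.vertices S₂ ++ (Seg.vertices S₁ ++ W)) ≤ N → Seg W (j₁ + suc j₂) (not ε) (not ε) false
  join-false {ε = ε} S₁ S₂ le = cast-seg refl refl (trans (cong (_xor ε) (not-τ (not ε))) (truth-table 1 (λ e → not (not e) xor e) (λ e → false) refl ε)) (join wide S₁ S₂ le)

  join-ε : ∀ {W W₁ j₁ j₂ ε} → (S₁ : Seg W₁ j₁ (not ε) (not ε) false) (S₂ : Seg (Seg.vertices S₁ ++ W) j₂ (not ε) (not ε) false) →
   length (Seg.vertices S₂ ++ (Seg.vertices S₁ ++ W)) ≤ N → Seg W (j₁ + suc j₂) (not ε) (not ε) ε
  join-ε {ε = ε} S₁ S₂ le = cast-seg refl refl (trans (cong (_xor false) (not-τ (not ε))) (truth-table 1 (λ e → not (not e) xor false) (λ e → e) refl ε)) (join wide S₁ S₂ le)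

  σ-bad : ∀ {ε} → σ ε ≡ not total-parity → σ (not ε) ≡ total-parity
  σ-bad {ε} e = trans (σ-not ε) (trans (cong not e) (truth-table 1 (λ p → not (not p)) (λ p → p) refl total-parity))

  odd-share : ∀ {ε} T₁ S T₂ S′ T′ → σ ε ≡ not total-parity → length T₁ ≡ h → length S ≡ h → length T₂ ≡ h → length S′ ≡ h → length T′ ≡ h →
   E (T₁ ++ S) ≡ true → E (S ++ T₂) ≡ true → E (S′ ++ T′) ≡ true → Flex τ T₁ → Flex τ T₂ → Flex τ S′ → Flex τ T′ →
   Unique ((T₁ ++ (S ++ T₂)) ++ (S′ ++ T′)) → par T₁ ≡ ε → par S ≡ ε → par T₂ ≡ ε → par S′ ≡ ε → par T′ ≡ ε → Gadget (4 + u)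
  odd-share {ε} T₁ S T₂ S′ T′ nok l₁ lS l₂ lS′ lT′ e₁ e₂ e₃ f₁ f₂ fS′ fT′ un refl pS p₂ pS′ pT′ =
   odd-finish 10 4 refl refl (≤20 10 10 refl) refl (join-false second first le) (trans (rest-4 (not (par T₁))) (σ-bad {par T₁} nok))
   where
   order : Unique ((S′ ++ T′) ++ (T₁ ++ (S ++ T₂)))
   order = Unique-↭ (++-comm (T₁ ++ (S ++ T₂)) (S′ ++ T′)) un
   len₃ : length (T₁ ++ (S ++ T₂)) ≡ 3 * h
   len₃ = trans (length-++ T₁) (trans (cong₂ _+_ l₁ (++-length S lS l₂)) (arith h))
    where
    arith : ∀ h → h + (h + h) ≡ 3 * h
    arith = solve-∀
   second : Seg (T₁ ++ (S ++ T₂)) 4 (not ε) (not ε) false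
   second = pieceε S′ T′ (T₁ ++ (S ++ T₂)) lS′ lT′ e₃ fS′ fT′ order (≡-≤ (trans (cong (_+ 3 * h) len₃) (sym (*-distribʳ-+ h 3 3))) (k≤20 6 14 refl big)) pS′ pT′
   module F = Seg second
   size-F : length (F.vertices ++ []) ≡ 4 * h
   size-F = trans (cong length (++-identityʳ F.vertices)) (seg-size second)
   first : Seg (F.vertices ++ []) 5 (not ε) (not ε) ε
   first = cast-seg (not-τ (par T₁)) (trans (cong (_xor τ) p₂) (not-τ (par T₁)))
    (trans (cong₂ (λ a b → (par T₁ xor τ) xor ((par T₁ xor (a xor b)) xor (b xor τ))) pS p₂)
     (truth-table 2 (λ e t → (e xor t) xor ((e xor (e xor e)) xor (e xor t))) (λ e t → e) refl (par T₁) τ))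
    (piece₂ T₁ S T₂ (F.vertices ++ []) l₁ lS l₂ e₁ e₂ f₁ f₂
     (Unique-↭ (↭-trans (++-comm F.vertices _) (↭-reflexive (cong ((T₁ ++ (S ++ T₂)) ++_) (sym (++-identityʳ F.vertices))))) F.unique)
     (≡-≤ (trans (cong (_+ 4 * h) size-F) (sym (*-distribʳ-+ h 4 4))) (k≤20 8 12 refl big)))
   le : length (Seg.vertices first ++ (F.vertices ++ [])) ≤ N
   le = ≡-≤ (trans (length-++ (Seg.vertices first)) (trans (cong₂ _+_ (seg-size first) size-F) (sym (*-distribʳ-+ h 5 4)))) (k≤20 9 11 refl big)

  odd-three : ∀ {ε} S₁ T₁ S₂ T₂ S₃ T₃ → σ ε ≡ not total-parity → length S₁ ≡ h → length T₁ ≡ h → length S₂ ≡ h → length T₂ ≡ h → length S₃ ≡ h → length T₃ ≡ h →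
   E (S₁ ++ T₁) ≡ true → E (S₂ ++ T₂) ≡ true → E (S₃ ++ T₃) ≡ true → Flex τ S₁ → Flex τ T₁ → Flex τ S₂ → Flex τ T₂ → Flex τ S₃ → Flex τ T₃ →
   Unique ((S₁ ++ T₁) ++ ((S₂ ++ T₂) ++ (S₃ ++ T₃))) → par S₁ ≡ ε → par T₁ ≡ ε → par S₂ ≡ ε → par T₂ ≡ ε → par S₃ ≡ ε → par T₃ ≡ ε → Gadget u
  odd-three {ε} S₁ T₁ S₂ T₂ S₃ T₃ nok lS₁ lT₁ lS₂ lT₂ lS₃ lT₃ e₁ e₂ e₃ fS₁ fT₁ fS₂ fT₂ fS₃ fT₃ un pS₁ pT₁ pS₂ pT₂ pS₃ pT₃ =
   odd-finish 14 0 refl refl (≤20 14 6 refl) refl (join-false {ε = ε} first rest rest≤) (σ-bad {ε} nok)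
   where
   first : Seg ((S₂ ++ T₂) ++ (S₃ ++ T₃)) 4 (not ε) (not ε) false
   first = pieceε S₁ T₁ _ lS₁ lT₁ e₁ fS₁ fT₁ un (≡-≤ (trans (cong (_+ 3 * h) (trans (length-++ (S₂ ++ T₂)) (cong₂ _+_
    (++-length S₂ lS₂ lT₂) (++-length S₃ lS₃ lT₃)))) (arith h)) (k≤20 7 13 refl big)) pS₁ pT₁
    where
    arith : ∀ h → h + h + (h + h) + 3 * h ≡ 7 * h
    arith = solve-∀
   module F = Seg first
   size-F : length (F.vertices ++ []) ≡ 4 * h
   size-F = trans (cong length (++-identityʳ F.vertices)) (seg-size first)
   W₂ : List V
   W₂ = (S₃ ++ T₃) ++ (F.vertices ++ [])
   size-W₂ : length W₂ ≡ 6 * h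
   size-W₂ = trans (length-++ (S₃ ++ T₃)) (trans (cong₂ _+_ (++-length S₃ lS₃ lT₃) size-F) (arith h))
    where
    arith : ∀ h → h + h + 4 * h ≡ 6 * h
    arith = solve-∀
   second : Seg W₂ 4 (not ε) (not ε) false
   second = pieceε S₂ T₂ W₂ lS₂ lT₂ e₂ fS₂ fT₂ (Unique-↭ (↭-trans (++-comm F.vertices _) (↭-trans (↭-reflexive (++-assoc (S₂ ++ T₂) _ _))
     (↭-reflexive (cong (λ l → (S₂ ++ T₂) ++ ((S₃ ++ T₃) ++ l)) (sym (++-identityʳ F.vertices)))))) F.unique)
    (≡-≤ (trans (cong (_+ 3 * h) size-W₂) (sym (*-distribʳ-+ h 6 3))) (k≤20 9 11 refl big)) pS₂ pT₂
   module G = Seg second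
   size-G : length (G.vertices ++ (F.vertices ++ [])) ≡ 8 * h
   size-G = trans (length-++ G.vertices) (trans (cong₂ _+_ (seg-size second) size-F) (sym (*-distribʳ-+ h 4 4)))
   third : Seg (G.vertices ++ (F.vertices ++ [])) 4 (not ε) (not ε) false
   third = pieceε S₃ T₃ _ lS₃ lT₃ e₃ fS₃ fT₃ (Unique-↭ (shifts G.vertices (S₃ ++ T₃)) G.unique)
    (≡-≤ (trans (cong (_+ 3 * h) size-G) (sym (*-distribʳ-+ h 8 3))) (k≤20 11 9 refl big)) pS₃ pT₃
   rest : Seg (F.vertices ++ []) 9 (not ε) (not ε) ε
   rest = join-ε second third (≡-≤ (trans (length-++ (Seg.vertices third)) (trans (cong₂ _+_ (seg-size third) size-G) (sym (*-distribʳ-+ h 4 8)))) (k≤20 12 8 refl big))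
   rest≤ : length (Seg.vertices rest ++ (F.vertices ++ [])) ≤ N
   rest≤ = ≡-≤ (trans (length-++ (Seg.vertices rest)) (trans (cong₂ _+_ (seg-size rest) size-F) (sym (*-distribʳ-+ h 9 4)))) (k≤20 13 7 refl big)

-- Wrong edges when all blocks are flexible

tabulate-nth : ∀ {A : Set} {l} (d : A) (xs : List A) → length xs ≡ l → tabulate {n = l} (nth d xs) ≡ xs
tabulate-nth {l = zero} d [] e = refl
tabulate-nth {l = suc l} d (x ∷ xs) e = cong (x ∷_) (tabulate-nth d xs (suc-injective e))

list-split : {A : Set} (a b : ℕ) (xs : List A) → length xs ≡ a + b →
 ∃ λ ys → ∃ λ zs → xs ≡ ys ++ zs × length ys ≡ a × length zs ≡ b
list-split zero b xs e = [] , xs , refl , refl , e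
list-split (suc a) b (x ∷ xs) e with list-split a b xs (suc-injective e)
... | ys , zs , refl , l₁ , l₂ = x ∷ ys , zs , refl , cong suc l₁ , l₂

Pure : ∀ {n} → (Fin n → Bool) → Bool → List (Fin n) → Set
Pure χ c xs = ∀ {v} → v ∈ xs → χ v ≡ c

Mixed : ∀ {n} → (Fin n → Bool) → List (Fin n) → Set
Mixed χ xs = ∃ λ x → ∃ λ y → ∃ λ R → χ x ≡ true × χ y ≡ false × xs ↭ x ∷ y ∷ R

classify : ∀ {n} (χ : Fin n → Bool) xs → Mixed χ xs ⊎ ∃ λ c → Pure χ c xs
classify χ [] = inj₂ (true , λ ())
classify χ (v ∷ xs) with classify χ xs
... | inj₁ (x , y , R , cx , cy , p) = inj₁ (x , y , v ∷ R , cx , cy , ↭-trans (_↭_.prep v p) (shifts [ v ] (x ∷ y ∷ [])))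
... | inj₂ (c , pure) with xs | pure
... | [] | _ = inj₂ (χ v , λ { (here refl) → refl })
... | w ∷ ws | pure′ with χ v in cv | χ w in cw
... | true | true = inj₂ (true , λ { (here refl) → cv ; (there m) → trans (pure′ m) (trans (sym (pure′ (here refl))) cw) })
... | false | false = inj₂ (false , λ { (here refl) → cv ; (there m) → trans (pure′ m) (trans (sym (pure′ (here refl))) cw) })
... | true | false = inj₁ (v , w , ws , cv , cw , ↭-refl)
... | false | true = inj₁ (w , v , ws , cw , cv , _↭_.swap v w ↭-refl)

pure-parity : ∀ {n} (χ : Fin n → Bool) {c} xs → Pure χ c xs → xors (map χ xs) ≡ c ∧ oddᵇ (length xs)
pure-parity χ {true} [] p = refl
pure-parity χ {false} [] p = refl
pure-parity χ {c} (x ∷ xs) p = trans (cong₂ _xor_ (p (here refl)) (pure-parity χ xs (λ m → p (there m))))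
 (truth-table 2 (λ c o → c xor (c ∧ o)) (λ c o → c ∧ not o) refl c (oddᵇ (length xs)))

odd-double : ∀ h → oddᵇ (h + h) ≡ false
odd-double h = trans (odd-+ h h) (xor-self (oddᵇ h))

opaque
 unfolding #
 #-pos : ∀ {n} {P : List (Fin n) → Bool} xs → P xs ≡ true → 0 < # (length xs) P
 #-pos {P = P} [] e = ≤-reflexive (cong bit (sym e))
 #-pos {n} {P} (x ∷ xs) e = ≤-trans (#-pos {P = λ ys → P (x ∷ ys)} xs e) (term-≤-∑ (λ v → # (length xs) (λ ys → P (v ∷ ys))) x)

module WrongEdges {B : Base} (Q : Params B)
 (E-unique : ∀ xs → length xs ≡ Blocks.h B + Blocks.h B → Base.E B xs ≡ true → Unique xs) where

 open Parities Q public

 Wrong : List V → Set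
 Wrong e = length e ≡ h + h × E e ≡ true × par e ≡ not τ

 wrong-↭ : ∀ {e e′} → e ↭ e′ → Wrong e → Wrong e′
 wrong-↭ p (l , x , q) = trans (↭-length (↭-sym p)) l , trans (sym (E-↭ p)) x , trans (sym (par-↭ p)) q

 wrong-unique : ∀ {e} → Wrong e → Unique e
 wrong-unique {e} (l , x , _) = E-unique e l x

 record Split (e : List V) (b : Bool) : Set where
  field
   S T : List V
   e↭ : e ↭ S ++ T
   len-S : length S ≡ h
   len-T : length T ≡ h
   par-T : par T ≡ b

  edge : E e ≡ true → E (S ++ T) ≡ true
  edge x = trans (sym (E-↭ e↭)) x

  par-S : par e ≡ not τ → par S ≡ b xor not τ
  par-S p = trans (sym (truth-table 2 (λ s t → (s xor t) xor t) (λ s t → s) refl (par S) (par T)))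
   (trans (cong₂ _xor_ (trans (sym (par-++ S T)) (trans (sym (par-↭ e↭)) p)) par-T) (xor-comm (not τ) b))

 halve : ∀ e → length e ≡ h + h → ∃ (Split e)
 halve e l with list-split h h e l
 ... | S , T , refl , lS , lT = par T , record { S = S; T = T; e↭ = ↭-refl; len-S = lS; len-T = lT; par-T = refl }

 mixed-split : ∀ b {e} → length e ≡ h + h → Mixed χ e → Split e b
 mixed-split b {e} l (x , y , R , cx , cy , p) = found (list-split g g R lenR)
  where
  lenR : length R ≡ g + g
  lenR = suc-injective (suc-injective (trans (sym (↭-length p)) (trans l (cong suc (+-suc g g)))))
  found : (∃ λ R₁ → ∃ λ R₂ → R ≡ R₁ ++ R₂ × length R₁ ≡ g × length R₂ ≡ g) → Split e b
  found (R₁ , R₂ , refl , l₁ , l₂) = choose-parity (decide (b ≐ par R₂))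
   where
   choose-parity : (b ≐ par R₂) ≡ true ⊎ (b ≐ par R₂) ≡ false → Split e b
   choose-parity (inj₁ q) = record
    { S = x ∷ R₁; T = y ∷ R₂; e↭ = ↭-trans p (_↭_.prep x (↭-sym (shift y R₁ R₂))); len-S = cong suc l₁; len-T = cong suc l₂
    ; par-T = trans (cong (_xor par R₂) cy) (sym (≐-true q)) }
   choose-parity (inj₂ q) = record
    { S = y ∷ R₁; T = x ∷ R₂; e↭ = ↭-trans p (↭-trans (_↭_.swap x y ↭-refl) (_↭_.prep y (↭-sym (shift x R₁ R₂)))); len-S = cong suc l₁; len-T = cong suc l₂
    ; par-T = trans (cong (_xor par R₂) cx) (sym (≐-false {b} q)) }

 type : Bool → Bool
 type c = c ∧ oddᵇ h

 pure-split : ∀ {c e} → length e ≡ h + h → Pure χ c e → Split e (type c)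
 pure-split {c} {e} l pure = found (halve e l)
  where
  found : ∃ (Split e) → Split e (type c)
  found (b , s) = record { S = s.S; T = s.T; e↭ = s.e↭; len-S = s.len-S; len-T = s.len-T
   ; par-T = trans (pure-parity χ s.T (λ m → pure (∈-resp-↭ (↭-sym s.e↭) (∈-++⁺ʳ s.S m)))) (cong (λ l → c ∧ oddᵇ l) s.len-T) }
   where module s = Split s

 Cover : (Fin h → Bool) → Set
 Cover cs = ∀ D → map χ D ≡ tabulate cs → Unique D → ∃ λ Y → length Y ≡ h × Wrong (D ++ Y)

 record Pair (cs : Fin h → Bool) : Set where
  field
   D D′ Y Y′ S T₁ T₂ : List V
   col : map χ D ≡ tabulate cs
   col′ : map χ D′ ≡ tabulate cs
   wrong₁ : Wrong (D ++ Y)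
   wrong₂ : Wrong (D′ ++ Y′)
   perm₁ : D ++ Y ↭ S ++ T₁
   perm₂ : D′ ++ Y′ ↭ S ++ T₂
   unique : Unique ((S ++ T₁) ++ T₂)
   sizes : length S ≡ 0 ⊎ length S ≡ h

 class : Bool → List V
 class c = members (λ v → χ v ≐ c)

 class-length : ∀ c → length (class c) ≡ avail χ c []
 class-length c = trans (members-length _) (size-cong (λ v → sym (∧-identityʳ (χ v ≐ c))))

 pair : ∀ cs {NR} → CoverPair h NR → (∀ c → NR ≤ avail χ c []) → Cover cs → Pair cs
 pair cs {NR} cp big cov = found (cp χ cs v₀ Y pool pool-big pool-colours pool-unique valid)
  where
  v₀ : V
  v₀ = vertex n {{pos}}
   where
   vertex : ∀ n → .{{NonZero n}} → Fin n
   vertex (suc n) = zero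
  pool : List (V × V)
  pool = Data.List.zip (class true) (class false)
  pool-big : NR ≤ length pool
  pool-big = ≤-≡ (⊓-glb (≤-≡ (big true) (sym (class-length true))) (≤-≡ (big false) (sym (class-length false))))
   (sym (length-zipWith _,_ (class true) (class false)))
  nothing : (xs : List V) → [] ⊆ xs
  nothing [] = []
  nothing (x ∷ xs) = x ∷ʳ nothing xs
  zip-⊆₁ : (as bs : List V) → map proj₁ (Data.List.zip as bs) ⊆ as
  zip-⊆₁ [] bs = []
  zip-⊆₁ (a ∷ as) [] = nothing (a ∷ as)
  zip-⊆₁ (a ∷ as) (b ∷ bs) = refl ∷ zip-⊆₁ as bs
  zip-⊆₂ : (as bs : List V) → map proj₂ (Data.List.zip as bs) ⊆ bs
  zip-⊆₂ [] bs = nothing bs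
  zip-⊆₂ (a ∷ as) [] = []
  zip-⊆₂ (a ∷ as) (b ∷ bs) = refl ∷ zip-⊆₂ as bs
  pool-⊆ : ∀ c → map (rep c) pool ⊆ class c
  pool-⊆ true = zip-⊆₁ (class true) (class false)
  pool-⊆ false = zip-⊆₂ (class true) (class false)
  pool-colours : ∀ {p} → p ∈ pool → ∀ c → χ (rep c p) ≡ c
  pool-colours m c = ≐-true (members-elim (λ v → χ v ≐ c) (Any-resp-⊆ (pool-⊆ c) (∈-map⁺ (rep c) m)))
  pool-unique : ∀ c → Unique (map (rep c) pool)
  pool-unique c = unique-⊆ (pool-⊆ c) (members-unique _)
  valid? : ∀ D → Dec (map χ D ≡ tabulate cs × fresh [] D ≡ true)
  valid? D = _×-dec_ (≡-dec Data.Bool._≟_ (map χ D) (tabulate cs)) (Data.Bool._≟_ (fresh [] D) true)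
  completion : ∀ D → Dec (map χ D ≡ tabulate cs × fresh [] D ≡ true) → List V
  completion D (yes (c , f)) = proj₁ (cov D c (unique-of f))
   where
   unique-of : ∀ {D} → fresh [] D ≡ true → Unique D
   unique-of {D} f = fresh-list-unique D f
  completion D (no _) = []
  completes : ∀ D (d : Dec (map χ D ≡ tabulate cs × fresh [] D ≡ true)) → map χ D ≡ tabulate cs → Unique D →
   length (completion D d) ≡ h × Wrong (D ++ completion D d)
  completes D (yes (c , f)) _ _ = proj₂ (cov D c _)
  completes D (no ¬v) c u = contradiction (c , unique-fresh-[] D u) ¬v
  Y : List V → Fin h → V
  Y D = nth v₀ (completion D (valid? D))
  is-wrong : ∀ D → map χ D ≡ tabulate cs → Unique D → Wrong (D ++ tabulate (Y D))
  is-wrong D c u = subst (λ ys → Wrong (D ++ ys)) (sym (tabulate-nth v₀ _ (proj₁ (completes D (valid? D) c u)))) (proj₂ (completes D (valid? D) c u))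
  valid : ∀ D → map χ D ≡ tabulate cs → Unique D → Unique (D ++ tabulate (Y D))
  valid D c u = wrong-unique (is-wrong D c u)
  found : (∃ λ D → ∃ λ D′ → ∃ λ S → ∃ λ T₁ → ∃ λ T₂ →
   (map χ D ≡ tabulate cs × Unique D) × (map χ D′ ≡ tabulate cs × Unique D′) ×
   (D ++ tabulate (Y D) ↭ S ++ T₁) × (D′ ++ tabulate (Y D′) ↭ S ++ T₂) ×
   Unique ((S ++ T₁) ++ T₂) × (length S ≡ 0 ⊎ length S ≡ h)) → Pair cs
  found (D , D′ , S , T₁ , T₂ , (c , u) , (c′ , u′) , p₁ , p₂ , un , sz) = record
   { D = D; D′ = D′; Y = tabulate (Y D); Y′ = tabulate (Y D′); S = S; T₁ = T₁; T₂ = T₂; col = c; col′ = c′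
   ; wrong₁ = is-wrong D c u; wrong₂ = is-wrong D′ c′ u′; perm₁ = p₁; perm₂ = p₂; unique = un; sizes = sz }

 -- The two edges of a pair contain vertices of the same colours, so they cannot be pure of different classes.
 same-class : ∀ {cs} (P : Pair cs) {c c′} → Pure χ c (Pair.D P ++ Pair.Y P) → Pure χ c′ (Pair.D′ P ++ Pair.Y′ P) → c ≡ c′
 same-class {cs₀} P {c} {c′} p p′ = go {cs₀} (Pair.D P) (Pair.D′ P) (Pair.col P) (Pair.col′ P) p p′
  where
  go : ∀ {cs : Fin h → Bool} D D′ {Y Y′ : List V} → map χ D ≡ tabulate cs → map χ D′ ≡ tabulate cs → Pure χ c (D ++ Y) → Pure χ c′ (D′ ++ Y′) → c ≡ c′
  go (x ∷ D) (y ∷ D′) e e′ p p′ = trans (sym (p (here refl))) (trans (∷-injectiveˡ (trans e (sym e′))) (p′ (here refl)))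

 share-parities : ∀ S T → Wrong (S ++ T) → par T ≡ par S xor not τ
 share-parities S T (_ , _ , p) = trans (sym (xor-cancel (par S) (par T))) (cong (par S xor_) (trans (sym (par-++ S T)) p))

 share-length : ∀ S T → Wrong (S ++ T) → length S ≡ h → length T ≡ h
 share-length S T (l , _) lS = +-cancelˡ-≡ h _ _ (trans (cong (_+ length T) (sym lS)) (trans (sym (length-++ S)) l))

 module AllFlex (flex : ∀ X → length X ≡ h → Unique X → Flex τ X) where

  flex-S : ∀ {S T W} → length S ≡ h → Unique ((S ++ T) ++ W) → Flex τ S
  flex-S {S} {T} {W} l u = flex S l (unique-++ˡ S (unique-++ˡ (S ++ T) u))

  flex-T : ∀ {S T W} → length T ≡ h → Unique ((S ++ T) ++ W) → Flex τ T
  flex-T {S} {T} {W} l u = flex T l (unique-++ʳ S (unique-++ˡ (S ++ T) u))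

  even-case : ∀ {cs} (P : Pair cs) u₀ → Wide → Big → (9 + suc u₀) * h ≡ n → oddᵇ (8 + suc u₀) ≡ true → even-obstructed (8 + suc u₀) → ∃ Gadget
  even-case {cs} P u₀ wide big m o obs = by-size sizes
   where
   open Pair P
   by-size : length S ≡ 0 ⊎ length S ≡ h → ∃ Gadget
   by-size (inj₂ lS) = 4 + u₀ , even-share T₁ S T₂ (4 + u₀) wide big m o obs (share-length S T₁ w₁ lS) lS (share-length S T₂ w₂ lS)
     (trans (E-↭ (++-comm T₁ S)) (proj₁ (proj₂ w₁))) (proj₁ (proj₂ w₂)) (flex-T {S} {T₁} {T₂} (share-length S T₁ w₁ lS) unique)
     (flex T₂ (share-length S T₂ w₂ lS) (unique-++ʳ (S ++ T₁) unique))
     (Unique-↭ (↭-trans (++⁺ʳ T₂ (++-comm S T₁)) (↭-reflexive (++-assoc T₁ S T₂))) unique) (share-parities S T₁ w₁) (share-parities S T₂ w₂)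
    where
    w₁ : Wrong (S ++ T₁)
    w₁ = wrong-↭ perm₁ wrong₁
    w₂ : Wrong (S ++ T₂)
    w₂ = wrong-↭ perm₂ wrong₂
   by-size (inj₁ lS) = splits-of (classify χ (D ++ Y)) (classify χ (D′ ++ Y′))
    where
    empty : ∀ (S : List V) → length S ≡ 0 → S ≡ []
    empty [] _ = refl
    un : Unique ((D ++ Y) ++ (D′ ++ Y′))
    un = Unique-↭ (++⁺ (↭-trans (↭-reflexive refl) (↭-sym perm₁)) (↭-trans (↭-reflexive (cong (_++ T₂) (sym (empty S lS)))) (↭-sym perm₂))) unique
    finish : ∀ {b} → Split (D ++ Y) b → Split (D′ ++ Y′) b → ∃ Gadget
    finish {b} s s′ = u₀ , even-two s.S s.T s′.S s′.T u₀ wide big m o obs s.len-S s.len-T s′.len-S s′.len-T (s.edge (proj₁ (proj₂ wrong₁))) (s′.edge (proj₁ (proj₂ wrong₂)))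
      (flex-S {s.S} {s.T} s.len-S un′) (flex-T {s.S} {s.T} s.len-T un′) (flex s′.S s′.len-S (unique-++ˡ s′.S un″)) (flex s′.T s′.len-T (unique-++ʳ s′.S un″)) un′
      (trans s′.par-T (sym s.par-T)) (trans (s.par-S (proj₂ (proj₂ wrong₁))) (cong (_xor not τ) (sym s.par-T))) (trans (s′.par-S (proj₂ (proj₂ wrong₂))) (cong (_xor not τ) (sym s.par-T)))
     where
     module s = Split s
     module s′ = Split s′
     un′ : Unique ((s.S ++ s.T) ++ (s′.S ++ s′.T))
     un′ = Unique-↭ (++⁺ s.e↭ s′.e↭) un
     un″ : Unique (s′.S ++ s′.T)
     un″ = unique-++ʳ (s.S ++ s.T) un′
    len : length (D ++ Y) ≡ h + h
    len = proj₁ wrong₁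
    len′ : length (D′ ++ Y′) ≡ h + h
    len′ = proj₁ wrong₂
    splits-of : Mixed χ (D ++ Y) ⊎ (∃ λ c → Pure χ c (D ++ Y)) → Mixed χ (D′ ++ Y′) ⊎ (∃ λ c → Pure χ c (D′ ++ Y′)) → ∃ Gadget
    splits-of (inj₁ mx) _ = finish (mixed-split (proj₁ (halve (D′ ++ Y′) len′)) len mx) (proj₂ (halve (D′ ++ Y′) len′))
    splits-of (inj₂ _) (inj₁ mx) = finish (proj₂ (halve (D ++ Y) len)) (mixed-split (proj₁ (halve (D ++ Y) len)) len′ mx)
    splits-of (inj₂ (c , p)) (inj₂ (c′ , p′)) = finish (pure-split len p) (subst (λ c → Split (D′ ++ Y′) (type c)) (sym (same-class {cs} P p p′)) (pure-split len′ p′))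

hits : ∀ {n} → List (Fin n) → List (Fin n) → Bool
hits [] xs = false
hits (w ∷ W) xs = mem w xs ∨ hits W xs

hits-disjoint : ∀ {n} W {xs : List (Fin n)} → hits W xs ≡ false → ∀ {w} → w ∈ W → w ∉ xs
hits-disjoint (w ∷ W) {xs} e (here refl) = mem-∉ xs (∨-left e)
hits-disjoint (w ∷ W) {xs} e (there m) = hits-disjoint W (∨-right {mem w xs} e) m

-- By symmetry of P, a vertex of a tuple can be moved to the front.
#-containing : ∀ {n} t (P : List (Fin n) → Bool) w → (∀ {xs ys} → xs ↭ ys → P xs ≡ P ys) →
 # (suc t) (λ xs → P xs ∧ mem w xs) ≤ suc t * # t (λ xs → P (w ∷ xs))
#-containing {n} t P w sym-P = begin
 # (suc t) (λ xs → P xs ∧ mem w xs)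
  ≡⟨ #-suc t _ ⟩
 ∑ (λ v → # t (λ xs → P (v ∷ xs) ∧ (does (w ≟F v) ∨ mem w xs)))
  ≤⟨ ∑-mono split ⟩
 ∑ (λ v → # t (λ xs → P (w ∷ xs)) * bit (does (v ≟F w) ∧ true) + # t (λ xs → P (v ∷ xs) ∧ mem w xs))
  ≡⟨ trans (∑-+ _ _) (cong (_+ ∑ (λ v → # t (λ xs → P (v ∷ xs) ∧ mem w xs)))
     (trans (∑-* (# t (λ xs → P (w ∷ xs))) _) (trans (cong (# t (λ xs → P (w ∷ xs)) *_) (∑-indicator w true)) (*-identityʳ _)))) ⟩
 # t (λ xs → P (w ∷ xs)) + ∑ (λ v → # t (λ xs → P (v ∷ xs) ∧ mem w xs))
  ≤⟨ +-monoʳ-≤ (# t (λ xs → P (w ∷ xs))) (later t) ⟩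
 suc t * # t (λ xs → P (w ∷ xs)) ∎
 where
 open ≤-Reasoning
 split : ∀ v → # t (λ xs → P (v ∷ xs) ∧ (does (w ≟F v) ∨ mem w xs)) ≤
  # t (λ xs → P (w ∷ xs)) * bit (does (v ≟F w) ∧ true) + # t (λ xs → P (v ∷ xs) ∧ mem w xs)
 split v with w ≟F v | v ≟F w
 ... | yes refl | yes _ = ≤-trans (#-mono t (λ xs _ e → ∧-left {P (w ∷ xs)} e)) (≡-≤ (sym (*-identityʳ _)) (m≤m+n _ _))
 ... | yes e | no ne = contradiction (sym e) ne
 ... | no _ | _ = m≤n+m _ _
 later : ∀ t → ∑ (λ v → # t (λ xs → P (v ∷ xs) ∧ mem w xs)) ≤ t * # t (λ xs → P (w ∷ xs))
 later zero = ≤-reflexive (trans (∑-cong (λ v → trans (#-zero _) (cong bit (∧-zeroʳ (P (v ∷ [])))))) (trans (∑-const n 0) (*-zeroʳ n)))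
 later (suc t) = begin
  ∑ (λ v → # (suc t) (λ xs → P (v ∷ xs) ∧ mem w xs))
   ≤⟨ ∑-mono (λ v → #-containing t (λ xs → P (v ∷ xs)) w (λ p → sym-P (_↭_.prep v p))) ⟩
  ∑ (λ v → suc t * # t (λ xs → P (v ∷ w ∷ xs)))
   ≡⟨ ∑-* (suc t) _ ⟩
  suc t * ∑ (λ v → # t (λ xs → P (v ∷ w ∷ xs)))
   ≤⟨ *-monoʳ-≤ (suc t) (∑-mono (λ v → #-mono t (λ xs _ e → trans (sym-P (_↭_.swap w v ↭-refl)) e))) ⟩
  suc t * ∑ (λ v → # t (λ xs → P (w ∷ v ∷ xs)))
   ≡⟨ cong (suc t *_) (sym (#-suc t (λ xs → P (w ∷ xs)))) ⟩
  suc t * # (suc t) (λ xs → P (w ∷ xs)) ∎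

#-hits : ∀ {n} t (P : List (Fin n) → Bool) W → (∀ {xs ys} → xs ↭ ys → P xs ≡ P ys) →
 # (suc t) (λ xs → P xs ∧ hits W xs) ≤ suc t * sum (map (λ w → # t (λ xs → P (w ∷ xs))) W)
#-hits {n} t P [] sym-P = ≤-trans (#-mono (suc t) {R = λ _ → false} (λ xs _ e → ∧-right {P xs} e))
 (≡-≤ (#-none (suc t)) z≤n)
#-hits t P (w ∷ W) sym-P = ≤-trans (≤-trans (#-mono (suc t) split) (#-∨ (suc t) _ _))
 (≤-≡ (+-mono-≤ (#-containing t P w sym-P) (#-hits t P W sym-P)) (sym (*-distribˡ-+ (suc t) (# t (λ xs → P (w ∷ xs))) (sum (map (λ w → # t (λ xs → P (w ∷ xs))) W)))))
 where
 split : ∀ xs → length xs ≡ suc t → P xs ∧ (mem w xs ∨ hits W xs) ≡ true → (P xs ∧ mem w xs) ∨ (P xs ∧ hits W xs) ≡ true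
 split xs _ e with P xs | mem w xs
 ... | true | true = refl
 ... | true | false = e

-- Either a tuple avoids W, or some vertex of W is contained in a positive proportion of all tuples.
avoid-or-heavy : ∀ {n} .{{_ : NonZero n}} t C M (P : List (Fin n) → Bool) W → (∀ {xs ys} → xs ↭ ys → P xs ≡ P ys) →
 n ^ t ≤ C * # (suc t) P → length W < M →
 (∃ λ e → length e ≡ suc t × P e ≡ true × hits W e ≡ false) ⊎ (∃ λ w → w ∈ W × Dense (C * suc t * M) t (λ xs → P (w ∷ xs)))
avoid-or-heavy {n} t C M P W sym-P dense W<M = step (0 <? # (suc t) (λ xs → P xs ∧ not (hits W xs)))
 where
 C′ : ℕ
 C′ = C * suc t * M
 f : Fin n → ℕ
 f w = # t (λ xs → P (w ∷ xs))
 search : ∀ W → (∃ λ w → w ∈ W × Dense C′ t (λ xs → P (w ∷ xs))) ⊎ (C′ * sum (map f W) ≤ length W * n ^ t)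
 search [] = inj₂ (≤-reflexive (*-zeroʳ C′))
 search (w ∷ W) with n ^ t ≤? C′ * f w
 ... | yes d = inj₁ (w , here refl , mkDense d)
 ... | no ¬d with search W
 ... | inj₁ (w′ , m , d) = inj₁ (w′ , there m , d)
 ... | inj₂ le = inj₂ (≡-≤ (*-distribˡ-+ C′ (f w) _) (+-mono-≤ (<⇒≤ (≰⇒> ¬d)) le))
 step : Dec (0 < # (suc t) (λ xs → P xs ∧ not (hits W xs))) →
  (∃ λ e → length e ≡ suc t × P e ≡ true × hits W e ≡ false) ⊎ (∃ λ w → w ∈ W × Dense C′ t (λ xs → P (w ∷ xs)))
 step (yes pos) = found (#-find (suc t) pos)
  where
  found : (∃ λ e → length e ≡ suc t × P e ∧ not (hits W e) ≡ true) → _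
  found (e , l , q) = inj₁ (e , l , ∧-left q , not-true (∧-right {P e} q))
 step (no ¬pos) = decide-search (search W)
  where
  open ≤-Reasoning
  few : # (suc t) P ≤ suc t * sum (map f W)
  few = ≤-trans (≤-trans (#-mono (suc t) split) (#-∨ (suc t) _ _)) (≤-≡ (+-mono-≤ (#-hits t P W sym-P) (≮⇒≥ ¬pos)) (+-identityʳ _))
   where
   split : ∀ xs → length xs ≡ suc t → P xs ≡ true → (P xs ∧ hits W xs) ∨ (P xs ∧ not (hits W xs)) ≡ true
   split xs _ e with P xs | hits W xs
   ... | true | true = refl
   ... | true | false = refl
  decide-search : (∃ λ w → w ∈ W × Dense C′ t (λ xs → P (w ∷ xs))) ⊎ (C′ * sum (map f W) ≤ length W * n ^ t) → _
  decide-search (inj₁ h) = inj₂ h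
  decide-search (inj₂ le) = contradiction (begin
   M * n ^ t ≤⟨ *-monoʳ-≤ M dense ⟩
   M * (C * # (suc t) P) ≤⟨ *-monoʳ-≤ M (*-monoʳ-≤ C few) ⟩
   M * (C * (suc t * sum (map f W))) ≡⟨ regroup M C (suc t) (sum (map f W)) ⟩
   C′ * sum (map f W) ≤⟨ le ⟩
   length W * n ^ t ∎) (<⇒≱ (*-monoˡ-< (n ^ t) {{m^n≢0 n t}} W<M))
   where
   regroup : ∀ m c t s → m * (c * (t * s)) ≡ c * t * m * s
   regroup = solve-∀

module OddEdges {B : Base} (Q : Params B)
 (E-unique : ∀ xs → length xs ≡ Blocks.h B + Blocks.h B → Base.E B xs ≡ true → Unique xs) where

 open WrongEdges Q E-unique public

 module Flexible (flex : ∀ X → length X ≡ h → Unique X → Flex τ X) (τ≡ : τ ≡ true) (u : ℕ) (m : (14 + suc u) * h ≡ n)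
  (o : oddᵇ (suc u) ≡ true) (wide : Wide) (big : Big) where

  open AllFlex flex public
  open Odd τ≡ u m o wide big public

  P : Bool
  P = total-parity

  par-S′ : ∀ {e b} → Wrong e → (s : Split e b) → par (Split.S s) ≡ b
  par-S′ {e} {b} (_ , _ , p) s = trans (Split.par-S s p) (trans (cong (λ t → b xor not t) τ≡) (xor-identityʳ b))

  split-unique : ∀ {e b} → Wrong e → (s : Split e b) → Unique (Split.S s ++ Split.T s)
  split-unique w s = Unique-↭ (Split.e↭ s) (wrong-unique w)

  single : ∀ {e b} → Wrong e → Split e b → σ b ≡ P → ∃ Gadget
  single {e} {b} w s ok = 10 + u , odd-one s.S s.T ok s.len-S s.len-T (s.edge (proj₁ (proj₂ w))) (flex s.S s.len-S (unique-++ˡ s.S un)) (flex s.T s.len-T (unique-++ʳ s.S un)) un (par-S′ w s) s.par-T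
   where
   module s = Split s
   un : Unique (s.S ++ s.T)
   un = split-unique w s

  BadPure : List V → Set
  BadPure e = ∃ λ c → Pure χ c e × σ (type c) ≡ not P

  try : ∀ e → Wrong e → ∃ Gadget ⊎ BadPure e
  try e w = go (classify χ e)
   where
   good-type : ∃ λ b → σ b ≡ P
   good-type with decide (σ false ≐ P)
   ... | inj₁ y = false , ≐-true y
   ... | inj₂ n = true , trans (σ-not false) (trans (cong not (≐-false {σ false} n)) (truth-table 1 (λ p → not (not p)) (λ p → p) refl P))
   go : Mixed χ e ⊎ (∃ λ c → Pure χ c e) → ∃ Gadget ⊎ BadPure e
   go (inj₁ mx) = inj₁ (single w (mixed-split (proj₁ good-type) (proj₁ w) mx) (proj₂ good-type))
   go (inj₂ (c , p)) with decide (σ (type c) ≐ P)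
   ... | inj₁ y = inj₁ (single w (pure-split (proj₁ w) p) (≐-true y))
   ... | inj₂ n = inj₂ (c , p , ≐-false {σ (type c)} n)

  bad-same : ∀ {b b′} → σ b ≡ not P → σ b′ ≡ not P → b ≡ b′
  bad-same {true} {true} _ _ = refl
  bad-same {false} {false} _ _ = refl
  bad-same {true} {false} e e′ = contradiction (trans (sym e) (trans (σ-not false) (cong not e′))) (not-≢ (not P))
   where
   not-≢ : ∀ x → x ≢ not x
   not-≢ true ()
   not-≢ false ()
  bad-same {false} {true} e e′ = contradiction (trans (sym e′) (trans (σ-not false) (cong not e))) (not-≢ (not P))
   where
   not-≢ : ∀ x → x ≢ not x
   not-≢ true ()
   not-≢ false ()

  bad-split : ∀ {e ε} → Wrong e → BadPure e → σ ε ≡ not P → Split e ε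
  bad-split {e} w (c , p , b) bε = subst (Split e) (bad-same b bε) (pure-split (proj₁ w) p)

  bad-parity : ∀ {ε} X Y → BadPure (X ++ Y) → σ ε ≡ not P → length X ≡ h → par X ≡ ε
  bad-parity X Y (c , p , b) bε l = trans (pure-parity χ X (λ m → p (∈-++⁺ˡ m))) (trans (cong (λ l → c ∧ oddᵇ l) l) (bad-same b bε))

  three : ∀ e₁ e₂ e₃ → Wrong e₁ → Wrong e₂ → Wrong e₃ → Unique (e₁ ++ (e₂ ++ e₃)) → ∃ Gadget
  three e₁ e₂ e₃ w₁ w₂ w₃ un = go (try e₁ w₁) (try e₂ w₂) (try e₃ w₃)
   where
   go : ∃ Gadget ⊎ BadPure e₁ → ∃ Gadget ⊎ BadPure e₂ → ∃ Gadget ⊎ BadPure e₃ → ∃ Gadget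
   go (inj₁ G) _ _ = G
   go (inj₂ _) (inj₁ G) _ = G
   go (inj₂ _) (inj₂ _) (inj₁ G) = G
   go (inj₂ b₁) (inj₂ b₂) (inj₂ b₃) = build {type (proj₁ b₁)} (proj₂ (proj₂ b₁)) refl
    where
    build : ∀ {ε} → σ ε ≡ not P → ε ≡ type (proj₁ b₁) → ∃ Gadget
    build {ε} bε _ = u , odd-three s₁.S s₁.T s₂.S s₂.T s₃.S s₃.T bε s₁.len-S s₁.len-T s₂.len-S s₂.len-T s₃.len-S s₃.len-T
      (s₁.edge (proj₁ (proj₂ w₁))) (s₂.edge (proj₁ (proj₂ w₂))) (s₃.edge (proj₁ (proj₂ w₃)))
      (fS w₁ s₁) (fT w₁ s₁) (fS w₂ s₂) (fT w₂ s₂) (fS w₃ s₃) (fT w₃ s₃)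
      (Unique-↭ (++⁺ s₁.e↭ (++⁺ s₂.e↭ s₃.e↭)) un) (par-S′ w₁ s₁) s₁.par-T (par-S′ w₂ s₂) s₂.par-T (par-S′ w₃ s₃) s₃.par-T
     where
     s₁ : Split e₁ ε
     s₁ = bad-split w₁ b₁ bε
     s₂ : Split e₂ ε
     s₂ = bad-split w₂ b₂ bε
     s₃ : Split e₃ ε
     s₃ = bad-split w₃ b₃ bε
     module s₁ = Split s₁
     module s₂ = Split s₂
     module s₃ = Split s₃
     fS : ∀ {e} → Wrong e → (s : Split e ε) → Flex τ (Split.S s)
     fS w s = flex _ (Split.len-S s) (unique-++ˡ (Split.S s) (split-unique w s))
     fT : ∀ {e} → Wrong e → (s : Split e ε) → Flex τ (Split.T s)
     fT w s = flex _ (Split.len-T s) (unique-++ʳ (Split.S s) (split-unique w s))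

  shared : ∀ S T₁ T₂ e₃ → Wrong (S ++ T₁) → Wrong (S ++ T₂) → Wrong e₃ → length S ≡ h → Unique ((T₁ ++ (S ++ T₂)) ++ e₃) → ∃ Gadget
  shared S T₁ T₂ e₃ w₁ w₂ w₃ lS un = go (try (S ++ T₁) w₁) (try (S ++ T₂) w₂) (try e₃ w₃)
   where
   l₁ : length T₁ ≡ h
   l₁ = share-length S T₁ w₁ lS
   l₂ : length T₂ ≡ h
   l₂ = share-length S T₂ w₂ lS
   go : ∃ Gadget ⊎ BadPure (S ++ T₁) → ∃ Gadget ⊎ BadPure (S ++ T₂) → ∃ Gadget ⊎ BadPure e₃ → ∃ Gadget
   go (inj₁ G) _ _ = G
   go (inj₂ _) (inj₁ G) _ = G
   go (inj₂ _) (inj₂ _) (inj₁ G) = G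
   go (inj₂ b₁) (inj₂ b₂) (inj₂ b₃) = build {type (proj₁ b₁)} (proj₂ (proj₂ b₁))
    where
    build : ∀ {ε} → σ ε ≡ not P → ∃ Gadget
    build {ε} bε = 4 + u , odd-share T₁ S T₂ s.S s.T bε l₁ lS l₂ s.len-S s.len-T
      (trans (E-↭ (++-comm T₁ S)) (proj₁ (proj₂ w₁))) (proj₁ (proj₂ w₂)) (s.edge (proj₁ (proj₂ w₃)))
      (flex T₁ l₁ (unique-++ˡ T₁ (unique-++ˡ (T₁ ++ (S ++ T₂)) un))) (flex T₂ l₂ (unique-++ʳ S (unique-++ʳ T₁ (unique-++ˡ (T₁ ++ (S ++ T₂)) un))))
      (flex s.S s.len-S (unique-++ˡ s.S (split-unique w₃ s))) (flex s.T s.len-T (unique-++ʳ s.S (split-unique w₃ s)))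
      (Unique-↭ (++⁺ˡ (T₁ ++ (S ++ T₂)) s.e↭) un)
      (tail-parity w₁ (bad-parity S T₁ b₁ bε lS)) (bad-parity S T₁ b₁ bε lS) (tail-parity w₂ (bad-parity S T₁ b₁ bε lS)) (par-S′ w₃ s) s.par-T
     where
     s : Split e₃ ε
     s = bad-split w₃ b₃ bε
     module s = Split s
     tail-parity : ∀ {T} → Wrong (S ++ T) → par S ≡ ε → par T ≡ ε
     tail-parity {T} w pS = trans (share-parities S T w) (trans (cong₂ (λ a t → a xor not t) pS τ≡) (xor-identityʳ ε))

  wrongᵇ : List V → Bool
  wrongᵇ e = link (not τ) e

  wrongᵇ-↭ : ∀ {xs ys} → xs ↭ ys → wrongᵇ xs ≡ wrongᵇ ys
  wrongᵇ-↭ p = cong₂ (λ a b → a ∧ (b ≐ not τ)) (E-↭ p) (par-↭ p)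

  is-wrong : ∀ {e} → length e ≡ h + h → wrongᵇ e ≡ true → Wrong e
  is-wrong {e} l q = l , ∧-left {E e} q , ≐-true (∧-right {E e} q)

  DenseWrong : ℕ → Set
  DenseWrong C = n ^ (h + g) ≤ C * # (h + h) wrongᵇ

  Star : ℕ → Set
  Star C = ∀ a → σ (type (χ a)) ≡ not P → (∃ λ e → Wrong e × ¬ Pure χ (χ a) e) ⊎ ((∃ λ e → Wrong e × a ∉ e) × DenseWrong C)

  module WithStar (C : ℕ) (star : Star C) (C≤ρ : 2 * (C * suc (h + g) * suc (4 * h)) ≤ ρ) where

   C′ : ℕ
   C′ = C * suc (h + g) * suc (4 * h)

   small : ∀ j (U : List V) → length U ≡ j * h → j ≤ 20 → length U ≤ N
   small j U e le = ≡-≤ e (≤-trans (*-monoˡ-≤ h le) big)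

   -- Many wrong edges through w give two of them that share h vertices and are disjoint from e₃.
   share-dense : ∀ w e₃ → Wrong e₃ → w ∉ e₃ → Dense C′ (h + g) (λ xs → wrongᵇ (w ∷ xs)) → ∃ Gadget
   share-dense w e₃ w₃ w∉ d = first (pick-dense g (w ∷ e₃) {R = λ _ → false} (n≤1+n g)
     (≤-trans (+-mono-≤ {1} {h} {length e₃} {h + h} (s≤s z≤n) (≤-reflexive (proj₁ w₃))) (≡-≤ (arith₁ h) (k≤20 3 17 refl big)))
     (dense-weaken C≤ρ heavies) (none-rare (4 * ρ) g))
    where
    arith₁ : ∀ h → h + (h + h) ≡ 3 * h
    arith₁ = solve-∀
    heavies : Dense (2 * C′) g (heavy (2 * C′) h (λ xs → wrongᵇ (w ∷ xs)))
    heavies = dense-heavy C′ (subst (λ t → Dense C′ t (λ xs → wrongᵇ (w ∷ xs))) (+-comm h g) d)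
    first : (∃ λ f → length f ≡ g × fresh (w ∷ e₃) f ≡ true × heavy (2 * C′) h (λ xs → wrongᵇ (w ∷ xs)) f ≡ true × false ≡ false) → ∃ Gadget
    first (f , lf , ff , hv , _) = second (pick-dense h (Z ++ e₃) {R = λ _ → false} ≤-refl (small 3 (Z ++ e₃) size-Z 3≤20) dense (none-rare (4 * ρ) h))
     where
     3≤20 : 3 ≤ 20
     3≤20 = s≤s (s≤s (s≤s z≤n))
     4≤20 : 4 ≤ 20
     4≤20 = s≤s 3≤19
      where
      3≤19 : 3 ≤ 19
      3≤19 = s≤s (s≤s (s≤s z≤n))
     Z : List V
     Z = w ∷ f
     lZ : length Z ≡ h
     lZ = cong suc lf
     size-Z : length (Z ++ e₃) ≡ 3 * h
     size-Z = trans (length-++ Z) (trans (cong₂ _+_ lZ (proj₁ w₃)) (arith₁ h))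
     uZ : Unique (Z ++ e₃)
     uZ = Unique-↭ (shift w f e₃) (fresh-unique f (∉-All w∉ ∷ wrong-unique w₃) ff)
     dense : Dense ρ h (λ T → wrongᵇ (Z ++ T))
     dense = dense-weaken C≤ρ (heavy-dense {P = λ xs → wrongᵇ (w ∷ xs)} f hv)
     second : (∃ λ T₁ → length T₁ ≡ h × fresh (Z ++ e₃) T₁ ≡ true × wrongᵇ (Z ++ T₁) ≡ true × false ≡ false) → ∃ Gadget
     second (T₁ , l₁ , f₁ , x₁ , _) = third (pick-dense h (T₁ ++ (Z ++ e₃)) {R = λ _ → false} ≤-refl
       (small 4 (T₁ ++ (Z ++ e₃)) (++-length T₁ l₁ size-Z) 4≤20) dense (none-rare (4 * ρ) h))
      where
      third : (∃ λ T₂ → length T₂ ≡ h × fresh (T₁ ++ (Z ++ e₃)) T₂ ≡ true × wrongᵇ (Z ++ T₂) ≡ true × false ≡ false) → ∃ Gadget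
      third (T₂ , l₂ , f₂ , x₂ , _) = shared Z T₁ T₂ e₃ (is-wrong {Z ++ T₁} (++-length Z lZ l₁) x₁) (is-wrong {Z ++ T₂} (++-length Z lZ l₂) x₂) w₃ lZ
       (Unique-↭ (↭-trans (shifts T₂ T₁) (↭-trans (++⁺ˡ T₁ (shifts T₂ Z)) (↭-reflexive (trans (cong (λ l → T₁ ++ l) (sym (++-assoc Z T₂ e₃))) (sym (++-assoc T₁ (Z ++ T₂) e₃))))))
        (fresh-unique T₂ (fresh-unique T₁ uZ f₁) f₂))

   heavy-vertex : ∀ w → Dense C′ (h + g) (λ xs → wrongᵇ (w ∷ xs)) → ∃ Gadget
   heavy-vertex w d = one (dense-find d)
    where
    one : (∃ λ xs → length xs ≡ h + g × wrongᵇ (w ∷ xs) ≡ true) → ∃ Gadget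
    one (xs , l , q) = go (try (w ∷ xs) we)
     where
     we : Wrong (w ∷ xs)
     we = is-wrong {w ∷ xs} (trans (cong suc l) (sym (+-suc h g))) q
     go : ∃ Gadget ⊎ BadPure (w ∷ xs) → ∃ Gadget
     go (inj₁ G) = G
     go (inj₂ (c , p , b)) = by-star (star w (trans (cong (λ c → σ (type c)) (p (here refl))) b))
      where
      by-star : (∃ λ e → Wrong e × ¬ Pure χ (χ w) e) ⊎ ((∃ λ e → Wrong e × w ∉ e) × DenseWrong C) → ∃ Gadget
      by-star (inj₂ ((e , w₃ , w∉) , _)) = share-dense w e w₃ w∉ d
      by-star (inj₁ (e , w₃ , np)) = pure-case (try e w₃)
       where
       pure-case : ∃ Gadget ⊎ BadPure e → ∃ Gadget
       pure-case (inj₁ G) = G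
       pure-case (inj₂ (c′ , p′ , _)) = share-dense w e w₃ (λ m → np (λ m′ → trans (p′ m′) (sym (p′ m)))) d

   many-wrong : DenseWrong C → ∃ Gadget
   many-wrong dw = first (avoid-or-heavy (h + g) C (suc (4 * h)) wrongᵇ [] wrongᵇ-↭ dw′ (s≤s z≤n))
    where
    dw′ : n ^ (h + g) ≤ C * # (suc (h + g)) wrongᵇ
    dw′ = subst (λ t → n ^ (h + g) ≤ C * # t wrongᵇ) (+-suc h g) dw
    Outcome : List V → Set
    Outcome W = (∃ λ e → length e ≡ suc (h + g) × wrongᵇ e ≡ true × hits W e ≡ false) ⊎ (∃ λ w → w ∈ W × Dense C′ (h + g) (λ xs → wrongᵇ (w ∷ xs)))
    len : ∀ (e : List V) → length e ≡ suc (h + g) → length e ≡ h + h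
    len e l = trans l (sym (+-suc h g))
    first : Outcome [] → ∃ Gadget
    first (inj₂ (w , () , _))
    first (inj₁ (e₁ , l₁ , x₁ , _)) = second (avoid-or-heavy (h + g) C (suc (4 * h)) wrongᵇ e₁ wrongᵇ-↭ dw′
      (s≤s (≡-≤ (len e₁ l₁) (≡-≤ (cong (h +_) (sym (+-identityʳ h))) (*-monoˡ-≤ h 2≤4)))))
     where
     w₁ : Wrong e₁
     w₁ = is-wrong {e₁} (len e₁ l₁) x₁
     second : Outcome e₁ → ∃ Gadget
     second (inj₂ (w , _ , d)) = heavy-vertex w d
     second (inj₁ (e₂ , l₂ , x₂ , d₂)) = third (avoid-or-heavy (h + g) C (suc (4 * h)) wrongᵇ (e₁ ++ e₂) wrongᵇ-↭ dw′
       (s≤s (≤-reflexive (trans (length-++ e₁) (trans (cong₂ _+_ (len e₁ l₁) (len e₂ l₂)) (arith h))))))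
      where
      arith : ∀ h → h + h + (h + h) ≡ 4 * h
      arith = solve-∀
      w₂ : Wrong e₂
      w₂ = is-wrong {e₂} (len e₂ l₂) x₂
      third : Outcome (e₁ ++ e₂) → ∃ Gadget
      third (inj₂ (w , _ , d)) = heavy-vertex w d
      third (inj₁ (e₃ , l₃ , x₃ , d₃)) = three e₁ e₂ e₃ w₁ w₂ w₃
       (Unique-↭ (↭-reflexive (++-assoc e₁ e₂ e₃)) (unique-++ (unique-++ (wrong-unique w₁) (wrong-unique w₂) (λ m → hits-disjoint e₁ d₂ m)) (wrong-unique w₃) (λ m → hits-disjoint (e₁ ++ e₂) d₃ m)))
       where
       w₃ : Wrong e₃
       w₃ = is-wrong {e₃} (len e₃ l₃) x₃

   odd-case : ∀ {cs} → Pair cs → ∃ Gadget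
   odd-case {cs} P₀ = go (try (D ++ Y) wrong₁) (try (D′ ++ Y′) wrong₂)
    where
    open Pair P₀
    go : ∃ Gadget ⊎ BadPure (D ++ Y) → ∃ Gadget ⊎ BadPure (D′ ++ Y′) → ∃ Gadget
    go (inj₁ G) _ = G
    go (inj₂ _) (inj₁ G) = G
    go (inj₂ (c , p , b)) (inj₂ (c′ , p′ , b′)) = at-head D col p
     where
     c≡ : c ≡ c′
     c≡ = same-class {cs} P₀ p p′
     at-head : ∀ D₀ → map χ D₀ ≡ tabulate cs → Pure χ c (D₀ ++ Y) → ∃ Gadget
     at-head (a ∷ _) _ pa = by-star (star a (trans (cong (λ c → σ (type c)) ca) b))
      where
      ca : χ a ≡ c
      ca = pa (here refl)
      by-star : (∃ λ e → Wrong e × ¬ Pure χ (χ a) e) ⊎ ((∃ λ e → Wrong e × a ∉ e) × DenseWrong C) → ∃ Gadget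
      by-star (inj₂ (_ , dw)) = many-wrong dw
      by-star (inj₁ (e , w₃ , np)) = pure-case (try e w₃)
       where
       pure-case : ∃ Gadget ⊎ BadPure e → ∃ Gadget
       pure-case (inj₁ G) = G
       pure-case (inj₂ (c₃ , p₃ , _)) = by-size sizes
        where
        other : c₃ ≢ c
        other refl = np (λ m → trans (p₃ m) (sym ca))
        S∪T-pure : ∀ {x} → x ∈ (S ++ T₁) ++ T₂ → χ x ≡ c
        S∪T-pure m with ∈-++⁻ (S ++ T₁) m
        ... | inj₁ i = p (∈-resp-↭ (↭-sym perm₁) i)
        ... | inj₂ i = trans (p′ (∈-resp-↭ (↭-sym perm₂) (∈-++⁺ʳ S i))) (sym c≡)
        un : Unique (((S ++ T₁) ++ T₂) ++ e)
        un = unique-++ unique (wrong-unique w₃) (λ m m′ → other (trans (sym (p₃ m′)) (S∪T-pure m)))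
        empty : ∀ (S : List V) → length S ≡ 0 → S ≡ []
        empty [] _ = refl
        by-size : length S ≡ 0 ⊎ length S ≡ h → ∃ Gadget
        by-size (inj₂ lS) = shared S T₁ T₂ e (wrong-↭ perm₁ wrong₁) (wrong-↭ perm₂ wrong₂) w₃ lS
         (Unique-↭ (++⁺ʳ e (↭-trans (++⁺ʳ T₂ (++-comm S T₁)) (↭-reflexive (++-assoc T₁ S T₂)))) un)
        by-size (inj₁ lS) = three (D ++ Y) (D′ ++ Y′) e wrong₁ wrong₂ w₃
         (Unique-↭ (↭-trans (++⁺ʳ e (++⁺ (↭-sym perm₁) (↭-trans (↭-reflexive (cong (_++ T₂) (sym (empty S lS)))) (↭-sym perm₂)))) (↭-reflexive (++-assoc (D ++ Y) (D′ ++ Y′) e))) un)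

-- Inflexible blocks

search-Fin : ∀ {n} {A : Set} {P : Fin n → Set} → (∀ v → A ⊎ P v) → A ⊎ (∀ v → P v)
search-Fin {zero} f = inj₂ λ ()
search-Fin {suc n} f with f zero | search-Fin (λ v → f (suc v))
... | inj₁ a | _ = inj₁ a
... | inj₂ _ | inj₁ a = inj₁ a
... | inj₂ p | inj₂ q = inj₂ λ { zero → p ; (suc v) → q v }

Ample : ∀ {n} → ℕ → ℕ → (List (Fin n) → Bool) → Set
Ample {n} q t P = q * n ^ t ≤ 2 * q * # t P + n ^ t

ample-upper : ∀ {n} q t (P R : List (Fin n) → Bool) → # t P + # t R ≤ n ^ t → Ample q t R → 2 * q * # t P ≤ q * n ^ t + n ^ t
ample-upper {n} q t P R le am = +-cancelʳ-≤ (2 * q * # t R) _ _ (begin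
 2 * q * # t P + 2 * q * # t R ≡⟨ sym (*-distribˡ-+ (2 * q) (# t P) (# t R)) ⟩
 2 * q * (# t P + # t R) ≤⟨ *-monoʳ-≤ (2 * q) le ⟩
 2 * q * n ^ t ≡⟨ twice q (n ^ t) ⟩
 q * n ^ t + q * n ^ t ≤⟨ +-monoʳ-≤ (q * n ^ t) am ⟩
 q * n ^ t + (2 * q * # t R + n ^ t) ≡⟨ regroup (q * n ^ t) (2 * q * # t R) (n ^ t) ⟩
 q * n ^ t + n ^ t + 2 * q * # t R ∎)
 where
 open ≤-Reasoning
 twice : ∀ q x → 2 * q * x ≡ q * x + q * x
 twice = solve-∀
 regroup : ∀ a b c → a + (b + c) ≡ a + c + b
 regroup = solve-∀

bit-parts : ∀ e p → bit p ≡ bit (p ∧ not e) + bit (e ∧ p)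
bit-parts true true = refl
bit-parts true false = refl
bit-parts false true = refl
bit-parts false false = refl

-- With q ≥ 64 the hypothesis gives 63 x ≤ 128 (a + b).
majority : ∀ q x a b → 64 ≤ q → q * x ≤ 2 * q * (a + b) + x → 64 * a ≤ x → x ≤ 4 * b
majority q x a b q≥ half 64a≤ = *-cancelˡ-≤ 64 (+-cancelʳ-≤ (64 * x) _ _ (begin
 64 * x + 64 * x ≤⟨ +-mono-≤ scaled scaled ⟩
 128 * (a + b) + x + (128 * (a + b) + x) ≡⟨ arith a b x ⟩
 4 * (64 * a) + (256 * b + 2 * x) ≤⟨ +-monoˡ-≤ _ (*-monoʳ-≤ 4 64a≤) ⟩
 4 * x + (256 * b + 2 * x) ≡⟨ arith′ b x ⟩
 64 * (4 * b) + 6 * x ≤⟨ +-monoʳ-≤ (64 * (4 * b)) (*-monoˡ-≤ x (m≤m+n 6 58)) ⟩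
 64 * (4 * b) + 64 * x ∎))
 where
 open ≤-Reasoning
 arith : ∀ r w x → 128 * (r + w) + x + (128 * (r + w) + x) ≡ 4 * (64 * r) + (256 * w + 2 * x)
 arith = solve-∀
 arith′ : ∀ w x → 4 * x + (256 * w + 2 * x) ≡ 64 * (4 * w) + 6 * x
 arith′ = solve-∀
 arith₂ : ∀ q y x → 64 * (2 * q * y + x) ≡ q * (128 * y) + 64 * x
 arith₂ = solve-∀
 scaled : 64 * x ≤ 128 * (a + b) + x
 scaled = *-cancelˡ-≤ q {{>-nonZero (≤-trans (s≤s z≤n) q≥)}} (begin
  q * (64 * x) ≡⟨ *-swap q 64 x ⟩
  64 * (q * x) ≤⟨ *-monoʳ-≤ 64 half ⟩
  64 * (2 * q * (a + b) + x) ≡⟨ arith₂ q (a + b) x ⟩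
  q * (128 * (a + b)) + 64 * x ≤⟨ +-monoʳ-≤ _ (*-monoˡ-≤ x q≥) ⟩
  q * (128 * (a + b)) + q * x ≡⟨ sym (*-distribˡ-+ q _ x) ⟩
  q * (128 * (a + b) + x) ∎)

module Nonflex {B : Base} (Q : Params B)
 (E-unique : ∀ xs → length xs ≡ Blocks.h B + Blocks.h B → Base.E B xs ≡ true → Unique xs)
 (c₁ : ℕ) (1≤c₁ : 1 ≤ c₁) (q₀ : ℕ) (q₀≥ : 64 * c₁ ≤ q₀) (ρ≥ : 64 * c₁ ≤ Params.ρ Q)
 (parity-ample : ∀ b → Ample q₀ (Blocks.h B) (λ Z → Blocks.par B Z ≐ b))
 (degree-ample : ∀ X → length X ≡ Blocks.h B → Unique X → Ample q₀ (Blocks.h B) (λ Z → Base.E B (X ++ Z))) where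

 open OddEdges Q E-unique public

 nonflex : List V → Bool
 nonflex X = fresh [] X ∧ not (rich ρ X)

 nonflex-↭ : ∀ {X Y} → X ↭ Y → nonflex X ≡ true → nonflex Y ≡ true
 nonflex-↭ {X} {Y} p e with ∧-true {fresh [] X} e
 ... | f , r = ∧-intro (unique-fresh Y (subst Unique (sym (++-identityʳ Y)) (Unique-↭ p (fresh-list-unique X f))))
    (trans (cong not (rich-↭ (↭-sym p))) r)
  where
  rich-↭ : ∀ {X Y} → X ↭ Y → rich ρ X ≡ rich ρ Y
  rich-↭ {X} {Y} p = cong (λ k → n ^ h ≤ᵇ ρ * k) (#-cong h (λ Z _ → cong₂ (λ a b → a ∧ (b ≐ τ)) (E-↭ (++⁺ʳ Z p)) (par-↭ (++⁺ʳ Z p))))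

 few-right : ∀ X → rich ρ X ≡ false → ρ * # h (λ Z → linked (X ++ Z)) ≤ n ^ h
 few-right X e = <⇒≤ (≤ᵇ-false {n ^ h} e)

 wrong-part : List V → List V → Bool
 wrong-part X Z = link (not τ) (X ++ Z)

 edge-parts : ∀ X → # h (λ Z → E (X ++ Z)) ≡ # h (λ Z → linked (X ++ Z)) + # h (wrong-part X)
 edge-parts X = #-split h (λ Z _ → parts (E (X ++ Z)) (par (X ++ Z)) τ)
  where
  parts : ∀ e p t → bit e ≡ bit (e ∧ (p ≐ t)) + bit (e ∧ (p ≐ not t))
  parts false p t = refl
  parts true true true = refl
  parts true true false = refl
  parts true false true = refl
  parts true false false = refl

 par-shift : ∀ X b Z → (par (X ++ Z) ≐ b) ≡ (par Z ≐ (par X xor b))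
 par-shift X b Z = trans (cong (_≐ b) (par-++ X Z)) (truth-table 3 (λ x z b → (x xor z) ≐ b) (λ x z b → z ≐ (x xor b)) refl (par X) (par Z) b)

 1≤q₀ : 64 ≤ q₀
 1≤q₀ = ≤-trans (*-monoʳ-≤ 64 1≤c₁) q₀≥

 1≤ρ : 64 ≤ ρ
 1≤ρ = ≤-trans (*-monoʳ-≤ 64 1≤c₁) ρ≥

 nonflex-unique : ∀ X → nonflex X ≡ true → Unique X
 nonflex-unique X e = fresh-list-unique X (∧-left e)

 -- A set with few right neighbours has almost all of the wrong ones.
 missing-wrong : List V → List V → Bool
 missing-wrong X Z = (par (X ++ Z) ≐ not τ) ∧ not (E (X ++ Z))

 missing-rare : ∀ X r → 2 * r ≤ q₀ → 2 * r ≤ ρ → length X ≡ h → nonflex X ≡ true → Rare r h (missing-wrong X)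
 missing-rare X r rq rρ l e = mkRare (*-cancelˡ-≤ (2 * q₀) {{>-nonZero (≤-trans (s≤s z≤n) (*-monoʳ-≤ 2 1≤q₀))}} (begin
   2 * q₀ * (r * M) ≡⟨ regroup₁ q₀ r M ⟩
   r * (2 * q₀ * M) ≤⟨ *-monoʳ-≤ r bound ⟩
   r * (2 * N′ + 2 * q₀ * R) ≡⟨ regroup₂ r N′ q₀ R ⟩
   2 * r * N′ + q₀ * (2 * r * R) ≤⟨ +-mono-≤ (*-monoˡ-≤ N′ rq) (*-monoʳ-≤ q₀ (≤-trans (*-monoˡ-≤ R rρ) (few-right X (not-true (∧-right {fresh [] X} e))))) ⟩
   q₀ * N′ + q₀ * N′ ≡⟨ regroup₃ q₀ N′ ⟩
   2 * q₀ * N′ ∎))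
  where
  open ≤-Reasoning
  M R W N′ Par : ℕ
  M = # h (missing-wrong X)
  R = # h (λ Z → linked (X ++ Z))
  W = # h (wrong-part X)
  N′ = n ^ h
  Par = # h (λ Z → par (X ++ Z) ≐ not τ)
  regroup₁ : ∀ q r m → 2 * q * (r * m) ≡ r * (2 * q * m)
  regroup₁ = solve-∀
  regroup₂ : ∀ r x q y → r * (2 * x + 2 * q * y) ≡ 2 * r * x + q * (2 * r * y)
  regroup₂ = solve-∀
  regroup₃ : ∀ q x → q * x + q * x ≡ 2 * q * x
  regroup₃ = solve-∀
  Par≡ : Par ≡ M + W
  Par≡ = #-split h (λ Z _ → bit-parts (E (X ++ Z)) (par (X ++ Z) ≐ not τ))
  Par≤ : 2 * q₀ * Par ≤ q₀ * N′ + N′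
  Par≤ = ample-upper q₀ h _ (λ Z → par Z ≐ (par X xor τ)) (≤-reflexive (trans (cong (Par +_) (count-shift τ)) total)) (parity-ample (par X xor τ))
   where
   count-shift : ∀ b → # h (λ Z → par Z ≐ (par X xor b)) ≡ # h (λ Z → par (X ++ Z) ≐ b)
   count-shift b = #-cong h (λ Z _ → sym (par-shift X b Z))
   total : Par + # h (λ Z → par (X ++ Z) ≐ τ) ≡ N′
   total = trans (cong (Par +_) (#-cong h (λ Z _ → truth-table 2 (λ p t → p ≐ t) (λ p t → not (p ≐ not t)) refl (par (X ++ Z)) τ)))
    (#-not h (λ Z → par (X ++ Z) ≐ not τ))
  bound : 2 * q₀ * M ≤ 2 * N′ + 2 * q₀ * R
  bound = +-cancelʳ-≤ (2 * q₀ * W + q₀ * N′) _ _ (begin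
   2 * q₀ * M + (2 * q₀ * W + q₀ * N′) ≤⟨ +-monoʳ-≤ (2 * q₀ * M) (+-monoʳ-≤ (2 * q₀ * W) (degree-ample X l (nonflex-unique X e))) ⟩
   2 * q₀ * M + (2 * q₀ * W + (2 * q₀ * # h (λ Z → E (X ++ Z)) + N′)) ≡⟨ cong (λ k → 2 * q₀ * M + (2 * q₀ * W + (2 * q₀ * k + N′))) (edge-parts X) ⟩
   2 * q₀ * M + (2 * q₀ * W + (2 * q₀ * (R + W) + N′)) ≡⟨ arith (2 * q₀) M W R N′ ⟩
   2 * q₀ * (M + W) + (2 * q₀ * R + 2 * q₀ * W + N′) ≤⟨ +-monoˡ-≤ _ (≡-≤ (cong (2 * q₀ *_) (sym Par≡)) Par≤) ⟩
   (q₀ * N′ + N′) + (2 * q₀ * R + 2 * q₀ * W + N′) ≡⟨ arith′ (q₀ * N′) N′ (2 * q₀ * R) (2 * q₀ * W) ⟩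
   2 * N′ + 2 * q₀ * R + (2 * q₀ * W + q₀ * N′) ∎)
   where
   arith : ∀ q m w r x → q * m + (q * w + (q * (r + w) + x)) ≡ q * (m + w) + (q * r + q * w + x)
   arith = solve-∀
   arith′ : ∀ a x r w → (a + x) + (r + w + x) ≡ 2 * x + r + (w + a)
   arith′ = solve-∀

 nonflex-wrong : ∀ X → length X ≡ h → nonflex X ≡ true → Flex (not τ) X
 nonflex-wrong X l e = mkDense (≤-trans (majority q₀ (n ^ h) R W 1≤q₀ (≤-≡ (degree-ample X l (nonflex-unique X e)) (cong (λ k → 2 * q₀ * k + n ^ h) (edge-parts X)))
   (≤-trans (*-monoˡ-≤ R 1≤ρ) (few-right X (not-true (∧-right {fresh [] X} e))))) (*-monoˡ-≤ W (≤-trans (m≤m+n 4 60) 1≤ρ)))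
  where
  R W : ℕ
  R = # h (λ Z → linked (X ++ Z))
  W = # h (wrong-part X)

 nonflex-decide : (∃ λ X → length X ≡ h × nonflex X ≡ true) ⊎ (∀ X → length X ≡ h → Unique X → Flex τ X)
 nonflex-decide = found (0 <? # h nonflex)
  where
  found : Dec (0 < # h nonflex) → (∃ λ X → length X ≡ h × nonflex X ≡ true) ⊎ (∀ X → length X ≡ h → Unique X → Flex τ X)
  found (yes pos) = inj₁ (#-find h pos)
  found (no ¬pos) = inj₂ λ X l u → heavy-dense {P = linked} X (not-false (¬true λ r → ¬pos (subst (λ t → 0 < # t nonflex) l
   (#-pos X (∧-intro (unique-fresh-[] X u) r)))))

 module OddNonflex (splits₁ : ∀ w b → Dense c₁ g (λ f → (par (w ∷ f) ≐ b) ∧ rich ρ (w ∷ f)))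
  (quarter : ∀ c → n ≤ 4 * avail χ c []) (8^h<K : 8 ^ h < 4 * K) (q₁≥ : 64 ≤ q₁)
  (τ≡ : τ ≡ true) (u : ℕ) (m : (14 + suc u) * h ≡ n) (o : oddᵇ (suc u) ≡ true) (wide : Wide) (big : Big) where

  open Odd τ≡ u m o wide big

  good-flex : ∀ X → good X ≡ true → rich ρ X ≡ true
  good-flex X gX = ≤⇒≤ᵇ-true {n ^ h} {ρ * R} (≤-trans (majority q₀ (n ^ h) M R 1≤q₀
    (≤-≡ (parity-ample (par X xor τ)) (cong (λ k → 2 * q₀ * k + n ^ h) Par≡)) (≤-trans (*-monoˡ-≤ M q₁≥) (rare-≤ (good-rare X gX))))
    (*-monoˡ-≤ R (≤-trans (m≤m+n 4 60) 1≤ρ)))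
   where
   R M : ℕ
   R = # h (λ Z → linked (X ++ Z))
   M = # h (λ Z → bad (X ++ Z))
   Par≡ : # h (λ Z → par Z ≐ (par X xor τ)) ≡ M + R
   Par≡ = #-split h (λ Z _ → trans (cong bit (sym (par-shift X τ Z))) (bit-parts (E (X ++ Z)) (par (X ++ Z) ≐ τ)))

  record Exit (ε : Bool) : Set where
   field
    t : V
    R : List V
    nf : nonflex (t ∷ R) ≡ true
    len : length R ≡ g
    few-nonflex : 8 * size (λ z → (χ z ≐ (par R xor ε)) ∧ nonflex (z ∷ R)) < n

  -- The vertices of a nonflexible set are replaced one by one; if at each step there were many nonflexible
  -- replacements of the required colour, then nonflexible sets would not be rare.
  exit-or-many : ∀ ε R zs → length (R ++ zs) ≡ h → nonflex (R ++ zs) ≡ true →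
   Exit ε ⊎ (n ^ length R ≤ 8 ^ length R * # (length R) (λ ys → nonflex (ys ʳ++ zs)))
  exit-or-many ε [] zs l nf = inj₂ (≤-reflexive (sym (trans (+-identityʳ _) (trans (#-zero (λ ys → nonflex (ys ʳ++ zs))) (cong bit nf)))))
  exit-or-many ε (t ∷ R) zs l nf = by-size (8 * size cand <? n)
   where
   R′ : List V
   R′ = R ++ zs
   cand : V → Bool
   cand z = (χ z ≐ (par R′ xor ε)) ∧ nonflex (z ∷ R′)
   r : ℕ
   r = length R
   Many : V → Set
   Many z = cand z ≡ true → n ^ r ≤ 8 ^ r * # r (λ ys → nonflex (ys ʳ++ (z ∷ zs)))
   by-size : Dec (8 * size cand < n) → Exit ε ⊎ (n ^ suc r ≤ 8 ^ suc r * # (suc r) (λ ys → nonflex (ys ʳ++ zs)))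
   by-size (yes few) = inj₁ record { t = t; R = R′; nf = nf; len = suc-injective l; few-nonflex = few }
   by-size (no many) = collect (search-Fin each)
    where
    each : ∀ z → Exit ε ⊎ Many z
    each z with decide (cand z)
    ... | inj₂ no-cand = inj₂ λ e → contradiction (trans (sym e) no-cand) λ ()
    ... | inj₁ yes-cand with exit-or-many ε R (z ∷ zs) (trans (↭-length (shift z R zs)) l) (nonflex-↭ (↭-sym (shift z R zs)) (∧-right {χ z ≐ (par R′ xor ε)} yes-cand))
    ... | inj₁ ex = inj₁ ex
    ... | inj₂ le = inj₂ λ _ → le
    collect : Exit ε ⊎ (∀ z → Many z) → Exit ε ⊎ (n ^ suc r ≤ 8 ^ suc r * # (suc r) (λ ys → nonflex (ys ʳ++ zs)))
    collect (inj₁ ex) = inj₁ ex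
    collect (inj₂ all) = inj₂ (begin
     n * n ^ r ≤⟨ *-monoˡ-≤ (n ^ r) (≮⇒≥ many) ⟩
     8 * size cand * n ^ r ≡⟨ regroup 8 (size cand) (n ^ r) ⟩
     8 * (n ^ r * size cand) ≡⟨ cong (8 *_) (sym (∑-select (n ^ r) cand)) ⟩
     8 * ∑ (λ z → n ^ r * bit (cand z)) ≤⟨ *-monoʳ-≤ 8 (∑-mono pointwise) ⟩
     8 * ∑ (λ z → 8 ^ r * # r (λ ys → nonflex (ys ʳ++ (z ∷ zs)))) ≡⟨ cong (8 *_) (∑-* (8 ^ r) _) ⟩
     8 * (8 ^ r * ∑ (λ z → # r (λ ys → nonflex (ys ʳ++ (z ∷ zs))))) ≡⟨ sym (*-assoc 8 (8 ^ r) _) ⟩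
     8 ^ suc r * ∑ (λ z → # r (λ ys → nonflex (ys ʳ++ (z ∷ zs)))) ≡⟨ cong (8 ^ suc r *_) (sym (#-suc r (λ ys → nonflex (ys ʳ++ zs)))) ⟩
     8 ^ suc r * # (suc r) (λ ys → nonflex (ys ʳ++ zs)) ∎)
     where
     open ≤-Reasoning
     regroup : ∀ a b c → a * b * c ≡ a * (c * b)
     regroup = solve-∀
     pointwise : ∀ z → n ^ r * bit (cand z) ≤ 8 ^ r * # r (λ ys → nonflex (ys ʳ++ (z ∷ zs)))
     pointwise z with cand z in e
     ... | true = ≡-≤ (*-identityʳ (n ^ r)) (all z e)
     ... | false = ≡-≤ (*-zeroʳ (n ^ r)) z≤n

  exit : ∀ ε X → length X ≡ h → nonflex X ≡ true → Exit ε
  exit ε X l nf = go (exit-or-many ε X [] (trans (cong length (++-identityʳ X)) l) (trans (cong nonflex (++-identityʳ X)) nf))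
   where
   k : ℕ
   k = # h nonflex
   rare : 4 * K * k ≤ n ^ h
   rare = ≤-trans (*-monoʳ-≤ (4 * K) (#-mono h λ Y _ e → cong not (¬true λ gY → contradiction (trans (sym (good-flex Y gY)) (not-true (∧-right {fresh [] Y} e))) λ ()))) (rare-≤ not-good)
   go : Exit ε ⊎ (n ^ length X ≤ 8 ^ length X * # (length X) (λ ys → nonflex (ys ʳ++ []))) → Exit ε
   go (inj₁ ex) = ex
   go (inj₂ le) = contradiction (*-cancelʳ-≤ (4 * K) (8 ^ h) k {{>-nonZero k>0}} (≤-trans rare le′)) (<⇒≱ 8^h<K)
    where
    k>0 : 0 < k
    k>0 = subst (λ t → 0 < # t nonflex) l (#-pos X nf)
    le′ : n ^ h ≤ 8 ^ h * k
    le′ = ≤-trans (subst (λ t → n ^ t ≤ 8 ^ t * # t (λ ys → nonflex (ys ʳ++ []))) l le)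
     (*-monoʳ-≤ (8 ^ h) (#-mono h (λ ys _ e → nonflex-↭ (↭-trans (↭-sym (++↭ʳ++ ys [])) (↭-reflexive (++-identityʳ ys))) e)))

  odd-gadget : ∀ X → length X ≡ h → nonflex X ≡ true → ∃ Gadget
  odd-gadget X lX nfX = from-type good-type
   where
   P : Bool
   P = total-parity
   good-type : ∃ λ b → σ b ≡ P
   good-type with decide (σ false ≐ P)
   ... | inj₁ y = false , ≐-true y
   ... | inj₂ no-false = true , trans (σ-not false) (trans (cong not (≐-false {σ false} no-false)) (truth-table 1 (λ p → not (not p)) (λ p → p) refl P))
   from-type : (∃ λ b → σ b ≡ P) → ∃ Gadget
   from-type (ε , ok) = from-exit (exit ε X lX nfX)
    where
    from-exit : Exit ε → ∃ Gadget
    from-exit ex = found (dense-find (dense-minus {q = 8 * c₁} {P = A} {R = λ xs → not (fresh T xs) ∨ missing-wrong T xs} (mkDense dense)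
      (rare-∨ {q = 2 * (8 * c₁)} (rare-weaken (≤-reflexive (regroup c₁)) (clash-rare (32 * c₁) h T clash≤))
       (rare-weaken (≤-reflexive (regroup c₁)) (missing-rare T (32 * c₁) (≡-≤ (double c₁) q₀≥) (≡-≤ (double c₁) ρ≥) lT nf)))))
     where
     open Exit ex
     T : List V
     T = t ∷ R
     lT : length T ≡ h
     lT = cong suc len
     col : Bool
     col = par R xor ε
     regroup : ∀ c → 2 * (2 * (8 * c)) ≡ 32 * c
     regroup = solve-∀
     double : ∀ c → 2 * (32 * c) ≡ 64 * c
     double = solve-∀
     clash≤ : 32 * c₁ * (h * (length T + h)) ≤ n
     clash≤ = ≤-trans (*-mono-≤ (≤-trans (*-monoˡ-≤ c₁ (m≤m+n 32 32)) (≤-trans ρ≥ (m≤m+n ρ (3 * ρ)))) (*-monoʳ-≤ h (+-monoˡ-≤ h (≡-≤ lT (≤-trans (m≤m+n h (19 * h)) big))))) room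
     usable : V → Bool
     usable z = (χ z ≐ col) ∧ not (nonflex (z ∷ R))
     tail-ok : List V → Bool
     tail-ok Y = (par (t ∷ Y) ≐ ε) ∧ rich ρ (t ∷ Y)
     A : List V → Bool
     A [] = false
     A (z ∷ Y) = usable z ∧ tail-ok Y
     usable-many : n ≤ 8 * size usable
     usable-many = +-cancelˡ-≤ n n _ (begin
      n + n ≡⟨ cong (n +_) (sym (+-identityʳ n)) ⟩
      2 * n ≤⟨ *-monoʳ-≤ 2 (quarter col) ⟩
      2 * (4 * avail χ col []) ≡⟨ sym (*-assoc 2 4 (avail χ col [])) ⟩
      8 * avail χ col [] ≡⟨ cong (8 *_) (size-split _ _ _ pointwise) ⟩
      8 * (size nfs + size usable) ≡⟨ *-distribˡ-+ 8 (size nfs) (size usable) ⟩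
      8 * size nfs + 8 * size usable ≤⟨ +-monoˡ-≤ _ (<⇒≤ few-nonflex) ⟩
      n + 8 * size usable ∎)
      where
      open ≤-Reasoning
      nfs : V → Bool
      nfs z = (χ z ≐ col) ∧ nonflex (z ∷ R)
      pointwise : ∀ z → bit ((χ z ≐ col) ∧ true) ≡ bit (nfs z) + bit (usable z)
      pointwise z with χ z ≐ col | nonflex (z ∷ R)
      ... | true | true = refl
      ... | true | false = refl
      ... | false | _ = refl
     dense : n ^ h ≤ 8 * c₁ * # h A
     dense = begin
      n * n ^ g ≤⟨ *-mono-≤ usable-many (dense-≤ (splits₁ t ε)) ⟩
      8 * size usable * (c₁ * # g tail-ok) ≡⟨ arith (size usable) c₁ (# g tail-ok) ⟩
      8 * c₁ * (# g tail-ok * size usable) ≡⟨ cong (8 * c₁ *_) (sym (∑-select (# g tail-ok) usable)) ⟩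
      8 * c₁ * ∑ (λ z → # g tail-ok * bit (usable z)) ≤⟨ *-monoʳ-≤ (8 * c₁) (∑-mono pointwise) ⟩
      8 * c₁ * ∑ (λ z → # g (λ Y → A (z ∷ Y))) ≡⟨ cong (8 * c₁ *_) (sym (#-suc g A)) ⟩
      8 * c₁ * # h A ∎
      where
      open ≤-Reasoning
      arith : ∀ s c t → 8 * s * (c * t) ≡ 8 * c * (t * s)
      arith = solve-∀
      pointwise : ∀ z → # g tail-ok * bit (usable z) ≤ # g (λ Y → usable z ∧ tail-ok Y)
      pointwise z with usable z
      ... | true = ≤-reflexive (*-identityʳ _)
      ... | false = ≡-≤ (*-zeroʳ (# g tail-ok)) z≤n
     found : (∃ λ xs → length xs ≡ h × A xs ∧ not (not (fresh T xs) ∨ missing-wrong T xs) ≡ true) → ∃ Gadget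
     found ([] , () , _)
     found (z ∷ Y , l , e) = 10 + u , odd-one S T′ ok lS lT′ edge (heavy-dense {P = linked} S rich-S) (heavy-dense {P = linked} T′ (∧-right {par T′ ≐ ε} tl)) un pS pT
      where
      S T′ : List V
      S = z ∷ R
      T′ = t ∷ Y
      lS : length S ≡ h
      lS = cong suc len
      lT′ : length T′ ≡ h
      lT′ = l
      parts : A (z ∷ Y) ≡ true × not (not (fresh T (z ∷ Y)) ∨ missing-wrong T (z ∷ Y)) ≡ true
      parts = ∧-true e
      us : usable z ≡ true
      us = ∧-left {usable z} (proj₁ parts)
      tl : tail-ok Y ≡ true
      tl = ∧-right {usable z} (proj₁ parts)
      clean-parts : not (fresh T (z ∷ Y)) ≡ false × missing-wrong T (z ∷ Y) ≡ false
      clean-parts = ∨-false {not (fresh T (z ∷ Y))} (not-true (proj₂ parts))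
      cz : χ z ≡ col
      cz = ≐-true (∧-left {χ z ≐ col} us)
      un : Unique (S ++ T′)
      un = Unique-↭ swap-heads (fresh-unique (z ∷ Y) (nonflex-unique T nf) (not-false (proj₁ clean-parts)))
       where
       swap-heads : z ∷ (Y ++ t ∷ R) ↭ z ∷ (R ++ t ∷ Y)
       swap-heads = _↭_.prep z (↭-trans (shift t Y R) (↭-trans (_↭_.prep t (++-comm Y R)) (↭-sym (shift t R Y))))
      perm : (t ∷ R) ++ (z ∷ Y) ↭ S ++ T′
      perm = ↭-trans (_↭_.prep t (shift z R Y)) (↭-trans (_↭_.swap t z ↭-refl) (_↭_.prep z (↭-sym (shift t R Y))))
      pS : par S ≡ ε
      pS = trans (cong (_xor par R) cz) (truth-table 2 (λ r e → (r xor e) xor r) (λ r e → e) refl (par R) ε)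
      pT : par T′ ≡ ε
      pT = ≐-true (∧-left {par T′ ≐ ε} tl)
      par-all : par ((t ∷ R) ++ (z ∷ Y)) ≡ not τ
      par-all = trans (par-↭ perm) (trans (par-++ S T′) (trans (cong₂ _xor_ pS pT) (trans (xor-self ε) (cong not (sym τ≡)))))
      edge : E (S ++ T′) ≡ true
      edge = trans (sym (E-↭ perm)) (no-missing (E ((t ∷ R) ++ (z ∷ Y))) (trans (sym (cong (_∧ not (E ((t ∷ R) ++ (z ∷ Y)))) (≐-intro par-all))) (proj₂ clean-parts)))
       where
       no-missing : ∀ b → true ∧ not b ≡ false → b ≡ true
       no-missing true _ = refl
      uS : Unique S
      uS = unique-++ˡ S un
      rich-S : rich ρ S ≡ true
      rich-S = not-false (trans (sym (cong (_∧ not (rich ρ S)) (unique-fresh-[] S uS))) (not-true (∧-right {χ z ≐ col} us)))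

-- Degrees and counts of tuples

subset-ext : ∀ {n} {X Y : Subset n} → (∀ v → Vec.lookup X v ≡ Vec.lookup Y v) → X ≡ Y
subset-ext {X = Vec.[]} {Vec.[]} e = refl
subset-ext {X = x Vec.∷ X} {y Vec.∷ Y} e = cong₂ Vec._∷_ (e zero) (subset-ext (λ v → e (suc v)))

∣∣-size : ∀ {n} (X : Subset n) → ∣ X ∣ ≡ size (Vec.lookup X)
∣∣-size {n} Vec.[] = sym (size-false λ ())
∣∣-size (true Vec.∷ X) = trans (cong suc (∣∣-size X)) (sym (trans (size≡ _) (trans (∑-suc _) (cong suc (sym (size≡ _))))))
∣∣-size (false Vec.∷ X) = trans (∣∣-size X) (sym (trans (size≡ _) (trans (∑-suc _) (sym (size≡ _)))))

lookup-setOf : ∀ {n} (xs : List (Fin n)) v → Vec.lookup (setOf xs) v ≡ mem v xs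
lookup-setOf {n} [] v = VecP.lookup-replicate v false
lookup-setOf (x ∷ xs) v = trans (VecP.lookup-zipWith _∨_ v ⁅ x ⁆ (setOf xs)) (cong₂ _∨_ (lookup-single x v) (lookup-setOf xs v))
 where
 lookup-single : ∀ {n} (x v : Fin n) → Vec.lookup ⁅ x ⁆ v ≡ does (v ≟F x)
 lookup-single zero zero = refl
 lookup-single zero (suc v) = VecP.lookup-replicate v false
 lookup-single (suc x) zero = refl
 lookup-single (suc x) (suc v) with v ≟F x | lookup-single x v
 ... | yes _ | e = e
 ... | no _ | e = e

mem-size≤ : ∀ {n} (xs : List (Fin n)) → size (λ v → mem v xs) ≤ length xs
mem-size≤ [] = ≤-reflexive (size-false λ _ → refl)
mem-size≤ (x ∷ xs) = ≡-≤ (size≡ _) (≤-trans (∑-mono (λ v → bit-∨ (does (v ≟F x)) (mem v xs)))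
 (≡-≤ (∑-+ _ _) (+-mono-≤ (≤-reflexive one) (≡-≤ (sym (size≡ _)) (mem-size≤ xs)))))
 where
 one : ∑ (λ v → bit (does (v ≟F x))) ≡ 1
 one = trans (∑-cong (λ v → cong bit (sym (∧-identityʳ (does (v ≟F x)))))) (∑-indicator x true)

full-size-unique : ∀ {n} (xs : List (Fin n)) → size (λ v → mem v xs) ≡ length xs → Unique xs
full-size-unique [] e = []
full-size-unique {n} (x ∷ xs) e with mem x xs in m
... | true = contradiction (≡-≤ (sym e) (≡-≤ (size-cong same) (mem-size≤ xs))) (<⇒≱ ≤-refl)
 where
 same : ∀ v → mem v (x ∷ xs) ≡ mem v xs
 same v with v ≟F x
 ... | yes refl = sym m
 ... | no _ = refl
... | false = ∉-All (mem-∉ xs m) ∷ full-size-unique xs (suc-injective (trans (sym (trans (size-split _ (λ v → does (v ≟F x) ∧ true) (λ v → mem v xs) pointwise)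
   (cong (_+ size (λ v → mem v xs)) (size-indicator x true)))) e))
 where
 pointwise : ∀ v → bit (mem v (x ∷ xs)) ≡ bit (does (v ≟F x) ∧ true) + bit (mem v xs)
 pointwise v with v ≟F x
 ... | yes refl rewrite m = refl
 ... | no _ = refl

size-weighted : ∀ {n} (χ : Fin n → Bool) xs → Unique xs → size (λ v → mem v xs ∧ χ v) ≡ cnt χ true xs
size-weighted χ [] u = size-false λ _ → refl
size-weighted χ (x ∷ xs) (p ∷ u) = trans (size-split _ (λ v → does (v ≟F x) ∧ χ x) (λ v → mem v xs ∧ χ v) pointwise)
 (cong₂ _+_ (trans (size-indicator x (χ x)) (cong bit (truth-table 1 (λ b → b) (λ b → b ≐ true) refl (χ x)))) (size-weighted χ xs u))
 where
 pointwise : ∀ v → bit (mem v (x ∷ xs) ∧ χ v) ≡ bit (does (v ≟F x) ∧ χ x) + bit (mem v xs ∧ χ v)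
 pointwise v with v ≟F x
 ... | yes refl rewrite ∉-mem xs (All-∉ p) = sym (+-identityʳ _)
 ... | no _ = refl

setOf-size : ∀ {n} (xs : List (Fin n)) → ∣ setOf xs ∣ ≡ size (λ v → mem v xs)
setOf-size xs = trans (∣∣-size (setOf xs)) (size-cong (lookup-setOf xs))

setOf-unique : ∀ {n} {xs : List (Fin n)} → Unique xs → ∣ setOf xs ∣ ≡ length xs
setOf-unique {xs = xs} u = trans (setOf-size xs) (trans (size-cong (λ v → truth-table 1 (λ b → b) (λ b → b ∧ true) refl (mem v xs)))
 (trans (size-weighted (λ _ → true) xs u) (all-counted xs)))
 where
 all-counted : ∀ {n} (xs : List (Fin n)) → cnt (λ _ → true) true xs ≡ length xs
 all-counted [] = refl
 all-counted (x ∷ xs) = cong suc (all-counted xs)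

⊆ᵇ-elim : ∀ {n} (X Y : Subset n) → (X ⊆ᵇ Y) ≡ true → ∀ v → Vec.lookup X v ≡ true → Vec.lookup Y v ≡ true
⊆ᵇ-elim (true Vec.∷ X) (y Vec.∷ Y) e zero _ = ∧-left {y} e
⊆ᵇ-elim (x Vec.∷ X) (y Vec.∷ Y) e (suc v) l = ⊆ᵇ-elim X Y (∧-right {not x ∨ y} e) v l

⊆ᵇ-intro : ∀ {n} (X Y : Subset n) → (∀ v → Vec.lookup X v ≡ true → Vec.lookup Y v ≡ true) → (X ⊆ᵇ Y) ≡ true
⊆ᵇ-intro Vec.[] Vec.[] f = refl
⊆ᵇ-intro (true Vec.∷ X) (y Vec.∷ Y) f = ∧-intro (f zero refl) (⊆ᵇ-intro X Y (λ v → f (suc v)))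
⊆ᵇ-intro (false Vec.∷ X) (y Vec.∷ Y) f = ⊆ᵇ-intro X Y (λ v → f (suc v))

count-none : {A : Set} (p : A → Bool) (xs : List A) → (∀ x → p x ≡ false) → count p xs ≡ 0
count-none p [] f = refl
count-none p (x ∷ xs) f rewrite f x = count-none p xs f

count-eq : ∀ {n} (P : Subset n → Bool) X → count (λ Y → P Y ∧ ((X ⊆ᵇ Y) ∧ (Y ⊆ᵇ X))) (allSubsets n) ≡ bit (P X)
count-eq {zero} P Vec.[] with P Vec.[]
... | true = refl
... | false = refl
count-eq {suc n} P (x Vec.∷ X) = trans (count-++ _ (map (true Vec.∷_) (allSubsets n)) _) (trans (cong₂ _+_ (count-map _ (true Vec.∷_) (allSubsets n)) (count-map _ (false Vec.∷_) (allSubsets n))) (by-head x))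
 where
 by-head : ∀ x → count (λ Y → P (true Vec.∷ Y) ∧ (((x Vec.∷ X) ⊆ᵇ (true Vec.∷ Y)) ∧ ((true Vec.∷ Y) ⊆ᵇ (x Vec.∷ X)))) (allSubsets n) +
  count (λ Y → P (false Vec.∷ Y) ∧ (((x Vec.∷ X) ⊆ᵇ (false Vec.∷ Y)) ∧ ((false Vec.∷ Y) ⊆ᵇ (x Vec.∷ X)))) (allSubsets n) ≡ bit (P (x Vec.∷ X))
 by-head true = trans (cong₂ _+_ (count-eq (λ Y → P (true Vec.∷ Y)) X) (count-none _ (allSubsets n) (λ Y → ∧-zeroʳ (P (false Vec.∷ Y))))) (+-identityʳ _)
 by-head false = cong₂ _+_ (count-none _ (allSubsets n) (λ Y → truth-table 2 (λ p q → p ∧ (q ∧ false)) (λ p q → false) refl (P (true Vec.∷ Y)) (X ⊆ᵇ Y))) (count-eq (λ Y → P (false Vec.∷ Y)) X)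

module Degree {n k : ℕ} (G : KGraph n) (uniform : Uniform k G) where

 edge-unique : ∀ xs → length xs ≡ k → G (setOf xs) ≡ true → Unique xs
 edge-unique xs l e = full-size-unique xs (trans (sym (setOf-size xs)) (trans (uniform (setOf xs) e) (sym l)))

 contains-setOf : ∀ (D : List (Fin n)) T → (setOf D ⊆ᵇ T) ≡ true → ∀ {v} → v ∈ D → Vec.lookup T v ≡ true
 contains-setOf D T e {v} m = ⊆ᵇ-elim (setOf D) T e v (trans (lookup-setOf D v) (∈-mem m))

 -- T contains D ∪ {v} for exactly |T| − |D| vertices v outside D.
 extensions : ∀ D T → Unique D → (setOf D ⊆ᵇ T) ≡ true → length D + size (λ v → not (mem v D) ∧ (setOf (v ∷ D) ⊆ᵇ T)) ≡ ∣ T ∣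
 extensions D T u sub = trans (cong (_+ size ext′) (sym (trans (sym (setOf-size D)) (setOf-unique u))))
   (trans (sym (size-split (Vec.lookup T) (λ v → mem v D) ext′ pointwise)) (sym (∣∣-size T)))
  where
  ext′ : Fin n → Bool
  ext′ v = not (mem v D) ∧ (setOf (v ∷ D) ⊆ᵇ T)
  extend-sub : ∀ v → (setOf (v ∷ D) ⊆ᵇ T) ≡ Vec.lookup T v
  extend-sub v = bool-≡ (λ e → contains-setOf (v ∷ D) T e (here refl))
   (λ e → ⊆ᵇ-intro (setOf (v ∷ D)) T λ w lw → inside w (∨-true {does (w ≟F v)} (trans (sym (lookup-setOf (v ∷ D) w)) lw)) e)
   where
   inside : ∀ w → does (w ≟F v) ≡ true ⊎ mem w D ≡ true → Vec.lookup T v ≡ true → Vec.lookup T w ≡ true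
   inside w (inj₁ d) e = subst (λ z → Vec.lookup T z ≡ true) (sym (does-true d)) e
   inside w (inj₂ m) e = contains-setOf D T sub (mem-∈ D m)
  pointwise : ∀ v → bit (Vec.lookup T v) ≡ bit (mem v D) + bit (ext′ v)
  pointwise v with mem v D in m
  ... | true = cong bit (contains-setOf D T sub (mem-∈ D m))
  ... | false = cong bit (sym (extend-sub v))

 degree-tuples : ∀ t D → Unique D → length D + t ≡ k → # t (λ Z → G (setOf (D ++ Z))) ≡ t ! * deg G (setOf D)
 degree-tuples zero D u l = trans (#-zero _) (trans (cong (λ xs → bit (G (setOf xs))) (++-identityʳ D))
   (trans (sym (count-eq G (setOf D))) (trans (count-cong (allSubsets n) pointwise) (sym (+-identityʳ _)))))
  where
  pointwise : ∀ T → G T ∧ ((setOf D ⊆ᵇ T) ∧ (T ⊆ᵇ setOf D)) ≡ G T ∧ (setOf D ⊆ᵇ T)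
  pointwise T with G T in g | setOf D ⊆ᵇ T in s
  ... | false | _ = refl
  ... | true | false = refl
  ... | true | true = ⊆ᵇ-intro T (setOf D) λ v lv → back v lv
   where
   extra : Fin n → Bool
   extra v = Vec.lookup T v ∧ not (mem v D)
   no-extra : size extra ≡ 0
   no-extra = +-cancelˡ-≡ k _ 0 (trans (cong (_+ size extra) (trans (sym l) (trans (+-identityʳ (length D)) (trans (sym (setOf-unique u)) (setOf-size D)))))
    (trans (sym (size-split (Vec.lookup T) (λ v → mem v D) extra split)) (trans (sym (∣∣-size T)) (trans (uniform T g) (sym (+-identityʳ k))))))
    where
    split : ∀ v → bit (Vec.lookup T v) ≡ bit (mem v D) + bit (extra v)
    split v with mem v D in m
    ... | true = trans (cong bit (contains-setOf D T s (mem-∈ D m))) (cong suc (sym (cong bit (truth-table 1 (λ b → b ∧ false) (λ b → false) refl (Vec.lookup T v)))))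
    ... | false = cong bit (truth-table 1 (λ b → b) (λ b → b ∧ true) refl (Vec.lookup T v))
   back : ∀ v → Vec.lookup T v ≡ true → Vec.lookup (setOf D) v ≡ true
   back v lv = trans (lookup-setOf D v) (not-false (¬true λ m → <⇒≱ (size-pos {P = extra} v (∧-intro lv m)) (≤-reflexive no-extra)))
 degree-tuples (suc t) D u l = begin
  # (suc t) (λ Z → G (setOf (D ++ Z)))
   ≡⟨ #-suc t _ ⟩
  ∑ (λ v → # t (λ Z → G (setOf (D ++ v ∷ Z))))
   ≡⟨ ∑-cong by-vertex ⟩
  ∑ (λ v → t ! * count (λ T → G T ∧ new v T) (allSubsets n))
   ≡⟨ ∑-* (t !) _ ⟩
  t ! * ∑ (λ v → count (λ T → G T ∧ new v T) (allSubsets n))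
   ≡⟨ cong (t ! *_) (trans (count-∑ (λ v T → G T ∧ new v T) (allSubsets n)) (by-edge (allSubsets n))) ⟩
  t ! * (suc t * deg G (setOf D))
   ≡⟨ regroup (t !) (suc t) (deg G (setOf D)) ⟩
  suc t * t ! * deg G (setOf D) ∎
  where
  open ≡-Reasoning
  regroup : ∀ a b c → a * (b * c) ≡ b * a * c
  regroup = solve-∀
  new : Fin n → Subset n → Bool
  new v T = not (mem v D) ∧ (setOf (v ∷ D) ⊆ᵇ T)
  by-vertex : ∀ v → # t (λ Z → G (setOf (D ++ v ∷ Z))) ≡ t ! * count (λ T → G T ∧ new v T) (allSubsets n)
  by-vertex v with mem v D in m
  ... | true = trans (trans (#≡S t _) (trans (S-cong t no-edge) (trans (S-const {n} t 0) (*-zeroʳ (n ^ t)))))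
     (sym (trans (cong (t ! *_) (count-none _ (allSubsets n) (λ T → truth-table 1 (λ b → b ∧ false) (λ b → false) refl (G T)))) (*-zeroʳ (t !))))
   where
   no-edge : ∀ Z → length Z ≡ t → bit (G (setOf (D ++ v ∷ Z))) ≡ 0
   no-edge Z lZ = cong bit (¬true λ e → unique-disjoint D (edge-unique (D ++ v ∷ Z) (trans (length-++ D) (trans (cong (λ z → length D + suc z) lZ) l)) e) (mem-∈ D m) (here refl))
  ... | false = trans (#-cong t (λ Z _ → cong G (setOf-↭ (shift v D Z))))
     (degree-tuples t (v ∷ D) (∉-All (mem-∉ D m) ∷ u) (trans (sym (+-suc (length D) t)) l))
  by-edge : ∀ Xs → sum (map (λ T → size (λ v → G T ∧ new v T)) Xs) ≡ suc t * count (λ T → G T ∧ (setOf D ⊆ᵇ T)) Xs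
  by-edge [] = sym (*-zeroʳ (suc t))
  by-edge (T ∷ Ts) = trans (cong₂ _+_ single-edge (by-edge Ts)) (trans (sym (*-distribˡ-+ (suc t) (bit (G T ∧ (setOf D ⊆ᵇ T))) _))
    (cong (suc t *_) (sym (count-∷ (λ T → G T ∧ (setOf D ⊆ᵇ T)) T Ts))))
   where
   single-edge : size (λ v → G T ∧ new v T) ≡ suc t * bit (G T ∧ (setOf D ⊆ᵇ T))
   single-edge with G T in g | setOf D ⊆ᵇ T in s
   ... | false | _ = trans (size-false λ _ → refl) (sym (*-zeroʳ (suc t)))
   ... | true | true = trans (+-cancelˡ-≡ (length D) _ (suc t) (trans (extensions D T u s) (trans (uniform T g) (sym l)))) (sym (*-identityʳ (suc t)))
   ... | true | false = trans (size-false λ v → ¬true λ e → contradiction (trans (sym (⊆ᵇ-intro (setOf D) T λ w lw →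
       ⊆ᵇ-elim (setOf (v ∷ D)) T (∧-right {not (mem v D)} e) w (trans (lookup-setOf (v ∷ D) w) (∨-introʳ {does (w ≟F v)} (trans (sym (lookup-setOf D w)) lw))))) s) λ ())
      (sym (*-zeroʳ (suc t)))

 edge-tuples : # k (λ Z → G (setOf Z)) ≡ k ! * count G (allSubsets n)
 edge-tuples = trans (degree-tuples k [] [] refl) (cong (k ! *_) (count-cong (allSubsets n) (λ T → trans (cong (G T ∧_) (⊆ᵇ-intro (setOf []) T λ v lv →
  contradiction (trans (sym lv) (lookup-setOf [] v)) λ ())) (truth-table 1 (λ b → b ∧ true) (λ b → b) refl (G T)))))

minList-≤ : {A : Set} (f : A → ℕ) {xs : List A} {x : A} → x ∈ xs → minList (map f xs) ≤ f x
minList-≤ f {x ∷ []} (here refl) = ≤-refl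
minList-≤ f {x ∷ y ∷ xs} (here refl) = m⊓n≤m _ _
minList-≤ f {x ∷ y ∷ xs} (there m) = ≤-trans (m⊓n≤n (f x) _) (minList-≤ f m)

minList-attained : {A : Set} (f : A → ℕ) {xs : List A} {x : A} → x ∈ xs → ∃ λ y → y ∈ xs × minList (map f xs) ≡ f y
minList-attained f {x ∷ []} _ = x , here refl , refl
minList-attained f {x ∷ y ∷ xs} _ with minList-attained f {y ∷ xs} (here refl) | ≤-total (f x) (minList (map f (y ∷ xs)))
... | z , m , e | inj₁ le = x , here refl , m≤n⇒m⊓n≡m le
... | z , m , e | inj₂ le = z , there m , trans (m≥n⇒m⊓n≡n le) e

maxList-≥ : ∀ {xs x} → x ∈ xs → x ≤ maxList xs
maxList-≥ {x ∷ xs} (here refl) = m≤m⊔n x (maxList xs)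
maxList-≥ {y ∷ xs} (there m) = ≤-trans (maxList-≥ m) (m≤n⊔m y (maxList xs))

setOf-members : ∀ {n} (X : Subset n) → setOf (members (Vec.lookup X)) ≡ X
setOf-members X = subset-ext λ v → trans (lookup-setOf (members (Vec.lookup X)) v)
 (bool-≡ (λ e → members-elim (Vec.lookup X) (mem-∈ (members (Vec.lookup X)) e)) (λ e → ∈-mem (∈-members (Vec.lookup X) e)))

δ-≤ : ∀ {n} d (G : KGraph n) D → Unique D → length D ≡ d → δ d G ≤ deg G (setOf D)
δ-≤ {n} d G D u l = minList-≤ (deg G) (∈-filter⁺ (λ S → ∣ S ∣ Data.Nat.≟ d) (∈-allSubsets (setOf D)) (trans (setOf-unique u) l))

δ-attained : ∀ {n} d (G : KGraph n) D → Unique D → length D ≡ d → ∃ λ D₀ → Unique D₀ × length D₀ ≡ d × δ d G ≡ deg G (setOf D₀)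
δ-attained {n} d G D u l with minList-attained (deg G) (∈-filter⁺ (λ S → ∣ S ∣ Data.Nat.≟ d) (∈-allSubsets (setOf D)) (trans (setOf-unique u) l))
... | X , m , e = members (Vec.lookup X) , members-unique _ , trans (members-length _) (trans (sym (∣∣-size X)) (proj₂ (∈-filter⁻ (λ S → ∣ S ∣ Data.Nat.≟ d) {xs = allSubsets n} m))) ,
   trans e (cong (deg G) (sym (setOf-members X)))

-- The list form of δ(H) > δ(G).
beats : ∀ {n} d t (G H : KGraph n) → Uniform (d + t) G → Uniform (d + t) H → δ d G < δ d H → ∀ D₁ → Unique D₁ → length D₁ ≡ d →
 ∃ λ D₀ → Unique D₀ × length D₀ ≡ d × (∀ D → Unique D → length D ≡ d →
  # t (λ Z → G (setOf (D₀ ++ Z))) < # t (λ Z → H (setOf (D ++ Z))))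
beats d t G H uG uH lt D₁ u₁ l₁ with δ-attained d G D₁ u₁ l₁
... | D₀ , u₀ , l₀ , e = D₀ , u₀ , l₀ , λ D u l → subst₂ _<_
   (sym (Degree.degree-tuples G uG t D₀ u₀ (cong (_+ t) l₀))) (sym (Degree.degree-tuples H uH t D u (cong (_+ t) l)))
   (*-monoʳ-< (t !) {{t !≢0}} (<-≤-trans (subst (_< δ d H) e lt) (δ-≤ d H D u l)))
 where open import Data.Nat.Properties using (_!≢0)

Halfish : ∀ {n} → ℕ → (Fin n → Bool) → Set
Halfish {n} q χ = ∀ c → q * n ≤ 2 * q * avail χ c [] + n

avail-class : ∀ {n} (χ : Fin n → Bool) c → avail χ c [] ≡ size (λ v → χ v ≐ c)
avail-class χ c = size-cong (λ v → truth-table 1 (λ b → b ∧ true) (λ b → b) refl (χ v ≐ c))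

#-parity : ∀ {n} (χ : Fin n → Bool) t b M → (∀ c → M ≤ avail χ c []) →
 M * n ^ t ≤ # (suc t) (λ Z → xors (map χ Z) ≐ b)
#-parity {n} χ t b M big = begin
 M * n ^ t ≡⟨ cong (M *_) (sym both) ⟩
 M * (f true + f false) ≡⟨ *-distribˡ-+ M (f true) (f false) ⟩
 M * f true + M * f false ≤⟨ +-mono-≤ (*-monoˡ-≤ (f true) (≤-≡ (big true) (avail-class χ true))) (*-monoˡ-≤ (f false) (≤-≡ (big false) (avail-class χ false))) ⟩
 size (λ v → χ v ≐ true) * f true + size (λ v → χ v ≐ false) * f false ≡⟨ cong₂ _+_ (trans (*-comm _ (f true)) (sym (∑-select (f true) _))) (trans (*-comm _ (f false)) (sym (∑-select (f false) _))) ⟩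
 ∑ (λ v → f true * bit (χ v ≐ true)) + ∑ (λ v → f false * bit (χ v ≐ false)) ≡⟨ sym (∑-+ _ _) ⟩
 ∑ (λ v → f true * bit (χ v ≐ true) + f false * bit (χ v ≐ false)) ≡⟨ ∑-cong pointwise ⟩
 ∑ (λ v → f (χ v)) ≡⟨ ∑-cong (λ v → #-cong t (λ Z _ → truth-table 3 (λ c z b → z ≐ (c xor b)) (λ c z b → (c xor z) ≐ b) refl (χ v) (xors (map χ Z)) b)) ⟩
 ∑ (λ v → # t (λ Z → xors (map χ (v ∷ Z)) ≐ b)) ≡⟨ sym (#-suc t _) ⟩
 # (suc t) (λ Z → xors (map χ Z) ≐ b) ∎
 where
 open ≤-Reasoning
 f : Bool → ℕ
 f c = # t (λ Z → xors (map χ Z) ≐ (c xor b))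
 both : f true + f false ≡ n ^ t
 both = trans (+-comm (f true) (f false)) (trans (cong (f false +_) (#-cong t (λ Z _ → truth-table 2 (λ z b → z ≐ (true xor b)) (λ z b → not (z ≐ b)) refl (xors (map χ Z)) b))) (#-not t _))
 pointwise : ∀ v → f true * bit (χ v ≐ true) + f false * bit (χ v ≐ false) ≡ f (χ v)
 pointwise v with χ v
 ... | true = trans (cong₂ _+_ (*-identityʳ (f true)) (*-zeroʳ (f false))) (+-identityʳ (f true))
 ... | false = trans (cong₂ _+_ (*-zeroʳ (f true)) (*-identityʳ (f false))) refl

halfish-ample : ∀ {n} q (χ : Fin n → Bool) t b → Halfish q χ → Ample q (suc t) (λ Z → xors (map χ Z) ≐ b)
halfish-ample {n} q χ t b hf = begin
 q * (n * n ^ t) ≡⟨ sym (*-assoc q n (n ^ t)) ⟩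
 q * n * n ^ t ≤⟨ *-monoˡ-≤ (n ^ t) min-bound ⟩
 (2 * q * M + n) * n ^ t ≡⟨ arith (2 * q) M n (n ^ t) ⟩
 2 * q * (M * n ^ t) + n * n ^ t ≤⟨ +-monoˡ-≤ (n * n ^ t) (*-monoʳ-≤ (2 * q) (#-parity χ t b M λ { true → m⊓n≤m _ _ ; false → m⊓n≤n (avail χ true []) _ })) ⟩
 2 * q * # (suc t) (λ Z → xors (map χ Z) ≐ b) + n * n ^ t ∎
 where
 open ≤-Reasoning
 M : ℕ
 M = avail χ true [] Data.Nat.⊓ avail χ false []
 arith : ∀ q m n x → (q * m + n) * x ≡ q * (m * x) + n * x
 arith = solve-∀
 min-bound : q * n ≤ 2 * q * M + n
 min-bound with ≤-total (avail χ true []) (avail χ false [])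
 ... | inj₁ le = ≤-≡ (hf true) (cong (λ m → 2 * q * m + n) (sym (m≤n⇒m⊓n≡m le)))
 ... | inj₂ le = ≤-≡ (hf false) (cong (λ m → 2 * q * m + n) (sym (m≥n⇒m⊓n≡n le)))

-- Removing a rare set from an ample one halves the precision.
ample-minus : ∀ {n} q t (P R F : List (Fin n) → Bool) → Ample (2 * q) t P → Rare (4 * q) t R →
 (∀ Z → length Z ≡ t → P Z ≡ true → R Z ≡ false → F Z ≡ true) → Ample q t F
ample-minus {n} q t P R F am (mkRare r) imp = *-cancelˡ-≤ 2 (begin
 2 * (q * N) ≡⟨ sym (*-assoc 2 q N) ⟩
 2 * q * N ≤⟨ am ⟩
 2 * (2 * q) * # t P + N ≤⟨ +-monoˡ-≤ N (*-monoʳ-≤ (2 * (2 * q)) (≤-trans (#-mono t split) (#-∨ t F R))) ⟩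
 2 * (2 * q) * (# t F + # t R) + N ≡⟨ arith q (# t F) (# t R) N ⟩
 4 * q * # t F + (4 * q * # t R + N) ≤⟨ +-monoʳ-≤ (4 * q * # t F) (+-monoˡ-≤ N r) ⟩
 4 * q * # t F + (N + N) ≡⟨ arith′ q (# t F) N ⟩
 2 * (2 * q * # t F + N) ∎)
 where
 open ≤-Reasoning
 N : ℕ
 N = n ^ t
 arith : ∀ q f r x → 2 * (2 * q) * (f + r) + x ≡ 4 * q * f + (4 * q * r + x)
 arith = solve-∀
 arith′ : ∀ q f x → 4 * q * f + (x + x) ≡ 2 * (2 * q * f + x)
 arith′ = solve-∀
 split : ∀ Z → length Z ≡ t → P Z ≡ true → F Z ∨ R Z ≡ true
 split Z l e with R Z in eR
 ... | true = ∨-introʳ {F Z} refl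
 ... | false = ∨-introˡ (imp Z l e eR)

ample-down : ∀ {n} q s t (F : List (Fin n) → Bool) (X : List (Fin n)) → Rare (4 * q) s (λ W → not (fresh X W)) →
 (∀ W → length W ≡ s → fresh X W ≡ true → Ample (2 * q) t (λ Z → F (W ++ Z))) → Ample q (s + t) F
ample-down {n} q s t F X (mkRare r) am = *-cancelˡ-≤ 2 (begin
 2 * (q * n ^ (s + t)) ≡⟨ trans (cong (λ k → 2 * (q * k)) (^-distribˡ-+-* n s t)) (arith₀ q (n ^ s) N) ⟩
 n ^ s * (2 * q * N) ≡⟨ trans (*-comm (n ^ s) _) (sym (trans (S-const′ (2 * q * N)) (*-comm (n ^ s) _))) ⟩
 Sum s (λ _ → 2 * q * N) ≤⟨ S-mono s pointwise ⟩
 Sum s (λ W → (2 * (2 * q) * # t (λ Z → F (W ++ Z)) + N) + 2 * q * N * bit (not (fresh X W))) ≡⟨ trans (S-+ s _ _) (cong₂ _+_ (trans (S-+ s _ _) (cong₂ _+_ (S-* s (2 * (2 * q)) _) (S-const′ N))) (S-bit s (2 * q * N) _)) ⟩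
 (2 * (2 * q) * Sum s (λ W → # t (λ Z → F (W ++ Z))) + n ^ s * N) + 2 * q * N * C ≡⟨ cong (λ k → (2 * (2 * q) * k + n ^ s * N) + 2 * q * N * C) (sym (#-++ s t F)) ⟩
 (2 * (2 * q) * # (s + t) F + n ^ s * N) + 2 * q * N * C ≤⟨ +-monoʳ-≤ (2 * (2 * q) * # (s + t) F + n ^ s * N) small ⟩
 (2 * (2 * q) * # (s + t) F + n ^ s * N) + n ^ s * N ≡⟨ arith q (# (s + t) F) (n ^ s * N) ⟩
 2 * (2 * q * # (s + t) F + n ^ s * N) ≡⟨ cong (λ k → 2 * (2 * q * # (s + t) F + k)) (sym (^-distribˡ-+-* n s t)) ⟩
 2 * (2 * q * # (s + t) F + n ^ (s + t)) ∎)
 where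
 open ≤-Reasoning
 N C : ℕ
 N = n ^ t
 C = # s (λ W → not (fresh X W))
 S-const′ : ∀ c → Sum {n} s (λ _ → c) ≡ n ^ s * c
 S-const′ c = S-const {n} s c
 arith₀ : ∀ q a b → 2 * (q * (a * b)) ≡ a * (2 * q * b)
 arith₀ = solve-∀
 arith : ∀ q f x → (2 * (2 * q) * f + x) + x ≡ 2 * (2 * q * f + x)
 arith = solve-∀
 small : 2 * q * N * C ≤ n ^ s * N
 small = ≡-≤ (swap q N C) (*-monoˡ-≤ N (≤-trans (*-monoˡ-≤ C (*-monoˡ-≤ q (s≤s (s≤s (z≤n {2}))))) r))
  where
  swap : ∀ q x c → 2 * q * x * c ≡ 2 * q * c * x
  swap = solve-∀
 pointwise : ∀ W → length W ≡ s → 2 * q * N ≤ (2 * (2 * q) * # t (λ Z → F (W ++ Z)) + N) + 2 * q * N * bit (not (fresh X W))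
 pointwise W l with fresh X W in f
 ... | true = ≤-trans (am W l f) (m≤m+n _ _)
 ... | false = ≡-≤ (sym (*-identityʳ (2 * q * N))) (m≤n+m _ (2 * (2 * q) * # t (λ Z → F (W ++ Z)) + N))

ample-dense : ∀ {n} q t (P : List (Fin n) → Bool) → 3 ≤ q → Ample q t P → Dense 3 t P
ample-dense {n} q t P q≥3 am = mkDense (*-cancelˡ-≤ q {{>-nonZero (≤-trans (s≤s z≤n) q≥3)}} (begin
 q * N ≤⟨ *-cancelˡ-≤ 2 doubled ⟩
 q * (3 * # t P) ∎))
 where
 open ≤-Reasoning
 N : ℕ
 N = n ^ t
 doubled : 2 * (q * N) ≤ 2 * (q * (3 * # t P))
 doubled = +-cancelʳ-≤ (3 * N) _ _ (begin
  2 * (q * N) + 3 * N ≤⟨ +-monoʳ-≤ (2 * (q * N)) (*-monoˡ-≤ N q≥3) ⟩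
  2 * (q * N) + q * N ≡⟨ arith q N ⟩
  3 * (q * N) ≤⟨ *-monoʳ-≤ 3 am ⟩
  3 * (2 * q * # t P + N) ≡⟨ arith′ q (# t P) N ⟩
  2 * (q * (3 * # t P)) + 3 * N ∎)
  where
  arith : ∀ q x → 2 * (q * x) + q * x ≡ 3 * (q * x)
  arith = solve-∀
  arith′ : ∀ q p x → 3 * (2 * q * p + x) ≡ 2 * (q * (3 * p)) + 3 * x
  arith′ = solve-∀

parityGraph : ∀ {n} → ℕ → Bool → Subset n → KGraph n
parityGraph k true A = 𝓑 k A
parityGraph k false A = 𝓑̄ k A

≡ᵇ-refl : ∀ k → (k Data.Nat.≡ᵇ k) ≡ true
≡ᵇ-refl zero = refl
≡ᵇ-refl (suc k) = ≡ᵇ-refl k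

≡ᵇ-true : ∀ {a b} → (a Data.Nat.≡ᵇ b) ≡ true → a ≡ b
≡ᵇ-true {zero} {zero} e = refl
≡ᵇ-true {suc a} {suc b} e = cong suc (≡ᵇ-true e)

fresh-size : ∀ {n} k (xs : List (Fin n)) → length xs ≡ k → (∣ setOf xs ∣ Data.Nat.≡ᵇ k) ≡ fresh [] xs
fresh-size k xs refl = bool-≡
 (λ e → unique-fresh xs (subst Unique (sym (++-identityʳ xs)) (full-size-unique xs (trans (sym (setOf-size xs)) (≡ᵇ-true e)))))
 (λ e → trans (cong (Data.Nat._≡ᵇ length xs) (setOf-unique (fresh-list-unique xs e))) (≡ᵇ-refl (length xs)))

isOdd-list : ∀ {n} (A : Subset n) xs → Unique xs → isOdd A (setOf xs) ≡ xors (map (Vec.lookup A) xs)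
isOdd-list A xs u = trans (cong oddᵇ (trans (∣∣-size (setOf xs ∩ A)) (trans (size-cong λ v →
 trans (VecP.lookup-zipWith _∧_ v (setOf xs) A) (cong (_∧ Vec.lookup A v) (lookup-setOf xs v))) (size-weighted (Vec.lookup A) xs u)))) (odd-cnt (Vec.lookup A) xs)

parityGraph-list : ∀ {n} k b (A : Subset n) xs → length xs ≡ k →
 parityGraph k b A (setOf xs) ≡ fresh [] xs ∧ (xors (map (Vec.lookup A) xs) ≐ b)
parityGraph-list k b A xs l = trans (shape b) (trans (cong (_∧ (isOdd A (setOf xs) ≐ b)) (fresh-size k xs l)) (replace (fresh [] xs) refl))
 where
 shape : ∀ b → parityGraph k b A (setOf xs) ≡ (∣ setOf xs ∣ Data.Nat.≡ᵇ k) ∧ (isOdd A (setOf xs) ≐ b)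
 shape true = cong ((∣ setOf xs ∣ Data.Nat.≡ᵇ k) ∧_) (truth-table 1 (λ x → x) (λ x → x ≐ true) refl (isOdd A (setOf xs)))
 shape false = cong ((∣ setOf xs ∣ Data.Nat.≡ᵇ k) ∧_) (truth-table 1 (λ x → not x) (λ x → x ≐ false) refl (isOdd A (setOf xs)))
 replace : ∀ f → fresh [] xs ≡ f → f ∧ (isOdd A (setOf xs) ≐ b) ≡ f ∧ (xors (map (Vec.lookup A) xs) ≐ b)
 replace false e = refl
 replace true e = cong (_≐ b) (isOdd-list A xs (fresh-list-unique xs e))

parityGraph-uniform : ∀ {n} k b (A : Subset n) → Uniform k (parityGraph k b A)
parityGraph-uniform k true A S e = ≡ᵇ-true (∧-left {∣ S ∣ Data.Nat.≡ᵇ k} e)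
parityGraph-uniform k false A S e = ≡ᵇ-true (∧-left {∣ S ∣ Data.Nat.≡ᵇ k} e)

∑-permute : ∀ {n} (π π⁻¹ : Fin n → Fin n) → (∀ v → π (π⁻¹ v) ≡ v) → (∀ v → π⁻¹ (π v) ≡ v) → (f : Fin n → Bool) →
 size (λ i → f (π i)) ≡ size f
∑-permute {n} π π⁻¹ r l f = trans (size≡ _) (trans (∑-cong expand) (trans (∑-comm (λ i v → bit (does (v ≟F π i) ∧ f v)))
  (trans (∑-cong collapse) (sym (size≡ f)))))
 where
 expand : ∀ i → bit (f (π i)) ≡ ∑ (λ v → bit (does (v ≟F π i) ∧ f v))
 expand i = sym (trans (∑-cong same) (∑-indicator (π i) (f (π i))))
  where
  same : ∀ v → bit (does (v ≟F π i) ∧ f v) ≡ bit (does (v ≟F π i) ∧ f (π i))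
  same v with v ≟F π i
  ... | yes refl = refl
  ... | no _ = refl
 collapse : ∀ v → ∑ (λ i → bit (does (v ≟F π i) ∧ f v)) ≡ bit (f v)
 collapse v = trans (∑-cong λ i → cong (λ b → bit (b ∧ f v)) (bool-≡
   (λ e → true-does (trans (sym (l i)) (cong π⁻¹ (sym (does-true e)))))
   (λ e → true-does (trans (sym (r v)) (cong π (sym (does-true e))))))) (∑-indicator (π⁻¹ v) (f v))

relabel : ∀ {n} → Permutation′ n → Subset n → Subset n
relabel π A = Vec.tabulate (λ v → Vec.lookup A (π ⟨$⟩ˡ v))
 where open import Data.Fin.Permutation using (_⟨$⟩ˡ_)

copy-parityGraph : ∀ {n} k b (A : Subset n) (π : Permutation′ n) S → copy π (parityGraph k b A) S ≡ parityGraph k b (relabel π A) S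
copy-parityGraph {n} k b A π S = shape b
 where
 open import Data.Fin.Permutation using (_⟨$⟩ˡ_; inverseˡ; inverseʳ)
 S∘π : Subset n
 S∘π = Vec.tabulate (λ i → Vec.lookup S (π ⟨$⟩ʳ i))
 permute : (f : Fin n → Bool) → size (λ i → f (π ⟨$⟩ʳ i)) ≡ size f
 permute = ∑-permute (π ⟨$⟩ʳ_) (π ⟨$⟩ˡ_) (λ v → inverseʳ π) (λ v → inverseˡ π)
 size-same : ∣ S∘π ∣ ≡ ∣ S ∣
 size-same = trans (∣∣-size S∘π) (trans (size-cong (VecP.lookup∘tabulate _)) (trans (permute (Vec.lookup S)) (sym (∣∣-size S))))
 odd-same : isOdd A S∘π ≡ isOdd (relabel π A) S
 odd-same = cong oddᵇ (trans (∣∣-size (S∘π ∩ A)) (trans (size-cong left) (trans (permute both) (trans (sym (size-cong right)) (sym (∣∣-size (S ∩ relabel π A)))))))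
  where
  both : Fin n → Bool
  both v = Vec.lookup S v ∧ Vec.lookup A (π ⟨$⟩ˡ v)
  left : ∀ i → Vec.lookup (S∘π ∩ A) i ≡ both (π ⟨$⟩ʳ i)
  left i = trans (VecP.lookup-zipWith _∧_ i S∘π A) (cong₂ _∧_ (VecP.lookup∘tabulate _ i) (cong (Vec.lookup A) (sym (inverseˡ π))))
  right : ∀ v → Vec.lookup (S ∩ relabel π A) v ≡ both v
  right v = trans (VecP.lookup-zipWith _∧_ v S (relabel π A)) (cong (Vec.lookup S v ∧_) (VecP.lookup∘tabulate _ v))
 shape : ∀ b → parityGraph k b A S∘π ≡ parityGraph k b (relabel π A) S
 shape true = cong₂ (λ s o → (s Data.Nat.≡ᵇ k) ∧ o) size-same odd-same
 shape false = cong₂ (λ s o → (s Data.Nat.≡ᵇ k) ∧ not o) size-same odd-same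

relabel-size : ∀ {n} (A : Subset n) (π : Permutation′ n) → ∣ relabel π A ∣ ≡ ∣ A ∣
relabel-size A π = trans (∣∣-size (relabel π A)) (trans (size-cong (VecP.lookup∘tabulate _))
 (trans (∑-permute (π ⟨$⟩ˡ_) (π ⟨$⟩ʳ_) (λ v → inverseˡ π) (λ v → inverseʳ π) (Vec.lookup A)) (sym (∣∣-size A))))
 where open import Data.Fin.Permutation using (_⟨$⟩ˡ_; inverseˡ; inverseʳ)

-- Cleaning the partition

opaque
 unfolding Sum
 Sum-suc : ∀ {n} t (f : List (Fin n) → ℕ) → Sum (suc t) f ≡ ∑ (λ v → Sum t (λ xs → f (v ∷ xs)))
 Sum-suc t f = refl

anyᵇ : ∀ {n} → (Fin n → Bool) → List (Fin n) → Bool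
anyᵇ F [] = false
anyᵇ F (x ∷ xs) = F x ∨ anyᵇ F xs

#-any : ∀ {n} t (F : Fin n → Bool) → n * # t (anyᵇ F) ≤ t * size F * n ^ t
#-any {n} zero F = ≡-≤ (trans (cong (n *_) (#-zero {n} (anyᵇ F))) (*-zeroʳ n)) z≤n
#-any {n} (suc t) F = begin
 n * # (suc t) (anyᵇ F) ≡⟨ cong (n *_) (#-suc t (anyᵇ F)) ⟩
 n * ∑ (λ v → # t (λ xs → F v ∨ anyᵇ F xs)) ≤⟨ *-monoʳ-≤ n (∑-mono split) ⟩
 n * ∑ (λ v → n ^ t * bit (F v) + # t (anyᵇ F)) ≡⟨ cong (n *_) (trans (∑-+ _ _) (cong₂ _+_ (∑-select (n ^ t) F) (∑-const n _))) ⟩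
 n * (n ^ t * size F + n * # t (anyᵇ F)) ≤⟨ *-monoʳ-≤ n (+-monoʳ-≤ (n ^ t * size F) (#-any t F)) ⟩
 n * (n ^ t * size F + t * size F * n ^ t) ≡⟨ arith n (n ^ t) (size F) t ⟩
 suc t * size F * (n * n ^ t) ∎
 where
 open ≤-Reasoning
 arith : ∀ n x s t → n * (x * s + t * s * x) ≡ (s + t * s) * (n * x)
 arith = solve-∀
 split : ∀ v → # t (λ xs → F v ∨ anyᵇ F xs) ≤ n ^ t * bit (F v) + # t (anyᵇ F)
 split v with F v
 ... | true = ≤-trans (#-≤ t _) (≡-≤ (sym (*-identityʳ (n ^ t))) (m≤m+n _ _))
 ... | false = m≤n+m _ _

any-rare : ∀ {n} .{{_ : NonZero n}} q t (F : Fin n → Bool) → q * (t * size F) ≤ n → Rare q t (anyᵇ F)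
any-rare {n} q t F le = mkRare (*-cancelˡ-≤ n (begin
 n * (q * # t (anyᵇ F)) ≡⟨ *-swap n q (# t (anyᵇ F)) ⟩
 q * (n * # t (anyᵇ F)) ≤⟨ *-monoʳ-≤ q (#-any t F) ⟩
 q * (t * size F * n ^ t) ≡⟨ sym (*-assoc q _ (n ^ t)) ⟩
 q * (t * size F) * n ^ t ≤⟨ *-monoˡ-≤ (n ^ t) le ⟩
 n * n ^ t ∎))
 where
 open ≤-Reasoning

any-false : ∀ {n} (F : Fin n → Bool) (χ χ′ : Fin n → Bool) → (∀ v → F v ≡ false → χ v ≡ χ′ v) → ∀ xs → anyᵇ F xs ≡ false → map χ xs ≡ map χ′ xs
any-false F χ χ′ same [] e = refl
any-false F χ χ′ same (x ∷ xs) e = cong₂ _∷_ (same x (∨-left e)) (any-false F χ χ′ same xs (∨-right {F x} e))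

opaque
 c₁ : ℕ
 c₁ = 768

 1≤c₁ : 1 ≤ c₁
 1≤c₁ = s≤s z≤n

 budget : ℕ → ℕ
 budget r = 38 * (192 * r)

module Cleaning {n : ℕ} .{{_ : NonZero n}} (χ₀ : Fin n → Bool) (τ : Bool) (E : List (Fin n) → Bool)
 (E-↭ : ∀ {xs ys} → xs ↭ ys → E xs ≡ E ys) (g′ Q : ℕ)
 (third : ∀ c → n ≤ 3 * avail χ₀ c []) (12≤n : 12 ≤ n)
 (edges : ∀ D → Unique D → length D ≡ 3 → Dense 3 (g′ + suc g′) (λ Z → E (D ++ Z)))
 (bad-rare₀ : Rare Q (suc (2 + (g′ + suc g′))) (λ xs → (xors (map χ₀ xs) ≐ τ) ∧ not (E xs))) where

 V : Set
 V = Fin n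

 g h t : ℕ
 g = suc g′
 h = suc g
 t = g′ + g

 par₀ : List V → Bool
 par₀ xs = xors (map χ₀ xs)

 mixed? : List V → Bool
 mixed? (x ∷ y ∷ r) = (χ₀ x ≐ true) ∧ (χ₀ y ≐ false)
 mixed? _ = false

 R : V → Bool → List V → Bool
 R w c f = mixed? f ∧ (E (w ∷ f) ∧ (par₀ f ≐ c))

 pairs : ∀ (P : List V → Bool) → # (2 + t) P ≡ ∑ (λ x → ∑ (λ y → # t (λ r → P (x ∷ y ∷ r))))
 pairs P = trans (#-suc (suc t) P) (∑-cong λ x → #-suc t (λ f → P (x ∷ f)))

 ∑∑-select : ∀ M (X Y : V → Bool) → ∑ (λ x → ∑ (λ y → M * bit (X x ∧ Y y))) ≡ M * (size X * size Y)
 ∑∑-select M X Y = trans (∑-cong row) (trans (∑-select (M * size Y) X) (arith M (size X) (size Y)))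
  where
  arith : ∀ m x y → m * y * x ≡ m * (x * y)
  arith = solve-∀
  row : ∀ x → ∑ (λ y → M * bit (X x ∧ Y y)) ≡ M * size Y * bit (X x)
  row x with X x
  ... | true = trans (∑-select M Y) (sym (*-identityʳ _))
  ... | false = trans (trans (∑-cong {g = λ _ → 0} (λ y → *-zeroʳ M)) (trans (∑-const n 0) (*-zeroʳ n))) (sym (*-zeroʳ (M * size Y)))

 -- Choosing x in the first class and y in the second one, with q of the remaining tuples allowed.
 mixed-count : ∀ a q (X Y : V → Bool) (P : List V → Bool) → n ≤ a * size X → n ≤ a * size Y →
  (∀ x y → X x ≡ true → Y y ≡ true → n ^ t ≤ q * # t (λ r → P (x ∷ y ∷ r))) → n ^ (2 + t) ≤ a * a * q * # (2 + t) P
 mixed-count a q X Y P nX nY each = begin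
  n * (n * n ^ t) ≤⟨ *-mono-≤ nX (*-monoˡ-≤ (n ^ t) nY) ⟩
  a * size X * (a * size Y * n ^ t) ≡⟨ arith a (size X) (size Y) (n ^ t) ⟩
  a * a * (n ^ t * (size X * size Y)) ≡⟨ cong (a * a *_) (sym (∑∑-select (n ^ t) X Y)) ⟩
  a * a * ∑ (λ x → ∑ (λ y → n ^ t * bit (X x ∧ Y y))) ≤⟨ *-monoʳ-≤ (a * a) (∑-mono λ x → ∑-mono λ y → pointwise x y) ⟩
  a * a * ∑ (λ x → ∑ (λ y → q * # t (λ r → P (x ∷ y ∷ r)))) ≡⟨ cong (a * a *_) (trans (∑-cong λ x → ∑-* q _) (trans (∑-* q _) (cong (q *_) (sym (pairs P))))) ⟩
  a * a * (q * # (2 + t) P) ≡⟨ sym (*-assoc (a * a) q _) ⟩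
  a * a * q * # (2 + t) P ∎
  where
  open ≤-Reasoning
  arith : ∀ a x y m → a * x * (a * y * m) ≡ a * a * (m * (x * y))
  arith = solve-∀
  pointwise : ∀ x y → n ^ t * bit (X x ∧ Y y) ≤ q * # t (λ r → P (x ∷ y ∷ r))
  pointwise x y with X x in eX | Y y in eY
  ... | true | true = ≡-≤ (*-identityʳ (n ^ t)) (each x y eX eY)
  ... | true | false = ≡-≤ (*-zeroʳ (n ^ t)) z≤n
  ... | false | _ = ≡-≤ (*-zeroʳ (n ^ t)) z≤n

 all-mixed : ∀ w → n ^ (2 + t) ≤ 48 * # (2 + t) (λ f → mixed? f ∧ E (w ∷ f))
 all-mixed w = mixed-count 4 3 (λ x → (χ₀ x ≐ true) ∧ not (mem x [ w ])) (λ y → (χ₀ y ≐ false) ∧ not (mem y [ w ])) (λ f → mixed? f ∧ E (w ∷ f)) (quarter true) (quarter false) each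
  where
  quarter : ∀ c → n ≤ 4 * avail χ₀ c [ w ]
  quarter c = small (avail χ₀ c []) (avail χ₀ c [ w ]) (avail-≤ χ₀ c w []) (third c)
   where
   small : ∀ a b → a ≤ suc b → n ≤ 3 * a → n ≤ 4 * b
   small a b le n3 = ≤-trans (≤-trans n3 (*-monoʳ-≤ 3 le)) (≡-≤ (*-suc 3 b) (+-monoˡ-≤ (3 * b) (≤-pred four)))
    where
    four : 4 ≤ suc b
    four = *-cancelˡ-≤ 3 (≤-trans 12≤n (≤-trans n3 (*-monoʳ-≤ 3 le)))
  each : ∀ x y → (χ₀ x ≐ true) ∧ not (mem x [ w ]) ≡ true → (χ₀ y ≐ false) ∧ not (mem y [ w ]) ≡ true → n ^ t ≤ 3 * # t (λ r → mixed? (x ∷ y ∷ r) ∧ E (w ∷ x ∷ y ∷ r))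
  each x y ex ey = ≤-trans (dense-≤ (edges (w ∷ x ∷ y ∷ []) distinct refl)) (*-monoʳ-≤ 3 (#-mono t (λ r _ e → ∧-intro (∧-intro cx cy) e)))
   where
   cx : (χ₀ x ≐ true) ≡ true
   cx = ∧-left {χ₀ x ≐ true} ex
   cy : (χ₀ y ≐ false) ≡ true
   cy = ∧-left {χ₀ y ≐ false} ey
   not-w : ∀ {z} → not (mem z [ w ]) ≡ true → w ≢ z
   not-w e refl = mem-∉ [ w ] (not-true e) (here refl)
   distinct : Unique (w ∷ x ∷ y ∷ [])
   distinct = (not-w (∧-right {χ₀ x ≐ true} ex) ∷ not-w (∧-right {χ₀ y ≐ false} ey) ∷ []) ∷
    ((λ { refl → contradiction (trans (sym (≐-true {χ₀ x} {true} cx)) (≐-true {χ₀ x} {false} cy)) λ () }) ∷ []) ∷ [] ∷ []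

 N : ℕ
 N = n ^ (2 + t)

 keep : V → Bool
 keep w = N ≤ᵇ 96 * # (2 + t) (R w (χ₀ w xor τ))

 χ : V → Bool
 χ w = if keep w then χ₀ w else not (χ₀ w)

 flipped : V → Bool
 flipped w = not (keep w)

 par : List V → Bool
 par xs = xors (map χ xs)

 dense-R : ∀ w → N ≤ 96 * # (2 + t) (R w (χ w xor τ))
 dense-R w with keep w in e
 ... | true = ≤ᵇ-true e
 ... | false = +-cancelʳ-≤ N _ _ (begin
   N + N ≤⟨ +-mono-≤ (all-mixed w) (all-mixed w) ⟩
   48 * M + 48 * M ≡⟨ twice M ⟩
   96 * M ≤⟨ *-monoʳ-≤ 96 (≤-trans (#-mono (2 + t) split) (#-∨ (2 + t) (R w (not c)) (R w c))) ⟩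
   96 * (# (2 + t) (R w (not c)) + # (2 + t) (R w c)) ≡⟨ *-distribˡ-+ 96 (# (2 + t) (R w (not c))) _ ⟩
   96 * # (2 + t) (R w (not c)) + 96 * # (2 + t) (R w c) ≤⟨ +-mono-≤ (≤-reflexive (cong (λ b → 96 * # (2 + t) (R w b)) (sym (xor-assoc true (χ₀ w) τ)))) (<⇒≤ (≤ᵇ-false {N} e)) ⟩
   96 * # (2 + t) (R w (not (χ₀ w) xor τ)) + N ∎)
   where
   open ≤-Reasoning
   M : ℕ
   M = # (2 + t) (λ f → mixed? f ∧ E (w ∷ f))
   c : Bool
   c = χ₀ w xor τ
   twice : ∀ m → 48 * m + 48 * m ≡ 96 * m
   twice = solve-∀
   split : ∀ f → length f ≡ 2 + t → mixed? f ∧ E (w ∷ f) ≡ true → R w (not c) f ∨ R w c f ≡ true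
   split f _ e′ with mixed? f | E (w ∷ f)
   ... | true | true = either (par₀ f) c
    where
    either : ∀ p c → (p ≐ not c) ∨ (p ≐ c) ≡ true
    either true true = refl
    either true false = refl
    either false true = refl
    either false false = refl

 bad₀ : List V → Bool
 bad₀ xs = (par₀ xs ≐ τ) ∧ not (E xs)

 parity-tuples : ∀ c → n ^ t ≤ 3 * # t (λ r → par₀ r ≐ c)
 parity-tuples c = subst (λ s → n ^ s ≤ 3 * # s (λ r → par₀ r ≐ c)) (sym (+-suc g′ g′)) (begin
  n * n ^ (g′ + g′) ≤⟨ *-monoˡ-≤ (n ^ (g′ + g′)) min-third ⟩
  3 * M * n ^ (g′ + g′) ≡⟨ *-assoc 3 M _ ⟩
  3 * (M * n ^ (g′ + g′)) ≤⟨ *-monoʳ-≤ 3 (#-parity χ₀ (g′ + g′) c M λ { true → m⊓n≤m _ _ ; false → m⊓n≤n (avail χ₀ true []) _ }) ⟩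
  3 * # (suc (g′ + g′)) (λ r → par₀ r ≐ c) ∎)
  where
  open ≤-Reasoning
  M : ℕ
  M = avail χ₀ true [] Data.Nat.⊓ avail χ₀ false []
  min-third : n ≤ 3 * M
  min-third with ≤-total (avail χ₀ true []) (avail χ₀ false [])
  ... | inj₁ le = ≤-≡ (third true) (cong (3 *_) (sym (m≤n⇒m⊓n≡m le)))
  ... | inj₂ le = ≤-≡ (third false) (cong (3 *_) (sym (m≥n⇒m⊓n≡n le)))

 flipped-bad : ∀ w → flipped w ≡ true → N ≤ 38 * # (2 + t) (λ f → bad₀ (w ∷ f))
 flipped-bad w e = *-cancelˡ-≤ 69 (begin
  69 * N ≤⟨ +-cancelʳ-≤ (27 * N) _ _ total ⟩
  2592 * B ≤⟨ *-monoˡ-≤ B (m≤m+n 2592 30) ⟩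
  2622 * B ≡⟨ *-assoc 69 38 B ⟩
  69 * (38 * B) ∎)
  where
  open ≤-Reasoning
  c : Bool
  c = χ₀ w xor τ
  A B C : ℕ
  A = # (2 + t) (R w c)
  B = # (2 + t) (λ f → bad₀ (w ∷ f))
  C = # (2 + t) (λ f → mixed? f ∧ (par₀ f ≐ c))
  few : 96 * A ≤ N
  few = <⇒≤ (≤ᵇ-false {N} (not-true e))
  many : N ≤ 27 * C
  many = mixed-count 3 3 (λ x → χ₀ x ≐ true) (λ y → χ₀ y ≐ false) _ (third-class true) (third-class false) λ x y ex ey →
   ≤-trans (parity-tuples (χ₀ x xor (χ₀ y xor c))) (*-monoʳ-≤ 3 (#-mono t (λ r _ e′ → ∧-intro (∧-intro ex ey)
    (trans (truth-table 4 (λ x y p c → (x xor (y xor p)) ≐ c) (λ x y p c → p ≐ (x xor (y xor c))) refl (χ₀ x) (χ₀ y) (par₀ r) c) e′))))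
   where
   third-class : ∀ c → n ≤ 3 * size (λ x → χ₀ x ≐ c)
   third-class c = ≤-≡ (third c) (cong (3 *_) (avail-class χ₀ c))
  cover : C ≤ A + B
  cover = ≤-trans (#-mono (2 + t) split) (#-∨ (2 + t) (R w c) (λ f → bad₀ (w ∷ f)))
   where
   split : ∀ f → length f ≡ 2 + t → mixed? f ∧ (par₀ f ≐ c) ≡ true → R w c f ∨ bad₀ (w ∷ f) ≡ true
   split f _ e′ with ∧-true {mixed? f} e′
   ... | m , p with E (w ∷ f)
   ... | true = ∨-introˡ {mixed? f ∧ (par₀ f ≐ c)} e′
   ... | false = ∨-introʳ {mixed? f ∧ false} (∧-intro (trans (truth-table 3 (λ x p t → (x xor p) ≐ t) (λ x p t → p ≐ (x xor t)) refl (χ₀ w) (par₀ f) τ) p) refl)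
  total : 69 * N + 27 * N ≤ 2592 * B + 27 * N
  total = begin
   69 * N + 27 * N ≡⟨ arith₁ N ⟩
   96 * N ≤⟨ *-monoʳ-≤ 96 (≤-trans many (*-monoʳ-≤ 27 cover)) ⟩
   96 * (27 * (A + B)) ≡⟨ arith₂ A B ⟩
   2592 * B + 27 * (96 * A) ≤⟨ +-monoʳ-≤ (2592 * B) (*-monoʳ-≤ 27 few) ⟩
   2592 * B + 27 * N ∎
   where
   arith₁ : ∀ n → 69 * n + 27 * n ≡ 96 * n
   arith₁ = solve-∀
   arith₂ : ∀ a b → 96 * (27 * (a + b)) ≡ 2592 * b + 27 * (96 * a)
   arith₂ = solve-∀

 few-flipped : Q * size flipped ≤ 38 * n
 few-flipped = *-cancelˡ-≤ N {{m^n≢0 n (2 + t)}} (begin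
  N * (Q * size flipped) ≡⟨ *-swap N Q (size flipped) ⟩
  Q * (N * size flipped) ≡⟨ cong (Q *_) (sym (∑-select N flipped)) ⟩
  Q * ∑ (λ w → N * bit (flipped w)) ≤⟨ *-monoʳ-≤ Q (∑-mono pointwise) ⟩
  Q * ∑ (λ w → 38 * # (2 + t) (λ f → bad₀ (w ∷ f))) ≡⟨ cong (Q *_) (trans (∑-* 38 _) (cong (38 *_) (sym (#-suc (2 + t) bad₀)))) ⟩
  Q * (38 * # (suc (2 + t)) bad₀) ≡⟨ *-swap Q 38 (# (suc (2 + t)) bad₀) ⟩
  38 * (Q * # (suc (2 + t)) bad₀) ≤⟨ *-monoʳ-≤ 38 (rare-≤ bad-rare₀) ⟩
  38 * (n * N) ≡⟨ shuffle n N ⟩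
  N * (38 * n) ∎)
  where
  open ≤-Reasoning
  shuffle : ∀ a b → 38 * (a * b) ≡ b * (38 * a)
  shuffle = solve-∀
  pointwise : ∀ w → N * bit (flipped w) ≤ 38 * # (2 + t) (λ f → bad₀ (w ∷ f))
  pointwise w with flipped w in e
  ... | true = ≡-≤ (*-identityʳ N) (flipped-bad w e)
  ... | false = ≡-≤ (*-zeroʳ N) z≤n

 unflipped : ∀ v → flipped v ≡ false → χ v ≡ χ₀ v
 unflipped v e with keep v
 ... | true = refl

 any-flipped-rare : ∀ M s → 38 * (M * s) ≤ Q → Rare M s (anyᵇ flipped)
 any-flipped-rare M s le = any-rare M s flipped (*-cancelˡ-≤ 38 (begin
  38 * (M * (s * size flipped)) ≡⟨ arith M s (size flipped) ⟩
  38 * (M * s) * size flipped ≤⟨ *-monoˡ-≤ (size flipped) le ⟩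
  Q * size flipped ≤⟨ few-flipped ⟩
  38 * n ∎))
  where
  open ≤-Reasoning
  arith : ∀ m s f → 38 * (m * (s * f)) ≡ 38 * (m * s) * f
  arith = solve-∀

 bad-rare : ∀ M → 38 * (2 * M * suc (2 + t)) ≤ Q → Rare M (suc (2 + t)) (λ xs → (par xs ≐ τ) ∧ not (E xs))
 bad-rare M le = rare-mono split (rare-∨ {q = M} (rare-weaken 2M≤Q bad-rare₀) (any-flipped-rare (2 * M) (suc (2 + t)) le))
  where
  2M≤Q : 2 * M ≤ Q
  2M≤Q = ≤-trans (≤-trans (m≤m*n (2 * M) (suc (2 + t))) (m≤n*m (2 * M * suc (2 + t)) 38)) le
  split : ∀ xs → length xs ≡ suc (2 + t) → (par xs ≐ τ) ∧ not (E xs) ≡ true → bad₀ xs ∨ anyᵇ flipped xs ≡ true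
  split xs _ e with anyᵇ flipped xs in a
  ... | true = ∨-introʳ {bad₀ xs} refl
  ... | false = ∨-introˡ (trans (cong (λ p → (xors p ≐ τ) ∧ not (E xs)) (sym (any-false flipped χ χ₀ unflipped xs a))) e)

 linked : List V → Bool
 linked xs = E xs ∧ (par xs ≐ τ)

 splits-768 : 38 * (192 * (2 + t)) ≤ Q → ∀ w b → Dense 768 g (λ f → (par (w ∷ f) ≐ b) ∧ heavy 768 h linked (w ∷ f))
 splits-768 le w b = dense-mono rich-of (dense-heavy 384 (mkDense halves))
  where
  open ≤-Reasoning
  P : List V → Bool
  P xs = linked (w ∷ xs) ∧ (par (w ∷ Data.List.take g xs) ≐ b)
  Pm : List V → Bool
  Pm f = R w (χ w xor τ) f ∧ not (anyᵇ flipped f)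
  dense-Pm : Dense 192 (2 + t) Pm
  dense-Pm = dense-minus {q = 96} (mkDense (dense-R w)) (any-flipped-rare 192 (2 + t) le)
  G : V → V → ℕ
  G x y = Sum g′ (λ f₁ → # g (λ f₂ → P (x ∷ f₁ ++ y ∷ f₂)))
  count-P : # (g + h) P ≡ ∑ (λ x → ∑ (λ y → G x y))
  count-P = trans (#-++ g h P) (trans (Sum-suc g′ _) (∑-cong λ x →
   trans (S-cong g′ (λ f₁ _ → #-suc g (λ Z → P (x ∷ f₁ ++ Z)))) (S-∑ g′ (λ y f₁ → # g (λ f₂ → P (x ∷ f₁ ++ y ∷ f₂))))))
  count-Pm : # (2 + t) Pm ≡ ∑ (λ x → ∑ (λ y → Sum g′ (λ f₁ → # g (λ f₂ → Pm (x ∷ y ∷ f₁ ++ f₂)))))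
  count-Pm = trans (pairs Pm) (∑-cong λ x → ∑-cong λ y → #-++ g′ g (λ r → Pm (x ∷ y ∷ r)))
  take-g : ∀ f₁ (Z : List V) {l} → length f₁ ≡ l → Data.List.take l (f₁ ++ Z) ≡ f₁
  take-g [] Z refl = refl
  take-g (z ∷ zs) Z refl = cong (z ∷_) (take-g zs Z refl)
  -- Exchanging x and y, which have different colours, changes the parity of the part containing w.
  either : ∀ x y f₁ f₂ → length f₁ ≡ g′ → Pm (x ∷ y ∷ f₁ ++ f₂) ≡ true → P (x ∷ f₁ ++ y ∷ f₂) ∨ P (y ∷ f₁ ++ x ∷ f₂) ≡ true
  either x y f₁ f₂ l e = by-parity (decide ((χ w xor (χ x xor xors (map χ f₁))) ≐ b))
   where
   parts : R w (χ w xor τ) (x ∷ y ∷ f₁ ++ f₂) ≡ true × anyᵇ flipped (x ∷ y ∷ f₁ ++ f₂) ≡ false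
   parts = ∧-left {R w (χ w xor τ) (x ∷ y ∷ f₁ ++ f₂)} e , not-true (∧-right {R w (χ w xor τ) (x ∷ y ∷ f₁ ++ f₂)} e)
   same : map χ (x ∷ y ∷ f₁ ++ f₂) ≡ map χ₀ (x ∷ y ∷ f₁ ++ f₂)
   same = any-false flipped χ χ₀ unflipped _ (proj₂ parts)
   mixed-xy : (χ₀ x ≐ true) ≡ true × (χ₀ y ≐ false) ≡ true
   mixed-xy = ∧-true {χ₀ x ≐ true} (∧-left {mixed? (x ∷ y ∷ f₁ ++ f₂)} (proj₁ parts))
   cx : χ x ≡ true
   cx = trans (∷-injectiveˡ same) (≐-true (proj₁ mixed-xy))
   cy : χ y ≡ false
   cy = trans (∷-injectiveˡ (∷-injectiveʳ same)) (≐-true (proj₂ mixed-xy))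
   tail : E (w ∷ x ∷ y ∷ f₁ ++ f₂) ≡ true × (par₀ (x ∷ y ∷ f₁ ++ f₂) ≐ (χ w xor τ)) ≡ true
   tail = ∧-true {E (w ∷ x ∷ y ∷ f₁ ++ f₂)} (∧-right {mixed? (x ∷ y ∷ f₁ ++ f₂)} (proj₁ parts))
   all-linked : linked (w ∷ x ∷ y ∷ f₁ ++ f₂) ≡ true
   all-linked = ∧-intro (proj₁ tail) (trans (truth-table 3 (λ a p t → (a xor p) ≐ t) (λ a p t → p ≐ (a xor t)) refl (χ w) (par (x ∷ y ∷ f₁ ++ f₂)) τ)
    (trans (cong (λ m → xors m ≐ (χ w xor τ)) same) (proj₂ tail)))
   linked-↭ : ∀ {xs ys} → xs ↭ ys → linked xs ≡ true → linked ys ≡ true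
   linked-↭ p l = trans (sym (cong₂ (λ a q → a ∧ (q ≐ τ)) (E-↭ p) (xors-↭ (map⁺ χ p)))) l
   perm₁ : w ∷ x ∷ y ∷ f₁ ++ f₂ ↭ w ∷ x ∷ f₁ ++ y ∷ f₂
   perm₁ = _↭_.prep w (_↭_.prep x (↭-sym (shift y f₁ f₂)))
   perm₂ : w ∷ x ∷ y ∷ f₁ ++ f₂ ↭ w ∷ y ∷ f₁ ++ x ∷ f₂
   perm₂ = _↭_.prep w (↭-trans (_↭_.swap x y ↭-refl) (_↭_.prep y (↭-sym (shift x f₁ f₂))))
   by-parity : ((χ w xor (χ x xor xors (map χ f₁))) ≐ b) ≡ true ⊎ ((χ w xor (χ x xor xors (map χ f₁))) ≐ b) ≡ false → P (x ∷ f₁ ++ y ∷ f₂) ∨ P (y ∷ f₁ ++ x ∷ f₂) ≡ true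
   by-parity (inj₁ q) = ∨-introˡ (∧-intro (linked-↭ perm₁ all-linked) (trans (cong (λ l → par (w ∷ x ∷ l) ≐ b) (take-g f₁ (y ∷ f₂) l)) q))
   by-parity (inj₂ q) = ∨-introʳ {P (x ∷ f₁ ++ y ∷ f₂)} (∧-intro (linked-↭ perm₂ all-linked) (trans (cong (λ l → par (w ∷ y ∷ l) ≐ b) (take-g f₁ (x ∷ f₂) l)) other))
    where
    other : ((χ w xor (χ y xor xors (map χ f₁))) ≐ b) ≡ true
    other = trans (cong (λ c → (χ w xor (c xor xors (map χ f₁))) ≐ b) (trans cy (cong not (sym cx))))
     (trans (truth-table 4 (λ w x p b → (w xor (not x xor p)) ≐ b) (λ w x p b → not ((w xor (x xor p)) ≐ b)) refl (χ w) (χ x) (xors (map χ f₁)) b) (cong not q))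
  pairwise : ∀ x y → Sum g′ (λ f₁ → # g (λ f₂ → Pm (x ∷ y ∷ f₁ ++ f₂))) ≤ G x y + G y x
  pairwise x y = ≤-≡ (S-mono g′ (λ f₁ l → ≤-trans (#-mono g (λ f₂ _ e → either x y f₁ f₂ l e)) (#-∨ g _ _))) (S-+ g′ _ _)
  halves : n ^ (g + h) ≤ 384 * # (g + h) P
  halves = begin
   n ^ (g + h) ≡⟨ cong (n ^_) (trans (+-suc g g) (refl)) ⟩
   n ^ (2 + t) ≤⟨ dense-≤ {q = 192} {t = 2 + t} {P = Pm} dense-Pm ⟩
   192 * # (2 + t) Pm ≤⟨ *-monoʳ-≤ 192 (≡-≤ count-Pm (∑-mono λ x → ∑-mono λ y → pairwise x y)) ⟩
   192 * ∑ (λ x → ∑ (λ y → G x y + G y x)) ≡⟨ cong (192 *_) (trans (∑-cong λ x → ∑-+ (G x) (λ y → G y x)) (trans (∑-+ _ _) (cong (∑ (λ x → ∑ (G x)) +_) (∑-comm (λ x y → G y x))))) ⟩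
   192 * (∑ (λ x → ∑ (G x)) + ∑ (λ x → ∑ (G x))) ≡⟨ cong (λ k → 192 * (k + k)) (sym count-P) ⟩
   192 * (# (g + h) P + # (g + h) P) ≡⟨ arith (# (g + h) P) ⟩
   384 * # (g + h) P ∎
   where
   arith : ∀ p → 192 * (p + p) ≡ 384 * p
   arith = solve-∀
  rich-of : ∀ f → length f ≡ g → heavy (2 * 384) h P f ≡ true → (par (w ∷ f) ≐ b) ∧ heavy 768 h linked (w ∷ f) ≡ true
  rich-of f l e = ∧-intro parity (≤⇒≤ᵇ-true {n ^ h} {768 * # h (λ Z → linked (w ∷ f ++ Z))} (≤-trans (≤ᵇ-true {n ^ h} {768 * # h (λ Z → P (f ++ Z))} e) (*-monoʳ-≤ 768 (#-mono h (λ Z _ q → ∧-left q)))))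
   where
   parity : (par (w ∷ f) ≐ b) ≡ true
   parity = witness (dense-find (heavy-dense {q = 768} {b = h} {P = P} f e))
    where
    witness : (∃ λ Z → length Z ≡ h × P (f ++ Z) ≡ true) → (par (w ∷ f) ≐ b) ≡ true
    witness (Z , _ , q) = trans (cong (λ l → par (w ∷ l) ≐ b) (sym (take-g f Z l))) (∧-right {linked (w ∷ f ++ Z)} q)

 opaque
  unfolding budget

  splits : ∀ r → 2 + t ≤ r → budget r ≤ Q → ∀ w b → Dense c₁ g (λ f → (par (w ∷ f) ≐ b) ∧ heavy c₁ h linked (w ∷ f))
  splits r t≤r le = splits-768 (≤-trans (*-monoʳ-≤ 38 (*-monoʳ-≤ 192 t≤r)) le)

-- Consequences of beating the extremal graphs

#-less : ∀ {n} t (P R : List (Fin n) → Bool) → # t P < # t R → ∃ λ Z → length Z ≡ t × R Z ≡ true × P Z ≡ false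
#-less t P R lt = found (#-find t {P = λ Z → R Z ∧ not (P Z)} (≰⇒> λ none → <⇒≱ lt (≤-trans (#-mono t split)
  (≤-trans (#-∨ t P (λ Z → R Z ∧ not (P Z))) (≤-≡ (+-monoʳ-≤ (# t P) none) (+-identityʳ _))))))
 where
 split : ∀ Z → length Z ≡ t → R Z ≡ true → P Z ∨ (R Z ∧ not (P Z)) ≡ true
 split Z _ e with P Z
 ... | true = refl
 ... | false = ∧-intro e refl
 found : (∃ λ Z → length Z ≡ t × R Z ∧ not (P Z) ≡ true) → ∃ λ Z → length Z ≡ t × R Z ≡ true × P Z ≡ false
 found (Z , l , e) = Z , l , ∧-left {R Z} e , not-true (∧-right {R Z} e)

byColour : ℕ → ℕ → ℕ → (List Bool → Bool) → ℕ
byColour zero a b f = bit (f [])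
byColour (suc t) a b f = a * byColour t (a ∸ 1) b (λ cs → f (true ∷ cs)) + b * byColour t a (b ∸ 1) (λ cs → f (false ∷ cs))

#-byColour : ∀ {n} (χ : Fin n → Bool) t D f →
 # t (λ Z → fresh D Z ∧ f (map χ Z)) ≡ byColour t (avail χ true D) (avail χ false D) f
#-byColour χ zero D f = #-zero (λ Z → fresh D Z ∧ f (map χ Z))
#-byColour {n} χ (suc t) D f = trans (#-suc t _) (trans (∑-cong by-vertex) (trans (∑-+ _ _)
  (cong₂ _+_ (trans (∑-select T _) (*-comm T _)) (trans (∑-select F _) (*-comm F _)))))
 where
 T F : ℕ
 T = byColour t (avail χ true D ∸ 1) (avail χ false D) (λ cs → f (true ∷ cs))
 F = byColour t (avail χ true D) (avail χ false D ∸ 1) (λ cs → f (false ∷ cs))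
 drops : ∀ v c → mem v D ≡ false → avail χ c (v ∷ D) ≡ avail χ c D ∸ bit (χ v ≐ c)
 drops v c m = sym (trans (cong (_∸ bit (χ v ≐ c)) (trans (avail-∷ χ c v D) (cong (λ b → avail χ c (v ∷ D) + bit (not b ∧ (χ v ≐ c))) m))) (m+n∸n≡m _ (bit (χ v ≐ c))))
 by-vertex : ∀ v → # t (λ Z → (not (mem v D) ∧ fresh (v ∷ D) Z) ∧ f (χ v ∷ map χ Z)) ≡
  T * bit ((χ v ≐ true) ∧ not (mem v D)) + F * bit ((χ v ≐ false) ∧ not (mem v D))
 by-vertex v with mem v D in m
 ... | true = trans (#-none t) (sym (cong₂ _+_ (zero-term T (χ v ≐ true)) (zero-term F (χ v ≐ false))))
  where
  zero-term : ∀ x b → x * bit (b ∧ false) ≡ 0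
  zero-term x true = *-zeroʳ x
  zero-term x false = *-zeroʳ x
 ... | false = trans (#-byColour χ t (v ∷ D) (λ cs → f (χ v ∷ cs))) (trans (cong₂ (λ a b → byColour t a b (λ cs → f (χ v ∷ cs))) (drops v true m) (drops v false m)) (by-colour (χ v)))
  where
  by-colour : ∀ c → byColour t (avail χ true D ∸ bit (c ≐ true)) (avail χ false D ∸ bit (c ≐ false)) (λ cs → f (c ∷ cs)) ≡
   T * bit ((c ≐ true) ∧ true) + F * bit ((c ≐ false) ∧ true)
  by-colour true = sym (trans (cong₂ _+_ (*-identityʳ T) (*-zeroʳ F)) (+-identityʳ T))
  by-colour false = sym (trans (cong₂ _+_ (*-zeroʳ T) (*-identityʳ F)) refl)

cnt-map : ∀ {n} (χ : Fin n → Bool) c D D′ → map χ D ≡ map χ D′ → cnt χ c D ≡ cnt χ c D′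
cnt-map χ c [] [] e = refl
cnt-map χ c (x ∷ D) (y ∷ D′) e = cong₂ (λ b m → bit (b ≐ c) + m) (∷-injectiveˡ e) (cnt-map χ c D D′ (∷-injectiveʳ e))

same-colours : ∀ {n} (χ : Fin n → Bool) t D D′ f → Unique D → Unique D′ → map χ D ≡ map χ D′ →
 # t (λ Z → fresh D Z ∧ f (map χ Z)) ≡ # t (λ Z → fresh D′ Z ∧ f (map χ Z))
same-colours χ t D D′ f u u′ e = trans (#-byColour χ t D f) (trans (cong₂ (λ a b → byColour t a b f) (same true) (same false)) (sym (#-byColour χ t D′ f)))
 where
 same : ∀ c → avail χ c D ≡ avail χ c D′
 same c = +-cancelʳ-≡ (cnt χ c D) _ _ (trans (avail-cnt χ c u) (sym (trans (cong (avail χ c D′ +_) (cnt-map χ c D D′ e)) (avail-cnt χ c u′))))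

fresh-[] : ∀ {n} (D Z : List (Fin n)) → Unique D → fresh [] (D ++ Z) ≡ fresh D Z
fresh-[] D Z u = bool-≡ (λ e → unique-fresh Z (Unique-↭ (++-comm D Z) (fresh-list-unique (D ++ Z) e)))
 (λ e → unique-fresh (D ++ Z) (subst Unique (sym (++-identityʳ (D ++ Z))) (Unique-↭ (++-comm Z D) (fresh-unique Z u e))))

allSame : Bool → List Bool → Bool
allSame c [] = true
allSame c (b ∷ bs) = (b ≐ c) ∧ allSame c bs

pure? : ∀ {n} → (Fin n → Bool) → Bool → List (Fin n) → Bool
pure? χ c xs = allSame c (map χ xs)

pure?-true : ∀ {n} (χ : Fin n → Bool) c xs → pure? χ c xs ≡ true → Pure χ c xs
pure?-true χ c (x ∷ xs) e (here refl) = ≐-true (∧-left {χ x ≐ c} e)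
pure?-true χ c (x ∷ xs) e (there m) = pure?-true χ c xs (∧-right {χ x ≐ c} e) m

pure?-intro : ∀ {n} (χ : Fin n → Bool) c xs → Pure χ c xs → pure? χ c xs ≡ true
pure?-intro χ c [] p = refl
pure?-intro χ c (x ∷ xs) p = ∧-intro (≐-intro (p (here refl))) (pure?-intro χ c xs (λ m → p (there m)))

pure?-++ : ∀ {n} (χ : Fin n → Bool) c xs ys → pure? χ c (xs ++ ys) ≡ pure? χ c xs ∧ pure? χ c ys
pure?-++ χ c [] ys = refl
pure?-++ χ c (x ∷ xs) ys = trans (cong ((χ x ≐ c) ∧_) (pure?-++ χ c xs ys)) (truth-table 3 (λ a b d → a ∧ (b ∧ d)) (λ a b d → (a ∧ b) ∧ d) refl (χ x ≐ c) _ _)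

pure-colours : ∀ {n} (χ : Fin n → Bool) c D D′ → length D ≡ length D′ → Pure χ c D → Pure χ c D′ → map χ D ≡ map χ D′
pure-colours χ c [] [] l p p′ = refl
pure-colours χ c (x ∷ D) (y ∷ D′) l p p′ = cong₂ _∷_ (trans (p (here refl)) (sym (p′ (here refl))))
 (pure-colours χ c D D′ (suc-injective l) (λ m → p (there m)) (λ m → p′ (there m)))

-- Choosing the vertices one by one, each in at least n/4 ways.
#-pure : ∀ {n} (χ : Fin n → Bool) c t U → (∀ U′ → length U′ ≤ length U + t → n ≤ 4 * avail χ c U′) →
 n ^ t ≤ 4 ^ t * # t (λ Z → fresh U Z ∧ pure? χ c Z)
#-pure χ c zero U big = ≤-reflexive (sym (trans (+-identityʳ _) (#-zero (λ Z → fresh U Z ∧ pure? χ c Z))))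
#-pure {n} χ c (suc t) U big = begin
 n * n ^ t ≤⟨ *-monoˡ-≤ (n ^ t) (big U (m≤m+n _ _)) ⟩
 4 * avail χ c U * n ^ t ≡⟨ trans (*-assoc 4 (avail χ c U) _) (cong (4 *_) (trans (*-comm (avail χ c U) _) (sym (∑-select (n ^ t) _)))) ⟩
 4 * ∑ (λ v → n ^ t * bit ((χ v ≐ c) ∧ not (mem v U))) ≤⟨ *-monoʳ-≤ 4 (∑-mono pointwise) ⟩
 4 * ∑ (λ v → 4 ^ t * # t (λ Z → fresh U (v ∷ Z) ∧ pure? χ c (v ∷ Z))) ≡⟨ cong (4 *_) (trans (∑-* (4 ^ t) _) (cong (4 ^ t *_) (sym (#-suc t _)))) ⟩
 4 * (4 ^ t * # (suc t) (λ Z → fresh U Z ∧ pure? χ c Z)) ≡⟨ sym (*-assoc 4 (4 ^ t) _) ⟩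
 4 ^ suc t * # (suc t) (λ Z → fresh U Z ∧ pure? χ c Z) ∎
 where
 open ≤-Reasoning
 pointwise : ∀ v → n ^ t * bit ((χ v ≐ c) ∧ not (mem v U)) ≤ 4 ^ t * # t (λ Z → (not (mem v U) ∧ fresh (v ∷ U) Z) ∧ ((χ v ≐ c) ∧ pure? χ c Z))
 pointwise v with χ v ≐ c | mem v U
 ... | true | false = ≡-≤ (*-identityʳ (n ^ t)) (#-pure χ c t (v ∷ U) (λ U′ le → big U′ (≤-≡ le (sym (+-suc (length U) t)))))
 ... | true | true = ≡-≤ (*-zeroʳ (n ^ t)) z≤n
 ... | false | _ = ≡-≤ (*-zeroʳ (n ^ t)) z≤n

choose-any : ∀ {n} (χ : Fin n → Bool) cs U → (∀ c → suc (length cs) ≤ avail χ c U) → ∃ λ xs → map χ xs ≡ cs × fresh U xs ≡ true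
choose-any {n} χ cs U room = found (choose χ cs U 1 (λ _ → false) room (≤-≡ (s≤s (≤-reflexive (trans (#≡S (length cs) _)
  (trans (S-const {n} (length cs) 0) (*-zeroʳ (n ^ length cs)))))) (sym (^-zeroˡ (length cs)))))
 where
 found : (∃ λ xs → map χ xs ≡ cs × fresh U xs ≡ true × false ≡ false) → ∃ λ xs → map χ xs ≡ cs × fresh U xs ≡ true
 found (xs , e , f , _) = xs , e , f

module Exact {n : ℕ} (χ : Fin n → Bool) (τ : Bool) (E : List (Fin n) → Bool) (h s t : ℕ) (s+t : s + t ≡ h)
 (E-unique : ∀ xs → length xs ≡ h + h → E xs ≡ true → Unique xs)
 (big : ∀ c U → length U ≤ h + h → n ≤ 4 * avail χ c U) (8h<n : 8 * h < n) where

 par : List (Fin n) → Bool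
 par xs = xors (map χ xs)

 par-++ : ∀ xs ys → par (xs ++ ys) ≡ par xs xor par ys
 par-++ xs ys = trans (cong xors (map-++ χ xs ys)) (xors-++ (map χ xs) (map χ ys))

 Wrong : List (Fin n) → Set
 Wrong e = length e ≡ h + h × E e ≡ true × par e ≡ not τ

 right : List (Fin n) → Bool
 right xs = fresh [] xs ∧ (par xs ≐ τ)

 Beaten : (List (Fin n) → Bool) → Set
 Beaten F = ∃ λ D₀ → Unique D₀ × length D₀ ≡ h + s × (∀ D → Unique D → length D ≡ h + s → # t (λ Z → F (D₀ ++ Z)) < # t (λ Z → E (D ++ Z)))

 len-edge : ∀ (D Z : List (Fin n)) → length D ≡ h + s → length Z ≡ t → length (D ++ Z) ≡ h + h
 len-edge D Z lD lZ = trans (length-++ D) (trans (cong₂ _+_ lD lZ) (trans (+-assoc h s t) (cong (h +_) s+t)))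

 not-right : ∀ e → length e ≡ h + h → E e ≡ true → right e ≡ false → Wrong e
 not-right e l x r = l , x , ≐-false {par e} (trans (sym (cong (_∧ (par e ≐ τ)) (unique-fresh-[] e (E-unique e l x)))) r)

 right-split : ∀ D Z → Unique D → right (D ++ Z) ≡ fresh D Z ∧ ((par D xor xors (map χ Z)) ≐ τ)
 right-split D Z u = cong₂ (λ f p → f ∧ (p ≐ τ)) (fresh-[] D Z u) (par-++ D Z)

 right-count : ∀ D D′ → Unique D → Unique D′ → map χ D ≡ map χ D′ → # t (λ Z → right (D ++ Z)) ≡ # t (λ Z → right (D′ ++ Z))
 right-count D D′ u u′ e = trans (#-cong t (λ Z _ → right-split D Z u)) (trans (same-colours χ t D D′ (λ cs → (par D xor xors cs) ≐ τ) u u′ e)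
  (#-cong t (λ Z _ → trans (cong (λ p → fresh D′ Z ∧ ((xors p xor xors (map χ Z)) ≐ τ)) e) (sym (right-split D′ Z u′)))))

 avail-room : ∀ c U → length U ≤ h + h → suc h ≤ avail χ c U
 avail-room c U le = ≰⇒> λ small → <⇒≱ 8h<n (≤-trans (big c U le) (≤-trans (*-monoʳ-≤ 4 small) (*-monoˡ-≤ h (m≤m+n 4 4))))

 -- Every set with the colours of an initial part of D₀ extends to a set with the colours of D₀.
 pattern-of : Beaten right → ∃ λ (cs : Fin h → Bool) → ∀ X → map χ X ≡ tabulate cs → Unique X → ∃ λ Y → length Y ≡ h × Wrong (X ++ Y)
 pattern-of (D₀ , u₀ , l₀ , beat) = start (list-split h s D₀ l₀)
  where
  start : (∃ λ X₀ → ∃ λ W₀ → D₀ ≡ X₀ ++ W₀ × length X₀ ≡ h × length W₀ ≡ s) → ∃ λ (cs : Fin h → Bool) → ∀ X → map χ X ≡ tabulate cs → Unique X → ∃ λ Y → length Y ≡ h × Wrong (X ++ Y)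
  start (X₀ , W₀ , refl , lX , lW) = nth false (map χ X₀) , λ X e u → extend X (trans e (tabulate-nth false (map χ X₀) (trans (length-map χ X₀) lX))) u
   where
   extend : ∀ X → map χ X ≡ map χ X₀ → Unique X → ∃ λ Y → length Y ≡ h × Wrong (X ++ Y)
   extend X e u = choose-W (choose-any χ (map χ W₀) X (λ c → ≤-trans (s≤s (≡-≤ lW′ (≤-≡ (m≤m+n s t) s+t))) (avail-room c X (≡-≤ lX′ (m≤m+n h h)))))
    where
    lW′ : length (map χ W₀) ≡ s
    lW′ = trans (length-map χ W₀) lW
    lX′ : length X ≡ h
    lX′ = trans (sym (length-map χ X)) (trans (cong length e) (trans (length-map χ X₀) lX))
    choose-W : (∃ λ W → map χ W ≡ map χ W₀ × fresh X W ≡ true) → ∃ λ Y → length Y ≡ h × Wrong (X ++ Y)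
    choose-W (W , eW , fW) = choose-Z (#-less t (λ Z → right (D ++ Z)) (λ Z → E (D ++ Z))
      (subst (_< # t (λ Z → E (D ++ Z))) (right-count D₀ D u₀ uD (trans (map-++ χ X₀ W₀) (trans (cong₂ _++_ (sym e) (sym eW)) (sym (map-++ χ X W))))) (beat D uD lD)))
     where
     D : List (Fin n)
     D = X ++ W
     lenW : length W ≡ s
     lenW = trans (sym (length-map χ W)) (trans (cong length eW) lW′)
     lD : length D ≡ h + s
     lD = ++-length X lX′ lenW
     uD : Unique D
     uD = Unique-↭ (++-comm W X) (fresh-unique W u fW)
     choose-Z : (∃ λ Z → length Z ≡ t × E (D ++ Z) ≡ true × right (D ++ Z) ≡ false) → ∃ λ Y → length Y ≡ h × Wrong (X ++ Y)
     choose-Z (Z , lZ , x , r) = W ++ Z , trans (length-++ W) (trans (cong₂ _+_ lenW lZ) s+t) ,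
      subst Wrong (++-assoc X W Z) (not-right (D ++ Z) (len-edge D Z lD lZ) x r)

 wrong? : List (Fin n) → Bool
 wrong? e = E e ∧ (par e ≐ not τ)

 starred : Bool → Fin n → List (Fin n) → Bool
 starred c a xs = right xs ∨ (fresh [] xs ∧ (pure? χ c xs ∧ mem a xs))

 star-of : ∀ a t′ → τ ≡ true → t ≡ suc t′ → Beaten (starred (χ a) a) →
  (∃ λ e → Wrong e × ¬ Pure χ (χ a) e) ⊎ ((∃ λ e → Wrong e × a ∉ e) × n ^ (h + s + t′) ≤ 4 ^ (h + s + t′) * # (h + h) wrong?)
 star-of a t′ τ≡ t≡ (D₀ , u₀ , l₀ , beat) = by-purity (decide (pure? χ c D₀)) (decide (mem a D₀))
  where
  c : Bool
  c = χ a
  Result : Set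
  Result = (∃ λ e → Wrong e × ¬ Pure χ c e) ⊎ ((∃ λ e → Wrong e × a ∉ e) × n ^ (h + s + t′) ≤ 4 ^ (h + s + t′) * # (h + h) wrong?)
  from-D₀ : ∃ λ Z → length Z ≡ t × E (D₀ ++ Z) ≡ true × starred c a (D₀ ++ Z) ≡ false
  from-D₀ = #-less t _ _ (beat D₀ u₀ l₀)
  wrong-edge : ∀ D Z F → length D ≡ h + s → length Z ≡ t → E (D ++ Z) ≡ true → right (D ++ Z) ∨ F ≡ false → Wrong (D ++ Z)
  wrong-edge D Z F lD lZ x q = not-right (D ++ Z) (len-edge D Z lD lZ) x (∨-left q)
  by-purity : pure? χ c D₀ ≡ true ⊎ pure? χ c D₀ ≡ false → mem a D₀ ≡ true ⊎ mem a D₀ ≡ false → Result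
  by-purity (inj₂ np) _ = go from-D₀
   where
   go : (∃ λ Z → length Z ≡ t × E (D₀ ++ Z) ≡ true × starred c a (D₀ ++ Z) ≡ false) → Result
   go (Z , lZ , x , q) = inj₁ (D₀ ++ Z , wrong-edge D₀ Z _ l₀ lZ x q , λ p → contradiction (trans (sym (pure?-intro χ c D₀ (λ m → p (∈-++⁺ˡ m)))) np) λ ())
  -- Replacing a by another vertex of its class gives a set D with the same number of right and pure extensions.
  by-purity (inj₁ pu) (inj₁ ma) = replace (choose-any χ (map χ D₀) D₀ (λ c′ → ≤-trans (s≤s (≡-≤ (trans (length-map χ D₀) l₀) h+s≤)) (double-room c′)))
   where
   h+s≤ : h + s ≤ h + h
   h+s≤ = +-monoʳ-≤ h (≤-≡ (m≤m+n s t) s+t)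
   double-room : ∀ c′ → suc (h + h) ≤ avail χ c′ D₀
   double-room c′ = ≰⇒> λ small → <⇒≱ 8h<n (≤-trans (big c′ D₀ (≡-≤ l₀ h+s≤)) (≤-≡ (*-monoʳ-≤ 4 small) (arith h)))
    where
    arith : ∀ h → 4 * (h + h) ≡ 8 * h
    arith = solve-∀
   replace : (∃ λ D → map χ D ≡ map χ D₀ × fresh D₀ D ≡ true) → Result
   replace (D , e , f) = go (#-less t (λ Z → both (D ++ Z)) (λ Z → E (D ++ Z)) (≤-<-trans (≤-reflexive (sym counts)) (≤-<-trans (#-mono t (λ Z _ q → more Z q)) (beat D uD lD))))
    where
    uD : Unique D
    uD = unique-++ˡ D (fresh-unique D u₀ f)
    lD : length D ≡ h + s
    lD = trans (sym (length-map χ D)) (trans (cong length e) (trans (length-map χ D₀) l₀))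
    both : List (Fin n) → Bool
    both xs = right xs ∨ (fresh [] xs ∧ pure? χ c xs)
    more : ∀ Z → both (D₀ ++ Z) ≡ true → starred c a (D₀ ++ Z) ≡ true
    more Z q with ∨-true {right (D₀ ++ Z)} q
    ... | inj₁ r = ∨-introˡ r
    ... | inj₂ r = ∨-introʳ {right (D₀ ++ Z)} (∧-intro (∧-left {fresh [] (D₀ ++ Z)} r) (∧-intro (∧-right {fresh [] (D₀ ++ Z)} r) (∈-mem (∈-++⁺ˡ (mem-∈ D₀ ma)))))
    colour-test : List Bool → Bool
    colour-test cs = ((par D₀ xor xors cs) ≐ τ) ∨ allSame c cs
    both-split : ∀ D′ Z → Unique D′ → pure? χ c D′ ≡ true → map χ D′ ≡ map χ D₀ → both (D′ ++ Z) ≡ fresh D′ Z ∧ colour-test (map χ Z)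
    both-split D′ Z u′ p′ e′ = trans (cong₂ _∨_ (trans (right-split D′ Z u′) (cong (λ m → fresh D′ Z ∧ ((xors m xor xors (map χ Z)) ≐ τ)) e′))
      (cong₂ _∧_ (fresh-[] D′ Z u′) (trans (pure?-++ χ c D′ Z) (cong (_∧ pure? χ c Z) p′))))
     (truth-table 3 (λ f a b → (f ∧ a) ∨ (f ∧ b)) (λ f a b → f ∧ (a ∨ b)) refl (fresh D′ Z) ((par D₀ xor xors (map χ Z)) ≐ τ) (pure? χ c Z))
    pure-D : pure? χ c D ≡ true
    pure-D = pure?-intro χ c D (transport D D₀ e (pure?-true χ c D₀ pu))
     where
     transport : ∀ D D₀ → map χ D ≡ map χ D₀ → Pure χ c D₀ → Pure χ c D
     transport (x ∷ D) (y ∷ D₀) e p (here refl) = trans (∷-injectiveˡ e) (p (here refl))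
     transport (x ∷ D) (y ∷ D₀) e p (there m) = transport D D₀ (∷-injectiveʳ e) (λ m → p (there m)) m
    counts : # t (λ Z → both (D₀ ++ Z)) ≡ # t (λ Z → both (D ++ Z))
    counts = trans (#-cong t (λ Z _ → both-split D₀ Z u₀ pu refl)) (trans (same-colours χ t D₀ D colour-test u₀ uD (sym e)) (sym (#-cong t (λ Z _ → both-split D Z uD pure-D e))))
    go : (∃ λ Z → length Z ≡ t × E (D ++ Z) ≡ true × both (D ++ Z) ≡ false) → Result
    go (Z , lZ , x , q) = inj₁ (D ++ Z , w , λ p → contradiction (trans (sym (∧-intro (unique-fresh (D ++ Z) (subst Unique (sym (++-identityʳ (D ++ Z))) (E-unique _ (proj₁ w) x))) (pure?-intro χ c (D ++ Z) p))) (∨-right {right (D ++ Z)} q)) λ ())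
     where
     w : Wrong (D ++ Z)
     w = wrong-edge D Z _ lD lZ x q
  by-purity (inj₁ pu) (inj₂ na) = go from-D₀
   where
   open ≤-Reasoning
   P L : ℕ
   P = # t′ (λ Z → fresh (a ∷ D₀) Z ∧ pure? χ c Z)
   L = h + s
   room : ∀ U → length U ≤ h + h → n ≤ 4 * avail χ c U
   room = big c
   P-large : n ^ t′ ≤ 4 ^ t′ * P
   P-large = #-pure χ c t′ (a ∷ D₀) (λ U le → room U (≤-≡ le (trans (cong (λ l → suc l + t′) l₀) (trans (sym (+-suc (h + s) t′)) (trans (cong (h + s +_) (sym t≡)) (trans (+-assoc h s t) (cong (h +_) s+t)))))))
   -- The star contributes the extensions of D₀ that contain a.
   star-extensions : # t (λ Z → right (D₀ ++ Z)) + P ≤ # t (λ Z → starred c a (D₀ ++ Z))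
   star-extensions = begin
    # t (λ Z → right (D₀ ++ Z)) + P ≤⟨ +-monoʳ-≤ _ P≤ ⟩
    # t (λ Z → right (D₀ ++ Z)) + # t through-a ≡⟨ trans (cong₂ _+_ (#≡S t _) (#≡S t _)) (trans (sym (S-+ t _ _)) (trans (S-cong t (λ Z lZ → exclusive Z lZ)) (sym (#≡S t _)))) ⟩
    # t (λ Z → starred c a (D₀ ++ Z)) ∎
    where
    through-a : List (Fin n) → Bool
    through-a Z = not (right (D₀ ++ Z)) ∧ starred c a (D₀ ++ Z)
    exclusive : ∀ Z → length Z ≡ t → bit (right (D₀ ++ Z)) + bit (through-a Z) ≡ bit (starred c a (D₀ ++ Z))
    exclusive Z _ with right (D₀ ++ Z)
    ... | true = refl
    ... | false = refl
    P≤ : P ≤ # t through-a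
    P≤ = ≤-trans (#-mono t′ (λ Z lZ q → through Z lZ q)) (≤-≡ (term-≤-∑ (λ v → # t′ (λ Z → through-a (v ∷ Z))) a) (trans (sym (#-suc t′ through-a)) (cong (λ t → # t through-a) (sym t≡))))
     where
     through : ∀ Z → length Z ≡ t′ → fresh (a ∷ D₀) Z ∧ pure? χ c Z ≡ true → through-a (a ∷ Z) ≡ true
     through Z lZ q = ∧-intro (cong not (¬true not-right′)) (∨-introʳ {right (D₀ ++ a ∷ Z)} (∧-intro fr (∧-intro pa (∈-mem (∈-++⁺ʳ D₀ (here refl))))))
      where
      f : fresh (a ∷ D₀) Z ≡ true
      f = ∧-left {fresh (a ∷ D₀) Z} q
      fr : fresh [] (D₀ ++ a ∷ Z) ≡ true
      fr = trans (fresh-[] D₀ (a ∷ Z) u₀) (∧-intro (cong not na) f)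
      pa : pure? χ c (D₀ ++ a ∷ Z) ≡ true
      pa = trans (pure?-++ χ c D₀ (a ∷ Z)) (∧-intro pu (∧-intro (≐-refl c) (∧-right {fresh (a ∷ D₀) Z} q)))
      not-right′ : ¬ (right (D₀ ++ a ∷ Z) ≡ true)
      not-right′ r = contradiction (trans (sym (≐-true (∧-right {fresh [] (D₀ ++ a ∷ Z)} r))) (trans (pure-parity χ (D₀ ++ a ∷ Z) (pure?-true χ c _ pa))
       (trans (cong (λ l → c ∧ oddᵇ l) (len-edge D₀ (a ∷ Z) l₀ (trans (cong suc lZ) (sym t≡)))) (trans (cong (c ∧_) (odd-double h)) (truth-table 1 (λ c → c ∧ false) (λ c → false) refl c))))) (λ e → contradiction (trans (sym τ≡) e) λ ())
   M : ℕ
   M = # L (λ D → fresh [] D ∧ pure? χ c D)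
   M-large : n ^ L ≤ 4 ^ L * M
   M-large = #-pure χ c L [] (λ U le → room U (≤-trans le (+-monoʳ-≤ h (≤-≡ (m≤m+n s t) s+t))))
   P-each : ∀ D → Unique D → length D ≡ L → pure? χ c D ≡ true → P ≤ # t (λ Z → wrong? (D ++ Z))
   P-each D u l p = +-cancelˡ-≤ (# t (λ Z → right (D ++ Z))) _ _ (begin
    # t (λ Z → right (D ++ Z)) + P ≡⟨ cong (_+ P) (right-count D D₀ u u₀ (pure-colours χ c D D₀ (trans l (sym l₀)) (pure?-true χ c D p) (pure?-true χ c D₀ pu))) ⟩
    # t (λ Z → right (D₀ ++ Z)) + P ≤⟨ star-extensions ⟩
    # t (λ Z → starred c a (D₀ ++ Z)) ≤⟨ <⇒≤ (beat D u l) ⟩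
    # t (λ Z → E (D ++ Z)) ≤⟨ ≤-trans (#-mono t split) (#-∨ t _ _) ⟩
    # t (λ Z → right (D ++ Z)) + # t (λ Z → wrong? (D ++ Z)) ∎)
    where
    split : ∀ Z → length Z ≡ t → E (D ++ Z) ≡ true → right (D ++ Z) ∨ wrong? (D ++ Z) ≡ true
    split Z lZ x with right (D ++ Z) in r
    ... | true = refl
    ... | false = ∧-intro x (≐-intro (proj₂ (proj₂ (not-right (D ++ Z) (len-edge D Z l lZ) x r))))
   dense : n ^ (L + t′) ≤ 4 ^ (L + t′) * # (h + h) wrong?
   dense = begin
    n ^ (L + t′) ≡⟨ ^-distribˡ-+-* n L t′ ⟩
    n ^ L * n ^ t′ ≤⟨ *-mono-≤ M-large P-large ⟩
    4 ^ L * M * (4 ^ t′ * P) ≡⟨ arith (4 ^ L) M (4 ^ t′) P ⟩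
    4 ^ L * 4 ^ t′ * (P * M) ≡⟨ cong₂ _*_ (sym (^-distribˡ-+-* 4 L t′)) (trans (cong (P *_) (#≡S L _)) (sym (S-* L P _))) ⟩
    4 ^ (L + t′) * Sum L (λ D → P * bit (fresh [] D ∧ pure? χ c D)) ≤⟨ *-monoʳ-≤ (4 ^ (L + t′)) (S-mono L pointwise) ⟩
    4 ^ (L + t′) * Sum L (λ D → # t (λ Z → wrong? (D ++ Z))) ≡⟨ cong (4 ^ (L + t′) *_) (trans (sym (#-++ L t wrong?)) (cong (λ l → # l wrong?) (trans (+-assoc h s t) (cong (h +_) s+t)))) ⟩
    4 ^ (L + t′) * # (h + h) wrong? ∎
    where
    arith : ∀ a m b p → a * m * (b * p) ≡ a * b * (p * m)
    arith = solve-∀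
    pointwise : ∀ D → length D ≡ L → P * bit (fresh [] D ∧ pure? χ c D) ≤ # t (λ Z → wrong? (D ++ Z))
    pointwise D l with fresh [] D in f | pure? χ c D in p
    ... | true | true = ≡-≤ (*-identityʳ P) (P-each D (fresh-list-unique D f) l p)
    ... | true | false = ≡-≤ (*-zeroʳ P) z≤n
    ... | false | _ = ≡-≤ (*-zeroʳ P) z≤n
   go : (∃ λ Z → length Z ≡ t × E (D₀ ++ Z) ≡ true × starred c a (D₀ ++ Z) ≡ false) → Result
   go (Z , lZ , x , q) = by-a (decide (mem a (D₀ ++ Z)))
    where
    w : Wrong (D₀ ++ Z)
    w = wrong-edge D₀ Z _ l₀ lZ x q
    by-a : mem a (D₀ ++ Z) ≡ true ⊎ mem a (D₀ ++ Z) ≡ false → Result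
    by-a (inj₂ a∉) = inj₂ ((D₀ ++ Z , w , mem-∉ (D₀ ++ Z) a∉) , dense)
    by-a (inj₁ a∈) = inj₁ (D₀ ++ Z , w , λ p → contradiction (trans (sym (∧-intro (unique-fresh (D₀ ++ Z) (subst Unique (sym (++-identityʳ (D₀ ++ Z))) (E-unique _ (proj₁ w) x)))
     (∧-intro (pure?-intro χ c (D₀ ++ Z) p) a∈))) (∨-right {right (D₀ ++ Z)} q)) λ ())

∈-then : {A : Set} {b : Bool} {x : A} {xs ys : List A} → b ≡ true → x ∈ xs → x ∈ (if b then xs else ys)
∈-then refl m = m

∈-else : {A : Set} {b : Bool} {x : A} {xs ys : List A} → b ≡ false → x ∈ ys → x ∈ (if b then xs else ys)
∈-else refl m = m

∈-concatMap : {A B : Set} (f : A → List B) {xs : List A} {x : A} {y : B} → x ∈ xs → y ∈ f x → y ∈ concatMap f xs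
∈-concatMap f m m′ = ∈-concat⁺′ m′ (∈-map⁺ f m)

ext-even : ∀ n k′ τ (A : Subset n) → suc k′ ∣ n → (if τ then oddᵇ (n / suc k′ + ∣ A ∣) else oddᵇ ∣ A ∣) ≡ true → parityGraph (suc k′) τ A ∈ ext n (suc k′)
ext-even n k′ true A div e = ∈-then (dec-true (suc k′ ∣? n) div) (∈-concatMap _ (∈-allSubsets A) (∈-++⁺ˡ (∈-then e (here refl))))
ext-even n k′ false A div e = ∈-then (dec-true (suc k′ ∣? n) div) (∈-concatMap _ (∈-allSubsets A)
 (∈-++⁺ʳ (if oddᵇ (n / suc k′ + ∣ A ∣) then 𝓑 (suc k′) A ∷ [] else []) (∈-then e (here refl))))

ext-odd : ∀ n k′ (A : Subset n) → ¬ (suc k′ ∣ n) → parityGraph (suc k′) true A ∈ ext n (suc k′)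
ext-odd n k′ A ndiv = ∈-else (dec-false (suc k′ ∣? n) ndiv) (∈-concatMap _ (∈-allSubsets A) (here refl))

StarParity : (k q a : ℕ) → .{{NonZero k}} → Set
StarParity k q a = (((k % 4) Data.Nat.≡ᵇ 0) ≡ true × oddᵇ (q + a) ≡ true) ⊎
 (((k % 4) Data.Nat.≡ᵇ 0) ≡ false × ((k % 2) Data.Nat.≡ᵇ 0) ≡ true × oddᵇ (q + a) ≡ false)

ext-star : ∀ n k′ (A : Subset n) a → ¬ (suc k′ ∣ n) → StarParity (suc k′) (n / suc k′) ∣ A ∣ → Vec.lookup A a ≡ true → 𝓑′ (suc k′) A a ∈ ext n (suc k′)
ext-star n k′ A a ndiv cond la = ∈-else (dec-false (suc k′ ∣? n) ndiv) (∈-concatMap _ (∈-allSubsets A) (there (∈-then (prime cond)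
  (∈-map⁺ (𝓑′ (suc k′) A) (∈-filter⁺ (λ a → Data.Bool._≟_ (Vec.lookup A a) true) (∈-allFin a) la)))))
 where
 prime : StarParity (suc k′) (n / suc k′) ∣ A ∣ → (if (suc k′ % 4) Data.Nat.≡ᵇ 0 then oddᵇ (n / suc k′ + ∣ A ∣)
  else (if (suc k′ % 2) Data.Nat.≡ᵇ 0 then not (oddᵇ (n / suc k′ + ∣ A ∣)) else false)) ≡ true
 prime (inj₁ (e , o)) rewrite e = o
 prime (inj₂ (e , e′ , o)) rewrite e | e′ | o = refl

δ≤δ̄ : ∀ {n} k d {G : KGraph n} → G ∈ ext n k → δ d G ≤ δ̄ n k d
δ≤δ̄ k d m = maxList-≥ (∈-map⁺ (δ d) m)

𝓑′-uniform : ∀ {n} k (A : Subset n) a → Uniform k (𝓑′ k A a)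
𝓑′-uniform k A a X e with ∨-true {𝓑 k A X} e
... | inj₁ b = parityGraph-uniform k true A X b
... | inj₂ b = ≡ᵇ-true (∧-left {∣ X ∣ Data.Nat.≡ᵇ k} b)

-- Since k is even, the parity with respect to a class equals the parity with respect to the other one.
class-parity : ∀ {n} (χ : Fin n → Bool) c xs → oddᵇ (length xs) ≡ false → xors (map (λ v → χ v ≐ c) xs) ≡ xors (map χ xs)
class-parity χ c xs e = trans (go c xs) (trans (cong (λ o → xors (map χ xs) xor (not c ∧ o)) e) (truth-table 2 (λ x c → x xor (not c ∧ false)) (λ x c → x) refl (xors (map χ xs)) c))
 where
 go : ∀ c xs → xors (map (λ v → χ v ≐ c) xs) ≡ xors (map χ xs) xor (not c ∧ oddᵇ (length xs))
 go c [] = truth-table 1 (λ c → false) (λ c → not c ∧ false) refl c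
 go c (x ∷ xs) = trans (cong ((χ x ≐ c) xor_) (go c xs))
  (truth-table 4 (λ x c p o → (x ≐ c) xor (p xor (not c ∧ o))) (λ x c p o → (x xor p) xor (not c ∧ not o)) refl (χ x) c (xors (map χ xs)) (oddᵇ (length xs)))

classOf : ∀ {n} → (Fin n → Bool) → Bool → Subset n
classOf χ c = Vec.tabulate (λ v → χ v ≐ c)

classOf-size : ∀ {n} (χ : Fin n → Bool) c → ∣ classOf χ c ∣ ≡ avail χ c []
classOf-size χ c = trans (∣∣-size (classOf χ c)) (trans (size-cong (VecP.lookup∘tabulate _)) (sym (avail-class χ c)))

parityGraph-class : ∀ {n} k b c (χ : Fin n → Bool) xs → length xs ≡ k → oddᵇ k ≡ false →
 parityGraph k b (classOf χ c) (setOf xs) ≡ fresh [] xs ∧ (xors (map χ xs) ≐ b)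
parityGraph-class k b c χ xs l e = trans (parityGraph-list k b (classOf χ c) xs l) (cong (λ p → fresh [] xs ∧ (p ≐ b))
 (trans (cong xors (map-cong (VecP.lookup∘tabulate _) xs)) (class-parity χ c xs (trans (cong oddᵇ l) e))))
 where open import Data.List.Properties using (map-cong)

starGraph-class : ∀ {n} k c (χ : Fin n → Bool) a xs → length xs ≡ k → oddᵇ k ≡ false →
 𝓑′ k (classOf χ c) a (setOf xs) ≡ (fresh [] xs ∧ (xors (map χ xs) ≐ true)) ∨ (fresh [] xs ∧ (pure? χ c xs ∧ mem a xs))
starGraph-class k c χ a xs l e = cong₂ _∨_ (parityGraph-class k true c χ xs l e) (cong₂ _∧_ (fresh-size k xs l) (cong₂ _∧_ inside (lookup-setOf xs a)))
 where
 inside : (setOf xs ⊆ᵇ classOf χ c) ≡ pure? χ c xs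
 inside = bool-≡ (λ s → pure?-intro χ c xs λ {v} m → ≐-true (trans (sym (VecP.lookup∘tabulate (λ v → χ v ≐ c) v)) (⊆ᵇ-elim (setOf xs) (classOf χ c) s v (trans (lookup-setOf xs v) (∈-mem m)))))
  (λ p → ⊆ᵇ-intro (setOf xs) (classOf χ c) λ v lv → trans (VecP.lookup∘tabulate (λ v → χ v ≐ c) v) (≐-intro (pure?-true χ c xs p (mem-∈ xs (trans (sym (lookup-setOf xs v)) lv)))))

1/_ : ℕ → ℚ
1/ D = (int 1) ℚ./ suc D

1/-positive : ∀ D → 0ℚ <ℚ 1/ D
1/-positive D = ℚP.toℚᵘ-cancel-< (ℚᵘP.<-respʳ-≃ (ℚᵘP.≃-sym (ℚP.toℚᵘ-fromℚᵘ (ℚᵘ.mkℚᵘ (int 1) D))) (ℚᵘ.*<* (+<+ (s≤s z≤n))))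

1/-≤ : ∀ D a b → ℕtoℚ a ℚ.≤ (1/ D) ℚ.* ℕtoℚ b → suc D * a ≤ b
1/-≤ D a b le = ≡-≤ (trans (*-comm (suc D) a) (cong (a *_) (sym (*-identityʳ (suc D)))))
 (≤-trans (ℤP.drop‿+≤+ (subst₂ Data.Integer._≤_ (sym (ℤP.pos-* a (suc D * 1))) (trans (ℤP.*-identityʳ _) (ℤP.*-identityˡ (int b))) (ℚᵘP.drop-*≤* unnormalised))) ≤-refl)
 where
 unnormalised : ℚᵘ.mkℚᵘ (int a) 0 ℚᵘ.≤ ℚᵘ.mkℚᵘ (int 1) D ℚᵘ.* ℚᵘ.mkℚᵘ (int b) 0
 unnormalised = ℚᵘP.≤-respˡ-≃ (ℚP.toℚᵘ-fromℚᵘ (ℚᵘ.mkℚᵘ (int a) 0)) (ℚᵘP.≤-respʳ-≃ (ℚᵘP.≃-trans (ℚP.toℚᵘ-homo-* (1/ D) (ℕtoℚ b))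
  (ℚᵘP.*-cong (ℚP.toℚᵘ-fromℚᵘ (ℚᵘ.mkℚᵘ (int 1) D)) (ℚP.toℚᵘ-fromℚᵘ (ℚᵘ.mkℚᵘ (int b) 0)))) (ℚP.toℚᵘ-mono-≤ le))

close-tuples : ∀ {n} k b (H : KGraph n) (A : Subset n) (π : Permutation′ n) Q → Uniform k H →
 2 * Q * k ! * diff H (copy π (parityGraph k b A)) ≤ n ^ k → .{{_ : NonZero n}} → 2 * Q * (k * (0 + k)) ≤ n →
 Rare Q k (λ xs → (xors (map (Vec.lookup (relabel π A)) xs) ≐ b) ∧ not (H (setOf xs)))
close-tuples {n} k b H A π Q uH close clash = rare-mono split (rare-∨ {q = Q} {P = λ xs → D (setOf xs)} (mkRare (begin
  2 * Q * # k (λ xs → D (setOf xs)) ≡⟨ cong (2 * Q *_) (Degree.edge-tuples D uD) ⟩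
  2 * Q * (k ! * count D (allSubsets n)) ≤⟨ *-monoʳ-≤ (2 * Q) (*-monoʳ-≤ (k !) (count-mono (allSubsets n))) ⟩
  2 * Q * (k ! * diff H (copy π (parityGraph k b A))) ≡⟨ sym (*-assoc (2 * Q) (k !) _) ⟩
  2 * Q * k ! * diff H (copy π (parityGraph k b A)) ≤⟨ close ⟩
  n ^ k ∎)) (clash-rare (2 * Q) k [] clash))
 where
 open ≤-Reasoning
 G D : KGraph n
 G = parityGraph k b (relabel π A)
 D S = G S ∧ not (H S)
 uD : Uniform k D
 uD S e = parityGraph-uniform k b (relabel π A) S (∧-left {G S} e)
 count-mono : ∀ Xs → count D Xs ≤ count (λ S → H S xor copy π (parityGraph k b A) S) Xs
 count-mono [] = z≤n
 count-mono (X ∷ Xs) = ≡-≤ (count-∷ D X Xs) (≤-≡ (+-mono-≤ (bit-mono {D X} {H X xor copy π (parityGraph k b A) X} differs) (count-mono Xs)) (sym (count-∷ _ X Xs)))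
  where
  differs : G X ∧ not (H X) ≡ true → H X xor copy π (parityGraph k b A) X ≡ true
  differs e rewrite copy-parityGraph k b A π X with G X | H X
  ... | true | false = refl
 split : ∀ xs → length xs ≡ k → (xors (map (Vec.lookup (relabel π A)) xs) ≐ b) ∧ not (H (setOf xs)) ≡ true → D (setOf xs) ∨ not (fresh [] xs) ≡ true
 split xs l e with fresh [] xs in f
 ... | false = ∨-introʳ {D (setOf xs)} refl
 ... | true = ∨-introˡ (trans (cong (_∧ not (H (setOf xs))) (trans (parityGraph-list k b (relabel π A) xs l) (cong (_∧ (xors (map (Vec.lookup (relabel π A)) xs) ≐ b)) f))) e)

odd⇒suc-double : ∀ m → oddᵇ m ≡ true → ∃ λ v → m ≡ suc (v + v)
even⇒double : ∀ m → oddᵇ m ≡ false → ∃ λ v → m ≡ v + v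
odd⇒suc-double (suc m) e with even⇒double m (not-true e)
... | v , refl = v , refl
even⇒double zero e = 0 , refl
even⇒double (suc m) e with odd⇒suc-double m (not-false e)
... | v , refl = suc v , cong suc (sym (+-suc v v))

sumRest-alternating : ∀ v b → sumRest true (suc (v + v)) b ≡ oddᵇ (suc v) xor b
sumRest-alternating zero true = refl
sumRest-alternating zero false = refl
sumRest-alternating (suc v) b = trans (cong (λ l → sumRest true (suc (suc l)) b) (+-suc v v))
 (trans (cong (λ r → (b xor true) xor (((b xor true) xor true) xor r)) (sumRest-alternating v ((b xor true) xor true)))
  (truth-table 2 (λ b o → (b xor true) xor (((b xor true) xor true) xor (o xor ((b xor true) xor true)))) (λ b o → not o xor b) refl b (oddᵇ (suc v))))

-- Constants and the proof of the theorem

class-change : ∀ {n} (χ χ′ F : Fin n → Bool) c → (∀ v → F v ≡ false → χ v ≡ χ′ v) → avail χ c [] ≤ avail χ′ c [] + size F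
class-change χ χ′ F c same = ≡-≤ (size≡ _) (≤-≡ (∑-mono pointwise) (trans (∑-+ _ _) (sym (cong₂ _+_ (size≡ _) (size≡ F)))))
 where
 pointwise : ∀ v → bit ((χ v ≐ c) ∧ true) ≤ bit ((χ′ v ≐ c) ∧ true) + bit (F v)
 pointwise v with F v in e
 ... | true = ≤-trans (bit≤1 _) (m≤n+m 1 _)
 ... | false = ≡-≤ (cong (λ b → bit ((b ≐ c) ∧ true)) (same v e)) (m≤m+n _ 0)

halfish-change : ∀ {n} q r (χ χ′ F : Fin n → Bool) → (∀ v → F v ≡ false → χ v ≡ χ′ v) → (∀ c → n ≤ 2 * avail χ c [] + r) →
 4 * (q * (2 * size F + r)) ≤ 4 * n → Halfish q χ′
halfish-change {n} q r χ χ′ F same half le c = begin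
 q * n ≤⟨ *-monoʳ-≤ q (≤-trans (half c) (+-monoˡ-≤ r (*-monoʳ-≤ 2 (class-change χ χ′ F c same)))) ⟩
 q * (2 * (avail χ′ c [] + size F) + r) ≡⟨ arith q (avail χ′ c []) (size F) r ⟩
 2 * q * avail χ′ c [] + q * (2 * size F + r) ≤⟨ +-monoʳ-≤ (2 * q * avail χ′ c []) (*-cancelˡ-≤ {q * (2 * size F + r)} {n} 4 le) ⟩
 2 * q * avail χ′ c [] + n ∎
 where
 open ≤-Reasoning
 arith : ∀ q a f r → q * (2 * (a + f) + r) ≡ 2 * q * a + q * (2 * f + r)
 arith = solve-∀

halfish-two-fifths : ∀ {n} q (χ : Fin n → Bool) → 5 ≤ q → Halfish q χ → ∀ c → 2 * n ≤ 5 * avail χ c []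
halfish-two-fifths {n} q χ q≥5 hf c = *-cancelˡ-≤ (2 * q) {{>-nonZero (≤-trans (s≤s z≤n) (≤-trans q≥5 (m≤m+n q _)))}} (+-cancelʳ-≤ (5 * n) _ _ (begin
 2 * q * (2 * n) + 5 * n ≤⟨ +-monoʳ-≤ (2 * q * (2 * n)) (*-monoˡ-≤ n q≥5) ⟩
 2 * q * (2 * n) + q * n ≡⟨ arith q n ⟩
 5 * (q * n) ≤⟨ *-monoʳ-≤ 5 (hf c) ⟩
 5 * (2 * q * avail χ c [] + n) ≡⟨ arith′ q (avail χ c []) n ⟩
 2 * q * (5 * avail χ c []) + 5 * n ∎))
 where
 open ≤-Reasoning
 arith : ∀ q n → 2 * q * (2 * n) + q * n ≡ 5 * (q * n)
 arith = solve-∀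
 arith′ : ∀ q a n → 5 * (2 * q * a + n) ≡ 2 * q * (5 * a) + 5 * n
 arith′ = solve-∀

module Numbers (h Z NR : ℕ) (3≤h : 3 ≤ h) where

 private
  1≤h : 1 ≤ h
  1≤h = ≤-trans (s≤s z≤n) 3≤h

 opaque
  unfolding c₁

  q₀ : ℕ
  q₀ = 64 * c₁

  64c₁≤q₀ : 64 * c₁ ≤ q₀
  64c₁≤q₀ = ≤-refl

  42≤q₀ : 42 ≤ q₀
  42≤q₀ = m≤m+n 42 49110

 5≤q₀ : 5 ≤ q₀
 5≤q₀ = ≤-trans (m≤m+n 5 37) 42≤q₀

 opaque
  ρ : ℕ
  ρ = q₀ + Z

  q₀≤ρ : q₀ ≤ ρ
  q₀≤ρ = m≤m+n q₀ Z

  Z≤ρ : Z ≤ ρ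
  Z≤ρ = m≤n+m Z q₀

 opaque
  Δ : ℕ
  Δ = 44 * ρ * (h * h)

  Δ≡ : Δ ≡ 44 * ρ * (h * h)
  Δ≡ = refl

 168≤44ρ : 165 ≤ 44 * ρ
 168≤44ρ = ≤-trans (m≤m+n 165 3) (*-mono-≤ {4} {44} {42} {ρ} (m≤m+n 4 40) (≤-trans 42≤q₀ q₀≤ρ))

 165h≤Δ : 165 * h ≤ Δ
 165h≤Δ = ≤-≡ (*-mono-≤ {165} {44 * ρ} {h} {h * h} 168≤44ρ (≡-≤ (sym (*-identityʳ h)) (*-monoʳ-≤ h 1≤h))) (sym Δ≡)

 1≤Δ : 1 ≤ Δ
 1≤Δ = ≤-trans (≤-trans 1≤h (m≤n*m h 165)) 165h≤Δ

 opaque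
  c q : ℕ
  c = 4 * Δ
  q = 16 * Δ

  c≡ : c ≡ 4 * Δ
  c≡ = refl

  q≡ : q ≡ 16 * Δ
  q≡ = refl

  1≤q : 1 ≤ q
  1≤q = *-mono-≤ {1} {16} {1} {Δ} (s≤s z≤n) 1≤Δ

 opaque
  K : ℕ
  K = suc (c ^ h) + (4 * ρ + (8 ^ h + 16))

  K-big : c ^ h < K
  K-big = m≤m+n (suc (c ^ h)) (4 * ρ + (8 ^ h + 16))

  rest≤K : 4 * ρ + (8 ^ h + 16) ≤ K
  rest≤K = m≤n+m (4 * ρ + (8 ^ h + 16)) (suc (c ^ h))

 ρ≤K : 4 * ρ ≤ K
 ρ≤K = ≤-trans (m≤m+n (4 * ρ) (8 ^ h + 16)) rest≤K

 8^h+16≤K : 8 ^ h + 16 ≤ K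
 8^h+16≤K = ≤-trans (m≤n+m (8 ^ h + 16) (4 * ρ)) rest≤K

 8^h<4K : 8 ^ h < 4 * K
 8^h<4K = ≤-trans (≤-trans (≡-≤ (+-comm 1 (8 ^ h)) (+-monoʳ-≤ (8 ^ h) (m≤m+n 1 15))) 8^h+16≤K) (m≤n*m K 4)

 16≤K : 16 ≤ K
 16≤K = ≤-trans (m≤n+m 16 (8 ^ h)) 8^h+16≤K

 M : ℕ
 M = 4 * K * (4 * K * q)

 opaque
  Q : ℕ
  Q = 38 * (2 * M * (h + h)) + (budget (h + h) + 38 * (8 * q₀))

  Q≥M : 38 * (2 * M * (h + h)) ≤ Q
  Q≥M = m≤m+n (38 * (2 * M * (h + h))) (budget (h + h) + 38 * (8 * q₀))

  Q≥rest : budget (h + h) + 38 * (8 * q₀) ≤ Q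
  Q≥rest = m≤n+m (budget (h + h) + 38 * (8 * q₀)) (38 * (2 * M * (h + h)))

 Q≥splits : budget (h + h) ≤ Q
 Q≥splits = ≤-trans (m≤m+n (budget (h + h)) (38 * (8 * q₀))) Q≥rest

 Q≥q₀ : 38 * (8 * q₀) ≤ Q
 Q≥q₀ = ≤-trans (m≤n+m (38 * (8 * q₀)) (budget (h + h))) Q≥rest

 opaque
  n₃ : ℕ
  n₃ = 4 * NR + (20 * h + 12 * q₀)

  n₃-pool : 4 * NR ≤ n₃
  n₃-pool = m≤m+n (4 * NR) (20 * h + 12 * q₀)

  n₃-rest : 20 * h + 12 * q₀ ≤ n₃
  n₃-rest = m≤n+m (20 * h + 12 * q₀) (4 * NR)

 opaque
  n₂ : ℕ
  n₂ = Δ * (23 + 2 * h) + (2 * Q * ((h + h) * (h + h)) + n₃)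

  n₂-slots : Δ * (23 + 2 * h) ≤ n₂
  n₂-slots = m≤m+n (Δ * (23 + 2 * h)) (2 * Q * ((h + h) * (h + h)) + n₃)

  n₂-rest : 2 * Q * ((h + h) * (h + h)) + n₃ ≤ n₂
  n₂-rest = m≤n+m (2 * Q * ((h + h) * (h + h)) + n₃) (Δ * (23 + 2 * h))

 n₂-clash : 2 * Q * ((h + h) * (h + h)) ≤ n₂
 n₂-clash = ≤-trans (m≤m+n (2 * Q * ((h + h) * (h + h))) n₃) n₂-rest

 n₃≤n₂ : n₃ ≤ n₂
 n₃≤n₂ = ≤-trans (m≤n+m n₃ (2 * Q * ((h + h) * (h + h)))) n₂-rest

 n₂-pool : 4 * NR ≤ n₂
 n₂-pool = ≤-trans n₃-pool n₃≤n₂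

 n₂-blocks : 20 * h ≤ n₂
 n₂-blocks = ≤-trans (m≤m+n (20 * h) (12 * q₀)) (≤-trans n₃-rest n₃≤n₂)

 n₂-q₀ : 12 * q₀ ≤ n₂
 n₂-q₀ = ≤-trans (m≤n+m (12 * q₀) (20 * h)) (≤-trans n₃-rest n₃≤n₂)

 module Large (n : ℕ) (n≥ : n₂ ≤ n) where

  private
   instance
    Δ≢0 : NonZero Δ
    Δ≢0 = >-nonZero 1≤Δ

  x : ℕ
  x = n / Δ

  xΔ≤n : x * Δ ≤ n
  xΔ≤n = m/n*n≤m n Δ

  x≥ : 23 + 2 * h ≤ x
  x≥ = ≡-≤ (sym (trans (cong (_/ Δ) (*-comm Δ (23 + 2 * h))) (m*n/n≡m (23 + 2 * h) Δ))) (/-monoˡ-≤ Δ (≤-trans n₂-slots n≥))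
   where open import Data.Nat.DivMod using (/-monoˡ-≤)

  23≤x : 23 ≤ x
  23≤x = ≤-trans (m≤m+n 23 (2 * h)) x≥

  p N : ℕ
  p = x ∸ h
  N = 10 * (x * h)

  h≤x : h ≤ x
  h≤x = ≤-trans (≤-trans (m≤m+n h (h + 0)) (m≤n+m (2 * h) 23)) x≥

  p+h≤x : p + h ≤ x
  p+h≤x = ≤-reflexive (m∸n+n≡m h≤x)

  x≤2p : x ≤ 2 * p
  x≤2p = +-cancelʳ-≤ (2 * h) x (2 * p) (≤-≡ (+-monoʳ-≤ x (≤-trans (m≤n+m (2 * h) 23) x≥)) (trans (cong (λ y → y + y) (sym (m∸n+n≡m h≤x))) (arith p h)))
   where
   arith : ∀ p h → p + h + (p + h) ≡ 2 * p + 2 * h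
   arith = solve-∀

  n≤2xΔ : n ≤ 2 * (x * Δ)
  n≤2xΔ = ≤-trans (<⇒≤ (m<[1+m/n]*n n Δ)) (≤-≡ (*-monoˡ-≤ Δ {suc x} {2 * x} (≤-≡ (+-monoˡ-≤ x (≤-trans (s≤s z≤n) 23≤x)) (cong (x +_) (sym (+-identityʳ x))))) (*-assoc 2 x Δ))
   where
   m<[1+m/n]*n : ∀ m n .{{_ : NonZero n}} → m < suc (m / n) * n
   m<[1+m/n]*n m n = ≤-trans (s≤s (≤-reflexive (m≡m%n+[m/n]*n m n))) (+-monoˡ-≤ (m / n * n) (m%n<n m n))
    where open import Data.Nat.DivMod using (m≡m%n+[m/n]*n)

  n≤cp : n ≤ c * p
  n≤cp = ≤-trans n≤2xΔ (≤-≡ (*-monoʳ-≤ 2 (*-monoˡ-≤ Δ x≤2p)) (trans (arith p Δ) (cong (_* p) (sym c≡))))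
   where
   arith : ∀ p d → 2 * (2 * p * d) ≡ 4 * d * p
   arith = solve-∀

  8n≤qx : 8 * n ≤ q * x
  8n≤qx = ≤-≡ (*-monoʳ-≤ 8 n≤2xΔ) (trans (arith x Δ) (cong (_* x) (sym q≡)))
   where
   arith : ∀ x d → 8 * (2 * (x * d)) ≡ 16 * d * x
   arith = solve-∀

  165xh≤n : 165 * (x * h) ≤ n
  165xh≤n = ≡-≤ (arith x h) (≤-trans (*-monoʳ-≤ x 165h≤Δ) xΔ≤n)
   where
   arith : ∀ x h → 165 * (x * h) ≡ x * (165 * h)
   arith = solve-∀

  room : 4 * ρ * (h * (N + h)) ≤ n
  room = ≤-trans (*-monoʳ-≤ (4 * ρ) (*-monoʳ-≤ h (+-monoʳ-≤ N (≡-≤ (sym (*-identityˡ h)) (*-monoˡ-≤ h (≤-trans (s≤s z≤n) 23≤x))))))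
   (≡-≤ (trans (arith ρ h x) (cong (x *_) (sym Δ≡))) xΔ≤n)
   where
   arith : ∀ r h x → 4 * r * (h * (10 * (x * h) + x * h)) ≡ x * (44 * r * (h * h))
   arith = solve-∀

  clash : ∀ a b → a ≤ h + h → b ≤ h + h → 2 * Q * (a * b) ≤ n
  clash a b a≤ b≤ = ≤-trans (*-monoʳ-≤ (2 * Q) (*-mono-≤ a≤ b≤)) (≤-trans n₂-clash n≥)

  clash-q₀ : ∀ a b → a ≤ h + h → b ≤ h + h → 8 * q₀ * (a * b) ≤ n
  clash-q₀ a b a≤ b≤ = ≤-trans (*-monoˡ-≤ (a * b) (≤-trans (≤-trans (m≤n*m (8 * q₀) 38) Q≥q₀) (m≤m+n Q _))) (clash a b a≤ b≤)

  20h≤n : 20 * h ≤ n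
  20h≤n = ≤-trans n₂-blocks n≥

  12q₀≤n : 12 * q₀ ≤ n
  12q₀≤n = ≤-trans n₂-q₀ n≥

  12≤n : 12 ≤ n
  12≤n = ≡-≤ (sym (*-identityʳ 12)) (≤-trans (*-monoʳ-≤ 12 (≤-trans (s≤s z≤n) 5≤q₀)) 12q₀≤n)

module Planner {B : Base} (P : Params B) (x : ℕ) where

 open Assembly P

 plan : N ≡ 10 * (x * h) → p + h ≤ x → 8 * n ≤ q * x → (∀ c → 2 * n ≤ 5 * avail χ c []) → 165 * (x * h) ≤ n → 23 ≤ x → 3 ≤ h → 2 ≤ g →
  ∀ {u₀} (G : Gadget u₀) → Plan (length (Gadget.F₀ G ++ concat (Gadget.Bs G))) u₀
 plan N≡ ph 8n classes′ 165≤ 23≤ 3≤h g≥2 {u₀} G = record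
  { t = x; w = x; u = u₀ ∸ 9 * x
  ; blocks = trans (sym (m+[n∸m]≡n 9x≤u₀)) (arith₀ x (u₀ ∸ 9 * x))
  ; early = begin
    ℓ + (x * 3 + (x * 3 + x * 3)) * h + (h + h) ≤⟨ +-monoˡ-≤ (h + h) (+-monoˡ-≤ _ short) ⟩
    21 * h + (x * 3 + (x * 3 + x * 3)) * h + (h + h) ≡⟨ arith₁ h x ⟩
    23 * h + 9 * (x * h) ≤⟨ +-monoˡ-≤ (9 * (x * h)) (*-monoˡ-≤ h 23≤) ⟩
    x * h + 9 * (x * h) ≡⟨ sym N≡ ⟩
    N ∎
  ; classes = λ c → *-cancelˡ-≤ 15 (begin
    15 * (x + u₀ + (ℓ + (x * 3 + (x * 3 + x * 3)) * h)) ≤⟨ *-monoʳ-≤ 15 (+-mono-≤ (+-monoˡ-≤ u₀ x≤xh) (+-monoˡ-≤ _ ℓ≤xh)) ⟩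
    15 * (x * h + u₀ + (x * h + (x * 3 + (x * 3 + x * 3)) * h)) ≡⟨ arith₂ x h u₀ ⟩
    165 * (x * h) + 5 * (u₀ * 3) ≤⟨ +-mono-≤ 165≤ (*-monoʳ-≤ 5 (≤-trans (*-monoʳ-≤ u₀ 3≤h) (≤-≡ (m≤n+m (u₀ * h) (ℓ + 0)) (State.count-U state)))) ⟩
    n + 5 * n ≡⟨ arith₃ n ⟩
    3 * (2 * n) ≤⟨ *-monoʳ-≤ 3 (classes′ c) ⟩
    3 * (5 * avail χ c []) ≡⟨ sym (*-assoc 3 5 (avail χ c [])) ⟩
    15 * avail χ c [] ∎)
  ; pools = ph
  ; matching = ≤-trans (*-monoˡ-≤ n (m≤m+n 4 4)) 8n
  ; covering = 8n
  ; 2≤g = g≥2 }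
  where
  open ≤-Reasoning
  open Gadget G
  ℓ : ℕ
  ℓ = length (F₀ ++ concat Bs)
  x≤xh : x ≤ x * h
  x≤xh = ≡-≤ (sym (*-identityʳ x)) (*-monoʳ-≤ x {1} {h} (s≤s z≤n))
  ℓ≤xh : ℓ ≤ x * h
  ℓ≤xh = ≤-trans short (*-monoˡ-≤ h (≤-trans (m≤m+n 21 2) 23≤))
  arith₀ : ∀ x u → 9 * x + u ≡ x * 3 + (x * 3 + (x * 3 + u))
  arith₀ = solve-∀
  arith₁ : ∀ h x → 21 * h + (x * 3 + (x * 3 + x * 3)) * h + (h + h) ≡ 23 * h + 9 * (x * h)
  arith₁ = solve-∀
  arith₂ : ∀ x h u → 15 * (x * h + u + (x * h + (x * 3 + (x * 3 + x * 3)) * h)) ≡ 165 * (x * h) + 5 * (u * 3)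
  arith₂ = solve-∀
  arith₃ : ∀ n → n + 5 * n ≡ 3 * (2 * n)
  arith₃ = solve-∀
  9x≤u₀ : 9 * x ≤ u₀
  9x≤u₀ = *-cancelʳ-≤ (9 * x) u₀ h (+-cancelˡ-≤ (x * h) _ _ (begin
   x * h + 9 * x * h ≡⟨ arith x h ⟩
   10 * (x * h) ≤⟨ *-monoˡ-≤ (x * h) (m≤m+n 10 155) ⟩
   165 * (x * h) ≤⟨ 165≤ ⟩
   n ≡⟨ sym (State.count-U state) ⟩
   ℓ + 0 + u₀ * h ≤⟨ +-monoˡ-≤ (u₀ * h) (≡-≤ (+-identityʳ ℓ) ℓ≤xh) ⟩
   x * h + u₀ * h ∎))
   where
   arith : ∀ x h → x * h + 9 * x * h ≡ 10 * (x * h)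
   arith = solve-∀

heavy-weaken : ∀ {n q q′ b} {P : List (Fin n) → Bool} xs → q ≤ q′ → heavy q b P xs ≡ true → heavy q′ b P xs ≡ true
heavy-weaken {n} {q} {q′} {b} {P} xs le e = ≤⇒≤ᵇ-true {n ^ b} {q′ * # b (λ ys → P (xs ++ ys))}
 (≤-trans (≤ᵇ-true {n ^ b} {q * # b (λ ys → P (xs ++ ys))} e) (*-monoˡ-≤ (# b (λ ys → P (xs ++ ys))) le))

toggle : ∀ {n} → Subset (suc n) → Subset (suc n)
toggle (a Vec.∷ A) = not a Vec.∷ A

toggle-odd : ∀ {n} (A : Subset (suc n)) → oddᵇ ∣ toggle A ∣ ≡ not (oddᵇ ∣ A ∣)
toggle-odd (true Vec.∷ A) = sym (truth-table 1 (λ b → not (not b)) (λ b → b) refl (oddᵇ ∣ A ∣))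
toggle-odd (false Vec.∷ A) = refl

toggle-same : ∀ {n} (A : Subset (suc n)) v → does (v ≟F zero) ∧ true ≡ false → Vec.lookup A v ≡ Vec.lookup (toggle A) v
toggle-same (a Vec.∷ A) (suc v) e = refl

avail-subset : ∀ {n} (A : Subset n) → avail (Vec.lookup A) true [] ≡ ∣ A ∣
avail-subset A = trans (avail-class (Vec.lookup A) true) (trans (size-cong (λ v → truth-table 1 (λ b → b ≐ true) (λ b → b) refl (Vec.lookup A v))) (sym (∣∣-size A)))

balanced-half : ∀ {n} (A : Subset n) → Balanced A → ∀ c → n ≤ 2 * avail (Vec.lookup A) c [] + 1
balanced-half {n} A (b₁ , b₂) = λ { true → half aT aF sum′ (subst₂ _≤_ f≡ (cong suc (sym (avail-subset A))) b₂) ; false → half aF aT (trans (+-comm aF aT) sum′) (subst₂ _≤_ (sym (avail-subset A)) (cong suc f≡) b₁) }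
 where
 aT aF : ℕ
 aT = avail (Vec.lookup A) true []
 aF = avail (Vec.lookup A) false []
 sum′ : aT + aF ≡ n
 sum′ = avail-total (Vec.lookup A)
 f≡ : n ∸ ∣ A ∣ ≡ aF
 f≡ = trans (cong₂ _∸_ (sym sum′) (sym (avail-subset A))) (m+n∸m≡n aT aF)
 half : ∀ a b → a + b ≡ n → b ≤ suc a → n ≤ 2 * a + 1
 half a b e le = ≡-≤ (sym e) (≤-≡ (+-monoʳ-≤ a le) (arith a))
  where
  arith : ∀ a → a + suc a ≡ 2 * a + 1
  arith = solve-∀

odd-* : ∀ a b → oddᵇ (a * b) ≡ oddᵇ a ∧ oddᵇ b
odd-* zero b = refl
odd-* (suc a) b = trans (odd-+ b (a * b)) (trans (cong (oddᵇ b xor_) (odd-* a b)) (truth-table 2 (λ a b → b xor (a ∧ b)) (λ a b → not a ∧ b) refl (oddᵇ a) (oddᵇ b)))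

ample-cong : ∀ {n} q t {P R : List (Fin n) → Bool} → (∀ Z → length Z ≡ t → P Z ≡ R Z) → Ample q t P → Ample q t R
ample-cong {n} q t e am = ≤-≡ am (cong (λ c → 2 * q * c + n ^ t) (#-cong t e))

sumRest-even : ∀ u b → sumRest false u b ≡ oddᵇ u ∧ b
sumRest-even zero b = refl
sumRest-even (suc u) b = trans (cong ((b xor false) xor_) (sumRest-even u (b xor false)))
 (truth-table 2 (λ b o → (b xor false) xor (o ∧ (b xor false))) (λ b o → not o ∧ b) refl b (oddᵇ u))

quotient : ∀ r q k .{{_ : NonZero k}} → r < k → (r + q * k) / k ≡ q
quotient r q k r<k = trans (+-distrib-/-∣ʳ r (divides q refl)) (cong₂ _+_ (m<n⇒m/n≡0 r<k) (m*n/n≡m q k))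

not-multiple : ∀ r q k .{{_ : NonZero k}} → 0 < r → r < k → ¬ (k ∣ r + q * k)
not-multiple r q k r>0 r<k (divides p e) = <⇒≢ r>0 (trans (sym (m*n%n≡0 p k)) (trans (cong (_% k) (sym e)) (trans ([m+kn]%n≡m%n r q k) (m<n⇒m%n≡m r<k))))

star-parity : ∀ g q a → oddᵇ (q + a) ≡ not (oddᵇ (suc g)) → StarParity (suc (g + suc g)) q a
star-parity g q a e = by-parity (decide (oddᵇ h))
 where
 h k : ℕ
 h = suc g
 k = suc (g + h)
 even-half : (∃ λ w → h ≡ w + w) → ((k % 4) Data.Nat.≡ᵇ 0) ≡ true
 even-half (w , h≡) = cong (Data.Nat._≡ᵇ 0) (trans (cong (λ h → (h + h) % 4) h≡) (trans (cong (_% 4) (arith w)) (m*n%n≡0 w 4)))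
  where
  arith : ∀ w → w + w + (w + w) ≡ w * 4
  arith = solve-∀
 odd-half : (∃ λ w → h ≡ suc (w + w)) → ((k % 4) Data.Nat.≡ᵇ 0) ≡ false
 odd-half (w , h≡) = cong (Data.Nat._≡ᵇ 0) (trans (cong (λ h → (h + h) % 4) h≡) (trans (cong (_% 4) (arith w)) ([m+kn]%n≡m%n 2 w 4)))
  where
  arith : ∀ w → suc (w + w) + suc (w + w) ≡ 2 + w * 4
  arith = solve-∀
 by-parity : oddᵇ h ≡ true ⊎ oddᵇ h ≡ false → StarParity k q a
 by-parity (inj₂ ev) = inj₁ (even-half (even⇒double h ev) , trans e (cong not ev))
 by-parity (inj₁ od) = inj₂ (odd-half (odd⇒suc-double h od) ,
  cong (Data.Nat._≡ᵇ 0) (trans (cong (_% 2) (arith h)) (m*n%n≡0 h 2)) , trans e (cong not od))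
  where
  arith : ∀ h → h + h ≡ h * 2
  arith = solve-∀

module Main (g″ s t′ : ℕ) (s+t : s + suc t′ ≡ 3 + g″) where

 g′ g h t k k′ d : ℕ
 g′ = suc g″
 g = suc g′
 h = suc g
 t = suc t′
 k′ = g + h
 k = suc k′
 d = h + s

 3≤h : 3 ≤ h
 3≤h = s≤s (s≤s (s≤s z≤n))

 opaque
  C : ℕ
  C = 4 ^ (h + g)

  C≡ : C ≡ 4 ^ (h + g)
  C≡ = refl

 open Numbers h (2 * (C * suc (h + g) * suc (4 * h))) (proj₁ (cover-pair h)) 3≤h public

 d+t : d + t ≡ k
 d+t = trans (+-assoc h s t) (cong (h +_) s+t)

 k-even : oddᵇ k ≡ false
 k-even = odd-double h

 module Setup (n₁ : ℕ) (n≥ : n₂ ≤ suc n₁) (m : ℕ) (m*h : m * h ≡ suc n₁) (H : KGraph (suc n₁)) (uH : Uniform k H)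
  (beaten : δ̄ (suc n₁) k d < δ d H) (τ : Bool) (A : Subset (suc n₁)) (π : Permutation′ (suc n₁)) (balanced : Balanced A)
  (close : 2 * Q * k ! * diff H (copy π (parityGraph k τ A)) ≤ suc n₁ ^ k) where

  n : ℕ
  n = suc n₁

  open Large n n≥ public

  V : Set
  V = Fin n

  E : List V → Bool
  E xs = H (setOf xs)

  E-↭ : ∀ {xs ys} → xs ↭ ys → E xs ≡ E ys
  E-↭ p = cong H (setOf-↭ p)

  E-unique : ∀ xs → length xs ≡ h + h → E xs ≡ true → Unique xs
  E-unique = Degree.edge-unique H uH

  Uniform-d+t : ∀ {G : KGraph n} → Uniform k G → Uniform (d + t) G
  Uniform-d+t u S e = trans (u S e) (sym d+t)

  beaten-by : ∀ {G : KGraph n} → Uniform k G → G ∈ ext n k → ∀ D₁ → Unique D₁ → length D₁ ≡ d →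
   ∃ λ D₀ → Unique D₀ × length D₀ ≡ d × (∀ D → Unique D → length D ≡ d → # t (λ Z → G (setOf (D₀ ++ Z))) < # t (λ Z → E (D ++ Z)))
  beaten-by {G} uG m D₁ u₁ l₁ = beats d t G H (Uniform-d+t uG) (Uniform-d+t uH) (≤-<-trans (δ≤δ̄ k d m) beaten) D₁ u₁ l₁

  q₂ : ℕ
  q₂ = 2 * (2 * q₀)

  HalfGraph : Set
  HalfGraph = ∃ λ A₁ → ∃ λ b → parityGraph k b A₁ ∈ ext n k × Halfish q₂ (Vec.lookup A₁)

  -- Some member of the extremal family has almost equal classes; hence all degrees of H are almost half of the maximum.
  half-graph : HalfGraph
  half-graph = with-odd (decide (oddᵇ ∣ A ∣))
   where
   in-ext : ∀ A₁ → oddᵇ ∣ A₁ ∣ ≡ true → (∀ c → n ≤ 2 * avail (Vec.lookup A₁) c [] + 3) → HalfGraph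
   in-ext A₁ o half = by-div (k ∣? n)
    where
    hf : Halfish q₂ (Vec.lookup A₁)
    hf = halfish-change q₂ 3 (Vec.lookup A₁) (Vec.lookup A₁) (λ _ → false) (λ _ _ → refl) half
     (*-monoʳ-≤ 4 (≡-≤ (trans (cong (λ z → q₂ * (2 * z + 3)) (size-false {n} (λ _ → refl))) (arith q₀)) 12q₀≤n))
     where
     arith : ∀ q → 2 * (2 * q) * 3 ≡ 12 * q
     arith = solve-∀
    by-div : Dec (k ∣ n) → HalfGraph
    by-div (yes dv) = A₁ , false , ext-even n k′ false A₁ dv o , hf
    by-div (no nd) = A₁ , true , ext-odd n k′ A₁ nd , hf
   with-odd : oddᵇ ∣ A ∣ ≡ true ⊎ oddᵇ ∣ A ∣ ≡ false → HalfGraph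
   with-odd (inj₁ o) = in-ext A o (λ c → ≤-trans (balanced-half A balanced c) (+-monoʳ-≤ _ (s≤s z≤n)))
   with-odd (inj₂ o) = in-ext (toggle A) (trans (toggle-odd A) (cong not o)) (λ c → ≤-trans (balanced-half A balanced c)
    (≤-≡ (+-monoˡ-≤ 1 (*-monoʳ-≤ 2 (≤-trans (class-change (Vec.lookup A) (Vec.lookup (toggle A)) (λ v → does (v ≟F zero) ∧ true) c (toggle-same A)) (+-monoʳ-≤ _ (≤-reflexive (size-indicator {n} zero true))))))
     (arith (avail (Vec.lookup (toggle A)) c []))))
    where
    arith : ∀ a → 2 * (a + 1) + 1 ≡ 2 * a + 3
    arith = solve-∀

  t≤k : t ≤ h + h
  t≤k = ≤-≡ (m≤n+m t d) d+t

  d≤k : d ≤ h + h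
  d≤k = ≤-≡ (m≤m+n d t) d+t

  degree-d : ∀ D → Unique D → length D ≡ d → Ample (2 * q₀) t (λ Z → E (D ++ Z))
  degree-d D u l = from half-graph
   where
   from : HalfGraph → Ample (2 * q₀) t (λ Z → E (D ++ Z))
   from (A₁ , b , G∈ , hf) = compare (beaten-by (parityGraph-uniform k b A₁) G∈ D u l)
    where
    χ₁ : V → Bool
    χ₁ = Vec.lookup A₁
    compare : (∃ λ D₀ → Unique D₀ × length D₀ ≡ d × (∀ D → Unique D → length D ≡ d → # t (λ Z → parityGraph k b A₁ (setOf (D₀ ++ Z))) < # t (λ Z → E (D ++ Z)))) →
     Ample (2 * q₀) t (λ Z → E (D ++ Z))
    compare (D₀ , u₀ , l₀ , beat) = ≤-trans lower (+-monoˡ-≤ (n ^ t) (*-monoʳ-≤ (2 * (2 * q₀)) (<⇒≤ (beat D u l))))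
     where
     P : List V → Bool
     P Z = xors (map χ₁ Z) ≐ (xors (map χ₁ D₀) xor b)
     lower : Ample (2 * q₀) t (λ Z → parityGraph k b A₁ (setOf (D₀ ++ Z)))
     lower = ample-minus (2 * q₀) t P (λ Z → not (fresh D₀ Z)) _ (halfish-ample q₂ χ₁ t′ _ hf)
      (clash-rare (4 * (2 * q₀)) t D₀ (≡-≤ (trans (cong (λ z → 4 * (2 * q₀) * (t * (z + t))) l₀) (arith q₀ (t * (d + t)))) (clash-q₀ t (d + t) t≤k (≤-reflexive d+t)))) imp
      where
      arith : ∀ q x → 4 * (2 * q) * x ≡ 8 * q * x
      arith = solve-∀
      imp : ∀ Z → length Z ≡ t → P Z ≡ true → not (fresh D₀ Z) ≡ false → parityGraph k b A₁ (setOf (D₀ ++ Z)) ≡ true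
      imp Z lZ p f = trans (parityGraph-list k b A₁ (D₀ ++ Z) (trans (length-++ D₀) (trans (cong₂ _+_ l₀ lZ) d+t)))
       (∧-intro (trans (fresh-[] D₀ Z u₀) (not-false f)) (trans (cong (λ p → p ≐ b) (trans (cong xors (map-++ χ₁ D₀ Z)) (xors-++ (map χ₁ D₀) (map χ₁ Z))))
        (trans (truth-table 3 (λ x z b → (x xor z) ≐ b) (λ x z b → z ≐ (x xor b)) refl (xors (map χ₁ D₀)) (xors (map χ₁ Z)) b) p)))

  degree-below : ∀ j r X → Unique X → length X ≡ j → j + r ≡ d → Ample q₀ (r + t) (λ Z → E (X ++ Z))
  degree-below j r X u l e = ample-down q₀ r t (λ Z → E (X ++ Z)) X
   (clash-rare (4 * q₀) r X (≤-trans (≤-≡ (*-monoˡ-≤ (r * (length X + r)) (*-monoˡ-≤ q₀ (m≤m+n 4 4))) (cong (λ z → 8 * q₀ * (r * (z + r))) l))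
    (clash-q₀ r (j + r) (≤-trans (m≤n+m r j) (≡-≤ e d≤k)) (≡-≤ e d≤k))))
   (λ W lW f → ample-cong (2 * q₀) t (λ Z _ → cong E (++-assoc X W Z)) (degree-d (X ++ W) (Unique-↭ (++-comm W X) (fresh-unique W u f)) (trans (length-++ X) (trans (cong₂ _+_ l lW) e))))

  χ₀ : V → Bool
  χ₀ = Vec.lookup (relabel π A)

  half₀ : ∀ c → n ≤ 2 * avail χ₀ c [] + 1
  half₀ = balanced-half (relabel π A) (subst (λ a → (a ≤ suc (n ∸ a)) × (n ∸ a ≤ suc a)) (sym (relabel-size A π)) balanced)

  third : ∀ c → n ≤ 3 * avail χ₀ c []
  third c = small (avail χ₀ c []) (half₀ c)
   where
   small : ∀ a → n ≤ 2 * a + 1 → n ≤ 3 * a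
   small zero le = contradiction (≤-trans 12≤n le) λ { (s≤s ()) }
   small (suc a) le = ≤-trans le (≤-≡ (+-monoʳ-≤ (2 * suc a) (s≤s z≤n)) (+-comm (2 * suc a) (suc a)))

  t₃ : ℕ
  t₃ = g′ + suc g′

  k≡ : suc (2 + t₃) ≡ h + h
  k≡ = arith g″
   where
   arith : ∀ g → suc (2 + (suc g + suc (suc g))) ≡ 3 + g + (3 + g)
   arith = solve-∀

  edges : ∀ D → Unique D → length D ≡ 3 → Dense 3 t₃ (λ Z → E (D ++ Z))
  edges D u l = subst (λ r → Dense 3 r (λ Z → E (D ++ Z))) (trans (+-assoc g″ s t) (trans (cong (g″ +_) s+t) (arith g″)))
   (ample-dense q₀ (g″ + s + t) _ (≤-trans (m≤m+n 3 2) 5≤q₀) (degree-below 3 (g″ + s) D u l refl))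
   where
   arith : ∀ g → g + (3 + g) ≡ suc g + suc (suc g)
   arith = solve-∀

  bad₀ : Rare Q (suc (2 + t₃)) (λ xs → (xors (map χ₀ xs) ≐ τ) ∧ not (E xs))
  bad₀ = subst (λ l → Rare Q l (λ xs → (xors (map χ₀ xs) ≐ τ) ∧ not (E xs))) (sym k≡)
   (close-tuples k τ H A π Q uH close (clash k k ≤-refl ≤-refl))

  module Cl = Cleaning χ₀ τ E E-↭ g′ Q third 12≤n edges bad₀

  χ : V → Bool
  χ = Cl.χ

  halfish : Halfish q₀ χ
  halfish = halfish-change q₀ 1 χ₀ χ Cl.flipped (λ v e → sym (Cl.unflipped v e)) half₀ (begin
   4 * (q₀ * (2 * F + 1)) ≡⟨ arith q₀ F ⟩
   8 * q₀ * F + 4 * q₀ ≤⟨ +-mono-≤ (*-cancelˡ-≤ {8 * q₀ * F} {n} 38 flips) (≤-trans (*-monoˡ-≤ q₀ (m≤m+n 4 8)) 12q₀≤n) ⟩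
   n + n ≤⟨ +-monoʳ-≤ n (m≤m+n n (n + (n + 0))) ⟩
   4 * n ∎)
   where
   open ≤-Reasoning
   F : ℕ
   F = size Cl.flipped
   arith : ∀ q f → 4 * (q * (2 * f + 1)) ≡ 8 * q * f + 4 * q
   arith = solve-∀
   flips : 38 * (8 * q₀ * F) ≤ 38 * n
   flips = ≡-≤ (sym (*-assoc 38 (8 * q₀) F)) (≤-trans (*-monoˡ-≤ F Q≥q₀) Cl.few-flipped)

  classes : ∀ c → 2 * n ≤ 5 * avail χ c []
  classes = halfish-two-fifths q₀ χ 5≤q₀ halfish

  base : Base
  base = record { n = n; pos = _; χ = χ; τ = τ; E = E; E-↭ = E-↭; g′ = g′ }

  c₁≤q₀ : c₁ ≤ q₀
  c₁≤q₀ = ≤-trans (m≤n*m c₁ 64) 64c₁≤q₀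

  2+t₃≤k : 2 + t₃ ≤ h + h
  2+t₃≤k = ≤-≡ (n≤1+n (2 + t₃)) k≡

  cleaned-splits : ∀ w b → Dense c₁ g (λ f → (xors (map χ (w ∷ f)) ≐ b) ∧ heavy c₁ h Cl.linked (w ∷ f))
  cleaned-splits = Cl.splits (h + h) 2+t₃≤k Q≥splits

  splits : ∀ w b → Dense c₁ g (λ f → (xors (map χ (w ∷ f)) ≐ b) ∧ Blocks.rich base ρ (w ∷ f))
  splits w b = dense-mono {P = λ f → (xors (map χ (w ∷ f)) ≐ b) ∧ heavy c₁ h Cl.linked (w ∷ f)} weaken (cleaned-splits w b)
   where
   weaken : ∀ f → length f ≡ g → (xors (map χ (w ∷ f)) ≐ b) ∧ heavy c₁ h Cl.linked (w ∷ f) ≡ true → (xors (map χ (w ∷ f)) ≐ b) ∧ Blocks.rich base ρ (w ∷ f) ≡ true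
   weaken f _ e = ∧-intro (∧-left {xors (map χ (w ∷ f)) ≐ b} e)
    (heavy-weaken {q = c₁} {q′ = ρ} {b = h} {P = Cl.linked} (w ∷ f) (≤-trans c₁≤q₀ q₀≤ρ) (∧-right {xors (map χ (w ∷ f)) ≐ b} e))

  params : Params base
  params = record
   { K = K; q = q; ρ = ρ; c = c; p = p; N = N; q>0 = 1≤q; n≤cp = n≤cp; K-big = K-big; ρ≤K = ρ≤K; room = room
   ; bad-rare = subst (λ l → Rare M l (λ xs → (xors (map χ xs) ≐ τ) ∧ not (E xs))) k≡
     (Cl.bad-rare M (≡-≤ (cong (λ l → 38 * (2 * M * l)) k≡) Q≥M))
   ; splits = λ w b → dense-weaken (≤-trans c₁≤q₀ q₀≤ρ) (splits w b) }

  big : ∀ c U → length U ≤ h + h → n ≤ 4 * avail χ c U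
  big c U le = *-cancelˡ-≤ 5 (+-cancelʳ-≤ (3 * n) _ _ (begin
   5 * n + 3 * n ≡⟨ arith₁ n ⟩
   4 * (2 * n) ≤⟨ *-monoʳ-≤ 4 (≤-trans (classes c) (*-monoʳ-≤ 5 (≤-trans (Assembly.avail-++ params c U) (+-monoʳ-≤ (avail χ c U) le)))) ⟩
   4 * (5 * (avail χ c U + (h + h))) ≡⟨ arith₂ (avail χ c U) h ⟩
   5 * (4 * avail χ c U) + 2 * (20 * h) ≤⟨ +-monoʳ-≤ (5 * (4 * avail χ c U)) (≤-trans (*-monoʳ-≤ 2 20h≤n) (*-monoˡ-≤ n (m≤m+n 2 1))) ⟩
   5 * (4 * avail χ c U) + 3 * n ∎))
   where
   open ≤-Reasoning
   arith₁ : ∀ n → 5 * n + 3 * n ≡ 4 * (2 * n)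
   arith₁ = solve-∀
   arith₂ : ∀ a h → 4 * (5 * (a + (h + h))) ≡ 5 * (4 * a) + 2 * (20 * h)
   arith₂ = solve-∀

  8h<n : 8 * h < n
  8h<n = ≤-trans (*-monoˡ-< h {8} {20} (m≤m+n 9 11)) 20h≤n

  module Ex = Exact χ τ E h s t s+t E-unique big 8h<n

  wide : Segments.Wide params
  wide c = *-cancelˡ-≤ 15 (begin
   15 * (N + (p + h)) ≤⟨ *-monoʳ-≤ 15 (+-monoʳ-≤ N (≤-trans p+h≤x (≡-≤ (sym (*-identityʳ x)) (*-monoʳ-≤ x {1} {h} (s≤s z≤n))))) ⟩
   15 * (10 * (x * h) + x * h) ≡⟨ arith (x * h) ⟩
   165 * (x * h) ≤⟨ 165xh≤n ⟩
   n ≤⟨ m≤m+n n (5 * n) ⟩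
   6 * n ≡⟨ *-assoc 3 2 n ⟩
   3 * (2 * n) ≤⟨ *-monoʳ-≤ 3 (classes c) ⟩
   3 * (5 * avail χ c []) ≡⟨ sym (*-assoc 3 5 (avail χ c [])) ⟩
   15 * avail χ c [] ∎)
   where
   open ≤-Reasoning
   arith : ∀ y → 15 * (10 * y + y) ≡ 165 * y
   arith = solve-∀

  big-N : 20 * h ≤ N
  big-N = ≤-trans (*-monoˡ-≤ h (≤-trans (m≤m+n 20 3) 23≤x)) (m≤n*m (x * h) 10)

  pool : ∀ c → proj₁ (cover-pair h) ≤ avail χ c []
  pool c = *-cancelˡ-≤ 4 (≤-trans (≤-trans n₂-pool n≥) (big c [] z≤n))

  some-set : ∃ λ D → Unique D × length D ≡ d
  some-set = found (choose-any χ (replicate d true) [] λ c → ≤-trans (s≤s (≤-reflexive (length-replicate d)))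
    (*-cancelˡ-< 4 d _ (<-≤-trans (≤-<-trans (≤-≡ (*-monoʳ-≤ 4 d≤k) (arith h)) 8h<n) (big c [] z≤n))))
   where
   arith : ∀ h → 4 * (h + h) ≡ 8 * h
   arith = solve-∀
   found : (∃ λ xs → map χ xs ≡ replicate d true × fresh [] xs ≡ true) → ∃ λ D → Unique D × length D ≡ d
   found (xs , e , f) = xs , fresh-list-unique xs f , trans (sym (length-map χ xs)) (trans (cong length e) (length-replicate d))

  to-beaten : ∀ {G : KGraph n} F → Uniform k G → G ∈ ext n k → (∀ xs → length xs ≡ k → G (setOf xs) ≡ F xs) → Ex.Beaten F
  to-beaten {G} F uG G∈ same = convert (beaten-by uG G∈ (proj₁ some-set) (proj₁ (proj₂ some-set)) (proj₂ (proj₂ some-set)))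
   where
   convert : (∃ λ D₀ → Unique D₀ × length D₀ ≡ d × (∀ D → Unique D → length D ≡ d → # t (λ Z → G (setOf (D₀ ++ Z))) < # t (λ Z → E (D ++ Z)))) → Ex.Beaten F
   convert (D₀ , u₀ , l₀ , beat) = D₀ , u₀ , l₀ , λ D u l → subst (_< # t (λ Z → E (D ++ Z)))
    (#-cong t (λ Z lZ → same (D₀ ++ Z) (trans (length-++ D₀) (trans (cong₂ _+_ l₀ lZ) d+t)))) (beat D u l)

  finish : ∀ {u} → Assembly.Gadget params u → HamCycle k h H
  finish G = build (Assembly.assemble params G (Planner.plan params x refl p+h≤x 8n≤qx classes 165xh≤n 23≤x 3≤h (s≤s (s≤s z≤n)) G))
   where
   build : HamBlocks base → HamCycle k h H
   build Hm = ham-cycle (HamBlocks.F₀ Hm ++ concat (HamBlocks.Bs Hm)) (HamBlocks.unique Hm) (HamBlocks.full Hm) H h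
    (≡-≤ (arith h) (≤-trans (*-monoˡ-≤ h (m≤m+n 2 18)) 20h≤n)) (divides m (sym m*h)) (cyclic-windows base Hm)
    where
    arith : ∀ h → h + h ≡ 2 * h
    arith = solve-∀
  parity-ample : ∀ b → Ample q₀ h (λ Z → xors (map χ Z) ≐ b)
  parity-ample b = halfish-ample q₀ χ g b halfish

  degree-ample : ∀ X → length X ≡ h → Unique X → Ample q₀ h (λ Z → E (X ++ Z))
  degree-ample X lX uX = subst (λ r → Ample q₀ r (λ Z → E (X ++ Z))) s+t (degree-below h s X uX lX refl)

  module NF = Nonflex params E-unique c₁ 1≤c₁ q₀ 64c₁≤q₀ (≤-trans 64c₁≤q₀ q₀≤ρ) parity-ample degree-ample

  P : Bool
  P = oddᵇ (avail χ true [])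

  class-odd : ∀ c → oddᵇ ∣ classOf χ c ∣ ≡ P xor (not c ∧ oddᵇ n)
  class-odd c = trans (cong oddᵇ (classOf-size χ c)) (by-class c)
   where
   by-class : ∀ c → oddᵇ (avail χ c []) ≡ P xor (not c ∧ oddᵇ n)
   by-class true = sym (xor-identityʳ P)
   by-class false = trans (sym (xor-cancel P _)) (cong (P xor_) (trans (sym (odd-+ (avail χ true []) (avail χ false []))) (cong oddᵇ (avail-total χ))))

  20≤m : 20 ≤ m
  20≤m = *-cancelʳ-≤ 20 m h (≤-≡ 20h≤n (sym m*h))

  Rest : ℕ → Set
  Rest j = ∃ λ u → j + suc u ≡ m

  rest : ∀ j → suc j ≤ 20 → Rest j
  rest j le = m ∸ suc j , trans (+-suc j (m ∸ suc j)) (m+[n∸m]≡n (≤-trans le 20≤m))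

  size-n : ∀ j {u} → j + suc u ≡ m → (j + suc u) * h ≡ n
  size-n j e = trans (cong (_* h) e) m*h

  finish-any : ∃ (Assembly.Gadget params) → HamCycle k h H
  finish-any (u , G) = finish G

  beat-right : parityGraph k τ (classOf χ true) ∈ ext n k → Ex.Beaten Ex.right
  beat-right G∈ = to-beaten Ex.right (parityGraph-uniform k τ (classOf χ true)) G∈ (λ xs l → parityGraph-class k τ true χ xs l k-even)

  wrong-pair : parityGraph k τ (classOf χ true) ∈ ext n k → ∃ NF.Pair
  wrong-pair G∈ = found (Ex.pattern-of (beat-right G∈))
   where
   found : (∃ λ (cs : Fin h → Bool) → ∀ X → map χ X ≡ tabulate cs → Unique X → ∃ λ Y → length Y ≡ h × Ex.Wrong (X ++ Y)) → ∃ NF.Pair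
   found (cs , cover) = cs , NF.pair cs (proj₂ (cover-pair h)) pool cover

  even : oddᵇ m ≡ false → HamCycle k h H
  even m-even = start (rest 9 (m≤m+n 10 10))
   where
   start : Rest 9 → HamCycle k h H
   start (u₀ , r) = by-obstruction (Parities.even-decide params (8 + u₀) wide big-N (size-n 9 {u₀} r) o)
    where
    o : oddᵇ (8 + suc u₀) ≡ true
    o = not-false {oddᵇ (8 + suc u₀)} (trans (cong oddᵇ r) m-even)
    obstructed : Parities.even-obstructed params (8 + suc u₀) → HamCycle k h H
    obstructed obs = by-double (even⇒double m m-even)
     where
     by-double : (∃ λ v → m ≡ v + v) → HamCycle k h H
     by-double (v , m≡) = by-flex NF.nonflex-decide
      where
      n≡ : n ≡ v * k
      n≡ = trans (sym m*h) (trans (cong (_* h) m≡) (arith v h))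
       where
       arith : ∀ v h → (v + v) * h ≡ v * (h + h)
       arith = solve-∀
      n/k : n / k ≡ v
      n/k = trans (cong (_/ k) n≡) (m*n/n≡m v k)
      condition : ∀ b → b ≡ τ → (if b then oddᵇ (n / k + ∣ classOf χ true ∣) else oddᵇ ∣ classOf χ true ∣) ≡ true
      condition false e = trans (class-odd true) (trans (xor-identityʳ P) (solve P (trans (sym (trans (sumRest-even (8 + suc u₀) false) (truth-table 1 (λ o → o ∧ false) (λ o → false) refl (oddᵇ (8 + suc u₀)))))
        (subst (λ b → sumRest b (8 + suc u₀) false ≡ not (P xor false)) (sym e) (obs false)))))
       where
       solve : ∀ p → false ≡ not (p xor false) → p ≡ true
       solve true e = refl
      condition true e = trans (cong (λ q → oddᵇ (q + ∣ classOf χ true ∣)) n/k) (trans (odd-+ v _) (trans (cong (oddᵇ v xor_) (trans (class-odd true) (xor-identityʳ P)))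
        (trans (cong (_xor P) odd-v) (solve P))))
       where
       solve : ∀ p → not (p xor false) xor p ≡ true
       solve true = refl
       solve false = refl
       alternate : ∀ v M → suc M ≡ v + v → sumRest true M false ≡ oddᵇ v
       alternate (suc w) M e = trans (cong (λ M → sumRest true M false) (trans (suc-injective e) (+-suc w w))) (trans (sumRest-alternating w false) (xor-identityʳ (oddᵇ (suc w))))
       odd-v : oddᵇ v ≡ not (P xor false)
       odd-v = trans (sym (alternate v (8 + suc u₀) (trans r m≡))) (subst (λ b → sumRest b (8 + suc u₀) false ≡ not (P xor false)) (sym e) (obs false))
      by-flex : (∃ λ X → length X ≡ h × NF.nonflex X ≡ true) ⊎ (∀ X → length X ≡ h → Unique X → NF.Flex τ X) → HamCycle k h H
      by-flex (inj₁ (X , lX , nf)) = finish (NF.even-triple X (6 + u₀) wide big-N (size-n 9 {u₀} r) o obs lX (NF.nonflex-unique X nf) (NF.nonflex-wrong X lX nf))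
      by-flex (inj₂ flex) = by-pair (wrong-pair (ext-even n k′ τ (classOf χ true) (divides v n≡) (condition τ refl)))
       where
       by-pair : ∃ NF.Pair → HamCycle k h H
       by-pair (cs , pr) = finish-any (NF.AllFlex.even-case flex pr u₀ wide big-N (size-n 9 {u₀} r) o obs)
    by-obstruction : Assembly.Gadget params (8 + u₀) ⊎ Parities.even-obstructed params (suc (8 + u₀)) → HamCycle k h H
    by-obstruction (inj₁ G) = finish G
    by-obstruction (inj₂ obs) = obstructed obs

  odd-even : oddᵇ m ≡ true → τ ≡ false → HamCycle k h H
  odd-even m-odd τ≡ = start (rest 1 (m≤m+n 2 18))
   where
   start : Rest 1 → HamCycle k h H
   start (u , r) = finish (Parities.clean params P u wide big-N (size-n 1 {u} r)
     (trans (endPar-parity τ (suc u) P) (trans (cong (λ o → P xor (o ∧ τ)) ev) (cong (P xor_) (sym τ≡))))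
     (trans (cong (λ b → sumRest b (suc u) P) τ≡) (trans (sumRest-even (suc u) P) (trans (cong (_∧ P) ev) (truth-table 1 (λ p → false) (λ p → p xor p) refl P)))))
    where
    ev : oddᵇ (suc u) ≡ false
    ev = not-true (trans (cong oddᵇ r) m-odd)

  odd-odd : oddᵇ m ≡ true → τ ≡ true → HamCycle k h H
  odd-odd m-odd τ≡ = start (rest 14 (m≤m+n 15 5))
   where
   start : Rest 14 → HamCycle k h H
   start (u , r) = by-double (odd⇒suc-double (suc u) o)
    where
    o : oddᵇ (suc u) ≡ true
    o = trans (sym (odd-+ 14 (suc u))) (trans (cong oddᵇ r) m-odd)
    by-double : (∃ λ v → suc u ≡ suc (v + v)) → HamCycle k h H
    by-double (v , u≡) = by-flex NF.nonflex-decide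
     where
     n≡ : n ≡ h + (7 + v) * k
     n≡ = trans (sym (size-n 14 {u} r)) (trans (cong (λ u → (14 + u) * h) {suc u} {suc (v + v)} u≡) (arith v h))
      where
      arith : ∀ v h → (14 + suc (v + v)) * h ≡ h + (7 + v) * (h + h)
      arith = solve-∀
     h<k : h < k
     h<k = s≤s (m≤n+m h g)
     indivisible : ¬ (k ∣ n)
     indivisible = subst (λ n → ¬ (k ∣ n)) (sym n≡) (not-multiple h (7 + v) k (s≤s z≤n) h<k)
     n/k : n / k ≡ 7 + v
     n/k = trans (cong (_/ k) n≡) (quotient h (7 + v) k h<k)
     odd-n : oddᵇ n ≡ oddᵇ h
     odd-n = trans (cong oddᵇ (sym m*h)) (trans (odd-* m h) (cong (_∧ oddᵇ h) m-odd))
     star-condition : ∀ c → sumRest τ (suc u) (c ∧ oddᵇ h) ≡ not P → oddᵇ (n / k + ∣ classOf χ c ∣) ≡ not (oddᵇ h)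
     star-condition c e = trans (cong (λ q → oddᵇ (q + ∣ classOf χ c ∣)) n/k) (trans (odd-+ (7 + v) _) (trans (cong (oddᵇ (7 + v) xor_) (trans (class-odd c) (cong (λ o → P xor (not c ∧ o)) odd-n)))
       (solve (oddᵇ v) c (oddᵇ h) P (trans (sym (sumRest-alternating v (c ∧ oddᵇ h))) (trans (cong₂ (λ b u → sumRest b u (c ∧ oddᵇ h)) (sym τ≡) (sym u≡)) e)))))
      where
      solve : ∀ o c h P → not o xor (c ∧ h) ≡ not P → not (not (not (not (not (not (not o)))))) xor (P xor (not c ∧ h)) ≡ not h
      solve true true true false e = refl
      solve true true false true e = refl
      solve true false true true e = refl
      solve true false false true e = refl
      solve false true true true e = refl
      solve false true false false e = refl
      solve false false true false e = refl
      solve false false false false e = refl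
     by-flex : (∃ λ X → length X ≡ h × NF.nonflex X ≡ true) ⊎ (∀ X → length X ≡ h → Unique X → NF.Flex τ X) → HamCycle k h H
     by-flex (inj₁ (X , lX , nf)) = finish-any (NF.OddNonflex.odd-gadget splits (λ c → big c [] z≤n) 8^h<4K
      (≤-trans (*-monoʳ-≤ 4 {16} {K} 16≤K) NF.4K≤q₁) τ≡ u (size-n 14 {u} r) o wide big-N X lX nf)
     by-flex (inj₂ flex) = by-pair (wrong-pair (subst (λ b → parityGraph k b (classOf χ true) ∈ ext n k) (sym τ≡) (ext-odd n k′ (classOf χ true) indivisible)))
      where
      module F = NF.Flexible flex τ≡ u (size-n 14 {u} r) o wide big-N
      s+t′ : h + s + t′ ≡ h + g
      s+t′ = trans (+-assoc h s t′) (cong (h +_) (suc-injective (trans (sym (+-suc s t′)) s+t)))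
      density : ∀ r x → r ≡ h + g → n ^ r ≤ 4 ^ r * x → n ^ (h + g) ≤ C * x
      density .(h + g) x refl le = ≤-≡ le (cong (_* x) (sym C≡))
      star : F.Star C
      star a bad = convert (Ex.star-of a t′ τ≡ refl (to-beaten (Ex.starred (χ a) a) (𝓑′-uniform k (classOf χ (χ a)) a)
        (ext-star n k′ (classOf χ (χ a)) a indivisible (star-parity g (n / k) ∣ classOf χ (χ a) ∣ (star-condition (χ a) bad)) (trans (VecP.lookup∘tabulate (λ v → χ v ≐ χ a) a) (truth-table 1 (λ b → b ≐ b) (λ b → true) refl (χ a))))
        (λ xs l → trans (starGraph-class k (χ a) χ a xs l k-even) (cong (λ b → (fresh [] xs ∧ (xors (map χ xs) ≐ b)) ∨ (fresh [] xs ∧ (pure? χ (χ a) xs ∧ mem a xs))) (sym τ≡)))))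
       where
       convert : (∃ λ e → Ex.Wrong e × ¬ Pure χ (χ a) e) ⊎ ((∃ λ e → Ex.Wrong e × a ∉ e) × n ^ (h + s + t′) ≤ 4 ^ (h + s + t′) * # (h + h) Ex.wrong?) →
        (∃ λ e → Ex.Wrong e × ¬ Pure χ (χ a) e) ⊎ ((∃ λ e → Ex.Wrong e × a ∉ e) × n ^ (h + g) ≤ C * # (h + h) Ex.wrong?)
       convert (inj₁ w) = inj₁ w
       convert (inj₂ (w , dn)) = inj₂ (w , density (h + s + t′) (# (h + h) Ex.wrong?) s+t′ dn)
      by-pair : ∃ NF.Pair → HamCycle k h H
      by-pair (cs , pr) = finish-any (F.WithStar.odd-case C star Z≤ρ pr)

  cycle : HamCycle k h H
  cycle = by-parity (decide (oddᵇ m)) (decide τ)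
   where
   by-parity : oddᵇ m ≡ true ⊎ oddᵇ m ≡ false → τ ≡ true ⊎ τ ≡ false → HamCycle k h H
   by-parity (inj₂ e) _ = even e
   by-parity (inj₁ o) (inj₂ τ≡) = odd-even o τ≡
   by-parity (inj₁ o) (inj₁ τ≡) = odd-odd o τ≡

Conclusion : ℕ → ℕ → ℕ → Set
Conclusion k h d = Σ ℚ λ ε → (0ℚ <ℚ ε) × Σ ℕ λ n₂ → (n : ℕ) → n₂ ≤ n → h ∣ n → (H : KGraph n) → Uniform k H →
 δ̄ n k d < δ d H → (CloseToB ε k H ⊎ CloseToB̄ ε k H) → HamCycle k h H

module _ (g″ s t′ : ℕ) (s+t : s + suc t′ ≡ 3 + g″) where

 open Main g″ s t′ s+t using (n₂; Q; k; h; d; module Large)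

 precision : ℕ
 precision = 2 * Q * k !

 conclusion : Conclusion k h d
 conclusion = 1/ precision , 1/-positive precision , n₂ , ham
  where
  precise : ∀ {n} (a : ℕ) → ℕtoℚ a ℚ.≤ (1/ precision) ℚ.* ℕtoℚ (n ^ k) → precision * a ≤ n ^ k
  precise {n} a le = ≤-trans (m≤n+m (precision * a) a) (1/-≤ precision a (n ^ k) le)
  ham : (n : ℕ) → n₂ ≤ n → h ∣ n → (H : KGraph n) → Uniform k H → δ̄ n k d < δ d H →
   (CloseToB (1/ precision) k H ⊎ CloseToB̄ (1/ precision) k H) → HamCycle k h H
  ham zero n≥ _ H uH beaten close = contradiction (Large.12≤n 0 n≥) λ ()
  ham (suc n₁) n≥ (divides m e) H uH beaten (inj₁ (A , balanced , π , close)) =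
   Main.Setup.cycle g″ s t′ s+t n₁ n≥ m (sym e) H uH beaten true A π balanced (precise {suc n₁} (diff H (copy π (𝓑 k A))) close)
  ham (suc n₁) n≥ (divides m e) H uH beaten (inj₂ (A , balanced , π , close)) =
   Main.Setup.cycle g″ s t′ s+t n₁ n≥ m (sym e) H uH beaten false A π balanced (precise {suc n₁} (diff H (copy π (𝓑̄ k A))) close)

conclude : ∀ {k h d} g″ s t′ → k ≡ h + h → h ≡ 3 + g″ → d ≡ h + s → s + suc t′ ≡ h → Conclusion k h d
conclude g″ s t′ refl refl refl e = conclusion g″ s t′ e

theorem1p6 : (k : ℕ) → 2 ∣ k → 6 ≤ k → (d : ℕ) → k / 2 ≤ d → d < k →
    Σ ℚ λ ε → (0ℚ <ℚ ε) × Σ ℕ λ n₂ →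
    (n : ℕ) → n₂ ≤ n → (k / 2) ∣ n → (H : KGraph n) → Uniform k H →
    δ̄ n k d < δ d H →
    (CloseToB ε k H ⊎ CloseToB̄ ε k H) →
    HamCycle k (k / 2) H
theorem1p6 k (divides h k≡) 6≤k d k/2≤d d<k = subst (λ x → Conclusion k x d) (sym half)
  (conclude (h ∸ 3) (d ∸ h) (k ∸ suc d) double (sym (m+[n∸m]≡n (*-cancelʳ-≤ 3 h 2 (≤-trans 6≤k (≤-reflexive k≡)))))
    (sym (m+[n∸m]≡n h≤d)) (+-cancelˡ-≡ h _ _ rest≡))
  where
  half : k / 2 ≡ h
  half = trans (cong (_/ 2) k≡) (m*n/n≡m h 2)
  double : k ≡ h + h
  double = trans k≡ (trans (*-comm h 2) (cong (h +_) (+-identityʳ h)))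
  h≤d : h ≤ d
  h≤d = subst (_≤ d) half k/2≤d
  rest≡ : h + (d ∸ h + suc (k ∸ suc d)) ≡ h + h
  rest≡ = trans (sym (+-assoc h (d ∸ h) (suc (k ∸ suc d)))) (trans (cong (_+ suc (k ∸ suc d)) (m+[n∸m]≡n h≤d))
    (trans (+-suc d (k ∸ suc d)) (trans (m+[n∸m]≡n d<k) double)))
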